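{- Let $K$ be a fixed, sufficiently large positive integer. For every $\delta>0$ there is $N_0(\delta)$ such that the following holds for every natural number $N\geq N_0(\delta)$. Put $y=(\log N)^K$, let $\mathcal{S}(N,y)$ be the set of positive integers $n\leq N$ all of whose prime factors are at most $y$, and let $\Psi(N,y)=|\mathcal{S}(N,y)|$. If $A\subseteq \mathcal{S}(N,y)$ satisfies $|A|\geq \delta\,\Psi(N,y)$, then $A$ contains a nontrivial arithmetic progression of length $3$, i.e. there are integers $n$ and $d\neq 0$ with $n,\ n+d,\ n+2d\in A$.
   Context: A positive integer is $y$-smooth if every prime factor of it is at most $y$. -}

module Defs where

open import Data.Nat as ℕ using (ℕ; zero; suc)
open import Data.Nat.Divisibility using (_∣_)
open import Data.Nat.Primality using (Prime)
open import Data.Integer as ℤ using (ℤ)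
open import Data.Rational as ℚ using (ℚ; 0ℚ; 1ℚ; _/_)
open import Data.List using (List; length; map)
open import Data.List.Membership.Propositional using (_∈_)
open import Data.List.Relation.Unary.Unique.Propositional using (Unique)
open import Data.Product using (Σ; _×_; ∃)
open import Relation.Binary.PropositionalEquality using (_≡_; _≢_)
open import Function.Bundles using (_⇔_)

_^ℚ_ : ℚ → ℕ → ℚ
r ^ℚ zero  = 1ℚ
r ^ℚ suc k = r ^ℚ k ℚ.* r

expTerm : ℚ → ℕ → ℚ
expTerm r zero    = 1ℚ
expTerm r (suc i) = expTerm r i ℚ.* r ℚ.* (ℤ.+ 1 / suc i)

expPartial : ℚ → ℕ → ℚ
expPartial r zero    = 1ℚ
expPartial r (suc m) = expPartial r m ℚ.+ expTerm r (suc m)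

-- For rational r ≥ 0:  exp r ≤ N  iff every partial sum is ≤ N,
--                      N < exp r  iff some partial sum exceeds N.
ExpLe : ℚ → ℕ → Set
ExpLe r N = ∀ m → expPartial r m ℚ.≤ (ℤ.+ N / 1)

ExpGt : ℚ → ℕ → Set
ExpGt r N = ∃ λ m → (ℤ.+ N / 1) ℚ.< expPartial r m

-- p ≤ (log N)^K   (natural logarithm), via a rational r with p ≤ r^K ≤ (log N)^K
LeLogPow : ℕ → ℕ → ℕ → Set
LeLogPow K N p = ∃ λ r → (0ℚ ℚ.< r) × ((ℤ.+ p / 1) ℚ.≤ r ^ℚ K) × ExpLe r N

-- (log N)^K < q   via a rational r with log N < r and r^K ≤ q
LtLogPow : ℕ → ℕ → ℕ → Set
LtLogPow K N q = ∃ λ r → (0ℚ ℚ.≤ r) × ExpGt r N × (r ^ℚ K ℚ.≤ (ℤ.+ q / 1))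

IsFloorLogPow : ℕ → ℕ → ℕ → Set
IsFloorLogPow K N y = LeLogPow K N y × LtLogPow K N (suc y)

Smooth : ℕ → ℕ → Set
Smooth y n = (0 ℕ.< n) × (∀ p → Prime p → p ∣ n → p ℕ.≤ y)

InS : ℕ → ℕ → ℕ → Set
InS N y n = (n ℕ.≤ N) × Smooth y n

-- a duplicate-free list L enumerates exactly S(N, y); then Ψ(N,y) = length L
Enumerates : ℕ → ℕ → List ℕ → Set
Enumerates N y L = Unique L × (∀ n → (n ∈ L) ⇔ InS N y n)

-- A (a duplicate-free list) is a subset of S(N, y); then |A| = length A
SubsetS : ℕ → ℕ → List ℕ → Set
SubsetS N y A = Unique A × (∀ n → n ∈ A → InS N y n)

Has3AP : List ℕ → Set
Has3AP A = Σ ℤ λ n → Σ ℤ λ d → (d ≢ ℤ.+ 0)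
  × (n ∈ map ℤ.+_ A) × ((n ℤ.+ d) ∈ map ℤ.+_ A) × ((n ℤ.+ ℤ.+ 2 ℤ.* d) ∈ map ℤ.+_ A)

{-# OPTIONS --safe #-}

-- The numbers r i = 1 + w! (d + i) with i < d form an arithmetic progression, so by Roth's theorem (proved here by
-- Szemerédi's cube argument) a progression-free set A meets every multiple {m r i : i < d} in few points. Because y is
-- a power of log N, the number of smooth n ≤ N grows locally like a power of N with exponent less than 1, so that
-- almost every smooth number is divisible by many of the r i, and averaging over m bounds |A|.
--
-- No asymptotics of Ψ are needed: removing a prime q from n = q m with a suitable weight lam q turns the condition
-- n ≤ N into a weight V m, a function of log m whose slope is below 1 and varies slowly, while the normalisation
-- ν m = 1 / Σ_{q ∣ m} lam q does not change when m is multiplied by r i. With respect to the weight ν V, the variance of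
-- the number of r i dividing m can be computed term by term. Chebyshev's bounds allow lam to be spread over the primes
-- of each scale, and show that few smooth numbers have so few prime factors that Σ_{q ∣ m} lam q is small.
module Submission where

open import Defs
open import Data.Nat as ℕ using (ℕ)
open import Data.Integer as ℤ using ()
open import Data.Rational as ℚ using (ℚ; 0ℚ; _/_)
open import Data.List using (List; length)
open import Data.Product using (Σ; ∃; _×_)

open import Data.Nat hiding (_/_)
open import Data.Nat.Properties
open import Data.Nat.Divisibility
open import Data.Nat.Tactic.RingSolver using (solve)
open import Data.List using ([]; _∷_; map)
open import Data.List.Properties using (length-map)
open import Data.List.Relation.Unary.All using (All) renaming ([] to []ᵃ; _∷_ to _∷ᵃ_)
open import Data.Product using (_,_; proj₁; proj₂)
open import Data.Sum using (_⊎_; inj₁; inj₂; [_,_]′)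
open import Data.Empty using (⊥; ⊥-elim)
open import Function using (case_of_)
open import Relation.Nullary using (¬_; Dec; yes; no; _×-dec_)
open import Relation.Binary.PropositionalEquality hiding (J)
open import Relation.Binary.Definitions using (Tri; tri<; tri≈; tri>)
open import Data.Nat.GCD using (gcd; gcd[m,n]∣m; gcd[m,n]∣n; gcd-comm; gcd-greatest; c*gcd[m,n]≡gcd[cm,cn])
open import Data.Nat.Coprimality using (Coprime; coprime-divisor; gcd≡1⇒coprime)
open import Data.Nat.Primality using (Prime; prime?; ¬prime[1]; euclidsLemma; prime⇒nonZero; prime⇒nonTrivial; prime⇒irreducible)
open import Data.Nat.Primality.Factorisation using (factorise)
open import Data.Rational using (1ℚ)
open import Data.Rational.Unnormalised as ℚᵘ using (ℚᵘ; mkℚᵘ; *≡*; *≤*)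
open import Data.Integer.Properties as ℤP using ()
open import Data.Rational.Unnormalised.Properties as ℚᵘP using ()
open import Data.Rational.Properties as ℚP using ()
open import Data.Nat.DivMod using (m*n/n≡m; /-monoˡ-≤; m/n*n≤m; m≡m%n+[m/n]*n; m%n<n)
open import Data.List.Membership.DecPropositional _≟_ using (_∈?_)
open import Data.List.Membership.Propositional using (_∈_)
open import Data.List.Membership.Propositional.Properties using (∈-map⁺)
open import Data.List.Relation.Unary.Any using (here; there)
open import Data.List.Relation.Unary.All as All using ()
open import Data.List.Relation.Unary.AllPairs as AllPairs using ()
open import Data.List.Relation.Unary.Unique.Propositional using (Unique)
open import Function.Bundles using (module Equivalence)


-- Two demands fix the weight. The slope of `V` must stay below 1: a common divisor g of `r i` and
-- `r j` costs V(m)/V(gm) in the variance, and about d²/g² pairs of indices have r i and r j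
-- divisible by g, so the sum over g converges only if this cost is smaller than g by a power of g.
-- The choice of `r i` makes every gcd either 1 or larger than w, so that only a tail of this sum
-- counts. But the slope must also be close to 1: then `lam` varies over the primes by a factor of
-- about y^(1/k) only, an n with small Σ lam q has about y^(1/k) prime factors at most, and for
-- large k such n are negligible. The slope 1 - 1/k is thus a free parameter and not the true
-- exponent of Ψ. It must not set in abruptly either: `V` is compared at m, am, bm and abm, so it
-- has to be log-linear up to a small error over a range of length log R₂. Hence the slow ramp. All
-- quantities are natural numbers: fractions are cross-multiplied and reciprocals scaled by
-- factorials.

-- Certificates for inequalities, indicators and finite sums.

-- Polynomial inequalities are proved by certificates: `h` is a nonnegative combination of
-- hypotheses, assembled with `_⊕_` and `_⊛_`, `s` is the slack, and the ring solver confirms the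
-- identity. Sums on both sides avoid truncated subtraction.
by≤ : ∀ s {A B X Y} → X ≤ Y → A + Y + s ≡ B + X → A ≤ B
by≤ s {A} {B} {X} {Y} h e =
  +-cancelʳ-≤ Y A B (≤-trans (≤-trans (m≤m+n (A + Y) s) (≤-reflexive e)) (+-monoʳ-≤ B h))

infixl 6 _⊕_
infixl 7 _⊛_

_⊕_ : ∀ {a b c d} → a ≤ b → c ≤ d → a + c ≤ b + d
_⊕_ = +-mono-≤

_⊛_ : ∀ c {a b} → a ≤ b → c * a ≤ c * b
c ⊛ h = *-monoʳ-≤ c h

pos : ∀ {n} → 1 ≤ n → NonZero n
pos h = >-nonZero h

pos-* : ∀ {m n} → 1 ≤ m → 1 ≤ n → 1 ≤ m * n
pos-* = *-mono-≤

pos-^ : ∀ {m} n → 1 ≤ m → 1 ≤ m ^ n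
pos-^ {m} n h = m^n>0 m {{pos h}} n

cancelˡ : ∀ c {a b} → 1 ≤ c → c * a ≤ c * b → a ≤ b
cancelˡ c h = *-cancelˡ-≤ c {{pos h}}

m≤c*m : ∀ {c} m → 1 ≤ c → m ≤ c * m
m≤c*m {c} m h = m≤n*m m c {{pos h}}

≤⇒+ : ∀ {m n} → m ≤ n → ∃ λ o → n ≡ m + o
≤⇒+ {m} {n} h = n ∸ m , sym (m+[n∸m]≡n h)

⟦_⟧ : ∀ {P : Set} → Dec P → ℕ
⟦ yes _ ⟧ = 1
⟦ no  _ ⟧ = 0

⟦⟧-yes : ∀ {P : Set} (d : Dec P) → P → ⟦ d ⟧ ≡ 1
⟦⟧-yes (yes _) p = refl
⟦⟧-yes (no ¬p) p = ⊥-elim (¬p p)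

⟦⟧-no : ∀ {P : Set} (d : Dec P) → ¬ P → ⟦ d ⟧ ≡ 0
⟦⟧-no (yes p) ¬p = ⊥-elim (¬p p)
⟦⟧-no (no _)  ¬p = refl

⟦⟧≤1 : ∀ {P : Set} (d : Dec P) → ⟦ d ⟧ ≤ 1
⟦⟧≤1 (yes _) = ≤-refl
⟦⟧≤1 (no _)  = z≤n

⟦⟧-mono : ∀ {P Q : Set} (d : Dec P) (e : Dec Q) → (P → Q) → ⟦ d ⟧ ≤ ⟦ e ⟧
⟦⟧-mono (yes p) e f = ≤-reflexive (sym (⟦⟧-yes e (f p)))
⟦⟧-mono (no _)  e f = z≤n

⟦⟧-cong : ∀ {P Q : Set} (d : Dec P) (e : Dec Q) → (P → Q) → (Q → P) → ⟦ d ⟧ ≡ ⟦ e ⟧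
⟦⟧-cong d e f g = ≤-antisym (⟦⟧-mono d e f) (⟦⟧-mono e d g)

⟦⟧>0 : ∀ {P : Set} (d : Dec P) → 0 < ⟦ d ⟧ → P
⟦⟧>0 (yes p) _ = p

∑ : ℕ → (ℕ → ℕ) → ℕ
∑ zero    f = 0
∑ (suc n) f = ∑ n f + f n

∑-cong : ∀ n {f g} → (∀ i → i < n → f i ≡ g i) → ∑ n f ≡ ∑ n g
∑-cong zero    h = refl
∑-cong (suc n) h = cong₂ _+_ (∑-cong n (λ i i<n → h i (m≤n⇒m≤1+n i<n))) (h n ≤-refl)

∑-ext : ∀ n {f g} → (∀ i → f i ≡ g i) → ∑ n f ≡ ∑ n g
∑-ext n h = ∑-cong n (λ i _ → h i)

∑-mono : ∀ n {f g} → (∀ i → i < n → f i ≤ g i) → ∑ n f ≤ ∑ n g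
∑-mono zero    h = z≤n
∑-mono (suc n) h = +-mono-≤ (∑-mono n (λ i i<n → h i (m≤n⇒m≤1+n i<n))) (h n ≤-refl)

∑-const : ∀ n c → ∑ n (λ _ → c) ≡ n * c
∑-const zero    c = refl
∑-const (suc n) c = trans (cong (_+ c) (∑-const n c)) (+-comm (n * c) c)

∑-zero : ∀ n {f} → (∀ i → i < n → f i ≡ 0) → ∑ n f ≡ 0
∑-zero n h = trans (∑-cong n h) (trans (∑-const n 0) (*-zeroʳ n))

∑-+ : ∀ n f g → ∑ n (λ i → f i + g i) ≡ ∑ n f + ∑ n g
∑-+ zero    f g = refl
∑-+ (suc n) f g = trans (cong (_+ (f n + g n)) (∑-+ n f g)) (interchange (∑ n f) (∑ n g) (f n) (g n))
  where
  interchange : ∀ a b c d → (a + b) + (c + d) ≡ (a + c) + (b + d)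
  interchange a b c d = solve (a ∷ b ∷ c ∷ d ∷ [])

∑-*ˡ : ∀ n c f → ∑ n (λ i → c * f i) ≡ c * ∑ n f
∑-*ˡ zero    c f = sym (*-zeroʳ c)
∑-*ˡ (suc n) c f = trans (cong (_+ c * f n) (∑-*ˡ n c f)) (sym (*-distribˡ-+ c (∑ n f) (f n)))

∑-*ʳ : ∀ n c f → ∑ n (λ i → f i * c) ≡ ∑ n f * c
∑-*ʳ n c f = trans (∑-ext n (λ i → *-comm (f i) c)) (trans (∑-*ˡ n c f) (*-comm c (∑ n f)))

∑-swap : ∀ m n (f : ℕ → ℕ → ℕ) → ∑ m (λ i → ∑ n (λ j → f i j)) ≡ ∑ n (λ j → ∑ m (λ i → f i j))
∑-swap zero    n f = sym (∑-zero n (λ _ _ → refl))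
∑-swap (suc m) n f = trans (cong (_+ ∑ n (f m)) (∑-swap m n f)) (sym (∑-+ n _ _))

∑-term : ∀ n f {i} → i < n → f i ≤ ∑ n f
∑-term (suc n) f {i} i<1+n with m≤n⇒m<n∨m≡n (≤-pred i<1+n)
... | inj₁ i<n  = ≤-trans (∑-term n f i<n) (m≤m+n _ _)
... | inj₂ refl = m≤n+m (f i) (∑ n f)

∑-split : ∀ m n f → ∑ (m + n) f ≡ ∑ m f + ∑ n (λ i → f (m + i))
∑-split m zero    f = trans (cong (λ k → ∑ k f) (+-identityʳ m)) (sym (+-identityʳ _))
∑-split m (suc n) f = trans (cong (λ k → ∑ k f) (+-suc m n))
  (trans (cong (_+ f (m + n)) (∑-split m n f)) (+-assoc (∑ m f) _ _))

∑-≤ : ∀ {m n} f → m ≤ n → ∑ m f ≤ ∑ n f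
∑-≤ {m} f h with ≤⇒+ h
... | o , refl = ≤-trans (m≤m+n _ _) (≤-reflexive (sym (∑-split m o f)))

∑-windows : ∀ u w f → ∑ (u * w) f ≡ ∑ u (λ i → ∑ w (λ j → f (i * w + j)))
∑-windows zero    w f = refl
∑-windows (suc u) w f = trans (cong (λ k → ∑ k f) (+-comm w (u * w)))
  (trans (∑-split (u * w) w f) (cong (_+ ∑ w (λ j → f (u * w + j))) (∑-windows u w f)))

∑-delta : ∀ n (f : ℕ → ℕ) {x} → x < n → ∑ n (λ i → ⟦ i ≟ x ⟧ * f i) ≡ f x
∑-delta (suc n) f {x} x<1+n with m≤n⇒m<n∨m≡n (≤-pred x<1+n)
... | inj₁ x<n  = trans (cong₂ _+_ (∑-delta n f x<n) (cong (_* f n) (⟦⟧-no (n ≟ x) (λ e → <⇒≢ x<n (sym e))))) (+-identityʳ (f x))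
... | inj₂ refl = trans (cong₂ _+_ (∑-zero n (λ i i<n → cong (_* f i) (⟦⟧-no (i ≟ x) (<⇒≢ i<n)))) (cong (_* f x) (⟦⟧-yes (x ≟ x) refl)))
                    (+-identityʳ (f x))

∑-delta-out : ∀ n (f : ℕ → ℕ) {x} → n ≤ x → ∑ n (λ i → ⟦ i ≟ x ⟧ * f i) ≡ 0
∑-delta-out n f {x} h = ∑-zero n (λ i i<n → cong (_* f i) (⟦⟧-no (i ≟ x) (<⇒≢ (<-≤-trans i<n h))))

∑-delta≤ : ∀ n (f : ℕ → ℕ) x → ∑ n (λ i → ⟦ i ≟ x ⟧ * f i) ≤ f x
∑-delta≤ n f x with x <? n
... | yes h = ≤-reflexive (∑-delta n f h)
... | no  h = ≤-trans (≤-reflexive (∑-delta-out n f (≮⇒≥ h))) z≤n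

∑-pigeonhole : ∀ n c f → n * c < ∑ n f → ∃ λ i → i < n × c < f i
∑-pigeonhole zero    c f ()
∑-pigeonhole (suc n) c f h with c <? f n
... | yes p = n , ≤-refl , p
... | no ¬p with ∑-pigeonhole n c f (rec (n * c) c (∑ n f) (f n) h (≮⇒≥ ¬p))
  where
  rec : ∀ a c s t → c + a < s + t → t ≤ c → a < s
  rec a c s t h g = by≤ 0 (h ⊕ g) (solve (a ∷ c ∷ s ∷ t ∷ []))
...   | i , i<n , p = i , m≤n⇒m≤1+n i<n , p

∑-bounded : ∀ n c f → (∀ i → i < n → f i ≤ c) → ∑ n f ≤ n * c
∑-bounded n c f h = ≤-trans (∑-mono n h) (≤-reflexive (∑-const n c))

∑>0 : ∀ n f → 0 < ∑ n f → ∃ λ i → i < n × 0 < f i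
∑>0 n f h = ∑-pigeonhole n 0 f (≤-trans (s≤s (≤-reflexive (*-zeroʳ n))) h)

⟦⟧*-mono : ∀ {P : Set} (D : Dec P) {a b} → (P → a ≤ b) → ⟦ D ⟧ * a ≤ ⟦ D ⟧ * b
⟦⟧*-mono (yes p) h = +-mono-≤ (h p) z≤n
⟦⟧*-mono (no _)  h = z≤n

⟦⟧*≤ : ∀ {P : Set} (D : Dec P) {a b} → (P → a ≤ b) → ⟦ D ⟧ * a ≤ b
⟦⟧*≤ (yes p) {a} h = ≤-trans (≤-reflexive (+-identityʳ a)) (h p)
⟦⟧*≤ (no _)  h = z≤n

>0*-mono : ∀ c {a b} → (0 < c → a ≤ b) → c * a ≤ c * b
>0*-mono zero    h = z≤n
>0*-mono (suc c) h = suc c ⊛ h (s≤s z≤n)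

-- Progression-free sets and their density.

Free : (ℕ → ℕ) → Set
Free χ = (∀ i → χ i ≤ 1) × (∀ a b → 0 < b → 0 < χ a → 0 < χ (a + b) → χ (a + b + b) ≡ 0)

free-affine : ∀ {χ} → Free χ → ∀ c e → 1 ≤ e → Free (λ i → χ (c + i * e))
free-affine {χ} (h1 , h2) c e 1≤e = (λ i → h1 _) , λ a b 0<b p q →
  trans (cong χ (eq₂ a b)) (h2 (c + a * e) (b * e) (pos-* 0<b 1≤e) p (subst (λ z → 0 < χ z) (eq₁ a b) q))
  where
  eq₁ : ∀ a b → c + (a + b) * e ≡ c + a * e + b * e
  eq₁ a b = solve (a ∷ b ∷ c ∷ e ∷ [])
  eq₂ : ∀ a b → c + (a + b + b) * e ≡ c + a * e + b * e + b * e
  eq₂ a b = solve (a ∷ b ∷ c ∷ e ∷ [])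

-- With r₃(n) the largest size of a progression-free set among n consecutive integers, this is
-- r₃(n)/n ≤ p/Q. The descent below keeps `Q` fixed and lowers `p`.
Dens : ℕ → ℕ → ℕ → Set
Dens Q p n = ∀ χ → Free χ → Q * ∑ n χ ≤ p * n

free-shift : ∀ {χ} → Free χ → ∀ c → Free (λ i → χ (c + i))
free-shift {χ} F c = subst₂′ (free-affine F c 1 ≤-refl)
  where
  e : ∀ i → χ (c + i * 1) ≡ χ (c + i)
  e i = cong (λ z → χ (c + z)) (*-identityʳ i)
  subst₂′ : Free (λ i → χ (c + i * 1)) → Free (λ i → χ (c + i))
  subst₂′ (h1 , h2) = (λ i → subst (_≤ 1) (e i) (h1 i)) ,
    λ a b 0<b p q → trans (sym (e (a + b + b))) (h2 a b 0<b (subst (0 <_) (sym (e a)) p) (subst (0 <_) (sym (e (a + b))) q))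

dens-multiple : ∀ {Q p n} u → Dens Q p n → Dens Q p (u * n)
dens-multiple {Q} {p} {n} u D χ F = begin
  Q * ∑ (u * n) χ                                  ≡⟨ cong (Q *_) (∑-windows u n χ) ⟩
  Q * ∑ u (λ i → ∑ n (λ j → χ (i * n + j)))         ≡⟨ ∑-*ˡ u Q _ ⟨
  ∑ u (λ i → Q * ∑ n (λ j → χ (i * n + j)))         ≤⟨ ∑-bounded u (p * n) _ (λ i _ → D _ (free-shift F (i * n))) ⟩
  u * (p * n)                                      ≡⟨ solve (u ∷ p ∷ n ∷ []) ⟩
  p * (u * n)                                      ∎
  where open ≤-Reasoning

-- Hilbert cubes

Cube : (ℕ → Set) → ℕ → List ℕ → Set
Cube P a []       = P a
Cube P a (e ∷ ds) = Cube P a ds × Cube P (a + e) ds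

cube-map : ∀ {P R : ℕ → Set} w o → (∀ u → P u → R (u * w + o)) →
           ∀ a ds → Cube P a ds → Cube R (a * w + o) (map (_* w) ds)
cube-map w o f a [] c = f a c
cube-map {R = R} w o f a (e ∷ ds) (c , c′) = cube-map w o f a ds c ,
  subst (λ z → Cube R z (map (_* w) ds)) (eq a e) (cube-map w o f (a + e) ds c′)
  where
  eq : ∀ a e → (a + e) * w + o ≡ a * w + o + e * w
  eq a e = solve (a ∷ e ∷ w ∷ o ∷ [])

cube-imp : ∀ {P R : ℕ → Set} → (∀ u → P u → R u) → ∀ a ds → Cube P a ds → Cube R a ds
cube-imp f a [] c = f a c
cube-imp f a (e ∷ ds) (c , c′) = cube-imp f a ds c , cube-imp f (a + e) ds c′

cube-shift : ∀ {P : ℕ → Set} b a ds → Cube (λ u → P (b + u)) a ds → Cube P (b + a) ds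
cube-shift b a [] c = c
cube-shift {P} b a (e ∷ ds) (c , c′) = cube-shift b a ds c ,
  subst (λ z → Cube P z ds) (sym (+-assoc b a e)) (cube-shift {P} b (a + e) ds c′)

Step : ℕ → ℕ → Set
Step l e = 1 ≤ e × e ≤ l

steps-map : ∀ l w ds → 1 ≤ w → All (Step l) ds → All (Step (l * w)) (map (_* w) ds)
steps-map l w [] h []ᵃ = []ᵃ
steps-map l w (e ∷ ds) h ((p , q) ∷ᵃ ps) = (pos-* p h , *-monoˡ-≤ w q) ∷ᵃ steps-map l w ds h ps

pairs : (ℕ → ℕ) → ℕ → ℕ
pairs χ w = ∑ w (λ o′ → ∑ w (λ o → ⟦ o <? o′ ⟧ * (χ o * χ o′)))

-- s ≤ 1 + s(s - 1)/2 for the number s of points. So windows that hold two points on average hold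
-- one pair on average.
pairs-bound : ∀ χ w → (∀ i → χ i ≤ 1) → ∑ w χ ≤ 1 + pairs χ w
pairs-bound χ w h = go w ≤-refl
  where
  P : ℕ → ℕ
  P o′ = ∑ w (λ o → ⟦ o <? o′ ⟧ * (χ o * χ o′))
  below : ∀ o′ → o′ < w → ∑ o′ χ * χ o′ ≤ P o′
  below o′ lt = begin
    ∑ o′ χ * χ o′                                  ≡⟨ ∑-*ʳ o′ (χ o′) χ ⟨
    ∑ o′ (λ o → χ o * χ o′)                        ≡⟨ ∑-cong o′ (λ o o<o′ → sym (trans (cong (_* (χ o * χ o′)) (⟦⟧-yes (o <? o′) o<o′)) (*-identityˡ _))) ⟩
    ∑ o′ (λ o → ⟦ o <? o′ ⟧ * (χ o * χ o′))        ≤⟨ ∑-≤ _ (<⇒≤ lt) ⟩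
    P o′                                           ∎
    where open ≤-Reasoning
  step : ∀ s x p q → s ≤ 1 + p → x ≤ 1 → s * x ≤ q → s + x ≤ 1 + (p + q)
  step s zero p q a b c = ≤-trans (≤-reflexive (+-identityʳ s)) (≤-trans a (s≤s (m≤m+n p q)))
  step zero (suc zero) p q a b c = s≤s z≤n
  step (suc s) (suc zero) p q a b c = by≤ s (a ⊕ c) (solve (s ∷ p ∷ q ∷ []))
  step s (suc (suc x)) p q a (s≤s ()) c
  go : ∀ n → n ≤ w → ∑ n χ ≤ 1 + ∑ n P
  go zero    _ = z≤n
  go (suc n) l = step (∑ n χ) (χ n) (∑ n P) (P n) (go n (<⇒≤ l)) (h n) (below n l)

⊗>0 : ∀ {a b} → 0 < a * b → 0 < a × 0 < b
⊗>0 {zero} ()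
⊗>0 {suc a} {zero} h = ⊥-elim (<⇒≢ h (sym (*-zeroʳ a)))
⊗>0 {suc a} {suc b} h = s≤s z≤n , s≤s z≤n

CubeLemma : ℕ → ℕ → ℕ → Set
CubeLemma j Q l = ∀ χ → (∀ i → χ i ≤ 1) → l ≤ Q * ∑ l χ →
  ∃ λ a → ∃ λ ds → length ds ≡ j × All (Step l) ds × Cube (λ u → 0 < χ u × u < l) a ds

-- Cut [0, l′w) into l′ windows of length w = 2Q. They hold two points of `χ` on average, hence at
-- least l′ pairs altogether. By pigeonhole over the w² pairs of offsets, some pair (o, o′) occurs
-- in at least l′/w² windows. A cube formed by the numbers of these windows, scaled by `w`, gets o′
-- - o as its new step.
cube-step : ∀ j Q w l′ → w ≡ 2 * Q → 1 ≤ w → 1 ≤ l′ → CubeLemma j (w * w) l′ → CubeLemma (suc j) Q (l′ * w)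
cube-step j Q w l′ w≡2Q 1≤w 1≤l′ IH χ h p = result
  where
  1≤Q : 1 ≤ Q
  1≤Q = proj₂ (⊗>0 {2} (subst (1 ≤_) w≡2Q 1≤w))
  χw : ℕ → ℕ → ℕ
  χw u o = χ (u * w + o)
  pr : ℕ → ℕ → ℕ → ℕ
  pr u o′ o = ⟦ o <? o′ ⟧ * (χw u o * χw u o′)
  many : l′ ≤ ∑ l′ (λ u → ∑ w (λ o′ → ∑ w (λ o → pr u o′ o)))
  many = +-cancelˡ-≤ l′ _ _ (≤-trans (cancel l′ _ (subst (λ z → l′ * z ≤ Q * ∑ (l′ * w) χ) w≡2Q p)) (begin
    ∑ (l′ * w) χ                           ≡⟨ ∑-windows l′ w χ ⟩
    ∑ l′ (λ u → ∑ w (χw u))                ≤⟨ ∑-mono l′ (λ u _ → pairs-bound (χw u) w (λ i → h _)) ⟩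
    ∑ l′ (λ u → 1 + pairs (χw u) w)        ≡⟨ ∑-+ l′ (λ _ → 1) (λ u → pairs (χw u) w) ⟩
    ∑ l′ (λ _ → 1) + ∑ l′ (λ u → pairs (χw u) w) ≡⟨ cong (_+ ∑ l′ (λ u → pairs (χw u) w)) (trans (∑-const l′ 1) (*-identityʳ l′)) ⟩
    l′ + ∑ l′ (λ u → pairs (χw u) w)       ∎))
    where
    open ≤-Reasoning
    cancel : ∀ l s → l * (2 * Q) ≤ Q * s → l + l ≤ s
    cancel l s h = cancelˡ Q 1≤Q (by≤ 0 h (solve (l ∷ Q ∷ s ∷ [])))
  swapped : ∑ l′ (λ u → ∑ w (λ o′ → ∑ w (λ o → pr u o′ o))) ≡ ∑ w (λ o′ → ∑ w (λ o → ∑ l′ (λ u → pr u o′ o)))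
  swapped = trans (∑-swap l′ w _) (∑-ext w (λ o′ → ∑-swap l′ w _))
  -- Otherwise every pair of offsets is hit fewer than l′/w² times.
  find : ∃ λ o′ → o′ < w × ∃ λ o → o < w × l′ ≤ (w * w) * ∑ l′ (λ u → pr u o′ o)
  find with ∑-pigeonhole w (w * (l′ ∸ 1)) (λ o′ → ∑ w (λ o → (w * w) * ∑ l′ (λ u → pr u o′ o))) big
    where
    big : w * (w * (l′ ∸ 1)) < ∑ w (λ o′ → ∑ w (λ o → (w * w) * ∑ l′ (λ u → pr u o′ o)))
    big = begin-strict
      w * (w * (l′ ∸ 1)) ≡⟨ *-assoc w w _ ⟨
      w * w * (l′ ∸ 1)   <⟨ *-monoʳ-< (w * w) {{pos (pos-* 1≤w 1≤w)}} (≤-reflexive (trans (+-comm 1 _) (m∸n+n≡m 1≤l′))) ⟩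
      w * w * l′         ≤⟨ (w * w) ⊛ many ⟩
      w * w * ∑ l′ (λ u → ∑ w (λ o′ → ∑ w (λ o → pr u o′ o))) ≡⟨ cong (w * w *_) swapped ⟩
      w * w * ∑ w (λ o′ → ∑ w (λ o → ∑ l′ (λ u → pr u o′ o))) ≡⟨ ∑-*ˡ w (w * w) _ ⟨
      ∑ w (λ o′ → w * w * ∑ w (λ o → ∑ l′ (λ u → pr u o′ o))) ≡⟨ ∑-ext w (λ o′ → sym (∑-*ˡ w (w * w) _)) ⟩
      ∑ w (λ o′ → ∑ w (λ o → (w * w) * ∑ l′ (λ u → pr u o′ o))) ∎
      where open ≤-Reasoning
  ... | o′ , o′<w , b with ∑-pigeonhole w (l′ ∸ 1) _ b
  ...   | o , o<w , c = o′ , o′<w , o , o<w , ≤-trans (≤-reflexive (sym (trans (+-comm 1 _) (m∸n+n≡m 1≤l′)))) c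
  inside : ∀ u o → o < w → u < l′ → u * w + o < l′ * w
  inside u o o<w u<l′ = begin-strict
    u * w + o <⟨ +-monoʳ-< (u * w) o<w ⟩
    u * w + w ≡⟨ +-comm (u * w) w ⟩
    suc u * w ≤⟨ *-monoˡ-≤ w u<l′ ⟩
    l′ * w    ∎
    where open ≤-Reasoning
  P : ℕ → Set
  P u = 0 < χ u × u < l′ * w
  module Offsets (o o′ : ℕ) (o<w : o < w) (o′<w : o′ < w) where
    val : ∀ u → 0 < pr u o′ o → 0 < χw u o × 0 < χw u o′
    val u q = ⊗>0 {χw u o} {χw u o′} (proj₂ (⊗>0 {⟦ o <? o′ ⟧} {χw u o * χw u o′} q))
    ordered : ∀ u → 0 < pr u o′ o → o < o′
    ordered u q = ⟦⟧>0 (o <? o′) (proj₁ (⊗>0 {⟦ o <? o′ ⟧} {χw u o * χw u o′} q))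
    build : ∀ a ds → o < o′ → length ds ≡ j → All (Step l′) ds → Cube (λ u → 0 < pr u o′ o × u < l′) a ds →
            ∃ λ a → ∃ λ ds → length ds ≡ suc j × All (Step (l′ * w)) ds × Cube P a ds
    build a ds o<o′ len st cu = a * w + o , (o′ ∸ o) ∷ map (_* w) ds ,
      cong suc (trans (length-map _ ds) len) ,
      ((m<n⇒0<n∸m o<o′ , ≤-trans (m∸n≤m o′ o) (≤-trans (<⇒≤ o′<w) (m≤c*m w 1≤l′))) ∷ᵃ steps-map l′ w ds 1≤w st) ,
      (cube-map {R = P} w o (λ u q → proj₁ (val u (proj₁ q)) , inside u o o<w (proj₂ q)) a ds cu ,
       subst (λ z → Cube P z (map (_* w) ds)) eq
         (cube-map {R = P} w o′ (λ u q → proj₂ (val u (proj₁ q)) , inside u o′ o′<w (proj₂ q)) a ds cu))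
      where
      eq : a * w + o′ ≡ a * w + o + (o′ ∸ o)
      eq = sym (trans (+-assoc (a * w) o (o′ ∸ o)) (cong (a * w +_) (m+[n∸m]≡n (<⇒≤ o<o′))))
    finish : l′ ≤ (w * w) * ∑ l′ (λ u → pr u o′ o) →
             ∃ λ a → ∃ λ ds → length ds ≡ suc j × All (Step (l′ * w)) ds × Cube P a ds
    finish dense =
      case IH (λ u → pr u o′ o) (λ u → *-mono-≤ (⟦⟧≤1 (o <? o′)) (*-mono-≤ (h _) (h _))) dense of
        λ (a , ds , len , st , cu) → case ∑>0 l′ (λ u → pr u o′ o) (proj₂ (⊗>0 {w * w} (≤-trans 1≤l′ dense))) of
          λ (u₀ , _ , pr>0) → build a ds (ordered u₀ pr>0) len st cu
  result : ∃ λ a → ∃ λ ds → length ds ≡ suc j × All (Step (l′ * w)) ds × Cube P a ds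
  result = case find of λ (o′ , o′<w , o , o<w , dense) → Offsets.finish o o′ o<w o′<w dense

hilbert-cube : ∀ j Q → ∃ λ l → 1 ≤ l × CubeLemma j Q l
hilbert-cube zero Q = 1 , ≤-refl , λ χ h p → 0 , [] , refl , []ᵃ , proj₂ (⊗>0 {Q} p) , ≤-refl
hilbert-cube (suc j) zero = 1 , ≤-refl , λ χ h p → ⊥-elim (<⇒≱ p z≤n)
hilbert-cube (suc j) (suc Q) = let l′ , 1≤l′ , IH = hilbert-cube j (2 * suc Q * (2 * suc Q)) in
  l′ * (2 * suc Q) , pos-* 1≤l′ (s≤s z≤n) , cube-step j (suc Q) (2 * suc Q) l′ refl (s≤s z≤n) 1≤l′ IH

-- Szemerédi's cube argument for Roth's theorem.

const-or-jump : ∀ n (t : ℕ → ℕ) → (∀ i → i < n → t i ≡ t 0) ⊎ (∃ λ i → suc i < n × t i ≢ t (suc i))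
const-or-jump zero    t = inj₁ (λ i ())
const-or-jump (suc zero) t = inj₁ λ { zero _ → refl ; (suc i) (s≤s ()) }
const-or-jump (suc (suc n)) t with const-or-jump (suc n) t
... | inj₂ (i , i<n , ne) = inj₂ (i , m≤n⇒m≤1+n i<n , ne)
... | inj₁ c with t n ≟ t (suc n)
...   | no ne = inj₂ (n , ≤-refl , ne)
...   | yes e = inj₁ λ i h → [ (λ i<n → c i i<n) , (λ { refl → trans (sym e) (c n ≤-refl) }) ]′ (m≤n⇒m<n∨m≡n (≤-pred h))

diff : ℕ → ℕ → ℕ
diff a b = (a ∸ b) + (b ∸ a)

diff>0 : ∀ a b → a ≢ b → 1 ≤ diff a b
diff>0 zero    zero    h = ⊥-elim (h refl)
diff>0 zero    (suc b) h = s≤s z≤n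
diff>0 (suc a) zero    h = s≤s z≤n
diff>0 (suc a) (suc b) h = diff>0 a b (λ e → h (cong suc e))

diff-⊔ : ∀ a b → diff a b + (a + b) ≡ 2 * (a ⊔ b)
diff-⊔ zero    zero    = refl
diff-⊔ zero    (suc b) = s b
  where
  s : ∀ b → suc b + suc b ≡ 2 * suc b
  s b = solve (b ∷ [])
diff-⊔ (suc a) zero    = s a
  where
  s : ∀ a → suc a + 0 + (suc a + 0) ≡ 2 * suc a
  s a = solve (a ∷ [])
diff-⊔ (suc a) (suc b) = trans (l (diff a b) a b) (trans (cong (2 +_) (diff-⊔ a b)) (r (a ⊔ b)))
  where
  l : ∀ d a b → d + (suc a + suc b) ≡ 2 + (d + (a + b))
  l d a b = solve (d ∷ a ∷ b ∷ [])
  r : ∀ m → 2 + 2 * m ≡ 2 * suc m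
  r m = solve (m ∷ [])

-- If `t` is constant on the window, then either t = 0 and the density bound applies, or t = 1 and
-- the window contains no point of `x`. If `t` jumps, it differs there from its shifted copy `t′`,
-- and the second term pays for the whole window.
window-bound : ∀ Q p n (x t t′ : ℕ → ℕ) → (∀ i → x i ≤ 1) → (∀ i → t i ≤ 1) →
  (∀ i → 0 < t i → x i ≡ 0) → (∀ i → t′ (suc i) ≡ t i) → Q * ∑ n x ≤ p * n →
  Q * ∑ n x ≤ p * ∑ n (λ i → 1 ∸ t i) + Q * n * ∑ n (λ i → diff (t i) (t′ i))
window-bound Q p n x t t′ x≤1 t≤1 avoid shift D with const-or-jump n t
... | inj₂ (i , i<n , ne) = ≤-trans (begin
    Q * ∑ n x                               ≤⟨ Q ⊛ ∑-bounded n 1 x (λ i _ → x≤1 i) ⟩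
    Q * (n * 1)                             ≡⟨ *-assoc Q n 1 ⟨
    Q * n * 1                               ≤⟨ (Q * n) ⊛ diff>0 (t (suc i)) (t′ (suc i)) (λ e → ne (sym (trans e (shift i)))) ⟩
    Q * n * diff (t (suc i)) (t′ (suc i))   ≤⟨ (Q * n) ⊛ ∑-term n (λ i → diff (t i) (t′ i)) i<n ⟩
    Q * n * ∑ n (λ i → diff (t i) (t′ i))   ∎) (m≤n+m _ _)
  where open ≤-Reasoning
... | inj₁ c with t 0 in t0
...   | zero  = ≤-trans D (≤-trans (p ⊛ ≤-reflexive (sym (trans (∑-cong n (λ i h → cong (1 ∸_) (c i h))) (trans (∑-const n 1) (*-identityʳ n))))) (m≤m+n _ _))
...   | suc _ = ≤-trans (≤-reflexive (trans (cong (Q *_) (∑-zero n (λ i h → avoid i (subst (0 <_) (sym (c i h)) (s≤s z≤n))))) (*-zeroʳ Q))) z≤n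

module Reflected (χ : ℕ → ℕ) (F : Free χ) (M : ℕ) where

  -- Cube points lie in [M, 2M) and the points x to be reflected in [0, M), so x, c, 2c - x is a
  -- progression with nonzero difference that ends below 4M.
  R : ℕ → Set
  R c = 0 < χ c × M ≤ c × c < M + M

  -- D c ds is the indicator of the points 2c′ − x with c′ in the cube and x < M in χ; a progression-free χ avoids it.
  D₀ : ℕ → ℕ → ℕ
  D₀ c u = ⟦ u ≤? 2 * c ⟧ * (⟦ 2 * c ∸ u <? M ⟧ * χ (2 * c ∸ u))

  D : ℕ → List ℕ → ℕ → ℕ
  D c []       u = D₀ c u
  D c (e ∷ ds) u = D c ds u ⊔ D (c + e) ds u

  D≤1 : ∀ c ds u → D c ds u ≤ 1
  D≤1 c []       u = *-mono-≤ (⟦⟧≤1 (u ≤? 2 * c)) (*-mono-≤ (⟦⟧≤1 (2 * c ∸ u <? M)) (proj₁ F _))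
  D≤1 c (e ∷ ds) u = ⊔-lub (D≤1 c ds u) (D≤1 (c + e) ds u)

  D₀-shift : ∀ c e u → D₀ (c + e) (u + 2 * e) ≡ D₀ c u
  D₀-shift c e u = cong₂ _*_ (⟦⟧-cong (u + 2 * e ≤? 2 * (c + e)) (u ≤? 2 * c)
      (λ h → +-cancelʳ-≤ (2 * e) u (2 * c) (subst (u + 2 * e ≤_) dist h))
      (λ h → subst (u + 2 * e ≤_) (sym dist) (+-monoˡ-≤ (2 * e) h)))
    (cong (λ z → ⟦ z <? M ⟧ * χ z) same)
    where
    dist : 2 * (c + e) ≡ 2 * c + 2 * e
    dist = *-distribˡ-+ 2 c e
    same : 2 * (c + e) ∸ (u + 2 * e) ≡ 2 * c ∸ u
    same = trans (cong (_∸ (u + 2 * e)) dist) ([m+n]∸[o+n]≡m∸o (2 * c) u)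
      where
      [m+n]∸[o+n]≡m∸o : ∀ m o → m + 2 * e ∸ (o + 2 * e) ≡ m ∸ o
      [m+n]∸[o+n]≡m∸o m o = trans (cong₂ _∸_ (+-comm m (2 * e)) (+-comm o (2 * e))) ([m+n]∸[m+o]≡n∸o (2 * e) m o)

  -- Translating the cube by `e` translates its reflection by 2e. The two halves of a cube with
  -- first step `e` therefore reflect to a set and its translate.
  D-shift : ∀ c ds e u → D (c + e) ds (u + 2 * e) ≡ D c ds u
  D-shift c []        e u = D₀-shift c e u
  D-shift c (e′ ∷ ds) e u = cong₂ _⊔_ (D-shift c ds e u)
    (trans (cong (λ z → D z ds (u + 2 * e)) (swap c e e′)) (D-shift (c + e′) ds e u))
    where
    swap : ∀ c e e′ → c + e + e′ ≡ c + e′ + e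
    swap c e e′ = solve (c ∷ e ∷ e′ ∷ [])

  D₀≤D : ∀ c ds u → D₀ c u ≤ D c ds u
  D₀≤D c []       u = ≤-refl
  D₀≤D c (e ∷ ds) u = ≤-trans (D₀≤D c ds u) (m≤m⊔n _ _)

  D-elim : ∀ c ds u → Cube R c ds → 0 < D c ds u → ∃ λ c′ → R c′ × 0 < D₀ c′ u
  D-elim c []       u cu h = c , cu , h
  D-elim c (e ∷ ds) u (cu , cu′) h with ⊔-sel (D c ds u) (D (c + e) ds u)
  ... | inj₁ q = D-elim c ds u cu (subst (0 <_) q h)
  ... | inj₂ q = D-elim (c + e) ds u cu′ (subst (0 <_) q h)

  D₀-elim : ∀ c u → 0 < D₀ c u → ∃ λ x → 0 < χ x × x < M × u + x ≡ 2 * c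
  D₀-elim c u h = let p , q = ⊗>0 {⟦ u ≤? 2 * c ⟧} h
                      q₁ , q₂ = ⊗>0 {⟦ 2 * c ∸ u <? M ⟧} q
    in 2 * c ∸ u , q₂ , ⟦⟧>0 (2 * c ∸ u <? M) q₁ , m+[n∸m]≡n (⟦⟧>0 (u ≤? 2 * c) p)

  D-avoids : ∀ c ds u → Cube R c ds → 0 < D c ds u → χ u ≡ 0 × u < 4 * M
  D-avoids c ds u cu h = case D-elim c ds u cu h of λ (c′ , Rc , h′) → case D₀-elim c′ u h′ of λ (x , χx , x<M , eq) →
    core c′ x (proj₁ Rc) (proj₁ (proj₂ Rc)) (proj₂ (proj₂ Rc)) χx x<M eq
    where
    core : ∀ c x → 0 < χ c → M ≤ c → c < M + M → 0 < χ x → x < M → u + x ≡ 2 * c → χ u ≡ 0 × u < 4 * M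
    core c x χc M≤c c<2M χx x<M eq with ≤⇒+ (<⇒≤ (<-≤-trans x<M M≤c))
    ... | b , refl = subst (λ z → χ z ≡ 0) third (proj₂ F x b 0<b χx χc) , small u x b M eq c<2M
      where
      0<b : 0 < b
      0<b = +-cancelˡ-< x 0 b (subst (_< x + b) (sym (+-identityʳ x)) (<-≤-trans x<M M≤c))
      third : x + b + b ≡ u
      third = +-cancelʳ-≡ x _ _ (trans (rearr x b) (sym eq))
        where
        rearr : ∀ x b → x + b + b + x ≡ 2 * (x + b)
        rearr x b = solve (x ∷ b ∷ [])
      small : ∀ u x b M → u + x ≡ 2 * (x + b) → x + b < M + M → u < 4 * M
      small u x b M eq h = by≤ (1 + x) (2 ⊛ h ⊕ ≤-reflexive eq) (solve (u ∷ x ∷ b ∷ M ∷ []))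

  -- Reflection in `c` is injective, so every point of `χ` below `M` yields its own reflected point.
  D₀-count : ∀ c N → M ≤ c → 2 * c < N → ∑ M χ ≤ ∑ N (D₀ c)
  D₀-count c N M≤c 2c<N = begin
    ∑ M χ                                                 ≡⟨ ∑-ext M (λ x → ∑-delta N (λ _ → χ x) (≤-<-trans (m∸n≤m (2 * c) x) 2c<N)) ⟨
    ∑ M (λ x → ∑ N (λ u → ⟦ u ≟ 2 * c ∸ x ⟧ * χ x))       ≡⟨ ∑-swap M N _ ⟩
    ∑ N (λ u → ∑ M (λ x → ⟦ u ≟ 2 * c ∸ x ⟧ * χ x))       ≤⟨ ∑-mono N (λ u _ → ∑-mono M (λ x x<M → term u x x<M)) ⟩
    ∑ N (λ u → ∑ M (λ x → ⟦ x ≟ 2 * c ∸ u ⟧ * D₀ c u))    ≤⟨ ∑-mono N (λ u _ → ∑-delta≤ M (λ _ → D₀ c u) (2 * c ∸ u)) ⟩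
    ∑ N (D₀ c)                                            ∎
    where
    open ≤-Reasoning
    term : ∀ u x → x < M → ⟦ u ≟ 2 * c ∸ x ⟧ * χ x ≤ ⟦ x ≟ 2 * c ∸ u ⟧ * D₀ c u
    term u x x<M with u ≟ 2 * c ∸ x
    ... | no _     = z≤n
    ... | yes refl = ≤-reflexive (trans (*-identityˡ (χ x)) (sym (trans
        (cong₂ _*_ (⟦⟧-yes (x ≟ 2 * c ∸ (2 * c ∸ x)) (sym back))
          (cong₂ _*_ (⟦⟧-yes (2 * c ∸ x ≤? 2 * c) (m∸n≤m (2 * c) x))
            (cong₂ _*_ (⟦⟧-yes (2 * c ∸ (2 * c ∸ x) <? M) (subst (_< M) (sym back) x<M)) (cong χ back))))
        (trans (*-identityˡ _) (trans (*-identityˡ _) (*-identityˡ _))))))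
      where
      back : 2 * c ∸ (2 * c ∸ x) ≡ x
      back = m∸[m∸n]≡n (≤-trans (<⇒≤ x<M) (≤-trans M≤c (m≤m+n c (c + 0))))

  -- The sets D c ds grow with ds inside [0, N), so adding some e to ds adds at most g points.
  slow-step : ∀ N g l c ds → Cube R c ds → All (Step l) ds →
    (∃ λ e → ∃ λ ds′ → Cube R c ds′ × Cube R (c + e) ds′ × Step l e ×
      ∑ N (D c (e ∷ ds′)) ≤ ∑ N (D c ds′) + g) ⊎ (length ds * suc g ≤ ∑ N (D c ds))
  slow-step N g l c [] cu st = inj₂ z≤n
  slow-step N g l c (e ∷ ds) (cu , cu′) (s ∷ᵃ st) with slow-step N g l c ds cu st
  ... | inj₁ r = inj₁ r
  ... | inj₂ r with ∑ N (D c (e ∷ ds)) ≤? ∑ N (D c ds) + g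
  ...   | yes p = inj₁ (e , ds , cu , cu′ , s , p)
  ...   | no ¬p = inj₂ (≤-trans (+-monoʳ-≤ (suc g) r) (≤-trans (≤-reflexive (trans (+-comm (suc g) _) (+-suc _ g))) (≰⇒> ¬p)))

∑-AP : ∀ B n k f → ∑ (B * n * k) f ≡ ∑ B (λ b → ∑ k (λ r → ∑ n (λ i → f ((b * n * k + r) + i * k))))
∑-AP B n k f = trans (∑-windows (B * n) k f) (trans (∑-windows B n _)
  (∑-ext B (λ b → trans (∑-swap n k _) (∑-ext k (λ r → ∑-ext n (λ i → cong f (eq b n k r i)))))))
  where
  eq : ∀ b n k r i → (b * n + i) * k + r ≡ (b * n * k + r) + i * k
  eq b n k r i = solve (b ∷ n ∷ k ∷ r ∷ i ∷ [])

module Decrement (Q p n₁ : ℕ) (1≤Q : 1 ≤ Q) (1≤n₁ : 1 ≤ n₁) (dens : Dens Q p n₁)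
                 (χ : ℕ → ℕ) (F : Free χ) (g : ℕ) where
  -- `M` makes the boundary error of the windows, Q n₁ times 2g, equal to 2M. Reflected sets lie
  -- below 4M and steps satisfy 2e ≤ M, so that such a set and its translate both fit into [0, 5M).
  M N : ℕ
  M = Q * n₁ * g
  N = 5 * M
  open Reflected χ F M

  -- The set T = `D c ds` misses `χ`, and joining its translate by 2e adds at most `g` points, so T
  -- and the translate differ in at most 2g points. Hence T is constant on most progressions of
  -- difference 2e and length `n₁`, and the density bound can be applied to `χ` on the complement of
  -- T alone. That complement has at most N minus the number of points of `χ` below M elements.
  avoiding-bound : ∀ c e ds → Cube R c ds → Cube R (c + e) ds → 1 ≤ e → 2 * e ≤ M → M ≤ c → 2 * c < N →
    ∀ B → N ≡ B * n₁ * (2 * e) →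
    ∑ N (D c (e ∷ ds)) ≤ ∑ N (D c ds) + g →
    Q * ∑ N χ + p * ∑ M χ ≤ p * N + 2 * M
  avoiding-bound c e ds cu cu′ 1≤e 2e≤M M≤c 2c<N B N≡ slow =
    combine (∑ N χ) (∑ M χ) (∑ N (λ u → 1 ∸ T u)) (∑ N T) (∑ N (λ u → diff (T u) (T′ u))) (∑ N T′) (∑ N (λ u → T u ⊔ T′ u)) N M
      windows compl (≤-trans (D₀-count c N M≤c 2c<N) (∑-mono N (λ u _ → D₀≤D c ds u))) diffs slow shifted refl
    where
    T T′ : ℕ → ℕ
    T  = D c ds
    T′ = D (c + e) ds
    k = 2 * e
    windows : Q * ∑ N χ ≤ p * ∑ N (λ u → 1 ∸ T u) + Q * n₁ * ∑ N (λ u → diff (T u) (T′ u))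
    windows = begin
      Q * ∑ N χ ≡⟨ cong (Q *_) (dec χ) ⟩
      Q * ∑ B (λ b → ∑ k (λ r → ∑ n₁ (λ i → at b r i χ))) ≡⟨ ∑-*ˡ B Q _ ⟨
      ∑ B (λ b → Q * ∑ k (λ r → ∑ n₁ (λ i → at b r i χ))) ≡⟨ ∑-ext B (λ b → sym (∑-*ˡ k Q _)) ⟩
      ∑ B (λ b → ∑ k (λ r → Q * ∑ n₁ (λ i → at b r i χ))) ≤⟨ ∑-mono B (λ b _ → ∑-mono k (λ r _ → one b r)) ⟩
      ∑ B (λ b → ∑ k (λ r → p * ∑ n₁ (λ i → at b r i C) + Q * n₁ * ∑ n₁ (λ i → at b r i E)))
        ≡⟨ ∑-ext B (λ b → trans (∑-+ k _ _) (cong₂ _+_ (∑-*ˡ k p _) (∑-*ˡ k (Q * n₁) _))) ⟩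
      ∑ B (λ b → p * ∑ k (λ r → ∑ n₁ (λ i → at b r i C)) + Q * n₁ * ∑ k (λ r → ∑ n₁ (λ i → at b r i E)))
        ≡⟨ trans (∑-+ B _ _) (cong₂ _+_ (∑-*ˡ B p _) (∑-*ˡ B (Q * n₁) _)) ⟩
      p * ∑ B (λ b → ∑ k (λ r → ∑ n₁ (λ i → at b r i C))) + Q * n₁ * ∑ B (λ b → ∑ k (λ r → ∑ n₁ (λ i → at b r i E)))
        ≡⟨ cong₂ (λ x y → p * x + Q * n₁ * y) (dec C) (dec E) ⟨
      p * ∑ N C + Q * n₁ * ∑ N E ∎
      where
      open ≤-Reasoning
      C E : ℕ → ℕ
      C u = 1 ∸ T u
      E u = diff (T u) (T′ u)
      at : ℕ → ℕ → ℕ → (ℕ → ℕ) → ℕ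
      at b r i f = f ((b * n₁ * k + r) + i * k)
      dec : ∀ f → ∑ N f ≡ ∑ B (λ b → ∑ k (λ r → ∑ n₁ (λ i → at b r i f)))
      dec f = trans (cong (λ z → ∑ z f) N≡) (∑-AP B n₁ k f)
      next : ∀ b r i → at b r (suc i) T′ ≡ at b r i T
      next b r i = trans (cong T′ (eq (b * n₁ * k + r) i k)) (D-shift c ds e _)
        where
        eq : ∀ s i k → s + suc i * k ≡ s + i * k + k
        eq s i k = solve (s ∷ i ∷ k ∷ [])
      one : ∀ b r → Q * ∑ n₁ (λ i → at b r i χ) ≤ p * ∑ n₁ (λ i → at b r i C) + Q * n₁ * ∑ n₁ (λ i → at b r i E)
      one b r = window-bound Q p n₁ (λ i → at b r i χ) (λ i → at b r i T) (λ i → at b r i T′)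
        (λ i → proj₁ F _) (λ i → D≤1 c ds _) (λ i h → proj₁ (D-avoids c ds _ cu h)) (next b r)
        (dens _ (free-affine F (b * n₁ * k + r) k (pos-* {2} (s≤s z≤n) 1≤e)))
    compl : ∑ N (λ u → 1 ∸ T u) + ∑ N T ≡ N
    compl = trans (sym (∑-+ N _ _)) (trans (∑-ext N (λ u → m∸n+n≡m (D≤1 c ds u))) (trans (∑-const N 1) (*-identityʳ N)))
    diffs : ∑ N (λ u → diff (T u) (T′ u)) + (∑ N T + ∑ N T′) ≡ 2 * ∑ N (λ u → T u ⊔ T′ u)
    diffs = trans (cong (∑ N (λ u → diff (T u) (T′ u)) +_) (sym (∑-+ N T T′)))
      (trans (sym (∑-+ N _ _)) (trans (∑-ext N (λ u → diff-⊔ (T u) (T′ u))) (∑-*ˡ N 2 _)))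
    shifted : ∑ N T ≤ ∑ N T′
    shifted = case ≤⇒+ (≤-trans 2e≤M (m≤m+n M (4 * M))) of λ (N′ , N≡k+N′) → begin
      ∑ N T                                ≡⟨ cong (λ z → ∑ z T) (trans N≡k+N′ (+-comm k N′)) ⟩
      ∑ (N′ + k) T                         ≡⟨ ∑-split N′ k T ⟩
      ∑ N′ T + ∑ k (λ i → T (N′ + i))      ≡⟨ cong (∑ N′ T +_) (∑-zero k (λ i _ → outside (4*M≤ N′ N≡k+N′) i)) ⟩
      ∑ N′ T + 0                           ≡⟨ +-identityʳ _ ⟩
      ∑ N′ T                               ≡⟨ ∑-ext N′ (λ u → trans (sym (D-shift c ds e u)) (cong T′ (+-comm u k))) ⟩
      ∑ N′ (λ u → T′ (k + u))              ≤⟨ m≤n+m _ (∑ k T′) ⟩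
      ∑ k T′ + ∑ N′ (λ u → T′ (k + u))     ≡⟨ ∑-split k N′ T′ ⟨
      ∑ (k + N′) T′                        ≡⟨ cong (λ z → ∑ z T′) N≡k+N′ ⟨
      ∑ N T′                               ∎
      where
      open ≤-Reasoning
      4*M≤ : ∀ N′ → N ≡ k + N′ → 4 * M ≤ N′
      4*M≤ N′ eq = +-cancelˡ-≤ k _ _ (≤-trans (+-monoˡ-≤ (4 * M) 2e≤M) (≤-reflexive eq))
      outside : ∀ {N′} → 4 * M ≤ N′ → ∀ i → T (N′ + i) ≡ 0
      outside {N′} h i = n<1⇒n≡0 (≰⇒> λ T>0 → <⇒≱ (proj₂ (D-avoids c ds _ cu T>0)) (≤-trans h (m≤m+n N′ i)))
    combine : ∀ X c₀ C T E T′ U N M → Q * X ≤ p * C + Q * n₁ * E → C + T ≡ N → c₀ ≤ T → E + (T + T′) ≡ 2 * U → U ≤ T + g → T ≤ T′ →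
      M ≡ Q * n₁ * g → Q * X + p * c₀ ≤ p * N + 2 * M
    combine X c₀ C T E T′ U N M h₁ refl h₃ h₄ h₅ h₆ refl = by≤ 0 (h₁ ⊕ p ⊛ h₃ ⊕ (Q * n₁) ⊛ (≤-reflexive h₄ ⊕ 2 ⊛ h₅ ⊕ h₆))
      (arith X c₀ C T E T′ U g Q p n₁)
      where
      arith : ∀ X c₀ C T E T′ U g Q p n₁ → Q * X + p * c₀ + (p * C + Q * n₁ * E + p * T + Q * n₁ * (2 * U + 2 * (T + g) + T′)) + 0
        ≡ p * (C + T) + 2 * (Q * n₁ * g) + (Q * X + p * c₀ + Q * n₁ * (E + (T + T′) + 2 * U + T))
      arith X c₀ C T E T′ U g Q p n₁ = solve (X ∷ c₀ ∷ C ∷ T ∷ E ∷ T′ ∷ U ∷ g ∷ Q ∷ p ∷ n₁ ∷ [])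

∣! : ∀ {e n} → 1 ≤ e → e ≤ n → e ∣ n !
∣! {suc e} {n} _ h = ∣-trans (m∣m*n (e !)) (m≤n⇒m!∣n! h)

-- Suppose that `χ` has density above p/Q on [0, 5M). No fifth exceeds density (p + 1)/Q, so the
-- first two fifths are dense as well. A cube in the second fifth reflects the first one to a large
-- set missed by `χ`; as that set is nearly a union of progressions, `χ` would have to be too dense
-- on its complement.
decrement : ∀ Q p n₁ → 1 ≤ Q → 1 ≤ n₁ → 10 ≤ suc p → 40 * Q ≤ suc p * suc p →
            Dens Q (suc p) n₁ → ∃ λ n → 1 ≤ n × Dens Q p n
-- In dimension 5Qn₁ the reflected sets cannot grow by more than g at every step, as they would
-- overfill [0, 5Qn₁g).
decrement Q p n₁ 1≤Q 1≤n₁ 10≤p big dens = main (hilbert-cube (5 * (Q * n₁)) Q)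
  where
  main : (∃ λ l → 1 ≤ l × CubeLemma (5 * (Q * n₁)) Q l) → ∃ λ n → 1 ≤ n × Dens Q p n
  main (l , 1≤l , cube) = 5 * (Q * n₁ * g) , pos-* {5} (s≤s z≤n) 1≤M , λ χ F → ≮⇒≥ (contra χ F)
    where
    -- The factor 2 l! makes 5M a multiple of `n₁` times 2e for every step e ≤ l, and the factor `l`
    -- cuts M into windows of length `l`. As `l` depends on `Q` and `n₁` only, the choice is not
    -- circular.
    g = 2 * (l * l !)
    1≤g : 1 ≤ g
    1≤g = pos-* {2} (s≤s z≤n) (pos-* 1≤l (1≤n! l))
    1≤M : 1 ≤ Q * n₁ * g
    1≤M = pos-* (pos-* 1≤Q 1≤n₁) 1≤g
    module _ (χ : ℕ → ℕ) (F : Free χ) where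
      open Decrement Q (suc p) n₁ 1≤Q 1≤n₁ dens χ F g
      open Reflected χ F M
      a : ℕ → ℕ
      a i = ∑ M (λ j → χ (i * M + j))
      a≤ : ∀ i → Q * a i ≤ suc p * M
      a≤ i = subst (λ m → Q * ∑ m (λ j → χ (i * m + j)) ≤ suc p * m) (M≡) (dens-multiple {Q} {suc p} {n₁} (Q * g) dens _ (free-shift F (i * (Q * g * n₁))))
        where
        M≡ : Q * g * n₁ ≡ M
        M≡ = solve′ Q g n₁
          where
          solve′ : ∀ Q g n₁ → Q * g * n₁ ≡ Q * n₁ * g
          solve′ Q g n₁ = solve (Q ∷ g ∷ n₁ ∷ [])
      module _ (neg : p * N < Q * ∑ N χ) where
        fifths : p * N < Q * (0 + a 0 + a 1 + a 2 + a 3 + a 4)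
        fifths = subst (λ z → p * N < Q * z) (∑-windows 5 M χ) neg
        a₀-large : suc p * M < Q * ∑ M χ + 5 * M
        a₀-large = arith p M Q (a 0) (a 1) (a 2) (a 3) (a 4) fifths (a≤ 1) (a≤ 2) (a≤ 3) (a≤ 4)
          where
          arith : ∀ p M Q a b c d e → p * (5 * M) < Q * (0 + a + b + c + d + e) → Q * b ≤ suc p * M → Q * c ≤ suc p * M →
                  Q * d ≤ suc p * M → Q * e ≤ suc p * M → suc p * M < Q * a + 5 * M
          arith p M Q a b c d e h h₁ h₂ h₃ h₄ = by≤ 0 (h ⊕ h₁ ⊕ h₂ ⊕ h₃ ⊕ h₄) (solve (p ∷ M ∷ Q ∷ a ∷ b ∷ c ∷ d ∷ e ∷ []))
        a₁-large : 5 * M < Q * a 1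
        a₁-large = arith p M Q (a 0) (a 1) (a 2) (a 3) (a 4) 10≤p fifths (a≤ 0) (a≤ 2) (a≤ 3) (a≤ 4)
          where
          arith : ∀ p M Q a b c d e → 10 ≤ suc p → p * (5 * M) < Q * (0 + a + b + c + d + e) → Q * a ≤ suc p * M → Q * c ≤ suc p * M →
                  Q * d ≤ suc p * M → Q * e ≤ suc p * M → 5 * M < Q * b
          arith p M Q a b c d e g h h₁ h₂ h₃ h₄ = by≤ 0 (h ⊕ h₁ ⊕ h₂ ⊕ h₃ ⊕ h₄ ⊕ M ⊛ g) (solve (p ∷ M ∷ Q ∷ a ∷ b ∷ c ∷ d ∷ e ∷ []))
        final : ∀ c e ds → Cube R c ds → Cube R (c + e) ds → Step l e → ∑ N (D c (e ∷ ds)) ≤ ∑ N (D c ds) + g → ⊥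
        final c e ds cu cu′ (1≤e , e≤l) slow = absurd p M Q (∑ N χ) (∑ M χ) 1≤Q 10≤p big neg a₀-large
          (case ∣! 1≤e e≤l of λ (divides f eq) →
            avoiding-bound c e ds cu cu′ 1≤e 2e≤M (M≤c ds cu) (2c<N ds cu) (5 * (Q * l * f))
              (trans (cong (λ z → 5 * (Q * n₁ * (2 * (l * z)))) eq) (regroup Q n₁ l f e)) slow)
          where
          regroup : ∀ Q n₁ l f e → 5 * (Q * n₁ * (2 * (l * (f * e)))) ≡ 5 * (Q * l * f) * n₁ * (2 * e)
          regroup Q n₁ l f e = solve (Q ∷ n₁ ∷ l ∷ f ∷ e ∷ [])
          2e≤M : 2 * e ≤ M
          2e≤M = ≤-trans (2 ⊛ ≤-trans e≤l (m≤m*n l (l !) {{pos (1≤n! l)}})) (m≤c*m g (pos-* 1≤Q 1≤n₁))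
          M≤c : ∀ ds → Cube R c ds → M ≤ c
          M≤c []       cu = proj₁ (proj₂ cu)
          M≤c (e ∷ ds) cu = M≤c ds (proj₁ cu)
          2c<N : ∀ ds → Cube R c ds → 2 * c < N
          2c<N []       (_ , _ , h) = arith c M h
            where
            arith : ∀ c M → c < M + M → 2 * c < 5 * M
            arith c M h = by≤ (1 + M) (2 ⊛ h) (solve (c ∷ M ∷ []))
          2c<N (e ∷ ds) cu = 2c<N ds (proj₁ cu)
          -- The upper bound gives (p + 1)c < 7M, while Qc > (p + 1)M/2 because p + 1 ≥ 10. Together
          -- (p + 1)² < 14Q.
          absurd : ∀ p M Q X c → 1 ≤ Q → 10 ≤ suc p → 40 * Q ≤ suc p * suc p → p * (5 * M) < Q * X → suc p * M < Q * c + 5 * M →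
                   Q * X + suc p * c ≤ suc p * (5 * M) + 2 * M → ⊥
          absurd p M Q X c 1≤Q h₁ h₂ h₃ h₄ h₅ = <⇒≱ (s≤s z≤n) (by≤ (13 * (M * (suc p * suc p)) + (40 * suc p + 39 * Q)) {A = 1} {B = 0} total (solve (p ∷ M ∷ Q ∷ X ∷ c ∷ [])))
            where
            total : 40 * (suc p * (suc (suc p * M)) + Q * (suc (p * (5 * M)))
                     + Q * (Q * X + suc p * c) ) + (7 * M) * (40 * Q) + (20 * M * suc p) * 10 + 1
                  ≤ 40 * (suc p * (Q * c + 5 * M) + Q * (Q * X) + Q * (suc p * (5 * M) + 2 * M)) + (7 * M) * (suc p * suc p) + (20 * M * suc p) * suc p + Q
            total = (40 ⊛ (suc p ⊛ h₄ ⊕ Q ⊛ h₃ ⊕ Q ⊛ h₅)) ⊕ (7 * M) ⊛ h₂ ⊕ (20 * M * suc p) ⊛ h₁ ⊕ 1≤Q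
        contradiction : ⊥
        contradiction = case ∑-pigeonhole (Q * n₁ * (2 * (l !))) (l ∸ 1) (λ i → Q * ∑ l (λ j → χ (1 * M + (i * l + j)))) enough of
            λ (i , i<L , dense) → case cube _ (λ j → proj₁ F _) (≤-trans (≤-reflexive (sym (trans (+-comm 1 _) (m∸n+n≡m 1≤l)))) dense) of
            λ (c , ds , len , st , cu) → go i c ds i<L len st cu
          where
          L = Q * n₁ * (2 * (l !))
          Ll≡M : L * l ≡ M
          Ll≡M = eq Q n₁ l (l !)
            where
            eq : ∀ Q n₁ l f → Q * n₁ * (2 * f) * l ≡ Q * n₁ * (2 * (l * f))
            eq Q n₁ l f = solve (Q ∷ n₁ ∷ l ∷ f ∷ [])
          enough : L * (l ∸ 1) < ∑ L (λ i → Q * ∑ l (λ j → χ (1 * M + (i * l + j))))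
          enough = begin-strict
            L * (l ∸ 1) ≤⟨ L ⊛ m∸n≤m l 1 ⟩
            L * l ≡⟨ Ll≡M ⟩
            M ≤⟨ m≤m+n M (4 * M) ⟩
            5 * M <⟨ a₁-large ⟩
            Q * a 1 ≡⟨ cong (λ z → Q * ∑ z (λ j → χ (1 * M + j))) Ll≡M ⟨
            Q * ∑ (L * l) (λ j → χ (1 * M + j)) ≡⟨ cong (Q *_) (∑-windows L l _) ⟩
            Q * ∑ L (λ i → ∑ l (λ j → χ (1 * M + (i * l + j)))) ≡⟨ ∑-*ˡ L Q _ ⟨
            ∑ L (λ i → Q * ∑ l (λ j → χ (1 * M + (i * l + j)))) ∎
            where open ≤-Reasoning
          go : ∀ i c ds → i < L → length ds ≡ 5 * (Q * n₁) → All (Step l) ds → Cube (λ u → 0 < χ (1 * M + (i * l + u)) × u < l) c ds → ⊥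
          go i c ds i<L len st cu with slow-step N g l (b + c) ds cu′ st
            where
            b = M + i * l
            assoc : ∀ u → 1 * M + (i * l + u) ≡ b + u
            assoc u = trans (cong (_+ (i * l + u)) (*-identityˡ M)) (sym (+-assoc M (i * l) u))
            inside : ∀ u → u < l → b + u < M + M
            inside u u<l = begin-strict
              M + i * l + u   ≡⟨ +-assoc M (i * l) u ⟩
              M + (i * l + u) <⟨ +-monoʳ-< M (+-monoʳ-< (i * l) u<l) ⟩
              M + (i * l + l) ≡⟨ cong (M +_) (+-comm (i * l) l) ⟩
              M + suc i * l   ≤⟨ +-monoʳ-≤ M (*-monoˡ-≤ l i<L) ⟩
              M + L * l       ≡⟨ cong (M +_) Ll≡M ⟩
              M + M           ∎
              where open ≤-Reasoning
            cu′ : Cube R (b + c) ds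
            cu′ = cube-shift {R} b c ds (cube-imp (λ u (χu , u<l) →
              subst (λ z → 0 < χ z) (assoc u) χu , ≤-trans (m≤m+n M (i * l)) (m≤m+n b u) , inside u u<l) c ds cu)
          ... | inj₁ (e , ds′ , c₁ , c₂ , s , slow) = final _ e ds′ c₁ c₂ s slow
          ... | inj₂ many = <⇒≱ (too-many Q n₁ g (pos-* 1≤Q 1≤n₁)) (≤-trans (≤-trans (≤-reflexive (cong (_* suc g) (sym len))) many)
                  (≤-trans (∑-bounded N 1 _ (λ u _ → D≤1 _ ds u)) (≤-reflexive (*-identityʳ N))))
            where
            too-many : ∀ Q n₁ g → 1 ≤ Q * n₁ → 5 * (Q * n₁ * g) < 5 * (Q * n₁) * suc g
            too-many Q n₁ g h = by≤ 4 (5 ⊛ h) (solve (Q ∷ n₁ ∷ g ∷ []))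
      contra : ¬ (p * N < Q * ∑ N χ)
      contra = contradiction

roth-descent : ∀ Q p n → 1 ≤ Q → 1 ≤ n → Dens Q p n → ∃ λ p′ → ∃ λ n′ → 1 ≤ n′ × Dens Q p′ n′ × (p′ < 10 ⊎ p′ * p′ < 40 * Q)
roth-descent Q zero    n 1≤Q 1≤n D = 0 , n , 1≤n , D , inj₁ (s≤s z≤n)
roth-descent Q (suc p) n 1≤Q 1≤n D with 10 ≤? suc p | 40 * Q ≤? suc p * suc p
... | no ¬a | _     = suc p , n , 1≤n , D , inj₁ (≰⇒> ¬a)
... | yes _ | no ¬b = suc p , n , 1≤n , D , inj₂ (≰⇒> ¬b)
... | yes a | yes b = case decrement Q p n 1≤Q 1≤n a b D of λ (n′ , 1≤n′ , D′) → roth-descent Q p n′ 1≤Q 1≤n′ D′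

-- From the trivial density Q/Q the descent stops only when p < 10 or p² < 40Q. With Q = 40E² either
-- of them gives p/Q ≤ 1/E.
roth : ∀ E → 1 ≤ E → ∃ λ n → 1 ≤ n × Dens E 1 n
roth E 1≤E = case roth-descent Q Q 1 1≤Q ≤-refl trivial of λ (p , n , 1≤n , D , small) → n , 1≤n , λ χ F →
    cancelˡ Q 1≤Q (begin
      Q * (E * ∑ n χ) ≡⟨ swap Q E (∑ n χ) ⟩
      E * (Q * ∑ n χ) ≤⟨ E ⊛ D χ F ⟩
      E * (p * n)     ≡⟨ *-assoc E p n ⟨
      E * p * n       ≤⟨ *-monoˡ-≤ n (≤-trans (≤-reflexive (*-comm E p)) (pE≤Q p small)) ⟩
      Q * n           ≡⟨ cong (Q *_) (*-identityˡ n) ⟨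
      Q * (1 * n)     ∎)
  where
  open ≤-Reasoning
  Q = 40 * (E * E)
  1≤Q : 1 ≤ Q
  1≤Q = pos-* {40} (s≤s z≤n) (pos-* 1≤E 1≤E)
  swap : ∀ a b c → a * (b * c) ≡ b * (a * c)
  swap a b c = solve (a ∷ b ∷ c ∷ [])
  trivial : Dens Q Q 1
  trivial χ F = Q ⊛ ∑-bounded 1 1 χ (λ i _ → proj₁ F i)
  pE≤Q : ∀ p → (p < 10 ⊎ p * p < 40 * Q) → p * E ≤ Q
  pE≤Q p (inj₁ p<10) = ≤-trans (*-monoˡ-≤ E (<⇒≤ p<10)) (≤-trans (10 ⊛ m≤c*m E 1≤E) (*-monoˡ-≤ (E * E) {10} {40} (m≤m+n 10 30)))
  pE≤Q p (inj₂ p²<40Q) = ≤-trans (*-monoˡ-≤ E p≤40E) (≤-reflexive (*-assoc 40 E E))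
    where
    p≤40E : p ≤ 40 * E
    p≤40E = ≮⇒≥ λ 40E<p → <⇒≱ p²<40Q (≤-trans (≤-reflexive (sq E)) (*-mono-≤ (<⇒≤ 40E<p) (<⇒≤ 40E<p)))
      where
      sq : ∀ E → 40 * (40 * (E * E)) ≡ 40 * E * (40 * E)
      sq E = solve (E ∷ [])

-- The averaging argument for abstract weights.

∑-divisors : ∀ N q (h : ℕ → ℕ) → 1 ≤ q →
  ∑ (suc N) (λ n → ⟦ q ∣? n ⟧ * h n) ≡ ∑ (suc N) (λ m → ⟦ q * m ≤? N ⟧ * h (q * m))
∑-divisors N q h 1≤q = begin
  ∑ (suc N) (λ n → ⟦ q ∣? n ⟧ * h n)                                 ≡⟨ ∑-cong (suc N) expand ⟩
  ∑ (suc N) (λ n → ∑ (suc N) (λ m → ⟦ n ≟ q * m ⟧ * h n))            ≡⟨ ∑-swap (suc N) (suc N) _ ⟩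
  ∑ (suc N) (λ m → ∑ (suc N) (λ n → ⟦ n ≟ q * m ⟧ * h n))            ≡⟨ ∑-ext (suc N) collapse ⟩
  ∑ (suc N) (λ m → ⟦ q * m ≤? N ⟧ * h (q * m))                       ∎
  where
  open ≡-Reasoning
  expand : ∀ n → n < suc N → ⟦ q ∣? n ⟧ * h n ≡ ∑ (suc N) (λ m → ⟦ n ≟ q * m ⟧ * h n)
  expand n n<S with q ∣? n
  ... | no q∤n = sym (∑-zero (suc N) (λ m _ → cong (_* h n) (⟦⟧-no (n ≟ q * m) (λ e → q∤n (subst (q ∣_) (sym e) (m∣m*n m))))))
  ... | yes (divides m₀ refl) = sym (trans (∑-ext (suc N) (λ m → cong (_* h (m₀ * q))
          (⟦⟧-cong (m₀ * q ≟ q * m) (m ≟ m₀)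
            (λ e → sym (*-cancelˡ-≡ m₀ m q {{pos 1≤q}} (trans (*-comm q m₀) e)))
            (λ { refl → *-comm m₀ q }))))
          (trans (∑-delta (suc N) (λ _ → h (m₀ * q)) (≤-<-trans (m≤m*n m₀ q {{pos 1≤q}}) n<S)) (sym (*-identityˡ _))))
  collapse : ∀ m → ∑ (suc N) (λ n → ⟦ n ≟ q * m ⟧ * h n) ≡ ⟦ q * m ≤? N ⟧ * h (q * m)
  collapse m with q * m ≤? N
  ... | yes p = trans (∑-delta (suc N) h (s≤s p)) (sym (*-identityˡ _))
  ... | no ¬p = ∑-delta-out (suc N) h (≰⇒> ¬p)

∑-delta≡ : ∀ N (h : ℕ → ℕ) x → ∑ (suc N) (λ n → ⟦ n ≟ x ⟧ * h n) ≡ ⟦ x ≤? N ⟧ * h x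
∑-delta≡ N h x with x ≤? N
... | yes p = trans (∑-delta (suc N) h (s≤s p)) (sym (*-identityˡ _))
... | no ¬p = ∑-delta-out (suc N) h (≰⇒> ¬p)

-- ν weights an integer m by (a multiple of) the inverse of Σ_{q ∣ m} lam q, so that the indicator
-- of n ≤ N becomes, after removing a prime q from n, the weight V m of m = n/q.
record CoreData : Set where
  constructor coreData
  field
    N y : ℕ
    s : ℕ → ℕ
    s≤1 : ∀ m → s m ≤ 1
    s0 : s 0 ≡ 0
    R₂ : ℕ
    s-mul : ∀ x m → 1 ≤ x → x ≤ y → x * m ≤ N → s (x * m) ≡ s m
    R₂≤y : R₂ ≤ y
    lam : ℕ → ℕ
    lam-pos : ∀ q → 0 < lam q → 1 ≤ q
    ν : ℕ → ℕ
    Big Λ : ℕ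
    ν-pool : ∀ x m → 1 ≤ x → x ≤ R₂ → ν (x * m) ≡ ν m
    ν-dec : ∀ q m → q ≤ y → 0 < lam q → 1 ≤ m → ν (q * m) ≤ ν m
    ν-inc : ∀ q m → q ≤ y → 0 < lam q → 1 ≤ m → ν m ≤ 2 * ν (q * m)
    ων≤ : ∀ n → 1 ≤ n → ∑ (suc y) (λ q → lam q * ⟦ q ∣? n ⟧) * ν n ≤ Big
    ων≥ : ∀ n → 1 ≤ n → Λ ≤ ∑ (suc y) (λ q → lam q * ⟦ q ∣? n ⟧) → Big ≤ ∑ (suc y) (λ q → lam q * ⟦ q ∣? n ⟧) * ν n
    Λν≤ : ∀ n → 1 ≤ n → Λ * ν n ≤ Big
    V V⁻ : ℕ → ℕ
    Π : ℕ
    1≤Π : 1 ≤ Π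
    VV⁻ : ∀ m → V m * V⁻ m ≡ Π
    V⁻-mono : ∀ {m m′} → m ≤ m′ → V⁻ m ≤ V⁻ m′
    C₁ C₂ C₃ x : ℕ
    1≤x : 1 ≤ x
    W≤V : ∀ m → 1 ≤ m → ∑ (suc y) (λ q → lam q * ⟦ q * m ≤? N ⟧) ≤ C₁ * V m
    V≤W : ∀ m → 1 ≤ m → m * x ≤ N → V m ≤ C₂ * ∑ (suc y) (λ q → lam q * ⟦ q * m ≤? N ⟧)
    d R : ℕ
    r : ℕ → ℕ
    1≤d : 1 ≤ d
    1≤R : 1 ≤ R
    R≤r : ∀ i → i < d → R ≤ r i
    r≤R₂ : ∀ i → i < d → r i ≤ R₂
    V-ratio : ∀ m → 1 ≤ m → V (R * m) ≤ C₃ * V (R₂ * m)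
    -- `c i j` / `Θ` bounds the correlation between divisibility by `r i` and by `r j`. Its mean
    -- exceeds 1 by at most 1/e, which is what the variance requires. `cof i j` will be `r j`
    -- divided by the gcd.
    Θ e : ℕ
    1≤Θ : 1 ≤ Θ
    1≤e : 1 ≤ e
    c cof : ℕ → ℕ → ℕ
    cof≥1 : ∀ i j → i < d → j < d → 1 ≤ cof i j
    cof≤R₂ : ∀ i j → i < d → j < d → cof i j ≤ R₂
    common : ∀ i j → i < d → j < d → ∀ m₁ m₂ → r i * m₁ ≡ r j * m₂ → ∃ λ m → m₁ ≡ cof i j * m × m₂ ≡ cof j i * m
    V-corr : ∀ i j → i < d → j < d → ∀ m → 1 ≤ m → Θ * (V (cof i j * m) * V (cof j i * m) * V⁻ (r i * (cof i j * m))) ≤ c i j * (Π * V m)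
    c-sum : e * ∑ d (λ i → ∑ d (λ j → c i j)) ≤ (e + 1) * Θ * (d * d)
    a : ℕ → ℕ
    a≤s : ∀ n → a n ≤ s n
    E : ℕ
    1≤E : 1 ≤ E
    a-dens : ∀ m → 1 ≤ m → E * ∑ d (λ i → a (m * r i)) ≤ d

module Core (coreHyps : CoreData) where
  open CoreData coreHyps

  S X : ℕ
  S = suc N
  X = R₂ * x
  ω μ B : ℕ → ℕ
  ω n = ∑ (suc y) (λ q → lam q * ⟦ q ∣? n ⟧)
  μ m = s m * ν m
  B m = ⟦ m * x ≤? N ⟧
  W : ℕ → ℕ
  W m = ∑ (suc y) (λ q → lam q * ⟦ q * m ≤? N ⟧)
  -- `Mt` is the total mass and `Eg` the mass of those m that a multiplier up to `R₂` may push out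
  -- of the range. For these m only primes below `X` can be restored, so `Eg` is governed by their
  -- weight `σ`.
  Ψ σ Mt Eg : ℕ
  Ψ  = ∑ S s
  σ  = ∑ (suc y) (λ q → lam q * ⟦ q <? X ⟧)
  Mt = ∑ S (λ m → B m * (μ m * V m))
  Eg = ∑ S (λ m → ⟦ N <? m * X ⟧ * (B m * (μ m * V m)))

  1≤R₂ : 1 ≤ R₂
  1≤R₂ = ≤-trans 1≤R (≤-trans (R≤r 0 1≤d) (r≤R₂ 0 1≤d))

  -- The factor s m vanishes at 0, so the hypotheses are only needed for m ≥ 1.
  μ-mono : ∀ m {f g} → (1 ≤ m → f ≤ g) → μ m * f ≤ μ m * g
  μ-mono zero    {f} {g} h = ≤-reflexive (trans (z f) (sym (z g)))
    where
    z : ∀ f → μ 0 * f ≡ 0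
    z f = cong (λ t → t * ν 0 * f) s0
  μ-mono (suc m) h = μ (suc m) ⊛ h (s≤s z≤n)

  μ-pool : ∀ z m → 1 ≤ z → z ≤ R₂ → z * m ≤ N → μ (z * m) ≡ μ m
  μ-pool z m h₁ h₂ h₃ = cong₂ _*_ (s-mul z m h₁ (≤-trans h₂ R₂≤y) h₃) (ν-pool z m h₁ h₂)

  sν≤ : ∀ n → Λ * (s n * ν n) ≤ s n * Big
  sν≤ zero    rewrite s0 = ≤-reflexive (*-zeroʳ Λ)
  sν≤ (suc n) = ≤-trans (≤-reflexive (swap Λ (s (suc n)) (ν (suc n)))) (s (suc n) ⊛ Λν≤ (suc n) (s≤s z≤n))
    where
    swap : ∀ a b c → a * (b * c) ≡ b * (a * c)
    swap a b c = solve (a ∷ b ∷ c ∷ [])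

  module _ (lam′ : ℕ → ℕ) (lam′≤ : ∀ q → lam′ q ≤ lam q) where

    remove-prime : ∀ (h : ℕ → ℕ) →
      ∑ S (λ n → h n * ∑ (suc y) (λ q → lam′ q * ⟦ q ∣? n ⟧)) ≡ ∑ (suc y) (λ q → lam′ q * ∑ S (λ m → ⟦ q * m ≤? N ⟧ * h (q * m)))
    remove-prime h = begin
      ∑ S (λ n → h n * ∑ (suc y) (λ q → lam′ q * ⟦ q ∣? n ⟧)) ≡⟨ ∑-ext S (λ n → sym (∑-*ˡ (suc y) (h n) _)) ⟩
      ∑ S (λ n → ∑ (suc y) (λ q → h n * (lam′ q * ⟦ q ∣? n ⟧))) ≡⟨ ∑-swap S (suc y) _ ⟩
      ∑ (suc y) (λ q → ∑ S (λ n → h n * (lam′ q * ⟦ q ∣? n ⟧))) ≡⟨ ∑-ext (suc y) (λ q → trans (∑-ext S (λ n → swap (h n) (lam′ q) ⟦ q ∣? n ⟧)) (∑-*ˡ S (lam′ q) _)) ⟩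
      ∑ (suc y) (λ q → lam′ q * ∑ S (λ n → ⟦ q ∣? n ⟧ * h n)) ≡⟨ ∑-ext (suc y) (λ q → pointwise q) ⟩
      ∑ (suc y) (λ q → lam′ q * ∑ S (λ m → ⟦ q * m ≤? N ⟧ * h (q * m))) ∎
      where
      open ≡-Reasoning
      swap : ∀ a b c → a * (b * c) ≡ b * (c * a)
      swap a b c = solve (a ∷ b ∷ c ∷ [])
      pointwise : ∀ q → lam′ q * ∑ S (λ n → ⟦ q ∣? n ⟧ * h n) ≡ lam′ q * ∑ S (λ m → ⟦ q * m ≤? N ⟧ * h (q * m))
      pointwise q with lam′ q | lam′≤ q
      ... | zero  | _ = refl
      ... | suc l | p = cong (suc l *_) (∑-divisors N q h (lam-pos q (<-≤-trans (s≤s z≤n) p)))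

    -- The converse of `remove-prime`, as an inequality: passing from m to qm at most halves `ν`,
    -- whence the factor 2.
    restore-prime : ∑ S (λ m → μ m * ∑ (suc y) (λ q → lam′ q * ⟦ q * m ≤? N ⟧))
                    ≤ 2 * ∑ S (λ n → s n * ν n * ∑ (suc y) (λ q → lam′ q * ⟦ q ∣? n ⟧))
    restore-prime = begin
      ∑ S (λ m → μ m * ∑ (suc y) (λ q → lam′ q * ⟦ q * m ≤? N ⟧)) ≡⟨ ∑-ext S (λ m → sym (∑-*ˡ (suc y) (μ m) _)) ⟩
      ∑ S (λ m → ∑ (suc y) (λ q → μ m * (lam′ q * ⟦ q * m ≤? N ⟧))) ≡⟨ ∑-swap S (suc y) _ ⟩
      ∑ (suc y) (λ q → ∑ S (λ m → μ m * (lam′ q * ⟦ q * m ≤? N ⟧))) ≤⟨ ∑-mono (suc y) (λ q q<1+y → ∑-mono S (λ m _ → term q m (≤-pred q<1+y))) ⟩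
      ∑ (suc y) (λ q → ∑ S (λ m → 2 * lam′ q * (⟦ q * m ≤? N ⟧ * μ (q * m)))) ≡⟨ ∑-ext (suc y) (λ q → trans (∑-*ˡ S (2 * lam′ q) _) (*-assoc 2 (lam′ q) _)) ⟩
      ∑ (suc y) (λ q → 2 * (lam′ q * ∑ S (λ m → ⟦ q * m ≤? N ⟧ * μ (q * m)))) ≡⟨ ∑-*ˡ (suc y) 2 _ ⟩
      2 * ∑ (suc y) (λ q → lam′ q * ∑ S (λ m → ⟦ q * m ≤? N ⟧ * μ (q * m))) ≡⟨ cong (2 *_) (remove-prime μ) ⟨
      2 * ∑ S (λ n → s n * ν n * ∑ (suc y) (λ q → lam′ q * ⟦ q ∣? n ⟧)) ∎
      where
      open ≤-Reasoning
      comm₁ : ∀ m l b → m * (l * b) ≡ l * (b * m)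
      comm₁ m l b = solve (m ∷ l ∷ b ∷ [])
      comm₂ : ∀ l b m → 2 * l * (b * m) ≡ l * (b * (2 * m))
      comm₂ l b m = solve (m ∷ l ∷ b ∷ [])
      term : ∀ q m → q ≤ y → μ m * (lam′ q * ⟦ q * m ≤? N ⟧) ≤ 2 * lam′ q * (⟦ q * m ≤? N ⟧ * μ (q * m))
      term q m q≤y = subst₂ _≤_ (sym (comm₁ (μ m) (lam′ q) ⟦ q * m ≤? N ⟧)) (sym (comm₂ (lam′ q) ⟦ q * m ≤? N ⟧ (μ (q * m))))
        (>0*-mono (lam′ q) (λ l>0 → ⟦⟧*-mono (q * m ≤? N) (λ qm≤N → grow q m q≤y (<-≤-trans l>0 (lam′≤ q)) qm≤N)))
        where
        grow : ∀ q m → q ≤ y → 0 < lam q → q * m ≤ N → μ m ≤ 2 * μ (q * m)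
        grow q zero    _ l>0 _ = ≤-trans (≤-reflexive (cong (_* ν 0) s0)) z≤n
        grow q (suc m) q≤y l>0 h = begin
          s (suc m) * ν (suc m)               ≡⟨ cong (_* ν (suc m)) (s-mul q (suc m) (lam-pos q l>0) q≤y h) ⟨
          s (q * suc m) * ν (suc m)           ≤⟨ s (q * suc m) ⊛ ν-inc q (suc m) q≤y l>0 (s≤s z≤n) ⟩
          s (q * suc m) * (2 * ν (q * suc m)) ≡⟨ swap (s (q * suc m)) (ν (q * suc m)) ⟩
          2 * μ (q * suc m)                   ∎
          where
          swap : ∀ a b → a * (2 * b) ≡ 2 * (a * b)
          swap a b = solve (a ∷ b ∷ [])

  Mt-bound : Mt ≤ 2 * C₂ * (Big * Ψ)
  Mt-bound = begin
    Mt                                                     ≤⟨ ∑-mono S (λ m _ → ≤-trans (term m) (≤-reflexive (swap (μ m) C₂ (W m)))) ⟩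
    ∑ S (λ m → C₂ * (μ m * W m))                           ≡⟨ ∑-*ˡ S C₂ _ ⟩
    C₂ * ∑ S (λ m → μ m * W m)                             ≤⟨ C₂ ⊛ restore-prime lam (λ _ → ≤-refl) ⟩
    C₂ * (2 * ∑ S (λ n → s n * ν n * ω n))                 ≤⟨ C₂ ⊛ (2 ⊛ ∑-mono S (λ n _ → ω-term n)) ⟩
    C₂ * (2 * ∑ S (λ n → Big * s n))                       ≡⟨ cong (λ z → C₂ * (2 * z)) (∑-*ˡ S Big s) ⟩
    C₂ * (2 * (Big * Ψ))                                   ≡⟨ swap₂ C₂ (Big * Ψ) ⟩
    2 * C₂ * (Big * Ψ)                                     ∎
    where
    open ≤-Reasoning
    swap : ∀ a b c → a * (b * c) ≡ b * (a * c)
    swap a b c = solve (a ∷ b ∷ c ∷ [])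
    swap₂ : ∀ a b → a * (2 * b) ≡ 2 * a * b
    swap₂ a b = solve (a ∷ b ∷ [])
    term : ∀ m → B m * (μ m * V m) ≤ μ m * (C₂ * W m)
    term m = ⟦⟧*≤ (m * x ≤? N) (λ mx≤N → μ-mono m (λ 1≤m → V≤W m 1≤m mx≤N))
    ω-term : ∀ n → s n * ν n * ω n ≤ Big * s n
    ω-term zero    = ≤-trans (≤-reflexive (cong (λ z → z * ν 0 * ω 0) s0)) z≤n
    ω-term (suc n) = ≤-trans (≤-reflexive (assoc (s (suc n)) (ν (suc n)) (ω (suc n)))) (≤-trans (s (suc n) ⊛ ων≤ (suc n) (s≤s z≤n)) (≤-reflexive (*-comm (s (suc n)) Big)))
      where
      assoc : ∀ a b c → a * b * c ≡ a * (c * b)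
      assoc a b c = solve (a ∷ b ∷ c ∷ [])

  lamX : ℕ → ℕ
  lamX q = lam q * ⟦ q <? X ⟧

  lamX≤ : ∀ q → lamX q ≤ lam q
  lamX≤ q = ≤-trans (lam q ⊛ ⟦⟧≤1 (q <? X)) (≤-reflexive (*-identityʳ _))

  small-primes : Λ * ∑ S (λ n → s n * ν n * ∑ (suc y) (λ q → lamX q * ⟦ q ∣? n ⟧)) ≤ σ * (Big * Ψ)
  small-primes = begin
    Λ * ∑ S (λ n → s n * ν n * ∑ (suc y) (λ q → lamX q * ⟦ q ∣? n ⟧)) ≤⟨ Λ ⊛ ∑-mono S (λ n _ → (s n * ν n) ⊛ ∑-mono (suc y) (λ q _ → ≤-trans (lamX q ⊛ ⟦⟧≤1 (q ∣? n)) (≤-reflexive (*-identityʳ _)))) ⟩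
    Λ * ∑ S (λ n → s n * ν n * σ)       ≡⟨ ∑-*ˡ S Λ _ ⟨
    ∑ S (λ n → Λ * (s n * ν n * σ))     ≡⟨ ∑-ext S (λ n → sym (*-assoc Λ (s n * ν n) σ)) ⟩
    ∑ S (λ n → Λ * (s n * ν n) * σ)     ≤⟨ ∑-mono S (λ n _ → *-monoˡ-≤ σ (sν≤ n)) ⟩
    ∑ S (λ n → s n * Big * σ)           ≡⟨ ∑-ext S (λ n → swap (s n) Big σ) ⟩
    ∑ S (λ n → (σ * Big) * s n)         ≡⟨ ∑-*ˡ S (σ * Big) s ⟩
    σ * Big * Ψ                         ≡⟨ *-assoc σ Big Ψ ⟩
    σ * (Big * Ψ)                       ∎
    where
    open ≤-Reasoning
    swap : ∀ a b c → a * b * c ≡ c * b * a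
    swap a b c = solve (a ∷ b ∷ c ∷ [])

  -- N < mX and qm ≤ N give q < X. So here `V` is controlled by the primes below `X`, which carry at
  -- most σ/Λ of the normalised weight `Big` of any n.
  Eg-bound : Λ * Eg ≤ 2 * C₂ * (σ * (Big * Ψ))
  Eg-bound = begin
    Λ * Eg                                                 ≤⟨ Λ ⊛ ∑-mono S (λ m _ → ≤-trans (term m) (≤-reflexive (swap (μ m) C₂ (WX m)))) ⟩
    Λ * ∑ S (λ m → C₂ * (μ m * WX m))                      ≡⟨ cong (Λ *_) (∑-*ˡ S C₂ _) ⟩
    Λ * (C₂ * ∑ S (λ m → μ m * WX m))                      ≤⟨ Λ ⊛ (C₂ ⊛ restore-prime lamX lamX≤) ⟩
    Λ * (C₂ * (2 * Z))                                     ≡⟨ swap₂ Λ C₂ Z ⟩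
    2 * C₂ * (Λ * Z)                                       ≤⟨ (2 * C₂) ⊛ small-primes ⟩
    2 * C₂ * (σ * (Big * Ψ))                               ∎
    where
    open ≤-Reasoning
    WX : ℕ → ℕ
    WX m = ∑ (suc y) (λ q → lamX q * ⟦ q * m ≤? N ⟧)
    Z = ∑ S (λ n → s n * ν n * ∑ (suc y) (λ q → lamX q * ⟦ q ∣? n ⟧))
    swap : ∀ a b c → a * (b * c) ≡ b * (a * c)
    swap a b c = solve (a ∷ b ∷ c ∷ [])
    swap₂ : ∀ l a b → l * (a * (2 * b)) ≡ 2 * a * (l * b)
    swap₂ l a b = solve (l ∷ a ∷ b ∷ [])
    term : ∀ m → ⟦ N <? m * X ⟧ * (B m * (μ m * V m)) ≤ μ m * (C₂ * WX m)
    term m = ⟦⟧*≤ (N <? m * X) (λ N<mX → ⟦⟧*≤ (m * x ≤? N) (λ mx≤N → μ-mono m (λ 1≤m →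
      ≤-trans (V≤W m 1≤m mx≤N) (C₂ ⊛ ∑-mono (suc y) (λ q _ → edge q N<mX)))))
      where
      edge : ∀ q → N < m * X → lam q * ⟦ q * m ≤? N ⟧ ≤ lamX q * ⟦ q * m ≤? N ⟧
      edge q N<mX with q * m ≤? N
      ... | no _ = ≤-reflexive (trans (*-zeroʳ (lam q)) (sym (*-zeroʳ (lamX q))))
      ... | yes qm≤N = ≤-reflexive (cong (_* 1) {lam q} {lamX q} (sym (trans (cong (lam q *_) (⟦⟧-yes (q <? X) q<X)) (*-identityʳ _))))
        where
        q<X : q < X
        q<X = *-cancelʳ-< m q X (≤-<-trans qm≤N (subst (N <_) (*-comm m X) N<mX))

  α Y : ℕ → ℕ
  α m = ∑ (suc y) (λ q → lam q * (⟦ q * m ≤? N ⟧ * a (q * m)))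

  -- The value at a multiple m of `r i` is V(m / r i) and not V(m): this turns the first moment into
  -- a change of variables.
  Yᵢ : ℕ → ℕ → ℕ
  Yᵢ i m = ∑ S (λ m′ → ⟦ m ≟ r i * m′ ⟧ * V m′)
  Y m = ∑ d (λ i → Yᵢ i m)

  bad : ℕ → ℕ
  bad m = ⟦ 2 * Y m <? d * V m ⟧

  Bad Good : ℕ
  Bad = ∑ S (λ m → bad m * (B m * (μ m * V m)))
  Good = ∑ S (λ m → B m * (μ m * α m))

  A₁ : ℕ
  A₁ = ∑ S (λ n → ⟦ Λ ≤? ω n ⟧ * a n)

  a0 : a 0 ≡ 0
  a0 = n≤0⇒n≡0 (subst (a 0 ≤_) s0 (a≤s 0))

  lamL : ℕ → ℕ
  lamL q = lam q * ⟦ x ≤? q ⟧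

  -- When Λ ≤ ω n, the weight `ν n` shares out `Big` among the primes dividing n. Primes q < X are
  -- estimated trivially. For q ≥ x the cofactor m = n/q satisfies mx ≤ N and enters `Good`. As x ≤
  -- X, these two cases overlap and cover all primes.
  count-by-primes : Big * A₁ ≤ ∑ S (λ n → s n * ν n * ∑ (suc y) (λ q → lamX q * ⟦ q ∣? n ⟧)) + Good
  count-by-primes = begin
    Big * A₁                                             ≡⟨ ∑-*ˡ S Big _ ⟨
    ∑ S (λ n → Big * (⟦ Λ ≤? ω n ⟧ * a n))               ≤⟨ ∑-mono S (λ n _ → ≤-trans (≤-reflexive (swap Big ⟦ Λ ≤? ω n ⟧ (a n))) (⟦⟧*≤ (Λ ≤? ω n) (weight n))) ⟩
    ∑ S (λ n → a n * ν n * ω n)                          ≤⟨ ∑-mono S (λ n _ → (a n * ν n) ⊛ split n) ⟩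
    ∑ S (λ n → a n * ν n * (ωX n + ωL n))                ≡⟨ trans (∑-ext S (λ n → *-distribˡ-+ (a n * ν n) (ωX n) (ωL n))) (∑-+ S _ _) ⟩
    ∑ S (λ n → a n * ν n * ωX n) + ∑ S (λ n → a n * ν n * ωL n)
      ≤⟨ ∑-mono S (λ n _ → *-monoˡ-≤ (ωX n) (*-monoˡ-≤ (ν n) (a≤s n))) ⊕ large ⟩
    ∑ S (λ n → s n * ν n * ωX n) + Good                  ∎
    where
    open ≤-Reasoning
    swap : ∀ a b c → a * (b * c) ≡ b * (c * a)
    swap a b c = solve (a ∷ b ∷ c ∷ [])
    ωX ωL : ℕ → ℕ
    ωX n = ∑ (suc y) (λ q → lamX q * ⟦ q ∣? n ⟧)
    ωL n = ∑ (suc y) (λ q → lamL q * ⟦ q ∣? n ⟧)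
    lamL≤ : ∀ q → lamL q ≤ lam q
    lamL≤ q = ≤-trans (lam q ⊛ ⟦⟧≤1 (x ≤? q)) (≤-reflexive (*-identityʳ _))
    weight : ∀ n → Λ ≤ ω n → a n * Big ≤ a n * ν n * ω n
    weight zero    _ = ≤-trans (≤-reflexive (cong (_* Big) a0)) z≤n
    weight (suc n) h = ≤-trans (a (suc n) ⊛ ων≥ (suc n) (s≤s z≤n) h) (≤-reflexive (sym (assoc (a (suc n)) (ν (suc n)) (ω (suc n)))))
      where
      assoc : ∀ a b c → a * b * c ≡ a * (c * b)
      assoc a b c = solve (a ∷ b ∷ c ∷ [])
    split : ∀ n → ω n ≤ ωX n + ωL n
    split n = ≤-trans (∑-mono (suc y) (λ q _ → cover q)) (≤-reflexive (∑-+ (suc y) _ _))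
      where
      cover : ∀ q → lam q * ⟦ q ∣? n ⟧ ≤ lamX q * ⟦ q ∣? n ⟧ + lamL q * ⟦ q ∣? n ⟧
      cover q with q <? X | x ≤? q
      ... | yes _ | _ = ≤-trans (≤-reflexive (cong (_* ⟦ q ∣? n ⟧) (sym (*-identityʳ (lam q))))) (m≤m+n _ _)
      ... | no _ | yes _ = ≤-trans (≤-reflexive (cong (_* ⟦ q ∣? n ⟧) (sym (*-identityʳ (lam q))))) (m≤n+m _ _)
      ... | no q≮X | no x≰q = ⊥-elim (<⇒≱ (≰⇒> x≰q) (≤-trans (m≤c*m x 1≤R₂) (≮⇒≥ q≮X)))
    large : ∑ S (λ n → a n * ν n * ωL n) ≤ Good
    large = begin
      ∑ S (λ n → a n * ν n * ωL n) ≡⟨ remove-prime lamL lamL≤ (λ n → a n * ν n) ⟩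
      ∑ (suc y) (λ q → lamL q * ∑ S (λ m → ⟦ q * m ≤? N ⟧ * (a (q * m) * ν (q * m)))) ≡⟨ ∑-ext (suc y) (λ q → sym (∑-*ˡ S (lamL q) _)) ⟩
      ∑ (suc y) (λ q → ∑ S (λ m → lamL q * (⟦ q * m ≤? N ⟧ * (a (q * m) * ν (q * m))))) ≤⟨ ∑-mono (suc y) (λ q q<1+y → ∑-mono S (λ m _ → term q m (≤-pred q<1+y))) ⟩
      ∑ (suc y) (λ q → ∑ S (λ m → B m * μ m * (lam q * (⟦ q * m ≤? N ⟧ * a (q * m))))) ≡⟨ ∑-swap (suc y) S _ ⟩
      ∑ S (λ m → ∑ (suc y) (λ q → B m * μ m * (lam q * (⟦ q * m ≤? N ⟧ * a (q * m))))) ≡⟨ ∑-ext S (λ m → trans (∑-*ˡ (suc y) (B m * μ m) _) (*-assoc (B m) (μ m) _)) ⟩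
      Good ∎
      where
      term : ∀ q m → q ≤ y → lamL q * (⟦ q * m ≤? N ⟧ * (a (q * m) * ν (q * m))) ≤ B m * μ m * (lam q * (⟦ q * m ≤? N ⟧ * a (q * m)))
      term q m q≤y = subst₂ _≤_ (sym (assoc (lam q) ⟦ x ≤? q ⟧ _)) (sym (comm₁ (B m * μ m) (lam q) _))
        (>0*-mono (lam q) (λ l>0 → ⟦⟧*≤ (x ≤? q) (λ x≤q → ≤-trans (⟦⟧*-mono (q * m ≤? N) (λ qm≤N → inner q m q≤y l>0 x≤q qm≤N))
          (≤-reflexive (comm₂ ⟦ q * m ≤? N ⟧ (B m * μ m) (a (q * m)))))))
        where
        assoc : ∀ a b c → a * b * c ≡ a * (b * c)
        assoc = *-assoc
        comm₁ : ∀ b l t → b * (l * t) ≡ l * (b * t)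
        comm₁ b l t = solve (b ∷ l ∷ t ∷ [])
        comm₂ : ∀ k b a → k * (b * a) ≡ b * (k * a)
        comm₂ k b a = solve (k ∷ b ∷ a ∷ [])
        inner : ∀ q m → q ≤ y → 0 < lam q → x ≤ q → q * m ≤ N → a (q * m) * ν (q * m) ≤ B m * μ m * a (q * m)
        inner q zero    _ _ _ _ = ≤-trans (≤-reflexive (cong (λ z → a z * ν z) (*-zeroʳ q))) (≤-trans (≤-reflexive (cong (_* ν 0) a0)) z≤n)
        inner q (suc m) q≤y l>0 x≤q h = begin
          a (q * suc m) * ν (q * suc m) ≤⟨ a (q * suc m) ⊛ ν-dec q (suc m) q≤y l>0 (s≤s z≤n) ⟩
          a (q * suc m) * ν (suc m)     ≤⟨ *-monoˡ-≤ (ν (suc m)) (idem _ _ (s≤1 (suc m)) (subst (a (q * suc m) ≤_) (s-mul q (suc m) (lam-pos q l>0) q≤y h) (a≤s (q * suc m)))) ⟩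
          s (suc m) * a (q * suc m) * ν (suc m) ≡⟨ comm₃ (s (suc m)) (a (q * suc m)) (ν (suc m)) ⟩
          1 * μ (suc m) * a (q * suc m) ≡⟨ cong (λ z → z * μ (suc m) * a (q * suc m)) (⟦⟧-yes (suc m * x ≤? N) (≤-trans (≤-trans (suc m ⊛ x≤q) (≤-reflexive (*-comm (suc m) q))) h)) ⟨
          B (suc m) * μ (suc m) * a (q * suc m) ∎
          where
          idem : ∀ s a → s ≤ 1 → a ≤ s → a ≤ s * a
          idem zero    zero    _ _ = z≤n
          idem (suc zero) a _ _ = ≤-reflexive (sym (+-identityʳ a))
          idem (suc (suc s)) a (s≤s ()) _
          comm₃ : ∀ s a v → s * a * v ≡ 1 * (s * v) * a
          comm₃ s a v = solve (s ∷ a ∷ v ∷ [])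

  ∑-multiples : ∀ k (g h : ℕ → ℕ) →
    ∑ S (λ m → h m * ∑ S (λ m′ → ⟦ m ≟ k * m′ ⟧ * g m′)) ≡ ∑ S (λ m′ → g m′ * (⟦ k * m′ ≤? N ⟧ * h (k * m′)))
  ∑-multiples k g h = begin
    ∑ S (λ m → h m * ∑ S (λ m′ → ⟦ m ≟ k * m′ ⟧ * g m′))   ≡⟨ ∑-ext S (λ m → sym (∑-*ˡ S (h m) _)) ⟩
    ∑ S (λ m → ∑ S (λ m′ → h m * (⟦ m ≟ k * m′ ⟧ * g m′))) ≡⟨ ∑-swap S S _ ⟩
    ∑ S (λ m′ → ∑ S (λ m → h m * (⟦ m ≟ k * m′ ⟧ * g m′))) ≡⟨ ∑-ext S (λ m′ → trans (∑-ext S (λ m → swap (h m) ⟦ m ≟ k * m′ ⟧ (g m′))) (∑-*ˡ S (g m′) _)) ⟩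
    ∑ S (λ m′ → g m′ * ∑ S (λ m → ⟦ m ≟ k * m′ ⟧ * h m))   ≡⟨ ∑-ext S (λ m′ → cong (g m′ *_) (∑-delta≡ N h (k * m′))) ⟩
    ∑ S (λ m′ → g m′ * (⟦ k * m′ ≤? N ⟧ * h (k * m′)))     ∎
    where
    open ≡-Reasoning
    swap : ∀ a b c → a * (b * c) ≡ c * (b * a)
    swap a b c = solve (a ∷ b ∷ c ∷ [])

  ∑-Y : ∀ (h : ℕ → ℕ) → ∑ S (λ m → h m * Y m) ≡ ∑ d (λ i → ∑ S (λ m′ → V m′ * (⟦ r i * m′ ≤? N ⟧ * h (r i * m′))))
  ∑-Y h = trans (∑-ext S (λ m → sym (∑-*ˡ d (h m) _))) (trans (∑-swap S d _) (∑-ext d (λ i → ∑-multiples (r i) V h)))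

  B-dec : ∀ k m → 1 ≤ k → B (k * m) ≤ B m
  B-dec k m 1≤k = ⟦⟧-mono (k * m * x ≤? N) (m * x ≤? N) (≤-trans (*-monoˡ-≤ x (m≤c*m m 1≤k)))

  -- Away from the edge r i m stays in the range and has the same `μ` as m, so each i contributes
  -- the full mass.
  first-moment : d * Mt ≤ ∑ S (λ m → B m * μ m * Y m) + d * Eg
  first-moment = begin
    d * Mt ≡⟨ ∑-const d Mt ⟨
    ∑ d (λ _ → Mt) ≤⟨ ∑-mono d (λ i i<d → ≤-trans (∑-mono S (λ m _ → term i i<d m)) (≤-reflexive (∑-+ S _ _))) ⟩
    ∑ d (λ i → ∑ S (λ m → V m * (⟦ r i * m ≤? N ⟧ * (B (r i * m) * μ (r i * m)))) + Eg) ≡⟨ ∑-+ d _ _ ⟩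
    ∑ d (λ i → ∑ S (λ m → V m * (⟦ r i * m ≤? N ⟧ * (B (r i * m) * μ (r i * m))))) + ∑ d (λ _ → Eg) ≡⟨ cong₂ _+_ (sym (∑-Y (λ m → B m * μ m))) (∑-const d Eg) ⟩
    ∑ S (λ m → B m * μ m * Y m) + d * Eg ∎
    where
    open ≤-Reasoning
    term : ∀ i → i < d → ∀ m → B m * (μ m * V m) ≤ V m * (⟦ r i * m ≤? N ⟧ * (B (r i * m) * μ (r i * m))) + ⟦ N <? m * X ⟧ * (B m * (μ m * V m))
    term i i<d m with N <? m * X
    ... | yes _ = ≤-trans (≤-reflexive (sym (*-identityˡ _))) (m≤n+m _ (V m * (⟦ r i * m ≤? N ⟧ * (B (r i * m) * μ (r i * m)))))
    ... | no N≮mX = ≤-trans (⟦⟧*≤ (m * x ≤? N) (λ _ → ≤-reflexive (trans (*-comm (μ m) (V m)) (cong (V m *_) eq)))) (m≤m+n _ _)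
      where
      rm≤ : r i * m * x ≤ N
      rm≤ = begin
        r i * m * x  ≤⟨ *-monoˡ-≤ x (*-monoˡ-≤ m (r≤R₂ i i<d)) ⟩
        R₂ * m * x   ≡⟨ swap R₂ m x ⟩
        m * X        ≤⟨ ≮⇒≥ N≮mX ⟩
        N            ∎
        where
        swap : ∀ R m x → R * m * x ≡ m * (R * x)
        swap R m x = solve (R ∷ m ∷ x ∷ [])
      rm≤N : r i * m ≤ N
      rm≤N = ≤-trans (m≤m*n (r i * m) x {{pos 1≤x}}) rm≤
      eq : μ m ≡ ⟦ r i * m ≤? N ⟧ * (B (r i * m) * μ (r i * m))
      eq = sym (trans (cong₂ _*_ (⟦⟧-yes (r i * m ≤? N) rm≤N)
             (cong₂ _*_ (⟦⟧-yes (r i * m * x ≤? N) rm≤) (μ-pool (r i) m (≤-trans 1≤R (R≤r i i<d)) (r≤R₂ i i<d) rm≤N)))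
           (trans (*-identityˡ _) (*-identityˡ _)))

  Yᵢ-zero : ∀ i m → (∀ m′ → m′ < S → m ≢ r i * m′) → Yᵢ i m ≡ 0
  Yᵢ-zero i m h = ∑-zero S (λ m′ m′<S → cong (_* V m′) (⟦⟧-no (m ≟ r i * m′) (h m′ m′<S)))

  Yᵢ-value : ∀ i → i < d → ∀ m m₀ → m ≡ r i * m₀ → Yᵢ i m ≤ V m₀
  Yᵢ-value i i<d m m₀ refl = ≤-trans (∑-mono S (λ m′ _ → *-monoˡ-≤ (V m′) (⟦⟧-mono (r i * m₀ ≟ r i * m′) (m′ ≟ m₀)
      (λ e → sym (*-cancelˡ-≡ m₀ m′ (r i) {{pos (≤-trans 1≤R (R≤r i i<d))}} e)))))
    (∑-delta≤ S V m₀)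

  Yᵢ-cases : ∀ i m → (∃ λ m′ → m ≡ r i * m′) ⊎ (Yᵢ i m ≡ 0)
  Yᵢ-cases i m with r i ∣? m
  ... | yes (divides m′ e) = inj₁ (m′ , trans e (*-comm m′ (r i)))
  ... | no ¬p = inj₂ (Yᵢ-zero i m (λ m′ _ e → ¬p (divides m′ (trans e (*-comm (r i) m′)))))

  -- The product vanishes unless m is a multiple of both `r i` and `r j`, and then `common` makes it
  -- a multiple of `r i * cof i j`.
  YᵢYⱼ : ∀ i j → i < d → j < d → ∀ m → m < S →
    Yᵢ i m * Yᵢ j m ≤ ∑ S (λ m′ → ⟦ m ≟ r i * cof i j * m′ ⟧ * (V (cof i j * m′) * V (cof j i * m′)))
  YᵢYⱼ i j i<d j<d m m<S with Yᵢ-cases i m | Yᵢ-cases j m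
  ... | inj₂ z | _ = ≤-trans (≤-reflexive (cong (_* Yᵢ j m) z)) z≤n
  ... | inj₁ _ | inj₂ z = ≤-trans (≤-reflexive (trans (cong (Yᵢ i m *_) z) (*-zeroʳ (Yᵢ i m)))) z≤n
  ... | inj₁ (m₁ , e₁) | inj₁ (m₂ , e₂) = case common i j i<d j<d m₁ m₂ (trans (sym e₁) e₂) of λ (m₀ , f₁ , f₂) → go m₀ f₁ f₂
    where
    go : ∀ m₀ → m₁ ≡ cof i j * m₀ → m₂ ≡ cof j i * m₀ → _
    go m₀ f₁ f₂ = begin
      Yᵢ i m * Yᵢ j m ≤⟨ *-mono-≤ (Yᵢ-value i i<d m m₁ e₁) (Yᵢ-value j j<d m m₂ e₂) ⟩
      V m₁ * V m₂ ≡⟨ cong₂ (λ u v → V u * V v) f₁ f₂ ⟩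
      V (cof i j * m₀) * V (cof j i * m₀) ≡⟨ trans (cong (_* (V (cof i j * m₀) * V (cof j i * m₀))) (⟦⟧-yes (m ≟ r i * cof i j * m₀) m≡)) (*-identityˡ _) ⟨
      ⟦ m ≟ r i * cof i j * m₀ ⟧ * (V (cof i j * m₀) * V (cof j i * m₀)) ≤⟨ ∑-term S (λ m′ → ⟦ m ≟ r i * cof i j * m′ ⟧ * (V (cof i j * m′) * V (cof j i * m′))) m₀<S ⟩
      ∑ S (λ m′ → ⟦ m ≟ r i * cof i j * m′ ⟧ * (V (cof i j * m′) * V (cof j i * m′))) ∎
      where
      open ≤-Reasoning
      m≡ : m ≡ r i * cof i j * m₀
      m≡ = trans e₁ (trans (cong (r i *_) f₁) (sym (*-assoc (r i) (cof i j) m₀)))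
      m₀<S : m₀ < S
      m₀<S = ≤-<-trans (≤-trans (m≤c*m m₀ (pos-* (≤-trans 1≤R (R≤r i i<d)) (cof≥1 i j i<d j<d))) (≤-reflexive (sym m≡))) m<S

  -- Multiplication by `r i * cof i j` leaves `μ` unchanged and can only lower `B`, so `V-corr`
  -- applies term by term.
  pair-moment : ∀ i j → i < d → j < d →
    Θ * ∑ S (λ m → B m * μ m * V⁻ m * (Yᵢ i m * Yᵢ j m)) ≤ c i j * (Π * Mt)
  pair-moment i j i<d j<d = begin
    Θ * ∑ S (λ m → h m * (Yᵢ i m * Yᵢ j m))                                 ≤⟨ Θ ⊛ ∑-mono S (λ m m<S → h m ⊛ YᵢYⱼ i j i<d j<d m m<S) ⟩
    Θ * ∑ S (λ m → h m * ∑ S (λ m′ → ⟦ m ≟ L * m′ ⟧ * g m′))                ≡⟨ cong (Θ *_) (∑-multiples L g h) ⟩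
    Θ * ∑ S (λ m → g m * (⟦ L * m ≤? N ⟧ * h (L * m)))                      ≡⟨ ∑-*ˡ S Θ _ ⟨
    ∑ S (λ m → Θ * (g m * (⟦ L * m ≤? N ⟧ * h (L * m))))                    ≤⟨ ∑-mono S (λ m _ → term m) ⟩
    ∑ S (λ m → (c i j * Π) * (B m * (μ m * V m)))                           ≡⟨ ∑-*ˡ S (c i j * Π) _ ⟩
    c i j * Π * Mt                                                          ≡⟨ *-assoc (c i j) Π Mt ⟩
    c i j * (Π * Mt)                                                        ∎
    where
    open ≤-Reasoning
    L = r i * cof i j
    h g : ℕ → ℕ
    h m = B m * μ m * V⁻ m
    g m = V (cof i j * m) * V (cof j i * m)
    1≤r : 1 ≤ r i
    1≤r = ≤-trans 1≤R (R≤r i i<d)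
    1≤L : 1 ≤ L
    1≤L = pos-* 1≤r (cof≥1 i j i<d j<d)
    term : ∀ m → Θ * (g m * (⟦ L * m ≤? N ⟧ * h (L * m))) ≤ (c i j * Π) * (B m * (μ m * V m))
    term m = ≤-trans (≤-reflexive (comm₁ Θ (g m) ⟦ L * m ≤? N ⟧ (h (L * m)))) (⟦⟧*≤ (L * m ≤? N) (λ Lm≤N → begin
      Θ * (g m * (B (L * m) * μ (L * m) * V⁻ (L * m)))  ≡⟨ cong₂ (λ u z → Θ * (g m * (B (L * m) * u * V⁻ z))) (same Lm≤N) (*-assoc (r i) (cof i j) m) ⟩
      Θ * (g m * (B (L * m) * μ m * V⁻ (r i * (cof i j * m)))) ≤⟨ Θ ⊛ (g m ⊛ *-monoˡ-≤ (V⁻ (r i * (cof i j * m))) (*-monoˡ-≤ (μ m) (B-dec L m 1≤L))) ⟩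
      Θ * (g m * (B m * μ m * V⁻ (r i * (cof i j * m)))) ≡⟨ comm₂ Θ (g m) (B m) (μ m) (V⁻ (r i * (cof i j * m))) ⟩
      B m * (μ m * (Θ * (g m * V⁻ (r i * (cof i j * m))))) ≤⟨ B m ⊛ μ-mono m (λ 1≤m → V-corr i j i<d j<d m 1≤m) ⟩
      B m * (μ m * (c i j * (Π * V m)))                 ≡⟨ comm₃ (B m) (μ m) (c i j) Π (V m) ⟩
      c i j * Π * (B m * (μ m * V m))                   ∎))
      where
      comm₁ : ∀ t g k h → t * (g * (k * h)) ≡ k * (t * (g * h))
      comm₁ t g k h = solve (t ∷ g ∷ k ∷ h ∷ [])
      comm₂ : ∀ t g b u v → t * (g * (b * u * v)) ≡ b * (u * (t * (g * v)))
      comm₂ t g b u v = solve (t ∷ g ∷ b ∷ u ∷ v ∷ [])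
      comm₃ : ∀ b u c p v → b * (u * (c * (p * v))) ≡ c * p * (b * (u * v))
      comm₃ b u c p v = solve (b ∷ u ∷ c ∷ p ∷ v ∷ [])
      same : L * m ≤ N → μ (L * m) ≡ μ m
      same Lm≤N = trans (cong μ (*-assoc (r i) (cof i j) m))
        (trans (μ-pool (r i) (cof i j * m) 1≤r (r≤R₂ i i<d) rcm≤N)
          (μ-pool (cof i j) m (cof≥1 i j i<d j<d) (cof≤R₂ i j i<d j<d) (≤-trans (m≤c*m (cof i j * m) 1≤r) rcm≤N)))
        where
        rcm≤N : r i * (cof i j * m) ≤ N
        rcm≤N = subst (_≤ N) (*-assoc (r i) (cof i j) m) Lm≤N

  Q₂ : ℕ
  Q₂ = ∑ S (λ m → B m * μ m * V⁻ m * (Y m * Y m))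

  second-moment : e * Q₂ ≤ (e + 1) * (d * d) * (Π * Mt)
  second-moment = cancelˡ Θ 1≤Θ (begin
    Θ * (e * Q₂)                                            ≡⟨ swap Θ e Q₂ ⟩
    e * (Θ * Q₂)                                            ≡⟨ cong (λ z → e * (Θ * z)) expand ⟩
    e * (Θ * ∑ d (λ i → ∑ d (λ j → T i j)))                 ≡⟨ cong (e *_) (trans (sym (∑-*ˡ d Θ _)) (∑-ext d (λ i → sym (∑-*ˡ d Θ _)))) ⟩
    e * ∑ d (λ i → ∑ d (λ j → Θ * T i j))                   ≤⟨ e ⊛ ∑-mono d (λ i i<d → ∑-mono d (λ j j<d → pair-moment i j i<d j<d)) ⟩
    e * ∑ d (λ i → ∑ d (λ j → c i j * (Π * Mt)))            ≡⟨ cong (e *_) (trans (∑-ext d (λ i → ∑-*ʳ d (Π * Mt) _)) (∑-*ʳ d (Π * Mt) _)) ⟩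
    e * (∑ d (λ i → ∑ d (λ j → c i j)) * (Π * Mt))          ≡⟨ *-assoc e _ (Π * Mt) ⟨
    e * ∑ d (λ i → ∑ d (λ j → c i j)) * (Π * Mt)            ≤⟨ *-monoˡ-≤ (Π * Mt) c-sum ⟩
    (e + 1) * Θ * (d * d) * (Π * Mt)                        ≡⟨ swap₂ (e + 1) Θ (d * d) (Π * Mt) ⟩
    Θ * ((e + 1) * (d * d) * (Π * Mt))                      ∎)
    where
    open ≤-Reasoning
    T : ℕ → ℕ → ℕ
    T i j = ∑ S (λ m → B m * μ m * V⁻ m * (Yᵢ i m * Yᵢ j m))
    swap : ∀ a b c → a * (b * c) ≡ b * (a * c)
    swap a b c = solve (a ∷ b ∷ c ∷ [])
    swap₂ : ∀ e t d p → e * t * d * p ≡ t * (e * d * p)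
    swap₂ e t d p = solve (e ∷ t ∷ d ∷ p ∷ [])
    expand : Q₂ ≡ ∑ d (λ i → ∑ d (λ j → T i j))
    expand = trans (∑-ext S (λ m → sq (B m * μ m * V⁻ m) m)) (trans (∑-swap S d _) (∑-ext d (λ i → ∑-swap S d _)))
      where
      sq : ∀ h m → h * (Y m * Y m) ≡ ∑ d (λ i → ∑ d (λ j → h * (Yᵢ i m * Yᵢ j m)))
      sq h m = sym (trans (∑-ext d (λ i → trans (∑-*ˡ d h _) (cong (h *_) (∑-*ˡ d (Yᵢ i m) _)))) (trans (∑-*ˡ d h _) (cong (h *_) (∑-*ʳ d (Y m) _))))

  -- Weighted second moment method: Σ B μ V⁻ (Y - dV)² is at most d²Π(Mt/e + 2 Eg), and each bad m
  -- contributes to it at least d²Π/4 times its mass.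
  chebyshev : e * Bad ≤ 4 * Mt + 8 * e * Eg
  chebyshev = cancelˡ (d * d * Π) (pos-* (pos-* 1≤d 1≤d) 1≤Π) (combine d e Π Q₂ Mt Eg Bad Z pointwise first-moment second-moment)
    where
    Z = ∑ S (λ m → B m * μ m * Y m)
    combine : ∀ d e Π Q Mt Eg Bad Z → 8 * d * Π * Z + d * d * Π * Bad ≤ 4 * Q + 4 * (d * d) * Π * Mt → d * Mt ≤ Z + d * Eg →
      e * Q ≤ (e + 1) * (d * d) * (Π * Mt) → d * d * Π * (e * Bad) ≤ d * d * Π * (4 * Mt + 8 * e * Eg)
    combine d e Π Q Mt Eg Bad Z h₁ h₂ h₃ = by≤ 0 (e ⊛ h₁ ⊕ (8 * e * d * Π) ⊛ h₂ ⊕ 4 ⊛ h₃) (solve (d ∷ e ∷ Π ∷ Q ∷ Mt ∷ Eg ∷ Bad ∷ Z ∷ []))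
    sq≥ : ∀ a b → 2 * (a * b) ≤ a * a + b * b
    sq≥ a b with ≤-total a b
    ... | inj₁ h with ≤⇒+ h
    ...   | o , refl = by≤ (o * o) (≤-refl {0}) (solve (a ∷ o ∷ []))
    sq≥ a b | inj₂ h with ≤⇒+ h
    ...   | o , refl = by≤ (o * o) (≤-refl {0}) (solve (b ∷ o ∷ []))
    -- (Y − dV)² ≥ 0, and ≥ d²V²/4 when 2Y < dV
    square : ∀ Y d V V⁻ Π → V * V⁻ ≡ Π → 8 * d * Π * Y + ⟦ 2 * Y <? d * V ⟧ * (d * d * Π * V) ≤ 4 * (V⁻ * (Y * Y)) + 4 * (d * d) * Π * V
    square Y d V V⁻ .(V * V⁻) refl with 2 * Y <? d * V
    ... | no _ = by≤ 0 ((4 * V⁻) ⊛ sq≥ Y (d * V)) (solve (Y ∷ d ∷ V ∷ V⁻ ∷ []))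
    ... | yes h with ≤⇒+ (<⇒≤ h)
    ...   | z , eq = ≤-trans (≤-reflexive (l Y d V V⁻)) (≤-trans (V⁻ ⊛ core Y (d * V) z eq) (≤-reflexive (sym (r′ Y d V V⁻))))
      where
      l : ∀ Y d V V⁻ → 8 * d * (V * V⁻) * Y + 1 * (d * d * (V * V⁻) * V) ≡ V⁻ * (8 * (d * V) * Y + d * V * (d * V))
      l Y d V V⁻ = solve (Y ∷ d ∷ V ∷ V⁻ ∷ [])
      r′ : ∀ Y d V V⁻ → 4 * (V⁻ * (Y * Y)) + 4 * (d * d) * (V * V⁻) * V ≡ V⁻ * (4 * (Y * Y) + 4 * (d * V * (d * V)))
      r′ Y d V V⁻ = solve (Y ∷ d ∷ V ∷ V⁻ ∷ [])
      core : ∀ Y D z → D ≡ 2 * Y + z → 8 * D * Y + D * D ≤ 4 * (Y * Y) + 4 * (D * D)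
      core Y D z refl = by≤ (4 * Y * z + 3 * (z * z)) (≤-refl {0}) (solve (Y ∷ z ∷ []))
    pointwise : 8 * d * Π * Z + d * d * Π * Bad ≤ 4 * Q₂ + 4 * (d * d) * Π * Mt
    pointwise = begin
      8 * d * Π * Z + d * d * Π * Bad ≡⟨ cong₂ _+_ (∑-*ˡ S (8 * d * Π) _) (∑-*ˡ S (d * d * Π) _) ⟨
      ∑ S (λ m → 8 * d * Π * (B m * μ m * Y m)) + ∑ S (λ m → d * d * Π * (bad m * (B m * (μ m * V m)))) ≡⟨ ∑-+ S _ _ ⟨
      ∑ S (λ m → 8 * d * Π * (B m * μ m * Y m) + d * d * Π * (bad m * (B m * (μ m * V m)))) ≤⟨ ∑-mono S (λ m _ → term m) ⟩
      ∑ S (λ m → 4 * (B m * μ m * V⁻ m * (Y m * Y m)) + 4 * (d * d) * Π * (B m * (μ m * V m))) ≡⟨ ∑-+ S _ _ ⟩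
      ∑ S (λ m → 4 * (B m * μ m * V⁻ m * (Y m * Y m))) + ∑ S (λ m → 4 * (d * d) * Π * (B m * (μ m * V m))) ≡⟨ cong₂ _+_ (∑-*ˡ S 4 _) (∑-*ˡ S (4 * (d * d) * Π) _) ⟩
      4 * Q₂ + 4 * (d * d) * Π * Mt ∎
      where
      open ≤-Reasoning
      term : ∀ m → 8 * d * Π * (B m * μ m * Y m) + d * d * Π * (bad m * (B m * (μ m * V m))) ≤ 4 * (B m * μ m * V⁻ m * (Y m * Y m)) + 4 * (d * d) * Π * (B m * (μ m * V m))
      term m = subst₂ _≤_ (l d Π (B m) (μ m) (Y m) (bad m) (V m)) (r′ (B m) (μ m) (V⁻ m) (Y m) d Π (V m)) ((B m * μ m) ⊛ square (Y m) d (V m) (V⁻ m) Π (VV⁻ m))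
        where
        l : ∀ d Π B μ Y b V → B * μ * (8 * d * Π * Y + b * (d * d * Π * V)) ≡ 8 * d * Π * (B * μ * Y) + d * d * Π * (b * (B * (μ * V)))
        l d Π B μ Y b V = solve (d ∷ Π ∷ B ∷ μ ∷ Y ∷ b ∷ V ∷ [])
        r′ : ∀ B μ V⁻ Y d Π V → B * μ * (4 * (V⁻ * (Y * Y)) + 4 * (d * d) * Π * V) ≡ 4 * (B * μ * V⁻ * (Y * Y)) + 4 * (d * d) * Π * (B * (μ * V))
        r′ B μ V⁻ Y d Π V = solve (B ∷ μ ∷ V⁻ ∷ Y ∷ d ∷ Π ∷ V ∷ [])

  a≤1 : ∀ n → a n ≤ 1
  a≤1 n = ≤-trans (a≤s n) (s≤1 n)

  α≤W : ∀ m → α m ≤ W m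
  α≤W m = ∑-mono (suc y) (λ q _ → lam q ⊛ ≤-trans (⟦ q * m ≤? N ⟧ ⊛ a≤1 (q * m)) (≤-reflexive (*-identityʳ _)))

  -- For a fixed prime q the set `a` takes at most a share 1/E of the points q m r i. As all `r i`
  -- lie in [R, R₂], the weights `V⁻` and `W` at r i m may be replaced by their values at the ends
  -- of this interval.
  progression-bound : ∀ m → 1 ≤ m → E * ∑ d (λ i → ⟦ r i * m ≤? N ⟧ * (V⁻ (r i * m) * α (r i * m))) ≤ d * (C₁ * C₃ * Π)
  progression-bound m 1≤m = begin
    E * ∑ d (λ i → ⟦ r i * m ≤? N ⟧ * (V⁻ (r i * m) * α (r i * m))) ≤⟨ E ⊛ ∑-mono d (λ i i<d → ⟦⟧*≤ (r i * m ≤? N) (λ _ → *-mono-≤ (V⁻-mono (*-monoˡ-≤ m (r≤R₂ i i<d))) (α≤ i i<d))) ⟩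
    E * ∑ d (λ i → v * ∑ (suc y) (λ q → k q * a (q * m * r i)))  ≡⟨ cong (E *_) (∑-*ˡ d v _) ⟩
    E * (v * ∑ d (λ i → ∑ (suc y) (λ q → k q * a (q * m * r i)))) ≡⟨ swap E v _ ⟩
    v * (E * ∑ d (λ i → ∑ (suc y) (λ q → k q * a (q * m * r i)))) ≡⟨ cong (λ z → v * (E * z)) (trans (∑-swap d (suc y) _) (∑-ext (suc y) (λ q → ∑-*ˡ d (k q) _))) ⟩
    v * (E * ∑ (suc y) (λ q → k q * ∑ d (λ i → a (q * m * r i)))) ≡⟨ cong (v *_) (∑-*ˡ (suc y) E _) ⟨
    v * ∑ (suc y) (λ q → E * (k q * ∑ d (λ i → a (q * m * r i)))) ≤⟨ v ⊛ ∑-mono (suc y) (λ q _ → term q) ⟩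
    v * ∑ (suc y) (λ q → k q * d)                                ≡⟨ cong (v *_) (∑-*ʳ (suc y) d k) ⟩
    v * (W (R * m) * d)                                          ≤⟨ v ⊛ *-monoˡ-≤ d (≤-trans (W≤V (R * m) (pos-* 1≤R 1≤m)) (C₁ ⊛ V-ratio m 1≤m)) ⟩
    v * (C₁ * (C₃ * V (R₂ * m)) * d)                             ≡⟨ regroup v C₁ C₃ (V (R₂ * m)) d ⟩
    d * (C₁ * C₃ * (V (R₂ * m) * v))                             ≡⟨ cong (λ z → d * (C₁ * C₃ * z)) (VV⁻ (R₂ * m)) ⟩
    d * (C₁ * C₃ * Π)                                            ∎
    where
    open ≤-Reasoning
    v = V⁻ (R₂ * m)
    k : ℕ → ℕ
    k q = lam q * ⟦ q * (R * m) ≤? N ⟧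
    swap : ∀ a b c → a * (b * c) ≡ b * (a * c)
    swap a b c = solve (a ∷ b ∷ c ∷ [])
    regroup : ∀ v C D V d → v * (C * (D * V) * d) ≡ d * (C * D * (V * v))
    regroup v C D V d = solve (v ∷ C ∷ D ∷ V ∷ d ∷ [])
    order : ∀ q m r → q * (r * m) ≡ q * m * r
    order q m r = solve (q ∷ m ∷ r ∷ [])
    α≤ : ∀ i → i < d → α (r i * m) ≤ ∑ (suc y) (λ q → k q * a (q * m * r i))
    α≤ i i<d = ∑-mono (suc y) (λ q _ → ≤-trans
      (lam q ⊛ *-mono-≤ (⟦⟧-mono (q * (r i * m) ≤? N) (q * (R * m) ≤? N) (≤-trans (q ⊛ *-monoˡ-≤ m (R≤r i i<d)))) (≤-reflexive (cong a (order q m (r i)))))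
      (≤-reflexive (sym (*-assoc (lam q) _ _))))
    term : ∀ q → E * (k q * ∑ d (λ i → a (q * m * r i))) ≤ k q * d
    term q = ≤-trans (≤-reflexive (swap E (k q) _)) (>0*-mono (k q) (λ k>0 → a-dens (q * m) (pos-* (lam-pos q (proj₁ (⊗>0 {lam q} k>0))) 1≤m)))

  -- Where m is not bad, dV ≤ 2Y replaces V(m) by an average of V(m / r i). Exchanging the sums
  -- leaves, for each m′, a sum over the multiples r i m′, which is `progression-bound`. Bad m are
  -- estimated by α ≤ W ≤ C₁V.
  good-bound : E * Good ≤ 2 * C₁ * C₃ * Mt + E * C₁ * Bad
  good-bound = cancelˡ (Π * d) (pos-* 1≤Π 1≤d) (combine E Π d Good C₁ C₃ Mt Bad Z pointwise progressions)
    where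
    open ≤-Reasoning
    Z = ∑ S (λ m → B m * μ m * (V⁻ m * α m) * Y m)
    combine : ∀ E Π d G C D Mt Bad Z → Π * d * G ≤ 2 * Z + Π * d * C * Bad → E * Z ≤ d * (C * D * Π) * Mt →
      Π * d * (E * G) ≤ Π * d * (2 * C * D * Mt + E * C * Bad)
    combine E Π d G C D Mt Bad Z h₁ h₂ = by≤ 0 (E ⊛ h₁ ⊕ 2 ⊛ h₂) (solve (E ∷ Π ∷ d ∷ G ∷ C ∷ D ∷ Mt ∷ Bad ∷ Z ∷ []))
    pointwise : Π * d * Good ≤ 2 * Z + Π * d * C₁ * Bad
    pointwise = begin
      Π * d * Good ≡⟨ ∑-*ˡ S (Π * d) _ ⟨
      ∑ S (λ m → Π * d * (B m * (μ m * α m))) ≤⟨ ∑-mono S (λ m _ → term m) ⟩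
      ∑ S (λ m → 2 * (B m * μ m * (V⁻ m * α m) * Y m) + Π * d * C₁ * (bad m * (B m * (μ m * V m)))) ≡⟨ trans (∑-+ S _ _) (cong₂ _+_ (∑-*ˡ S 2 _) (∑-*ˡ S (Π * d * C₁) _)) ⟩
      2 * Z + Π * d * C₁ * Bad ∎
      where
      l : ∀ Π d B μ α → Π * d * (B * (μ * α)) ≡ B * (μ * (Π * d * α))
      l Π d B μ α = solve (Π ∷ d ∷ B ∷ μ ∷ α ∷ [])
      r′ : ∀ Π d B μ α C Y b V V⁻ → B * (μ * (2 * (V⁻ * α * Y) + Π * d * (b * (C * V)))) ≡ 2 * (B * μ * (V⁻ * α) * Y) + Π * d * C * (b * (B * (μ * V)))
      r′ Π d B μ α C Y b V V⁻ = solve (Π ∷ d ∷ B ∷ μ ∷ α ∷ C ∷ Y ∷ b ∷ V ∷ V⁻ ∷ [])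
      core : ∀ m → 1 ≤ m → Π * d * α m ≤ 2 * (V⁻ m * α m * Y m) + Π * d * (bad m * (C₁ * V m))
      core m 1≤m with 2 * Y m <? d * V m
      ... | yes _ = ≤-trans ((Π * d) ⊛ ≤-trans (≤-trans (α≤W m) (W≤V m 1≤m)) (≤-reflexive (sym (*-identityˡ _)))) (m≤n+m _ _)
      ... | no h = ≤-trans (≤-reflexive (cong (λ z → z * d * α m) (sym (VV⁻ m)))) (≤-trans (mult (V m) (V⁻ m) d (α m) (Y m) (≮⇒≥ h)) (m≤m+n _ _))
        where
        mult : ∀ V V⁻ d α Y → d * V ≤ 2 * Y → V * V⁻ * d * α ≤ 2 * (V⁻ * α * Y)
        mult V V⁻ d α Y h = by≤ 0 ((V⁻ * α) ⊛ h) (solve (V ∷ V⁻ ∷ d ∷ α ∷ Y ∷ []))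
      term : ∀ m → Π * d * (B m * (μ m * α m)) ≤ 2 * (B m * μ m * (V⁻ m * α m) * Y m) + Π * d * C₁ * (bad m * (B m * (μ m * V m)))
      term m = subst₂ _≤_ (sym (l Π d (B m) (μ m) (α m))) (r′ Π d (B m) (μ m) (α m) C₁ (Y m) (bad m) (V m) (V⁻ m)) (B m ⊛ μ-mono m (core m))
    progressions : E * Z ≤ d * (C₁ * C₃ * Π) * Mt
    progressions = begin
      E * Z ≡⟨ cong (E *_) (∑-Y (λ m → B m * μ m * (V⁻ m * α m))) ⟩
      E * ∑ d (λ i → ∑ S (λ m → V m * (⟦ r i * m ≤? N ⟧ * (B (r i * m) * μ (r i * m) * (V⁻ (r i * m) * α (r i * m))))))
        ≤⟨ E ⊛ ∑-mono d (λ i i<d → ∑-mono S (λ m _ → term i i<d m)) ⟩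
      E * ∑ d (λ i → ∑ S (λ m → B m * (μ m * V m) * f i m)) ≡⟨ cong (E *_) (trans (∑-swap d S _) (∑-ext S (λ m → ∑-*ˡ d (B m * (μ m * V m)) _))) ⟩
      E * ∑ S (λ m → B m * (μ m * V m) * ∑ d (λ i → f i m)) ≡⟨ ∑-*ˡ S E _ ⟨
      ∑ S (λ m → E * (B m * (μ m * V m) * ∑ d (λ i → f i m))) ≤⟨ ∑-mono S (λ m _ → final m) ⟩
      ∑ S (λ m → d * (C₁ * C₃ * Π) * (B m * (μ m * V m))) ≡⟨ ∑-*ˡ S (d * (C₁ * C₃ * Π)) _ ⟩
      d * (C₁ * C₃ * Π) * Mt ∎
      where
      f : ℕ → ℕ → ℕ
      f i m = ⟦ r i * m ≤? N ⟧ * (V⁻ (r i * m) * α (r i * m))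
      comm₁ : ∀ V k g → V * (k * g) ≡ k * (V * g)
      comm₁ V k g = solve (V ∷ k ∷ g ∷ [])
      comm₂ : ∀ B μ V k g → k * (V * (B * μ * g)) ≡ B * (μ * V) * (k * g)
      comm₂ B μ V k g = solve (B ∷ μ ∷ V ∷ k ∷ g ∷ [])
      term : ∀ i → i < d → ∀ m → V m * (⟦ r i * m ≤? N ⟧ * (B (r i * m) * μ (r i * m) * (V⁻ (r i * m) * α (r i * m)))) ≤ B m * (μ m * V m) * f i m
      term i i<d m = ≤-trans (≤-reflexive (comm₁ (V m) ⟦ r i * m ≤? N ⟧ _))
        (≤-trans (⟦⟧*-mono (r i * m ≤? N) (λ rm≤N → V m ⊛ *-monoˡ-≤ (V⁻ (r i * m) * α (r i * m))
            (*-mono-≤ (B-dec (r i) m 1≤r) (≤-reflexive (μ-pool (r i) m 1≤r (r≤R₂ i i<d) rm≤N)))))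
          (≤-reflexive (comm₂ (B m) (μ m) (V m) ⟦ r i * m ≤? N ⟧ (V⁻ (r i * m) * α (r i * m)))))
        where
        1≤r : 1 ≤ r i
        1≤r = ≤-trans 1≤R (R≤r i i<d)
      comm₃ : ∀ E B μ V t → E * (B * (μ * V) * t) ≡ B * (μ * (V * (E * t)))
      comm₃ E B μ V t = solve (E ∷ B ∷ μ ∷ V ∷ t ∷ [])
      comm₄ : ∀ k B μ V → B * (μ * (V * k)) ≡ k * (B * (μ * V))
      comm₄ k B μ V = solve (k ∷ B ∷ μ ∷ V ∷ [])
      final : ∀ m → E * (B m * (μ m * V m) * ∑ d (λ i → f i m)) ≤ d * (C₁ * C₃ * Π) * (B m * (μ m * V m))
      final m = subst₂ _≤_ (sym (comm₃ E (B m) (μ m) (V m) (∑ d (λ i → f i m)))) (comm₄ (d * (C₁ * C₃ * Π)) (B m) (μ m) (V m))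
        (B m ⊛ μ-mono m (λ 1≤m → V m ⊛ progression-bound m 1≤m))

  -- The three terms are the losses to small primes and the edge, of order σ/Λ, to Roth's theorem,
  -- of order 1/E, and to the variance, of order 1/e.
  main-bound : 1 ≤ Big → E * e * Λ * A₁ ≤ (E * e * σ * (1 + 16 * C₁ * C₂) + 4 * e * C₁ * C₂ * C₃ * Λ + 8 * E * C₁ * C₂ * Λ) * Ψ
  main-bound 1≤Big = cancelˡ Big 1≤Big (combine E e Λ A₁ σ C₁ C₂ C₃ Ψ Big Mt Eg Bad Good _
      count-by-primes small-primes good-bound chebyshev Mt-bound Eg-bound)
    where
    combine : ∀ E e Λ A σ C D F Ψ Big Mt Eg Bad Good Z → Big * A ≤ Z + Good → Λ * Z ≤ σ * (Big * Ψ) →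
      E * Good ≤ 2 * C * F * Mt + E * C * Bad → e * Bad ≤ 4 * Mt + 8 * e * Eg → Mt ≤ 2 * D * (Big * Ψ) → Λ * Eg ≤ 2 * D * (σ * (Big * Ψ)) →
      Big * (E * e * Λ * A) ≤ Big * ((E * e * σ * (1 + 16 * C * D) + 4 * e * C * D * F * Λ + 8 * E * C * D * Λ) * Ψ)
    combine E e Λ A σ C D F Ψ Big Mt Eg Bad Good Z h₁ h₂ h₃ h₄ h₅ h₆ =
      by≤ 0 ((E * e * Λ) ⊛ h₁ ⊕ (E * e) ⊛ h₂ ⊕ (e * Λ) ⊛ h₃ ⊕ (E * C * Λ) ⊛ h₄ ⊕ (2 * C * F * e * Λ + 4 * E * C * Λ) ⊛ h₅ ⊕ (8 * E * e * C) ⊛ h₆)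
        (solve (E ∷ e ∷ Λ ∷ A ∷ σ ∷ C ∷ D ∷ F ∷ Ψ ∷ Big ∷ Mt ∷ Eg ∷ Bad ∷ Good ∷ Z ∷ []))

-- A logarithmic grid and the slowly bending weight on it.

search : ∀ {P : ℕ → Set} → (∀ j → Dec (P j)) → ∀ n → P 0 → ¬ P n → ∃ λ j → P j × ¬ P (suc j)
search P? zero    p0 ¬pn = ⊥-elim (¬pn p0)
search P? (suc n) p0 ¬pn with P? n
... | yes p = n , p , ¬pn
... | no ¬p = search P? n p0 ¬p

*-mono-<₂ : ∀ {a b c d} → a < b → c < d → a * c < b * d
*-mono-<₂ {a} {suc b} {c} {d} h g = ≤-<-trans (*-monoˡ-≤ c (≤-pred h)) (lt b c d g)
  where
  lt : ∀ b c d → c < d → b * c < suc b * d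
  lt b c d h = by≤ c (suc b ⊛ h ⊕ z≤n {b}) (solve (b ∷ c ∷ d ∷ []))

-- Reciprocals are carried as n!/v, with one factorial as the common scale.
inverse : ∀ {v n} → 1 ≤ v → v ≤ n → ∃ λ w → v * w ≡ n !
inverse {v} 1≤v v≤n with ∣! 1≤v v≤n
... | divides w e = w , trans (*-comm v w) (sym e)

^-distribʳ-* : ∀ a b n → (a * b) ^ n ≡ a ^ n * b ^ n
^-distribʳ-* a b zero    = refl
^-distribʳ-* a b (suc n) = trans (cong (a * b *_) (^-distribʳ-* a b n)) (sw a b (a ^ n) (b ^ n))
  where
  sw : ∀ a b x y → a * b * (x * y) ≡ a * x * (b * y)
  sw a b x y = solve (a ∷ b ∷ x ∷ y ∷ [])

bernoulli : ∀ q n → q ^ n * (q + n) ≤ (1 + q) ^ n * q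
bernoulli q zero    = ≤-reflexive (cong (_+ 0) (+-identityʳ q))
bernoulli q (suc n) = step q n (q ^ n) ((1 + q) ^ n) (bernoulli q n)
  where
  step : ∀ q n a b → a * (q + n) ≤ b * q → q * a * (q + suc n) ≤ (1 + q) * b * q
  step q n a b h = by≤ (a * n) ((1 + q) ⊛ h) (solve (q ∷ n ∷ a ∷ b ∷ []))

-- (1 + 1/H)^n ≤ 1/(1 - n/H) for H = n + r, the upper counterpart of Bernoulli's inequality.
bernoulli′ : ∀ n r → (1 + (n + r)) ^ n * r ≤ (n + r) ^ n * (n + r)
bernoulli′ n r = go n r (n + r) refl
  where
  step : ∀ H r a b → a * (1 + r) ≤ b * H → 1 + r ≤ H → (1 + H) * a * r ≤ H * b * H
  step H r a b h g with ≤⇒+ g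
  ... | o , refl = by≤ (a * (1 + o)) ((1 + r + o) ⊛ h) (solve (a ∷ b ∷ r ∷ o ∷ []))
  go : ∀ n r H → H ≡ n + r → (1 + H) ^ n * r ≤ H ^ n * H
  go zero    r H e = ≤-reflexive (cong (_+ 0) (sym e))
  go (suc n) r H e = step H r ((1 + H) ^ n) (H ^ n) (go n (suc r) H (trans e (sym (+-suc n r)))) (≤-trans (s≤s (m≤n+m r n)) (≤-reflexive (sym e)))

module Grid (h : ℕ) (1≤h : 1 ≤ h) where

  H : ℕ
  H = 2 * h

  1≤H : 1 ≤ H
  1≤H = pos-* {2} (s≤s z≤n) 1≤h

  P : ℕ → ℕ → Set
  P m j = (1 + H) ^ j ≤ m * H ^ j

  stop : ∀ m → ¬ P m (H * m)
  stop m p = <⇒≱ (pos-* 1≤H (pos-^ (H * m) 1≤H)) (arith H m (H ^ (H * m)) ((1 + H) ^ (H * m)) (bernoulli H (H * m)) p)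
    where
    arith : ∀ H m a b → a * (H + H * m) ≤ b * H → b ≤ m * a → H * a ≤ 0
    arith H m a b h g = by≤ 0 (h ⊕ H ⊛ g) (solve (H ∷ m ∷ a ∷ b ∷ []))

  -- the integer part of the logarithm to base 1 + 1/H, with glog 0 = 0
  glog : ℕ → ℕ
  glog zero      = 0
  glog m@(suc _) = proj₁ (search (λ j → (1 + H) ^ j ≤? m * H ^ j) (H * m) (s≤s z≤n) (stop m))

  glog-lo : ∀ m → 1 ≤ m → P m (glog m)
  glog-lo m@(suc _) _ = proj₁ (proj₂ (search (λ j → (1 + H) ^ j ≤? m * H ^ j) (H * m) (s≤s z≤n) (stop m)))

  glog-hi : ∀ m → 1 ≤ m → m * H ^ suc (glog m) < (1 + H) ^ suc (glog m)
  glog-hi m@(suc _) _ = ≰⇒> (proj₂ (proj₂ (search (λ j → (1 + H) ^ j ≤? m * H ^ j) (H * m) (s≤s z≤n) (stop m))))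

  P-pred : ∀ m j → P m (suc j) → P m j
  P-pred m j p = cancelˡ H 1≤H (arith H ((1 + H) ^ j) m (H ^ j) p)
    where
    arith : ∀ H a m b → (1 + H) * a ≤ m * (H * b) → H * a ≤ H * (m * b)
    arith H a m b h = by≤ a h (solve (H ∷ a ∷ m ∷ b ∷ []))

  P-down : ∀ m {i j} → i ≤ j → P m j → P m i
  P-down m {i} h with ≤⇒+ h
  ... | o , refl = go o
    where
    go : ∀ o → P m (i + o) → P m i
    go zero    p = subst (P m) (+-identityʳ i) p
    go (suc o) p = go o (P-pred m (i + o) (subst (P m) (+-suc i o) p))

  glog-greatest : ∀ m j → 1 ≤ m → P m j → j ≤ glog m
  glog-greatest m j 1≤m p = ≮⇒≥ λ lt → <⇒≱ (glog-hi m 1≤m) (P-down m lt p)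

  glog-mono : ∀ {m m′} → 1 ≤ m → m ≤ m′ → glog m ≤ glog m′
  glog-mono {m} {m′} 1≤m h = glog-greatest m′ _ (≤-trans 1≤m h) (≤-trans (glog-lo m 1≤m) (*-monoˡ-≤ _ h))

  glog-+≤ : ∀ m m′ → 1 ≤ m → 1 ≤ m′ → glog m + glog m′ ≤ glog (m * m′)
  glog-+≤ m m′ 1≤m 1≤m′ = glog-greatest (m * m′) _ (pos-* 1≤m 1≤m′)
    (≤-trans (≤-reflexive (^-distribˡ-+-* (1 + H) i j)) (≤-trans (*-mono-≤ (glog-lo m 1≤m) (glog-lo m′ 1≤m′))
      (≤-reflexive (trans (sw m (H ^ i) m′ (H ^ j)) (cong (m * m′ *_) (sym (^-distribˡ-+-* H i j)))))))
    where
    i = glog m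
    j = glog m′
    sw : ∀ a b c d → a * b * (c * d) ≡ a * c * (b * d)
    sw a b c d = solve (a ∷ b ∷ c ∷ d ∷ [])

  glog-≤+ : ∀ m m′ → 1 ≤ m → 1 ≤ m′ → glog (m * m′) ≤ glog m + glog m′ + 1
  glog-≤+ m m′ 1≤m 1≤m′ = ≮⇒≥ λ lt → <⇒≱ over (P-down (m * m′) (≤-trans (≤-reflexive (sh i j)) lt) (glog-lo (m * m′) (pos-* 1≤m 1≤m′)))
    where
    i = glog m
    j = glog m′
    sh : ∀ i j → suc i + suc j ≡ suc (i + j + 1)
    sh i j = solve (i ∷ j ∷ [])
    sw : ∀ a b c d → a * b * (c * d) ≡ a * c * (b * d)
    sw a b c d = solve (a ∷ b ∷ c ∷ d ∷ [])
    over : m * m′ * H ^ (suc i + suc j) < (1 + H) ^ (suc i + suc j)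
    over = subst₂ _<_ (trans (sw m (H ^ suc i) m′ (H ^ suc j)) (cong (m * m′ *_) (sym (^-distribˡ-+-* H (suc i) (suc j)))))
      (sym (^-distribˡ-+-* (1 + H) (suc i) (suc j))) (*-mono-<₂ (glog-hi m 1≤m) (glog-hi m′ 1≤m′))

  -- (1 + 1/H)^h ≤ 1/(1 - h/H) = 2, since H = 2h.
  glog-2 : h ≤ glog 2
  glog-2 = glog-greatest 2 h (s≤s z≤n) (cancelˡ h 1≤h (arith h ((1 + H) ^ h) (H ^ h) (subst (λ z → (1 + z) ^ h * h ≤ z ^ h * z) (cong (h +_) (sym (+-identityʳ h))) (bernoulli′ h h))))
    where
    arith : ∀ h a b → a * h ≤ b * (2 * h) → h * a ≤ h * (2 * b)
    arith h a b g = by≤ 0 g (solve (h ∷ a ∷ b ∷ []))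

  glog-2^ : ∀ i → i * h ≤ glog (2 ^ i)
  glog-2^ zero    = z≤n
  glog-2^ (suc i) = ≤-trans (+-mono-≤ glog-2 (glog-2^ i)) (glog-+≤ 2 (2 ^ i) (s≤s z≤n) (pos-^ i (s≤s z≤n)))

  base-power : ∀ g → 1 ≤ g → (1 + H) ^ (glog g + 1) ≤ 2 * g * H ^ (glog g + 1)
  base-power g 1≤g = subst (λ z → (1 + H) ^ z ≤ 2 * g * H ^ z) (+-comm 1 (glog g)) (arith H g ((1 + H) ^ glog g) (H ^ glog g) 1≤H (glog-lo g 1≤g))
    where
    arith : ∀ H g a b → 1 ≤ H → a ≤ g * b → (1 + H) * a ≤ 2 * g * (H * b)
    arith H g a b h k = by≤ 0 ((1 + H) ⊛ k ⊕ (g * b) ⊛ h) (solve (H ∷ g ∷ a ∷ b ∷ []))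

  glog-2^≤ : ∀ n → glog (2 ^ n) ≤ n * H
  glog-2^≤ n = ≮⇒≥ λ lt → <⇒≱ ≤-refl (arith H (2 ^ n) ((1 + H) ^ (n * H)) (H ^ (n * H)) (pos-* (pos-^ n (s≤s z≤n)) (pos-^ (n * H) 1≤H)) power (P-down (2 ^ n) lt (glog-lo (2 ^ n) (pos-^ n (s≤s z≤n)))))
    where
    arith : ∀ H p a b → 1 ≤ p * b → p * b ≤ a → (1 + H) * a ≤ p * (H * b) → 1 ≤ 0
    arith H p a b h₁ h₂ h₃ = by≤ 0 (h₁ ⊕ (1 + H) ⊛ h₂ ⊕ h₃) (solve (H ∷ p ∷ a ∷ b ∷ []))
    one : 2 * H ^ H ≤ (1 + H) ^ H
    one = cancelˡ H 1≤H (ar H (H ^ H) ((1 + H) ^ H) (bernoulli H H))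
      where
      ar : ∀ H a b → a * (H + H) ≤ b * H → H * (2 * a) ≤ H * b
      ar H a b h = by≤ 0 h (solve (H ∷ a ∷ b ∷ []))
    power : 2 ^ n * H ^ (n * H) ≤ (1 + H) ^ (n * H)
    power = subst₂ _≤_ (trans (^-distribʳ-* 2 (H ^ H) n) (cong (2 ^ n *_) (trans (^-*-assoc H H n) (cong (H ^_) (*-comm H n)))))
      (trans (^-*-assoc (1 + H) H n) (cong ((1 + H) ^_) (*-comm H n))) (^-monoˡ-≤ n one)

  -- k governs the steepest slope of F, which is a little less than 1 - 1/k; the slope grows from 0 by steps 1/D, starting at j₀
  module Ramp (k t T j₀ : ℕ) (1≤k : 1 ≤ k) (1≤t : 1 ≤ t) where

    M emax D : ℕ
    M = t * (k * H)
    emax = t * (k ∸ 1)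
    D = M + emax

    1≤M : 1 ≤ M
    1≤M = pos-* 1≤t (pos-* 1≤k 1≤H)

    1≤D : 1 ≤ D
    1≤D = ≤-trans 1≤M (m≤m+n M emax)

    e num : ℕ → ℕ
    e j = ⟦ j <? T ⟧ * ((j ∸ j₀) ⊓ emax)
    num j = D ∸ e j

    e≤emax : ∀ j → e j ≤ emax
    e≤emax j = ⟦⟧*≤ (j <? T) (λ _ → m⊓n≤n (j ∸ j₀) emax)

    M≤num : ∀ j → M ≤ num j
    M≤num j = ≤-trans (≤-reflexive (sym (m+n∸n≡m M emax))) (∸-monoʳ-≤ D (e≤emax j))

    -- Only the growth of `e` has to be slow. The cutoff at `T` makes it fall to 0, which this
    -- direction permits.
    e-+ : ∀ j x → e (j + x) ≤ e j + x
    e-+ j x with j + x <? T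
    ... | no _ = z≤n
    ... | yes p = ≤-trans (≤-reflexive (*-identityˡ _)) (≤-trans slope (+-monoˡ-≤ x (≤-reflexive (sym (trans (cong (_* ((j ∸ j₀) ⊓ emax)) (⟦⟧-yes (j <? T) (≤-<-trans (m≤m+n j x) p))) (*-identityˡ _))))))
      where
      slope : (j + x ∸ j₀) ⊓ emax ≤ (j ∸ j₀) ⊓ emax + x
      slope = ≤-trans (⊓-mono-≤ (m+n∸o≤ j x j₀) (m≤m+n emax x)) (≤-reflexive (sym (+-distribʳ-⊓ x (j ∸ j₀) emax)))
        where
        m+n∸o≤ : ∀ m n o → m + n ∸ o ≤ (m ∸ o) + n
        m+n∸o≤ m n o = m≤n+o⇒m∸n≤o _ o (≤-trans (+-monoˡ-≤ n (m≤n+m∸n m o)) (≤-reflexive (+-assoc o (m ∸ o) n)))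

    num-+ : ∀ j x → num j ≤ num (j + x) + x
    num-+ j x = m≤n+o⇒m∸n≤o _ (e j) (≤-trans (≤-reflexive (sym (m∸n+n≡m (≤-trans (e≤emax (j + x)) (m≤n+m emax M)))))
      (≤-trans (+-monoʳ-≤ (num (j + x)) (e-+ j x)) (≤-reflexive (ar (num (j + x)) (e j) x))))
      where
      ar : ∀ a b c → a + (b + c) ≡ b + (a + c)
      ar a b c = solve (a ∷ b ∷ c ∷ [])

    -- F j is D^T times the product of 1 - e i / D over i < min(j, T). It is flat up to `j₀`, then
    -- bends down until the quotient of consecutive values is M/D, and is flat again from `T` on.
    A F : ℕ → ℕ
    A zero    = 1
    A (suc j) = A j * num j
    F j = A (j ⊓ T) * D ^ (T ∸ j)

    F-step : ∀ j → F (suc j) * D ≡ F j * num j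
    F-step j = go (j <? T)
      where
      ar : ∀ a n d D → a * n * d * D ≡ a * (D * d) * n
      ar a n d D = solve (a ∷ n ∷ d ∷ D ∷ [])
      go : Dec (j < T) → F (suc j) * D ≡ F j * num j
      go (yes p) = trans (cong (λ u → A u * D ^ (T ∸ suc j) * D) (m≤n⇒m⊓n≡m p))
        (trans (ar (A j) (num j) (D ^ (T ∸ suc j)) D)
          (cong₂ (λ u v → A u * v * num j) (sym (m≤n⇒m⊓n≡m (<⇒≤ p))) (cong (D ^_) (suc-∸ T p))))
        where
        suc-∸ : ∀ T → j < T → suc (T ∸ suc j) ≡ T ∸ j
        suc-∸ T p = sym (+-∸-assoc 1 p)
      go (no p) = trans (cong (_* D) (trans (flat (suc j) (m≤n⇒m≤1+n (≮⇒≥ p))) (sym (flat j (≮⇒≥ p)))))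
                        (cong (λ u → F j * (D ∸ u)) (sym (cong (_* ((j ∸ j₀) ⊓ emax)) (⟦⟧-no (j <? T) p))))
        where
        flat : ∀ j → T ≤ j → F j ≡ A T * 1
        flat j h = cong₂ (λ u v → A u * D ^ v) (m≥n⇒m⊓n≡n h) (m≤n⇒m∸n≡0 h)

    1≤F : ∀ j → 1 ≤ F j
    1≤F j = pos-* (1≤A (j ⊓ T)) (pos-^ (T ∸ j) 1≤D)
      where
      1≤A : ∀ j → 1 ≤ A j
      1≤A zero    = ≤-refl
      1≤A (suc j) = pos-* (1≤A j) (≤-trans 1≤M (M≤num j))

    F-dec₁ : ∀ j → F (suc j) ≤ F j
    F-dec₁ j = cancelˡ D 1≤D (≤-trans (≤-reflexive (trans (*-comm D _) (F-step j))) (≤-trans (F j ⊛ m∸n≤m D (e j)) (≤-reflexive (*-comm (F j) D))))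

    F-dec : ∀ {i j} → i ≤ j → F j ≤ F i
    F-dec {i} h with ≤⇒+ h
    ... | o , refl = go o
      where
      go : ∀ o → F (i + o) ≤ F i
      go zero    = ≤-reflexive (cong F (+-identityʳ i))
      go (suc o) = ≤-trans (≤-reflexive (cong F (+-suc i o))) (≤-trans (F-dec₁ (i + o)) (go o))

    F-slow : ∀ j → F j * M ≤ F (suc j) * D
    F-slow j = ≤-trans (F j ⊛ M≤num j) (≤-reflexive (sym (F-step j)))

    -- For a constant slope both products would agree. One more step in x changes their quotient by
    -- num(j + x)/num(j + x + z) ≤ 1 + z/M, as `num` falls by at most 1 per step and never below
    -- `M`. This is at most (M - xz)/(M - (x + 1)z), unless the last difference is truncated to 0
    -- and the claim is trivial.
    F-corr : ∀ j x z → F (j + x) * F (j + z) * (M ∸ x * z) ≤ M * (F j * F (j + x + z))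
    F-corr j zero    z = ≤-reflexive (trans (cong (λ u → F u * F (j + z) * M) (+-identityʳ j)) (trans (*-comm _ M) (cong (λ u → M * (F j * F (u + z))) (sym (+-identityʳ j)))))
    F-corr j (suc x) z = cancelˡ D 1≤D (begin
        D * (F (j + suc x) * F (j + z) * (M ∸ suc x * z)) ≡⟨ cong (λ u → D * (F u * F (j + z) * (M ∸ suc x * z))) (+-suc j x) ⟩
        D * (F (suc (j + x)) * F (j + z) * (M ∸ suc x * z)) ≡⟨ ar₁ D (F (suc (j + x))) (F (j + z)) (M ∸ suc x * z) ⟩
        F (suc (j + x)) * D * (F (j + z) * (M ∸ suc x * z)) ≡⟨ cong (_* (F (j + z) * (M ∸ suc x * z))) (F-step (j + x)) ⟩
        F (j + x) * num (j + x) * (F (j + z) * (M ∸ suc x * z)) ≡⟨ ar₂ (F (j + x)) (num (j + x)) (F (j + z)) (M ∸ suc x * z) ⟩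
        F (j + x) * F (j + z) * (num (j + x) * (M ∸ suc x * z)) ≤⟨ (F (j + x) * F (j + z)) ⊛ key ⟩
        F (j + x) * F (j + z) * (num (j + x + z) * (M ∸ x * z)) ≡⟨ ar₅ (F (j + x) * F (j + z)) (num (j + x + z)) (M ∸ x * z) ⟩
        num (j + x + z) * (F (j + x) * F (j + z) * (M ∸ x * z)) ≤⟨ num (j + x + z) ⊛ F-corr j x z ⟩
        num (j + x + z) * (M * (F j * F (j + x + z))) ≡⟨ ar₃ (num (j + x + z)) M (F j) (F (j + x + z)) ⟩
        M * F j * (F (j + x + z) * num (j + x + z)) ≡⟨ cong (M * F j *_) (F-step (j + x + z)) ⟨
        M * F j * (F (suc (j + x + z)) * D) ≡⟨ ar₄ M (F j) (F (suc (j + x + z))) D ⟩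
        D * (M * (F j * F (suc (j + x + z)))) ≡⟨ cong (λ u → D * (M * (F j * F u))) (cong (_+ z) (sym (+-suc j x))) ⟩
        D * (M * (F j * F (j + suc x + z))) ∎)
      where
      open ≤-Reasoning
      ar₁ : ∀ a b c d → a * (b * c * d) ≡ b * a * (c * d)
      ar₁ a b c d = solve (a ∷ b ∷ c ∷ d ∷ [])
      ar₂ : ∀ a b c d → a * b * (c * d) ≡ a * c * (b * d)
      ar₂ a b c d = solve (a ∷ b ∷ c ∷ d ∷ [])
      ar₃ : ∀ a b c d → a * (b * (c * d)) ≡ b * c * (d * a)
      ar₃ a b c d = solve (a ∷ b ∷ c ∷ d ∷ [])
      ar₄ : ∀ a b c d → a * b * (c * d) ≡ d * (a * (b * c))
      ar₄ a b c d = solve (a ∷ b ∷ c ∷ d ∷ [])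
      ar₅ : ∀ a b c → a * (b * c) ≡ b * (a * c)
      ar₅ a b c = solve (a ∷ b ∷ c ∷ [])
      arith : ∀ u v z k K → u ≤ v + z → k ≤ v → K ≡ z + k → u * k ≤ v * K
      arith u v z k K h g refl = by≤ 0 (k ⊛ h ⊕ z ⊛ g) (solve (u ∷ v ∷ z ∷ k ∷ []))
      key : num (j + x) * (M ∸ suc x * z) ≤ num (j + x + z) * (M ∸ x * z)
      key with z ≤? M ∸ x * z
      ... | yes p = arith _ _ z (M ∸ suc x * z) (M ∸ x * z) (num-+ (j + x) z) (≤-trans (m∸n≤m M (suc x * z)) (M≤num (j + x + z)))
                      (sym (trans (cong (z +_) (trans (cong (M ∸_) (+-comm z (x * z))) (sym (∸-+-assoc M (x * z) z)))) (m+[n∸m]≡n p)))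
      ... | no ¬p = ≤-trans (≤-reflexive (trans (cong (num (j + x) *_) (trans (cong (M ∸_) (+-comm z (x * z))) (trans (sym (∸-+-assoc M (x * z) z)) (m≤n⇒m∸n≡0 (<⇒≤ (≰⇒> ¬p)))))) (*-zeroʳ (num (j + x))))) z≤n

    -- D/M = q/(kH) and 1 + q = k(1 + H), so that D/M = (1 + 1/H) q/(1 + q): slope 1 on the grid,
    -- diminished by the factor q/(1 + q) per step.
    q : ℕ
    q = k * H + (k ∸ 1)

    1≤q : 1 ≤ q
    1≤q = ≤-trans (pos-* 1≤k 1≤H) (m≤m+n _ _)

    F-slow′ : ∀ j → F j * (H * (1 + q)) ≤ (1 + H) * q * F (suc j)
    F-slow′ j = cancelˡ t 1≤t (case ≤⇒+ 1≤k of λ (o , e) → go o e (F j) (F (suc j)) H (F-slow j))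
      where
      go : ∀ o → k ≡ 1 + o → ∀ a b H → a * (t * (k * H)) ≤ b * (t * (k * H) + t * (k ∸ 1)) →
           t * (a * (H * (1 + (k * H + (k ∸ 1))))) ≤ t * ((1 + H) * (k * H + (k ∸ 1)) * b)
      go o refl a b H h = arith o t a b H h
        where
        arith : ∀ o t a b H → a * (t * ((1 + o) * H)) ≤ b * (t * ((1 + o) * H) + t * o) →
          t * (a * (H * (1 + ((1 + o) * H + o)))) ≤ t * ((1 + H) * ((1 + o) * H + o) * b)
        arith o t a b H h = by≤ 0 ((1 + H) ⊛ h) (solve (o ∷ t ∷ a ∷ b ∷ H ∷ []))

    F-slope : ∀ j x → F j * (H * (1 + q)) ^ x ≤ ((1 + H) * q) ^ x * F (j + x)
    F-slope j zero    = ≤-reflexive (trans (*-identityʳ (F j)) (trans (cong F (sym (+-identityʳ j))) (sym (*-identityˡ _))))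
    F-slope j (suc x) = subst (λ z → F j * (H * (1 + q)) ^ suc x ≤ ((1 + H) * q) ^ suc x * F z) (sym (+-suc j x))
      (arith (F j) (H * (1 + q)) ((H * (1 + q)) ^ x) ((1 + H) * q) (((1 + H) * q) ^ x) (F (j + x)) (F (suc (j + x))) (F-slope j x) (F-slow′ (j + x)))
      where
      arith : ∀ f a p b r g g′ → f * p ≤ r * g → g * a ≤ b * g′ → f * (a * p) ≤ b * r * g′
      arith f a p b r g g′ h k = by≤ 0 (a ⊛ h ⊕ r ⊛ k) (solve (f ∷ a ∷ p ∷ b ∷ r ∷ g ∷ g′ ∷ []))

    -- one step gains a factor 1 + 1/q on the trivial slope 1, hence h steps gain 1 + 1/(4k)
    step-gain : (1 + 4 * k) * q ^ h ≤ 4 * k * (1 + q) ^ h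
    step-gain = cancelˡ q 1≤q (arith k h q (q ^ h) ((1 + q) ^ h) q≤ (bernoulli q h))
      where
      q≤ : q ≤ 4 * k * h
      q≤ = case ≤⇒+ 1≤h of λ (o , e) → ≤-trans (+-monoʳ-≤ (k * H) (m∸n≤m k 1)) (subst (λ h → k * (2 * h) + k ≤ 4 * k * h) (sym e) (ar k o))
        where
        ar : ∀ k o → k * (2 * (1 + o)) + k ≤ 4 * k * (1 + o)
        ar k o = by≤ (k + 2 * k * o) (≤-refl {0}) (solve (k ∷ o ∷ []))
      arith : ∀ k h q a b → q ≤ 4 * k * h → a * (q + h) ≤ b * q → q * ((1 + 4 * k) * a) ≤ q * (4 * k * b)
      arith k h q a b g l = by≤ 0 ((4 * k) ⊛ l ⊕ a ⊛ g) (solve (k ∷ h ∷ q ∷ a ∷ b ∷ []))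

    gain : ∀ i x → i * h ≤ x → (1 + 4 * k) ^ i * q ^ x ≤ (4 * k) ^ i * (1 + q) ^ x
    gain zero    x _ = ≤-trans (≤-reflexive (*-identityˡ _)) (≤-trans (^-monoˡ-≤ x (n≤1+n q)) (≤-reflexive (sym (*-identityˡ _))))
    gain (suc i) x l = case ≤⇒+ (≤-trans (m≤m+n h (i * h)) l) of λ (o , e) → go o e
      where
      go : ∀ o → x ≡ h + o → _
      go o refl = begin
        (1 + 4 * k) * (1 + 4 * k) ^ i * q ^ (h + o) ≡⟨ cong ((1 + 4 * k) * (1 + 4 * k) ^ i *_) (^-distribˡ-+-* q h o) ⟩
        (1 + 4 * k) * (1 + 4 * k) ^ i * (q ^ h * q ^ o) ≡⟨ sw (1 + 4 * k) ((1 + 4 * k) ^ i) (q ^ h) (q ^ o) ⟩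
        (1 + 4 * k) * q ^ h * ((1 + 4 * k) ^ i * q ^ o) ≤⟨ *-mono-≤ step-gain (gain i o (+-cancelˡ-≤ h _ _ l)) ⟩
        4 * k * (1 + q) ^ h * ((4 * k) ^ i * (1 + q) ^ o) ≡⟨ sw (4 * k) ((4 * k) ^ i) ((1 + q) ^ h) ((1 + q) ^ o) ⟨
        4 * k * (4 * k) ^ i * ((1 + q) ^ h * (1 + q) ^ o) ≡⟨ cong (4 * k * (4 * k) ^ i *_) (^-distribˡ-+-* (1 + q) h o) ⟨
        4 * k * (4 * k) ^ i * (1 + q) ^ (h + o) ∎
        where
        open ≤-Reasoning
        sw : ∀ a b c d → a * b * (c * d) ≡ a * c * (b * d)
        sw a b c d = solve (a ∷ b ∷ c ∷ d ∷ [])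

    F-gain : ∀ i j g → 1 ≤ g → i * h ≤ glog g + 1 → F j * (1 + 4 * k) ^ i ≤ 2 * g * (4 * k) ^ i * F (j + (glog g + 1))
    F-gain i j g 1≤g ih≤ = cancelˡ (H ^ x * q ^ x) (pos-* (pos-^ x 1≤H) (pos-^ x 1≤q))
      (arith (F j) (F (j + x)) (H ^ x) (q ^ x) ((1 + q) ^ x) ((1 + 4 * k) ^ i) ((4 * k) ^ i) g ((1 + H) ^ x)
        (subst₂ (λ u v → F j * u ≤ v * F (j + x)) (^-distribʳ-* H (1 + q) x) (^-distribʳ-* (1 + H) q x) (F-slope j x))
        (gain i x ih≤) (base-power g 1≤g))
      where
      x = glog g + 1
      arith : ∀ f f′ h q q′ a b g h′ → f * (h * q′) ≤ h′ * q * f′ → a * q ≤ b * q′ → h′ ≤ 2 * g * h →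
              h * q * (f * a) ≤ h * q * (2 * g * b * f′)
      arith f f′ h q q′ a b g h′ l₁ l₂ l₃ = by≤ 0 (b ⊛ l₁ ⊕ (f * h) ⊛ l₂ ⊕ (b * q * f′) ⊛ l₃) (solve (f ∷ f′ ∷ h ∷ q ∷ q′ ∷ a ∷ b ∷ g ∷ h′ ∷ []))

    V : ℕ → ℕ
    V m = F (glog m)

    V-antitone : ∀ {m m′} → m ≤ m′ → V m′ ≤ V m
    V-antitone {zero} {m′} h = F-dec {0} {glog m′} z≤n
    V-antitone {suc m} h = F-dec (glog-mono (s≤s z≤n) h)

    -- `V` falls more slowly than 1/g by the factor (1 + 1/(4k))^i, a power of g when i is log₂ g.
    -- This saving makes the sum over common divisors converge.
    V-gain : ∀ i m g → 1 ≤ m → 2 ^ i ≤ g → V m * (1 + 4 * k) ^ i ≤ 2 * g * (4 * k) ^ i * V (g * m)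
    V-gain i m g 1≤m h≤ = ≤-trans (F-gain i (glog m) g 1≤g (≤-trans (glog-2^ i) (≤-trans (glog-mono (pos-^ i (s≤s z≤n)) h≤) (m≤m+n _ 1))))
      ((2 * g * (4 * k) ^ i) ⊛ F-dec (≤-trans (glog-≤+ g m 1≤g 1≤m) (≤-reflexive (ar (glog g) (glog m)))))
      where
      1≤g : 1 ≤ g
      1≤g = ≤-trans (pos-^ i (s≤s z≤n)) h≤
      ar : ∀ a b → a + b + 1 ≡ b + (a + 1)
      ar a b = solve (a ∷ b ∷ [])

    V-scale : ∀ m g → 1 ≤ m → 1 ≤ g → V m ≤ 2 * g * V (g * m)
    V-scale m g 1≤m 1≤g = subst₂ _≤_ (*-identityʳ (V m)) (cong (_* V (g * m)) (*-identityʳ (2 * g))) (V-gain 0 m g 1≤m 1≤g)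

    -- `F-corr` at the logarithms of a and b; two factors D/M pay for the two roundings of `glog` at
    -- abm.
    V-product : ∀ a b m → 1 ≤ a → 1 ≤ b → 1 ≤ m →
      V (a * m) * V (b * m) * ((M ∸ glog a * glog b) * M) ≤ D * D * (V m * V (a * (b * m)))
    V-product a b m 1≤a 1≤b 1≤m = cancelˡ M 1≤M (arith M D (M ∸ la * lb) (V (a * m)) (V (b * m)) (F (lm + la)) (F (lm + lb)) (F lm) (F (lm + la + lb)) (V (a * (b * m)))
        (F-dec (≤-trans (≤-reflexive (+-comm lm la)) (glog-+≤ a m 1≤a 1≤m)))
        (F-dec (≤-trans (≤-reflexive (+-comm lm lb)) (glog-+≤ b m 1≤b 1≤m)))
        (F-corr lm la lb) two)
      where
      la = glog a
      lb = glog b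
      lm = glog m
      arith : ∀ M D K v w v′ w′ f g z → v ≤ v′ → w ≤ w′ → v′ * w′ * K ≤ M * (f * g) → g * M * M ≤ D * D * z →
        M * (v * w * (K * M)) ≤ M * (D * D * (f * z))
      arith M D K v w v′ w′ f g z l₁ l₂ l₃ l₄ = ≤-trans (M ⊛ *-monoˡ-≤ (K * M) (*-mono-≤ l₁ l₂)) core
        where
        core : M * (v′ * w′ * (K * M)) ≤ M * (D * D * (f * z))
        core = by≤ 0 ((M * M) ⊛ l₃ ⊕ (M * f) ⊛ l₄) (solve (M ∷ D ∷ K ∷ v′ ∷ w′ ∷ f ∷ g ∷ z ∷ []))
      two : F (lm + la + lb) * M * M ≤ D * D * V (a * (b * m))
      two = ≤-trans (arith₂ M D (F (lm + la + lb)) (F (suc (lm + la + lb))) (F (suc (suc (lm + la + lb)))) (F-slow _) (F-slow _))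
        ((D * D) ⊛ F-dec (≤-trans (glog-≤+ a (b * m) 1≤a (pos-* 1≤b 1≤m)) (≤-trans (+-monoˡ-≤ 1 (+-monoʳ-≤ la (glog-≤+ b m 1≤b 1≤m))) (≤-reflexive (ar la lb lm)))))
        where
        arith₂ : ∀ M D f g h → f * M ≤ g * D → g * M ≤ h * D → f * M * M ≤ D * D * h
        arith₂ M D f g h l₁ l₂ = by≤ 0 (M ⊛ l₁ ⊕ D ⊛ l₂) (solve (M ∷ D ∷ f ∷ g ∷ h ∷ []))
        ar : ∀ la lb lm → la + (lb + lm + 1) + 1 ≡ suc (suc (lm + la + lb))
        ar la lb lm = solve (la ∷ lb ∷ lm ∷ [])

    F-flat : ∀ j → j ≤ j₀ → F j ≡ F 0
    F-flat zero    _ = refl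
    F-flat (suc j) h = trans (*-cancelʳ-≡ (F (suc j)) (F j) D {{pos 1≤D}} (trans (F-step j) (cong (λ z → F j * (D ∸ z))
        (trans (cong (λ z → ⟦ j <? T ⟧ * (z ⊓ emax)) (m≤n⇒m∸n≡0 (<⇒≤ h))) (*-zeroʳ ⟦ j <? T ⟧))))) (F-flat j (<⇒≤ h))

    F-ratio : ∀ a a′ g → 1 ≤ g → a′ ≤ a + (glog g + 1) → F a ≤ 2 * g * F a′
    F-ratio a a′ g 1≤g h = ≤-trans (subst₂ _≤_ (*-identityʳ (F a)) (cong (_* F (a + (glog g + 1))) (*-identityʳ (2 * g))) (F-gain 0 a g 1≤g z≤n))
      ((2 * g) ⊛ F-dec h)

    -- Two steps are taken because at `j₀` itself the slope is still 0; at the second one it is at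
    -- least 1/D.
    F-drop : ∀ a → 2 ≤ k → j₀ ≤ a → suc a < T → D * F (2 + a) + F a ≤ D * F a
    F-drop a 2≤k j₀≤a a<T = arith D (e (suc a)) (F a) (F (1 + a)) (F (2 + a)) 1≤e (≤-trans (e≤emax (suc a)) (m≤n+m emax M)) (F-step (suc a)) (F-dec₁ a)
      where
      1≤e : 1 ≤ e (suc a)
      1≤e = ≤-trans (⊓-glb (m<n⇒0<n∸m (s≤s j₀≤a)) (pos-* 1≤t (∸-monoˡ-≤ 1 2≤k))) (≤-reflexive (sym (trans (cong (_* ((suc a ∸ j₀) ⊓ emax)) (⟦⟧-yes (suc a <? T) a<T)) (*-identityˡ _))))
      arith : ∀ D e f f₁ f₂ → 1 ≤ e → e ≤ D → f₂ * D ≡ f₁ * (D ∸ e) → f₁ ≤ f → D * f₂ + f ≤ D * f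
      arith D e f f₁ f₂ 1≤e e≤D h g = go (≤⇒+ e≤D)
        where
        go : (∃ λ o → D ≡ e + o) → D * f₂ + f ≤ D * f
        go (o , refl) = core (trans h (cong (f₁ *_) (m+n∸m≡n e o)))
          where
          core : f₂ * (e + o) ≡ f₁ * o → (e + o) * f₂ + f ≤ (e + o) * f
          core h = by≤ 0 (≤-reflexive h ⊕ o ⊛ g ⊕ f ⊛ 1≤e) (solve (e ∷ o ∷ f ∷ f₁ ∷ f₂ ∷ []))

    F-steep : ∀ j x → j₀ + emax ≤ j → j + x ≤ T → F (j + x) * q ^ x ≤ F j * (k * H) ^ x
    F-steep j zero    _ _ = ≤-reflexive (cong (λ z → F z * 1) (+-identityʳ j))
    F-steep j (suc x) h l = subst (λ z → F z * q ^ suc x ≤ F j * (k * H) ^ suc x) (sym (+-suc j x))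
        (arith (F (j + x)) (F (suc (j + x))) (F j) q (q ^ x) (k * H) ((k * H) ^ x) one (F-steep j x h (<⇒≤ l′)))
      where
      l′ : j + x < T
      l′ = subst (_≤ T) (+-suc j x) l
      e≡ : e (j + x) ≡ emax
      e≡ = trans (cong (_* ((j + x ∸ j₀) ⊓ emax)) (⟦⟧-yes (j + x <? T) l′)) (trans (*-identityˡ _)
             (m≥n⇒m⊓n≡n (m+n≤o⇒n≤o∸m′ (≤-trans h (m≤m+n j x)))))
        where
        m+n≤o⇒n≤o∸m′ : ∀ {o} → j₀ + emax ≤ o → emax ≤ o ∸ j₀
        m+n≤o⇒n≤o∸m′ {o} h = ≤-trans (≤-reflexive (sym (m+n∸m≡n j₀ emax))) (∸-monoˡ-≤ j₀ h)
      one : F (suc (j + x)) * q ≡ F (j + x) * (k * H)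
      one = *-cancelˡ-≡ _ _ t {{pos 1≤t}} (trans (ar t (F (suc (j + x))) k H (k ∸ 1)) (trans (F-step (j + x))
        (trans (cong (λ z → F (j + x) * z) (trans (cong (D ∸_) e≡) (m+n∸n≡m M emax))) (ar₂ (F (j + x)) t (k * H)))))
        where
        ar : ∀ t f k H k′ → t * (f * (k * H + k′)) ≡ f * (t * (k * H) + t * k′)
        ar t f k H k′ = solve (t ∷ f ∷ k ∷ H ∷ k′ ∷ [])
        ar₂ : ∀ f t z → f * (t * z) ≡ t * (f * z)
        ar₂ f t z = solve (f ∷ t ∷ z ∷ [])
      arith : ∀ a b c q qx m mx → b * q ≡ a * m → a * qx ≤ c * mx → b * (q * qx) ≤ c * (m * mx)
      arith a b c q qx m mx h g = by≤ 0 (qx ⊛ ≤-reflexive h ⊕ m ⊛ g) (solve (a ∷ b ∷ c ∷ q ∷ qx ∷ m ∷ mx ∷ []))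

    -- The bend needs `emax` steps to reach the full slope; the decay over these steps is given
    -- away.
    F-decay : ∀ j x → j₀ ≤ j → j + x ≤ T → F (j + x) * q ^ (x ∸ emax) ≤ F j * (k * H) ^ (x ∸ emax)
    F-decay j x h l with emax ≤? x
    ... | no ¬p = subst (λ z → F (j + x) * q ^ z ≤ F j * (k * H) ^ z) (sym (m≤n⇒m∸n≡0 (<⇒≤ (≰⇒> ¬p)))) (*-monoˡ-≤ 1 (F-dec (m≤m+n j x)))
    ... | yes p = ≤-trans (subst (λ z → F z * q ^ (x ∸ emax) ≤ F (j + emax) * (k * H) ^ (x ∸ emax)) eq
          (F-steep (j + emax) (x ∸ emax) (+-monoˡ-≤ emax h) (≤-trans (≤-reflexive eq) l))) (*-monoˡ-≤ ((k * H) ^ (x ∸ emax)) (F-dec (m≤m+n j emax)))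
      where
      eq : j + emax + (x ∸ emax) ≡ j + x
      eq = trans (+-assoc j emax _) (cong (j +_) (m+[n∸m]≡n p))

    q-double : (1 + q) ^ (k * h) ≤ 2 * q ^ (k * h)
    q-double = cancelˡ r 1≤r (≤-trans (≤-reflexive (*-comm r _)) (≤-trans (subst (λ z → (1 + z) ^ n * r ≤ z ^ n * z) (sym q≡) (bernoulli′ n r))
        (≤-trans ((q ^ n) ⊛ ≤-trans (≤-reflexive q≡) (+-monoˡ-≤ r (m≤m+n n (k ∸ 1)))) (≤-reflexive (ar₃ (q ^ n) r)))))
      where
      n = k * h
      r = n + (k ∸ 1)
      1≤r : 1 ≤ r
      1≤r = ≤-trans (pos-* 1≤k 1≤h) (m≤m+n n _)
      q≡ : q ≡ n + r
      q≡ = ar₂ k h (k ∸ 1)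
        where
        ar₂ : ∀ k h k′ → k * (2 * h) + k′ ≡ k * h + (k * h + k′)
        ar₂ k h k′ = solve (k ∷ h ∷ k′ ∷ [])
      ar₃ : ∀ a r → a * (r + r) ≡ r * (2 * a)
      ar₃ a r = solve (a ∷ r ∷ [])

    q-power : ∀ u x → x ≤ k * h * u → (1 + q) ^ x ≤ 2 ^ u * q ^ x
    q-power u x l = cancelˡ (q ^ (n ∸ x)) (pos-^ (n ∸ x) 1≤q) (begin
        q ^ (n ∸ x) * (1 + q) ^ x             ≤⟨ *-monoˡ-≤ _ (^-monoˡ-≤ (n ∸ x) (n≤1+n q)) ⟩
        (1 + q) ^ (n ∸ x) * (1 + q) ^ x       ≡⟨ trans (sym (^-distribˡ-+-* (1 + q) (n ∸ x) x)) (cong ((1 + q) ^_) (m∸n+n≡m l)) ⟩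
        (1 + q) ^ n                           ≡⟨ ^-*-assoc (1 + q) (k * h) u ⟨
        ((1 + q) ^ (k * h)) ^ u               ≤⟨ ^-monoˡ-≤ u q-double ⟩
        (2 * q ^ (k * h)) ^ u                 ≡⟨ trans (^-distribʳ-* 2 (q ^ (k * h)) u) (cong (2 ^ u *_) (^-*-assoc q (k * h) u)) ⟩
        2 ^ u * q ^ n                         ≡⟨ cong (2 ^ u *_) (trans (cong (q ^_) (sym (m∸n+n≡m l))) (^-distribˡ-+-* q (n ∸ x) x)) ⟩
        2 ^ u * (q ^ (n ∸ x) * q ^ x)         ≡⟨ ar (2 ^ u) (q ^ (n ∸ x)) (q ^ x) ⟩
        q ^ (n ∸ x) * (2 ^ u * q ^ x)         ∎)
      where
      open ≤-Reasoning
      n = k * h * u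
      ar : ∀ a b c → a * (b * c) ≡ b * (a * c)
      ar a b c = solve (a ∷ b ∷ c ∷ [])

-- The multipliers `r i` and the correlations of their divisibility.

n<2^n : ∀ n → n < 2 ^ n
n<2^n zero    = s≤s z≤n
n<2^n (suc n) = ≤-trans (+-mono-≤ (pos-^ n (s≤s z≤n)) (n<2^n n)) (+-monoʳ-≤ (2 ^ n) (m≤m+n (2 ^ n) 0))

-- the binary logarithm, with lg 0 = 0
lg : ℕ → ℕ
lg zero      = 0
lg n@(suc _) = proj₁ (search (λ j → 2 ^ j ≤? n) n (s≤s z≤n) (<⇒≱ (n<2^n n)))

2^lg : ∀ n → 1 ≤ n → 2 ^ lg n ≤ n
2^lg n@(suc _) _ = proj₁ (proj₂ (search (λ j → 2 ^ j ≤? n) n (s≤s z≤n) (<⇒≱ (n<2^n n))))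

<2^1+lg : ∀ n → n < 2 ^ suc (lg n)
<2^1+lg zero      = s≤s z≤n
<2^1+lg n@(suc _) = ≰⇒> (proj₂ (proj₂ (search (λ j → 2 ^ j ≤? n) n (s≤s z≤n) (<⇒≱ (n<2^n n)))))

2^-cancel-< : ∀ {i j} → 2 ^ i < 2 ^ j → i < j
2^-cancel-< {i} {j} h = ≰⇒> λ j≤i → <⇒≱ h (^-monoʳ-≤ 2 j≤i)

lg-≥ : ∀ {i n} → 2 ^ i ≤ n → i ≤ lg n
lg-≥ {i} {n} h = ≤-pred (2^-cancel-< (≤-<-trans h (<2^1+lg n)))

∑-atmost : ∀ n B f → (∀ i → i < n → f i ≤ B) → (∀ i j → i < j → j < n → 0 < f i → f j ≡ 0) → ∑ n f ≤ B
∑-atmost n B f f≤B h = go n ≤-refl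
  where
  go : ∀ m → m ≤ n → ∑ m f ≤ B
  go zero    _ = z≤n
  go (suc m) m<n = cases (f m) refl
    where
    cases : ∀ v → f m ≡ v → ∑ m f + f m ≤ B
    cases zero    e = ≤-trans (≤-reflexive (trans (cong (∑ m f +_) e) (+-identityʳ _))) (go m (<⇒≤ m<n))
    cases (suc v) e = ≤-trans (≤-reflexive (cong (_+ f m) (∑-zero m (λ i i<m → n<1⇒n≡0 (≰⇒> λ fi>0 →
      1+n≢0 (trans (sym e) (h i m i<m m<n fi>0))))))) (f≤B m m<n)

module Geometric (s J : ℕ) where

  -- (s/(1 + s))^l scaled by (1 + s)^J. With s = 4k it is the saving of `V-gain`.
  G : ℕ → ℕ
  G l = s ^ l * (1 + s) ^ (J ∸ l)

  G-step : ∀ l → l < J → (1 + s) * G (suc l) ≡ s * G l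
  G-step l l<J = trans (ar s (s ^ l) ((1 + s) ^ (J ∸ suc l))) (cong (λ z → s * (s ^ l * (1 + s) ^ z)) (sym (+-∸-assoc 1 l<J)))
    where
    ar : ∀ s a b → (1 + s) * (s * a * b) ≡ s * (a * ((1 + s) * b))
    ar s a b = solve (s ∷ a ∷ b ∷ [])

  G-dec₁ : ∀ l → l < J → G (suc l) ≤ G l
  G-dec₁ l l<J = cancelˡ (1 + s) (s≤s z≤n) (≤-trans (≤-reflexive (G-step l l<J)) (*-monoˡ-≤ (G l) (n≤1+n s)))

  G-dec : ∀ {i j} → i ≤ j → j ≤ J → G j ≤ G i
  G-dec {i} h with ≤⇒+ h
  ... | o , refl = go o
    where
    go : ∀ o → i + o ≤ J → G (i + o) ≤ G i
    go zero    _ = ≤-reflexive (cong G (+-identityʳ i))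
    go (suc o) l = ≤-trans (≤-reflexive (cong G (+-suc i o))) (≤-trans (G-dec₁ (i + o) l′) (go o (<⇒≤ l′)))
      where
      l′ : i + o < J
      l′ = subst (_≤ J) (+-suc i o) l

  G-sum : ∀ b n → b ≤ n → n ≤ J → ∑ n (λ l → ⟦ b ≤? l ⟧ * G l) + (1 + s) * G n ≤ (1 + s) * G b
  G-sum b n h with ≤⇒+ h
  ... | o , refl = go o
    where
    go : ∀ o → b + o ≤ J → ∑ (b + o) (λ l → ⟦ b ≤? l ⟧ * G l) + (1 + s) * G (b + o) ≤ (1 + s) * G b
    go zero    _ rewrite +-identityʳ b = ≤-reflexive (cong (_+ (1 + s) * G b) (∑-zero b (λ l l<b → cong (_* G l) (⟦⟧-no (b ≤? l) (<⇒≱ l<b)))))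
    go (suc o) l rewrite +-suc b o = ≤-trans (≤-reflexive (trans
        (cong₂ _+_ (cong (λ z → ∑ (b + o) (λ l → ⟦ b ≤? l ⟧ * G l) + z * G (b + o)) (⟦⟧-yes (b ≤? b + o) (m≤m+n b o))) (G-step (b + o) l))
        (ar (∑ (b + o) (λ l → ⟦ b ≤? l ⟧ * G l)) (G (b + o)) s))) (go o (<⇒≤ l))
      where
      ar : ∀ x g s → x + 1 * g + s * g ≡ x + (1 + s) * g
      ar x g s = solve (x ∷ g ∷ s ∷ [])

  G-power : ∀ b c → b ≤ J → c * s ^ b ≤ (1 + s) ^ b → c * G b ≤ (1 + s) ^ J
  G-power b c b≤J h = begin
    c * (s ^ b * (1 + s) ^ (J ∸ b))       ≡⟨ *-assoc c _ _ ⟨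
    c * s ^ b * (1 + s) ^ (J ∸ b)         ≤⟨ *-monoˡ-≤ _ h ⟩
    (1 + s) ^ b * (1 + s) ^ (J ∸ b)       ≡⟨ ^-distribˡ-+-* (1 + s) b (J ∸ b) ⟨
    (1 + s) ^ (b + (J ∸ b))               ≡⟨ cong ((1 + s) ^_) (m+[n∸m]≡n b≤J) ⟩
    (1 + s) ^ J                           ∎
    where open ≤-Reasoning

module Pool (w d : ℕ) (1≤d : 1 ≤ d) where

  Q₀ R R₂ : ℕ
  Q₀ = w !
  R = Q₀ * d
  R₂ = 2 * R

  1≤R : 1 ≤ R
  1≤R = pos-* (1≤n! w) 1≤d

  -- Being coprime to w!, these numbers have no divisor between 2 and w. The offset `d` keeps them
  -- between R and 2R.
  r : ℕ → ℕ
  r i = 1 + Q₀ * (d + i)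

  R≤r : ∀ i → R ≤ r i
  R≤r i = m≤n⇒m≤1+n (Q₀ ⊛ m≤m+n d i)

  r≤R₂ : ∀ i → i < d → r i ≤ R₂
  r≤R₂ i i<d = arith Q₀ d i (1≤n! w) i<d
    where
    arith : ∀ Q d i → 1 ≤ Q → i < d → 1 + Q * (d + i) ≤ 2 * (Q * d)
    arith Q d i h g = by≤ 0 (Q ⊛ g ⊕ h) (solve (Q ∷ d ∷ i ∷ []))

  -- `cof i j` is `r j` divided by the gcd, so `r i * cof i j` is the least common multiple.
  gᵢⱼ cof : ℕ → ℕ → ℕ
  gᵢⱼ i j = gcd (r i) (r j)
  cof i j = quotient (gcd[m,n]∣n (r i) (r j))

  cof-eq : ∀ i j → r j ≡ cof i j * gᵢⱼ i j
  cof-eq i j = _∣_.equality (gcd[m,n]∣n (r i) (r j))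

  cof-eq′ : ∀ i j → r i ≡ cof j i * gᵢⱼ i j
  cof-eq′ i j = trans (cof-eq j i) (cong (cof j i *_) (gcd-comm (r j) (r i)))

  1≤cof×g : ∀ i j → 1 ≤ cof i j × 1 ≤ gᵢⱼ i j
  1≤cof×g i j = ⊗>0 {cof i j} (subst (1 ≤_) (cof-eq i j) (s≤s z≤n))

  cof≤R₂ : ∀ i j → j < d → cof i j ≤ R₂
  cof≤R₂ i j j<d = ≤-trans (≤-trans (m≤m*n (cof i j) (gᵢⱼ i j) {{pos (proj₂ (1≤cof×g i j))}}) (≤-reflexive (sym (cof-eq i j)))) (r≤R₂ j j<d)

  cof-coprime : ∀ i j → Coprime (cof i j) (cof j i)
  cof-coprime i j = gcd≡1⇒coprime (*-cancelˡ-≡ _ 1 g {{pos 1≤g}} (begin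
    g * gcd (cof i j) (cof j i)        ≡⟨ c*gcd[m,n]≡gcd[cm,cn] g (cof i j) (cof j i) ⟩
    gcd (g * cof i j) (g * cof j i)    ≡⟨ cong₂ gcd (trans (*-comm g _) (sym (cof-eq i j))) (trans (*-comm g _) (sym (cof-eq′ i j))) ⟩
    gcd (r j) (r i)                    ≡⟨ gcd-comm (r j) (r i) ⟩
    g                                  ≡⟨ *-identityʳ g ⟨
    g * 1                              ∎))
    where
    open ≡-Reasoning
    g = gᵢⱼ i j
    1≤g = proj₂ (1≤cof×g i j)

  common : ∀ i j m₁ m₂ → r i * m₁ ≡ r j * m₂ → ∃ λ m → m₁ ≡ cof i j * m × m₂ ≡ cof j i * m
  common i j m₁ m₂ e = case coprime-divisor (cof-coprime i j) (divides m₂ (trans reduced (*-comm (cof i j) m₂))) of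
      λ { (divides m eq) → m , trans eq (*-comm m _) , *-cancelˡ-≡ m₂ _ (cof i j) {{pos (proj₁ (1≤cof×g i j))}}
            (trans (sym reduced) (trans (cong (cof j i *_) eq) (ar (cof j i) m (cof i j)))) }
    where
    ar : ∀ a m b → a * (m * b) ≡ b * (a * m)
    ar a m b = solve (a ∷ m ∷ b ∷ [])
    ar₂ : ∀ a g m → g * (a * m) ≡ a * g * m
    ar₂ a g m = solve (a ∷ g ∷ m ∷ [])
    reduced : cof j i * m₁ ≡ cof i j * m₂
    reduced = *-cancelˡ-≡ _ _ (gᵢⱼ i j) {{pos (proj₂ (1≤cof×g i j))}} (trans (ar₂ (cof j i) (gᵢⱼ i j) m₁)
      (trans (cong (_* m₁) (sym (cof-eq′ i j))) (trans e (trans (cong (_* m₂) (cof-eq i j)) (sym (ar₂ (cof i j) (gᵢⱼ i j) m₂))))))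

  divisor-large : ∀ i g → g ∣ r i → g ≡ 1 ⊎ w < g
  divisor-large i g g∣r with g ≤? w
  ... | no h = inj₂ (≰⇒> h)
  ... | yes h = inj₁ (∣1⇒≡1 (∣m+n∣m⇒∣n (subst (g ∣_) (+-comm 1 _) g∣r) (∣-trans (∣! (1≤g g g∣r) h) (m∣m*n (d + i)))))
    where
    1≤g : ∀ g → g ∣ r i → 1 ≤ g
    1≤g zero    p = ⊥-elim (1+n≢0 (0∣⇒≡0 p))
    1≤g (suc g) _ = s≤s z≤n

  divisor-coprime : ∀ i g → g ∣ r i → Coprime g Q₀
  divisor-coprime i g g∣r {c} (c∣g , c∣Q) = ∣1⇒≡1 (∣m+n∣m⇒∣n (subst (c ∣_) (+-comm 1 _) (∣-trans c∣g g∣r)) (∣-trans c∣Q (m∣m*n (d + i))))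

  divisor-gap : ∀ i o g → g ∣ r i → g ∣ r (i + o) → g ∣ o
  divisor-gap i o g p q = coprime-divisor (divisor-coprime i g p) (∣m+n∣m⇒∣n (subst (g ∣_) (ar Q₀ d i o) q) p)
    where
    ar : ∀ Q d i o → 1 + Q * (d + (i + o)) ≡ 1 + Q * (d + i) + Q * o
    ar Q d i o = solve (Q ∷ d ∷ i ∷ o ∷ [])

  count : ℕ → ℕ
  count γ = ∑ d (λ i → ⟦ γ ∣? r i ⟧)

  -- A common divisor γ of two of the numbers is coprime to w!, hence divides the difference of
  -- their indices. So γ consecutive indices contain at most one i with γ ∣ r i.
  count-bound : ∀ γ → 1 ≤ γ → count γ * γ ≤ d + γ
  count-bound γ 1≤γ = case ceil d of λ (u , d≤ , ≤dγ) → ≤-trans (*-monoˡ-≤ γ (≤-trans (∑-≤ (λ i → ⟦ γ ∣? r i ⟧) d≤) (windows u))) ≤dγ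
    where
    ceil : ∀ d → ∃ λ u → d ≤ u * γ × u * γ ≤ d + γ
    ceil zero = 0 , z≤n , z≤n
    ceil (suc d) with ceil d
    ... | u , a , b with suc d ≤? u * γ
    ...   | yes p = u , p , m≤n⇒m≤1+n b
    ...   | no ¬p = suc u , ≤-trans (≤-trans (≤-reflexive (+-comm 1 d)) (+-mono-≤ a 1≤γ)) (≤-reflexive (+-comm (u * γ) γ)) ,
                    ≤-trans (≤-reflexive (+-comm γ (u * γ))) (+-monoˡ-≤ γ (<⇒≤ (≰⇒> ¬p)))
    one : ∀ u → ∑ γ (λ j → ⟦ γ ∣? r (u * γ + j) ⟧) ≤ 1
    one u = ∑-atmost γ 1 _ (λ j _ → ⟦⟧≤1 (γ ∣? r (u * γ + j))) (λ i j i<j j<γ fi>0 → ⟦⟧-no (γ ∣? r (u * γ + j)) (λ γ∣ → clash i j i<j j<γ (⟦⟧>0 (γ ∣? r (u * γ + i)) fi>0) γ∣))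
      where
      clash : ∀ i j → i < j → j < γ → γ ∣ r (u * γ + i) → γ ∣ r (u * γ + j) → ⊥
      clash i j i<j j<γ p q with ≤⇒+ i<j
      ... | o , refl = <⇒≱ (≤-<-trans (m≤n+m (suc o) i) (subst (_< γ) (sym (+-suc i o)) j<γ)) (∣⇒≤ (divisor-gap (u * γ + i) (suc o) γ p (subst (λ z → γ ∣ r z) (ar (u * γ) i o) q)))
        where
        ar : ∀ a i o → a + (suc i + o) ≡ a + i + suc o
        ar a i o = solve (a ∷ i ∷ o ∷ [])
    windows : ∀ u → ∑ (u * γ) (λ i → ⟦ γ ∣? r i ⟧) ≤ u
    windows u = ≤-trans (≤-reflexive (∑-windows u γ _)) (≤-trans (∑-bounded u 1 _ (λ i _ → one i)) (≤-reflexive (*-identityʳ u)))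

lg-unique : ∀ l t → t < 2 ^ l → lg (2 ^ l + t) ≡ l
lg-unique l t t< = ≤-antisym
  (≤-pred (2^-cancel-< (≤-<-trans (2^lg (2 ^ l + t) (≤-trans (pos-^ l (s≤s z≤n)) (m≤m+n _ t))) (<-≤-trans (+-monoʳ-< (2 ^ l) t<) (+-monoʳ-≤ (2 ^ l) (≤-reflexive (sym (+-identityʳ _))))))))
  (lg-≥ (m≤m+n (2 ^ l) t))

module PoolSum (w d : ℕ) (1≤d : 1 ≤ d) (s e b l₀ : ℕ) (2^b≤w : 2 ^ b ≤ w) (2^l₀≤d : 2 ^ l₀ ≤ d) (b≤d : b ≤ d)
  (cond₁ : 2 * (2 * e + 1) * 18 * (1 + s) * s ^ b ≤ (1 + s) ^ b)
  (cond₂ : 2 * (2 * e + 1) * (4 * w !) * s ^ l₀ ≤ (1 + s) ^ l₀) where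

  open Pool w d 1≤d
  J = R₂
  open Geometric s J

  -- For s = 4k, `V-gain` bounds V(m)/V(gm) by κ g / (1 + s)^J.
  κ : ℕ → ℕ
  κ g = 2 * g * G (lg g)

  cost : ℕ → ℕ
  cost g with g ≟ 1
  ... | yes _ = (2 * e + 1) * (1 + s) ^ J
  ... | no  _ = (2 * e + 1) * κ g

  c : ℕ → ℕ → ℕ
  c i j = cost (gᵢⱼ i j)

  d≤R₂ : d ≤ R₂
  d≤R₂ = ≤-trans (m≤c*m d (1≤n! w)) (m≤m+n R (R + 0))

  block : ℕ → ℕ → ℕ → ℕ
  block i j l = ∑ (2 ^ l) (λ t → ⟦ 2 ^ l ≤? d ⟧ * (κ (2 ^ l + t) * (⟦ 2 ^ l + t ∣? r i ⟧ * ⟦ 2 ^ l + t ∣? r j ⟧)))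

  off : ℕ → ℕ → ℕ
  off i j = ∑ J (λ l → ⟦ b ≤? l ⟧ * block i j l)

  divisor-term : ∀ i j g → g ∣ r i → g ∣ r j → w < g → g ≤ d → κ g ≤ off i j
  divisor-term i j g p q w<g g≤d = begin
    κ g                     ≡⟨ cong κ g≡ ⟩
    κ (2 ^ l + t)           ≡⟨ sym (trans (cong₂ _*_ (⟦⟧-yes (2 ^ l ≤? d) (≤-trans (2^lg g 1≤g) g≤d)) (cong (κ (2 ^ l + t) *_)
                                 (cong₂ _*_ (⟦⟧-yes (2 ^ l + t ∣? r i) (subst (_∣ r i) g≡ p)) (⟦⟧-yes (2 ^ l + t ∣? r j) (subst (_∣ r j) g≡ q)))))
                                 (trans (*-identityˡ _) (*-identityʳ _))) ⟩
    term t                  ≤⟨ ∑-term (2 ^ l) term t<2^l ⟩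
    block i j l             ≡⟨ trans (cong (_* block i j l) (⟦⟧-yes (b ≤? l) (lg-≥ (≤-trans 2^b≤w (<⇒≤ w<g))))) (*-identityˡ _) ⟨
    ⟦ b ≤? l ⟧ * block i j l ≤⟨ ∑-term J (λ l → ⟦ b ≤? l ⟧ * block i j l) (<-≤-trans (n<2^n l) (≤-trans (2^lg g 1≤g) (≤-trans g≤d d≤R₂))) ⟩
    off i j                 ∎
    where
    open ≤-Reasoning
    1≤g : 1 ≤ g
    1≤g = ≤-trans (s≤s z≤n) w<g
    l = lg g
    t = g ∸ 2 ^ l
    term : ℕ → ℕ
    term t = ⟦ 2 ^ l ≤? d ⟧ * (κ (2 ^ l + t) * (⟦ 2 ^ l + t ∣? r i ⟧ * ⟦ 2 ^ l + t ∣? r j ⟧))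
    g≡ : g ≡ 2 ^ l + t
    g≡ = sym (m+[n∸m]≡n (2^lg g 1≤g))
    t<2^l : t < 2 ^ l
    t<2^l = +-cancelˡ-< (2 ^ l) t (2 ^ l) (subst₂ _<_ g≡ (cong (2 ^ l +_) (+-identityʳ (2 ^ l))) (<2^1+lg g))

  -- A gcd other than 1 exceeds w. For i ≠ j it also divides i - j, so it is at most d and lies in a
  -- dyadic block from `b` on; for i = j it is r i itself.
  c≤ : ∀ i j → i < d → j < d → c i j ≤ (2 * e + 1) * ((1 + s) ^ J + (⟦ i ≟ j ⟧ * κ (r j) + off i j))
  c≤ i j i<d j<d with gᵢⱼ i j ≟ 1
  ... | yes _ = (2 * e + 1) ⊛ m≤m+n _ _
  ... | no g≢1 = (2 * e + 1) ⊛ ≤-trans (main (<-cmp i j)) (m≤n+m _ ((1 + s) ^ J))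
    where
    g = gᵢⱼ i j
    g∣i : g ∣ r i
    g∣i = gcd[m,n]∣m (r i) (r j)
    g∣j : g ∣ r j
    g∣j = gcd[m,n]∣n (r i) (r j)
    w<g : w < g
    w<g = [ (λ e → ⊥-elim (g≢1 e)) , (λ h → h) ]′ (divisor-large i g g∣i)
    far : ∀ i j → j < d → i < j → g ∣ r i → g ∣ r j → g ≤ d
    far i j j<d i<j p q with ≤⇒+ i<j
    ... | o , refl = ≤-trans (∣⇒≤ (divisor-gap i (suc o) g p (subst (λ z → g ∣ r z) (sym (+-suc i o)) q)))
                       (≤-trans (≤-trans (m≤n+m (suc o) i) (≤-reflexive (+-suc i o))) (<⇒≤ j<d))
    main : Tri (i < j) (i ≡ j) (j < i) → κ g ≤ ⟦ i ≟ j ⟧ * κ (r j) + off i j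
    main (tri< i<j _ _) = ≤-trans (divisor-term i j g g∣i g∣j w<g (far i j j<d i<j g∣i g∣j)) (m≤n+m _ (⟦ i ≟ j ⟧ * κ (r j)))
    main (tri> _ _ j<i) = ≤-trans (divisor-term i j g g∣i g∣j w<g (far j i i<d j<i g∣j g∣i)) (m≤n+m _ (⟦ i ≟ j ⟧ * κ (r j)))
    main (tri≈ _ refl _) = ≤-trans (≤-reflexive (trans (cong κ (∣-antisym g∣i (gcd-greatest ∣-refl ∣-refl)))
        (sym (trans (cong (_* κ (r i)) (⟦⟧-yes (i ≟ i) refl)) (*-identityˡ _))))) (m≤m+n _ _)

  diagonal : ∑ d (λ i → ∑ d (λ j → ⟦ i ≟ j ⟧ * κ (r j))) ≤ d * (2 * R₂ * G l₀)
  diagonal = begin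
    ∑ d (λ i → ∑ d (λ j → ⟦ i ≟ j ⟧ * κ (r j))) ≡⟨ ∑-swap d d _ ⟩
    ∑ d (λ j → ∑ d (λ i → ⟦ i ≟ j ⟧ * κ (r j))) ≤⟨ ∑-mono d (λ j _ → ∑-delta≤ d (λ _ → κ (r j)) j) ⟩
    ∑ d (λ j → κ (r j))                         ≤⟨ ∑-bounded d _ _ (λ j j<d → *-mono-≤ (2 ⊛ r≤R₂ j j<d)
                                                     (G-dec (lg-≥ {l₀} (≤-trans 2^l₀≤d (≤-trans (m≤c*m d (1≤n! w)) (R≤r j)))) (≤-trans (lg≤ (r j)) (r≤R₂ j j<d)))) ⟩
    d * (2 * R₂ * G l₀)                         ∎
    where
    open ≤-Reasoning
    lg≤ : ∀ n → lg n ≤ n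
    lg≤ zero    = z≤n
    lg≤ (suc n) = <⇒≤ (<-≤-trans (n<2^n (lg (suc n))) (2^lg (suc n) (s≤s z≤n)))

  -- A number γ in the block of 2^l divides at most 3d/γ of the r i. Its pairs cost at most (3d/γ)²
  -- times 2γ G(l), and the 2^l ≤ γ numbers of the block together 18 d² G(l). The blocks form a
  -- geometric series from `b` on.
  off-sum : ∑ d (λ i → ∑ d (λ j → off i j)) ≤ 18 * (d * d) * ((1 + s) * G b)
  off-sum = begin
    ∑ d (λ i → ∑ d (λ j → off i j)) ≡⟨ ∑-ext d (λ i → ∑-swap d J _) ⟩
    ∑ d (λ i → ∑ J (λ l → ∑ d (λ j → ⟦ b ≤? l ⟧ * block i j l))) ≡⟨ ∑-swap d J _ ⟩
    ∑ J (λ l → ∑ d (λ i → ∑ d (λ j → ⟦ b ≤? l ⟧ * block i j l))) ≡⟨ ∑-ext J (λ l → trans (∑-ext d (λ i → ∑-*ˡ d ⟦ b ≤? l ⟧ _)) (∑-*ˡ d ⟦ b ≤? l ⟧ _)) ⟩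
    ∑ J (λ l → ⟦ b ≤? l ⟧ * ∑ d (λ i → ∑ d (λ j → block i j l))) ≤⟨ ∑-mono J (λ l _ → ⟦ b ≤? l ⟧ ⊛ per-block l) ⟩
    ∑ J (λ l → ⟦ b ≤? l ⟧ * (18 * (d * d) * G l)) ≡⟨ trans (∑-ext J (λ l → sw ⟦ b ≤? l ⟧ (18 * (d * d)) (G l))) (∑-*ˡ J (18 * (d * d)) _) ⟩
    18 * (d * d) * ∑ J (λ l → ⟦ b ≤? l ⟧ * G l) ≤⟨ (18 * (d * d)) ⊛ ≤-trans (m≤m+n _ _) (G-sum b J (≤-trans b≤d d≤R₂) ≤-refl) ⟩
    18 * (d * d) * ((1 + s) * G b) ∎
    where
    open ≤-Reasoning
    sw : ∀ a b c → a * (b * c) ≡ b * (a * c)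
    sw a b c = solve (a ∷ b ∷ c ∷ [])
    per-block : ∀ l → ∑ d (λ i → ∑ d (λ j → block i j l)) ≤ 18 * (d * d) * G l
    per-block l = cancelˡ (2 ^ l) (pos-^ l (s≤s z≤n)) (begin
      2 ^ l * ∑ d (λ i → ∑ d (λ j → block i j l)) ≡⟨ cong (2 ^ l *_) (trans (∑-ext d (λ i → ∑-swap d (2 ^ l) _)) (∑-swap d (2 ^ l) _)) ⟩
      2 ^ l * ∑ (2 ^ l) (λ t → ∑ d (λ i → ∑ d (λ j → ⟦ 2 ^ l ≤? d ⟧ * (κ (γ t) * (⟦ γ t ∣? r i ⟧ * ⟦ γ t ∣? r j ⟧))))) ≡⟨ cong (2 ^ l *_) (∑-ext (2 ^ l) (λ t → square t)) ⟩
      2 ^ l * ∑ (2 ^ l) (λ t → ⟦ 2 ^ l ≤? d ⟧ * (κ (γ t) * (count (γ t) * count (γ t)))) ≡⟨ ∑-*ˡ (2 ^ l) (2 ^ l) _ ⟨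
      ∑ (2 ^ l) (λ t → 2 ^ l * (⟦ 2 ^ l ≤? d ⟧ * (κ (γ t) * (count (γ t) * count (γ t))))) ≤⟨ ∑-bounded (2 ^ l) _ _ (λ t t< → ≤-trans (≤-reflexive (sw (2 ^ l) ⟦ 2 ^ l ≤? d ⟧ _)) (⟦⟧*≤ (2 ^ l ≤? d) (small t t<))) ⟩
      2 ^ l * (18 * (d * d) * G l) ∎)
      where
      γ : ℕ → ℕ
      γ t = 2 ^ l + t
      square : ∀ t → ∑ d (λ i → ∑ d (λ j → ⟦ 2 ^ l ≤? d ⟧ * (κ (γ t) * (⟦ γ t ∣? r i ⟧ * ⟦ γ t ∣? r j ⟧)))) ≡ ⟦ 2 ^ l ≤? d ⟧ * (κ (γ t) * (count (γ t) * count (γ t)))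
      square t = trans (∑-ext d (λ i → trans (∑-*ˡ d ⟦ 2 ^ l ≤? d ⟧ _) (cong (⟦ 2 ^ l ≤? d ⟧ *_) (trans (∑-*ˡ d (κ (γ t)) _) (cong (κ (γ t) *_) (∑-*ˡ d ⟦ γ t ∣? r i ⟧ _))))))
        (trans (∑-*ˡ d ⟦ 2 ^ l ≤? d ⟧ _) (cong (⟦ 2 ^ l ≤? d ⟧ *_) (trans (∑-*ˡ d (κ (γ t)) _) (cong (κ (γ t) *_) (∑-*ʳ d (count (γ t)) _)))))
      small : ∀ t → t < 2 ^ l → 2 ^ l ≤ d → 2 ^ l * (κ (γ t) * (count (γ t) * count (γ t))) ≤ 18 * (d * d) * G l
      small t t< h = subst (λ z → 2 ^ l * (2 * γ t * G z * (count (γ t) * count (γ t))) ≤ 18 * (d * d) * G l) (sym (lg-unique l t t<))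
        (arith (2 ^ l) t d (count (γ t)) (G l) (<⇒≤ t<) h (count-bound (γ t) (≤-trans (pos-^ l (s≤s z≤n)) (m≤m+n _ t))))
        where
        arith : ∀ p t d n G → t ≤ p → p ≤ d → n * (p + t) ≤ d + (p + t) → p * (2 * (p + t) * G * (n * n)) ≤ 18 * (d * d) * G
        arith p t d n G t≤p p≤d h = begin
          p * (2 * (p + t) * G * (n * n)) ≤⟨ *-monoˡ-≤ (2 * (p + t) * G * (n * n)) (m≤m+n p t) ⟩
          (p + t) * (2 * (p + t) * G * (n * n)) ≡⟨ ar₁ (p + t) n G ⟩
          2 * (n * (p + t) * (n * (p + t))) * G ≤⟨ *-monoˡ-≤ G (2 ⊛ *-mono-≤ h3 h3) ⟩
          2 * (3 * d * (3 * d)) * G ≡⟨ ar₂ d G ⟩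
          18 * (d * d) * G ∎
          where
          ar₁ : ∀ q n G → q * (2 * q * G * (n * n)) ≡ 2 * (n * q * (n * q)) * G
          ar₁ q n G = solve (q ∷ n ∷ G ∷ [])
          ar₂ : ∀ d G → 2 * (3 * d * (3 * d)) * G ≡ 18 * (d * d) * G
          ar₂ d G = solve (d ∷ G ∷ [])
          h3 : n * (p + t) ≤ 3 * d
          h3 = ≤-trans h (by≤ 0 (t≤p ⊕ 2 ⊛ p≤d) (solve (d ∷ p ∷ t ∷ [])))

  Θ : ℕ
  Θ = 2 * e * (1 + s) ^ J

  -- Relative to d², `cond₁` and `cond₂` bound the off-diagonal and the diagonal part by (1 + s)^J /
  -- (2(2e + 1)) each. The mean of c i j / Θ is then at most (1 + 1/(2e))(1 + 1/(2e + 1)) = 1 + 1/e.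
  c-sum : e * ∑ d (λ i → ∑ d (λ j → c i j)) ≤ (e + 1) * Θ * (d * d)
  c-sum = begin
    e * ∑ d (λ i → ∑ d (λ j → c i j)) ≤⟨ e ⊛ ∑-mono d (λ i i<d → ∑-mono d (λ j j<d → c≤ i j i<d j<d)) ⟩
    e * ∑ d (λ i → ∑ d (λ j → (2 * e + 1) * (p + (δ i j + off i j)))) ≡⟨ cong (e *_) (trans (∑-ext d (λ i → ∑-*ˡ d (2 * e + 1) _)) (∑-*ˡ d (2 * e + 1) _)) ⟩
    e * ((2 * e + 1) * ∑ d (λ i → ∑ d (λ j → p + (δ i j + off i j)))) ≡⟨ cong (λ z → e * ((2 * e + 1) * z)) expand ⟩
    e * ((2 * e + 1) * (d * (d * p) + (∑ d (λ i → ∑ d (λ j → δ i j)) + ∑ d (λ i → ∑ d (λ j → off i j))))) ≤⟨ e ⊛ ((2 * e + 1) ⊛ +-monoʳ-≤ (d * (d * p)) (+-mono-≤ diagonal off-sum)) ⟩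
    e * ((2 * e + 1) * (d * (d * p) + (d * (2 * (2 * (w ! * d)) * G l₀) + 18 * (d * d) * ((1 + s) * G b)))) ≤⟨ arith e d p (w !) (G l₀) (G b) s
        (G-power l₀ (2 * (2 * e + 1) * (4 * w !)) (≤-trans (<⇒≤ (<-≤-trans (n<2^n l₀) 2^l₀≤d)) d≤R₂) cond₂)
        (G-power b (2 * (2 * e + 1) * 18 * (1 + s)) (≤-trans b≤d d≤R₂) cond₁) ⟩
    (e + 1) * Θ * (d * d) ∎
    where
    open ≤-Reasoning
    p = (1 + s) ^ J
    δ : ℕ → ℕ → ℕ
    δ i j = ⟦ i ≟ j ⟧ * κ (r j)
    expand : ∑ d (λ i → ∑ d (λ j → p + (δ i j + off i j))) ≡ d * (d * p) + (∑ d (λ i → ∑ d (λ j → δ i j)) + ∑ d (λ i → ∑ d (λ j → off i j)))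
    expand = trans (∑-ext d (λ i → trans (∑-+ d _ _) (cong₂ _+_ (∑-const d p) (∑-+ d _ _)))) (trans (∑-+ d _ _) (cong₂ _+_ (∑-const d (d * p)) (∑-+ d _ _)))
    arith : ∀ e d p w g g′ s → 2 * (2 * e + 1) * (4 * w) * g ≤ p → 2 * (2 * e + 1) * 18 * (1 + s) * g′ ≤ p →
      e * ((2 * e + 1) * (d * (d * p) + (d * (2 * (2 * (w * d)) * g) + 18 * (d * d) * ((1 + s) * g′)))) ≤ (e + 1) * (2 * e * p) * (d * d)
    arith e d p w g g′ s h₁ h₂ = cancelˡ 2 (s≤s z≤n) (by≤ 0 ((e * (d * d)) ⊛ (h₁ ⊕ h₂)) (solve (e ∷ d ∷ p ∷ w ∷ g ∷ g′ ∷ s ∷ [])))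

module Correlation
  (h : ℕ) (1≤h : 1 ≤ h) (k t T j₀ : ℕ) (1≤k : 1 ≤ k) (1≤t : 1 ≤ t)
  (w d : ℕ) (1≤d : 1 ≤ d) (e b l₀ : ℕ) (2^b≤w : 2 ^ b ≤ w) (2^l₀≤d : 2 ^ l₀ ≤ d) (b≤d : b ≤ d)
  (cond₁ : 2 * (2 * e + 1) * 18 * (1 + 4 * k) * (4 * k) ^ b ≤ (1 + 4 * k) ^ b)
  (cond₂ : 2 * (2 * e + 1) * (4 * w !) * (4 * k) ^ l₀ ≤ (1 + 4 * k) ^ l₀) where

  open Grid h 1≤h
  open Ramp k t T j₀ 1≤k 1≤t hiding (e)
  open Pool w d 1≤d
  open PoolSum w d 1≤d (4 * k) e b l₀ 2^b≤w 2^l₀≤d b≤d cond₁ cond₂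

  λ₂ : ℕ
  λ₂ = glog R₂

  module _ (flat : D * D * (2 * e) ≤ (2 * e + 1) * ((M ∸ λ₂ * λ₂) * M))
           (V⁻ : ℕ → ℕ) (Π : ℕ) (VV⁻ : ∀ m → V m * V⁻ m ≡ Π) where

    product : ∀ i j → i < d → j < d → ∀ m → 1 ≤ m →
      2 * e * (V (cof i j * m) * V (cof j i * m)) ≤ (2 * e + 1) * (V m * V (cof j i * (cof i j * m)))
    product i j i<d j<d m 1≤m = cancelˡ (D * D) (pos-* 1≤D 1≤D)
      (arith (D * D) e (M ∸ λ₂ * λ₂) M (M ∸ glog a * glog b′) (V (cof i j * m)) (V (cof j i * m)) (V m * V (a * (b′ * m)))
        flat (∸-monoʳ-≤ M (*-mono-≤ (glog-mono 1≤a (cof≤R₂ j i i<d)) (glog-mono 1≤b (cof≤R₂ i j j<d)))) (V-product a b′ m 1≤a 1≤b 1≤m))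
      where
      a = cof j i
      b′ = cof i j
      1≤a = proj₁ (1≤cof×g j i)
      1≤b = proj₁ (1≤cof×g i j)
      arith : ∀ D e K M K′ v u z → D * (2 * e) ≤ (2 * e + 1) * (K * M) → K ≤ K′ → u * v * (K′ * M) ≤ D * z →
        D * (2 * e * (v * u)) ≤ D * ((2 * e + 1) * z)
      arith D e K M K′ v u z h₁ h₂ h₃ = by≤ 0 ((v * u) ⊛ h₁ ⊕ ((2 * e + 1) * (u * v) * M) ⊛ h₂ ⊕ (2 * e + 1) ⊛ h₃)
        (solve (D ∷ e ∷ K ∷ M ∷ K′ ∷ v ∷ u ∷ z ∷ []))

    -- With a = cof j i, b′ = cof i j and g the gcd, the common multiple is g a b′ m. `product`
    -- trades V(b′m)V(am) for V(m)V(ab′m), and `V-gain` trades V(ab′m) for V(gab′m), which cancels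
    -- against `V⁻`.
    V-corr : ∀ i j → i < d → j < d → ∀ m → 1 ≤ m →
      Θ * (V (cof i j * m) * V (cof j i * m) * V⁻ (r i * (cof i j * m))) ≤ c i j * (Π * V m)
    V-corr i j i<d j<d m 1≤m = subst (λ z → Θ * (V (cof i j * m) * V (cof j i * m) * V⁻ z) ≤ c i j * (Π * V m)) (sym r≡) main
      where
      a = cof j i
      b′ = cof i j
      g = gᵢⱼ i j
      1≤g = proj₂ (1≤cof×g i j)
      1≤abm : 1 ≤ a * (b′ * m)
      1≤abm = pos-* (proj₁ (1≤cof×g j i)) (pos-* (proj₁ (1≤cof×g i j)) 1≤m)
      r≡ : r i * (b′ * m) ≡ g * (a * (b′ * m))
      r≡ = trans (cong (_* (b′ * m)) (trans (cof-eq′ i j) (*-comm a g))) (*-assoc g a (b′ * m))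
      lg≤J : lg g ≤ J
      lg≤J = ≤-trans (<⇒≤ (<-≤-trans (n<2^n (lg g)) (2^lg g 1≤g))) (≤-trans (∣⇒≤ (gcd[m,n]∣n (r i) (r j))) (r≤R₂ j j<d))
      main : Θ * (V (b′ * m) * V (a * m) * V⁻ (g * (a * (b′ * m)))) ≤ c i j * (Π * V m)
      main with gᵢⱼ i j ≟ 1
      ... | yes g≡1 = subst (λ z → Θ * (V (b′ * m) * V (a * m) * V⁻ z) ≤ (2 * e + 1) * (1 + 4 * k) ^ J * (Π * V m))
              (sym (trans (cong (_* (a * (b′ * m))) g≡1) (*-identityˡ _)))
              (subst (λ z → Θ * (V (b′ * m) * V (a * m) * V⁻ (a * (b′ * m))) ≤ (2 * e + 1) * (1 + 4 * k) ^ J * (z * V m)) (VV⁻ (a * (b′ * m)))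
                (arith e ((1 + 4 * k) ^ J) (V (b′ * m)) (V (a * m)) (V m) (V (a * (b′ * m))) (V⁻ (a * (b′ * m))) (product i j i<d j<d m 1≤m)))
        where
        arith : ∀ e p v u x z z⁻ → 2 * e * (v * u) ≤ (2 * e + 1) * (x * z) → 2 * e * p * (v * u * z⁻) ≤ (2 * e + 1) * p * (z * z⁻ * x)
        arith e p v u x z z⁻ h = by≤ 0 ((p * z⁻) ⊛ h) (solve (e ∷ p ∷ v ∷ u ∷ x ∷ z ∷ z⁻ ∷ []))
      ... | no _ = subst₂ (λ z P → 2 * e * P * (V (b′ * m) * V (a * m) * V⁻ (g * (a * (b′ * m)))) ≤ (2 * e + 1) * κ g * (z * V m)) (VV⁻ (g * (a * (b′ * m))))
              (trans (sym (^-distribˡ-+-* (1 + 4 * k) (lg g) (J ∸ lg g))) (cong ((1 + 4 * k) ^_) (m+[n∸m]≡n lg≤J)))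
              (arith e ((1 + 4 * k) ^ lg g) ((1 + 4 * k) ^ (J ∸ lg g)) ((4 * k) ^ lg g) g (V (b′ * m)) (V (a * m)) (V m) (V (a * (b′ * m)))
                (V (g * (a * (b′ * m)))) (V⁻ (g * (a * (b′ * m)))) (product i j i<d j<d m 1≤m) (V-gain (lg g) (a * (b′ * m)) g 1≤abm (2^lg g 1≤g)))
        where
        arith : ∀ e p p′ s g v u x z y y⁻ → 2 * e * (v * u) ≤ (2 * e + 1) * (x * z) → z * p ≤ 2 * g * s * y →
          2 * e * (p * p′) * (v * u * y⁻) ≤ (2 * e + 1) * (2 * g * (s * p′)) * (y * y⁻ * x)
        arith e p p′ s g v u x z y y⁻ h₁ h₂ = by≤ 0 ((p * p′ * y⁻) ⊛ h₁ ⊕ ((2 * e + 1) * x * p′ * y⁻) ⊛ h₂) (solve (e ∷ p ∷ p′ ∷ s ∷ g ∷ v ∷ u ∷ x ∷ z ∷ y ∷ y⁻ ∷ []))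

-- Chebyshev's bounds

prime≥2 : ∀ {p} → Prime p → 2 ≤ p
prime≥2 {p} pp = nonTrivial⇒n>1 p {{prime⇒nonTrivial pp}}

prime-divisor : ∀ n → 2 ≤ n → ∃ λ p → Prime p × p ∣ n
prime-divisor n 2≤n with factorise n {{pos (<⇒≤ 2≤n)}}
... | record { factors = [] ; isFactorisation = e } = ⊥-elim (<⇒≢ 2≤n (sym e))
... | record { factors = p ∷ ps ; isFactorisation = e ; factorsPrime = pp ∷ᵃ _ } = p , pp , subst (p ∣_) (sym e) (m∣m*n _)

∤⇒coprime : ∀ {p m} → Prime p → ¬ (p ∣ m) → Coprime p m
∤⇒coprime {p} {m} pp p∤m {c} (c∣p , c∣m) with prime⇒irreducible pp c∣p
... | inj₁ e = e
... | inj₂ refl = ⊥-elim (p∤m c∣m)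

coprime-*-∣ : ∀ {a b c} → Coprime a b → a ∣ c → b ∣ c → a * b ∣ c
coprime-*-∣ {a} {b} {c} cop a∣c (divides u refl) = subst (a * b ∣_) (*-comm b u)
  (subst (_∣ b * u) (*-comm b a) (*-monoʳ-∣ b (coprime-divisor cop (subst (a ∣_) (*-comm u b) a∣c))))

prime∤! : ∀ {p} → Prime p → ∀ m → m < p → ¬ (p ∣ m !)
prime∤! pp zero    _ h = <⇒≱ (prime≥2 pp) (∣⇒≤ h)
prime∤! pp (suc m) l h with euclidsLemma (suc m) (m !) pp h
... | inj₁ q = <⇒≱ l (∣⇒≤ q)
... | inj₂ q = prime∤! pp m (<⇒≤ l) q

-- The binomial coefficient C(a + b, a), indexed symmetrically to avoid subtraction.
bin : ℕ → ℕ → ℕ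
bin zero    b       = 1
bin (suc a) zero    = 1
bin (suc a) (suc b) = bin a (suc b) + bin (suc a) b

bin-! : ∀ a b → bin a b * (a ! * b !) ≡ (a + b) !
bin-! zero    b       = trans (*-identityˡ _) (*-identityˡ (b !))
bin-! (suc a) zero    = trans (*-identityˡ _) (trans (*-identityʳ _) (cong (λ z → suc z !) (sym (+-identityʳ a))))
bin-! (suc a) (suc b) = trans (ar a b (bin a (suc b)) (bin (suc a) b) (a !) (b !))
  (trans (cong₂ (λ u v → suc a * u + suc b * v) (trans (bin-! a (suc b)) (cong _! (+-suc a b))) (bin-! (suc a) b))
    (trans (ar₂ a b ((suc a + b) !)) (cong (λ z → suc z * (z !)) (sym (+-suc a b)))))
  where
  ar : ∀ a b x y p q → (x + y) * (suc a * p * (suc b * q)) ≡ suc a * (x * (p * (suc b * q))) + suc b * (y * (suc a * p * q))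
  ar a b x y p q = solve (a ∷ b ∷ x ∷ y ∷ p ∷ q ∷ [])
  ar₂ : ∀ a b z → suc a * z + suc b * z ≡ suc (suc (a + b)) * z
  ar₂ a b z = solve (a ∷ b ∷ z ∷ [])

bin-up : ∀ a b → suc b * bin a (suc b) ≡ suc (a + b) * bin a b
bin-up a b = *-cancelʳ-≡ _ _ (a ! * b !) {{pos (pos-* (1≤n! a) (1≤n! b))}}
  (trans (ar a b (bin a (suc b)) (a !) (b !)) (trans (bin-! a (suc b)) (trans (cong _! (+-suc a b)) (trans (cong (suc (a + b) *_) (sym (bin-! a b))) (sym (*-assoc (suc (a + b)) (bin a b) _))))))
  where
  ar : ∀ a b x p q → suc b * x * (p * q) ≡ x * (p * (suc b * q))
  ar a b x p q = solve (a ∷ b ∷ x ∷ p ∷ q ∷ [])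

bin-right : ∀ a b → suc a * bin (suc a) b ≡ suc (a + b) * bin a b
bin-right a b = *-cancelʳ-≡ _ _ (a ! * b !) {{pos (pos-* (1≤n! a) (1≤n! b))}}
  (trans (ar a b (bin (suc a) b) (a !) (b !)) (trans (bin-! (suc a) b) (trans (cong (suc (a + b) *_) (sym (bin-! a b))) (sym (*-assoc (suc (a + b)) (bin a b) _)))))
  where
  ar : ∀ a b x p q → suc a * x * (p * q) ≡ x * (suc a * p * q)
  ar a b x p q = solve (a ∷ b ∷ x ∷ p ∷ q ∷ [])

1≤bin : ∀ a b → 1 ≤ bin a b
1≤bin zero    b       = ≤-refl
1≤bin (suc a) zero    = ≤-refl
1≤bin (suc a) (suc b) = ≤-trans (1≤bin a (suc b)) (m≤m+n _ _)

bin≤2^ : ∀ a b → bin a b ≤ 2 ^ (a + b)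
bin≤2^ zero    b       = pos-^ b (s≤s z≤n)
bin≤2^ (suc a) zero    = pos-^ (suc a + 0) (s≤s z≤n)
bin≤2^ (suc a) (suc b) = ≤-trans (+-mono-≤ (bin≤2^ a (suc b)) (≤-trans (bin≤2^ (suc a) b) (≤-reflexive (cong (2 ^_) (sym (+-suc a b))))))
  (≤-reflexive (cong (2 ^ (a + suc b) +_) (sym (+-identityʳ _))))

2^≤bin : ∀ n → 2 ^ n ≤ bin n n
2^≤bin zero    = ≤-refl
2^≤bin (suc n) = ≤-trans (2 ⊛ 2^≤bin n) (≤-trans (≤-reflexive (cong (bin n n +_) (+-identityʳ _))) (+-mono-≤ (right n n) (up n n)))
  where
  right : ∀ a b → bin a b ≤ bin a (suc b)
  right zero    b = ≤-refl
  right (suc a) b = m≤n+m _ _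
  up : ∀ a b → bin a b ≤ bin (suc a) b
  up a       zero    = ≤-trans (≤-reflexive (one a)) ≤-refl
    where
    one : ∀ a → bin a 0 ≡ 1
    one zero    = refl
    one (suc a) = refl
  up a (suc b) = m≤m+n _ _

-- The entries of the Leibniz triangle 1/(a bin a b) satisfy 1/x = 1/y + 1/z below.
leibniz : ∀ X a b → (∀ j → 1 ≤ j → j ≤ suc a + b → j ∣ X) → suc a * bin (suc a) b ∣ X
leibniz X zero b h = subst (_∣ X) (sym (trans (*-identityˡ _) (one b))) (h (suc b) (s≤s z≤n) ≤-refl)
  where
  one : ∀ b → bin 1 b ≡ suc b
  one zero    = refl
  one (suc b) = cong suc (one b)
leibniz X (suc a) b h = combine (leibniz X a b (λ j p q → h j p (m≤n⇒m≤1+n q)))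
                               (leibniz X a (suc b) (λ j p q → h j p (≤-trans q (≤-reflexive (+-suc (suc a) b)))))
  where
  x = suc a * bin (suc a) b
  y = suc a * bin (suc a) (suc b)
  z = suc (suc a) * bin (suc (suc a)) b
  1≤x : 1 ≤ x
  1≤x = pos-* {suc a} (s≤s z≤n) (1≤bin (suc a) b)
  1≤y : 1 ≤ y
  1≤y = pos-* {suc a} (s≤s z≤n) (1≤bin (suc a) (suc b))
  triangle : y * z ≡ x * z + x * y
  triangle = *-cancelˡ-≡ _ _ (suc b) (trans (ar₁ a b B C) (trans (cong₂ (λ u v → suc a * (u * v)) (bin-up (suc a) b) (bin-right (suc a) b))
      (trans (ar₂ a b A) (trans (cong₂ (λ u v → suc b * (suc a * A) * u + suc a * A * (suc a * v)) (sym (bin-right (suc a) b)) (sym (bin-up (suc a) b))) (ar₃ a b A B C)))))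
    where
    A = bin (suc a) b
    B = bin (suc a) (suc b)
    C = bin (suc (suc a)) b
    ar₁ : ∀ a b B C → suc b * (suc a * B * (suc (suc a) * C)) ≡ suc a * (suc b * B * (suc (suc a) * C))
    ar₁ a b B C = solve (a ∷ b ∷ B ∷ C ∷ [])
    ar₂ : ∀ a b A → suc a * (suc (suc a + b) * A * (suc (suc a + b) * A)) ≡ suc b * (suc a * A) * (suc (suc a + b) * A) + suc a * A * (suc a * (suc (suc a + b) * A))
    ar₂ a b A = solve (a ∷ b ∷ A ∷ [])
    ar₃ : ∀ a b A B C → suc b * (suc a * A) * (suc (suc a) * C) + suc a * A * (suc a * (suc b * B)) ≡ suc b * (suc a * A * (suc (suc a) * C) + suc a * A * (suc a * B))
    ar₃ a b A B C = solve (a ∷ b ∷ A ∷ B ∷ C ∷ [])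
  x≤y : x ≤ y
  x≤y = suc a ⊛ m≤n+m _ _
  combine : x ∣ X → y ∣ X → z ∣ X
  combine (divides v eₓ) (divides u e_y) = case ≤⇒+ u≤v of λ (o , v≡) → divides o (sym (go o v≡))
    where
    u≤v : u ≤ v
    u≤v = *-cancelʳ-≤ u v y {{pos 1≤y}} (≤-trans (≤-reflexive (trans (sym e_y) eₓ)) (v ⊛ x≤y))
    go : ∀ o → v ≡ u + o → o * z ≡ X
    go o refl = *-cancelʳ-≡ (o * z) X x {{pos 1≤x}} (+-cancelˡ-≡ (u * x * z) _ _ (begin
      u * x * z + o * z * x ≡⟨ ar₁ u x z o ⟩
      (u + o) * x * z       ≡⟨ cong (_* z) (trans (sym eₓ) e_y) ⟩
      u * y * z             ≡⟨ *-assoc u y z ⟩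
      u * (y * z)           ≡⟨ cong (u *_) triangle ⟩
      u * (x * z + x * y)   ≡⟨ ar₂ u x z y ⟩
      u * x * z + u * y * x ≡⟨ cong (λ w → u * x * z + w * x) e_y ⟨
      u * x * z + X * x     ∎))
      where
      open ≡-Reasoning
      ar₁ : ∀ u x z o → u * x * z + o * z * x ≡ (u + o) * x * z
      ar₁ u x z o = solve (u ∷ x ∷ z ∷ o ∷ [])
      ar₂ : ∀ u x z y → u * (x * z + x * y) ≡ u * x * z + u * y * x
      ar₂ u x z y = solve (u ∷ x ∷ z ∷ y ∷ [])

common-multiple-large : ∀ X n → 1 ≤ X → (∀ j → 1 ≤ j → j ≤ 2 * suc n → j ∣ X) → 2 ^ suc n ≤ X
common-multiple-large X n 1≤X h = ≤-trans (2^≤bin (suc n)) (≤-trans (m≤c*m {suc n} _ (s≤s z≤n))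
  (∣⇒≤ {{pos 1≤X}} (leibniz X n (suc n) (λ j p q → h j p (≤-trans q (≤-reflexive (cong (suc n +_) (sym (+-identityʳ (suc n))))))))))

-- the product of the primes in (m, m + o]
primes-product : ℕ → ℕ → ℕ
primes-product m zero    = 1
primes-product m (suc o) with prime? (suc (m + o))
... | yes _ = suc (m + o) * primes-product m o
... | no  _ = primes-product m o

primorial : ℕ → ℕ
primorial n = primes-product 0 n

1≤primes-product : ∀ m o → 1 ≤ primes-product m o
1≤primes-product m zero = ≤-refl
1≤primes-product m (suc o) with prime? (suc (m + o))
... | yes pp = pos-* {suc (m + o)} (s≤s z≤n) (1≤primes-product m o)
... | no _ = 1≤primes-product m o

prime∤primes-product : ∀ {p} → Prime p → ∀ m o → m + o < p → ¬ (p ∣ primes-product m o)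
prime∤primes-product pp m zero    _ h = <⇒≱ (prime≥2 pp) (∣⇒≤ h)
prime∤primes-product pp m (suc o) l h with prime? (suc (m + o))
... | no _ = prime∤primes-product pp m o (<-trans (+-monoʳ-< m ≤-refl) l) h
... | yes q with euclidsLemma (suc (m + o)) (primes-product m o) pp h
...   | inj₁ p∣ = <⇒≱ l (≤-trans (∣⇒≤ p∣) (≤-reflexive (sym (+-suc m o))))
...   | inj₂ p∣ = prime∤primes-product pp m o (<-trans (+-monoʳ-< m ≤-refl) l) p∣

prime∣primes-product : ∀ {p} → Prime p → ∀ m o → m < p → p ≤ m + o → p ∣ primes-product m o
prime∣primes-product pp m zero    l l′ = ⊥-elim (<⇒≱ l (≤-trans l′ (≤-reflexive (+-identityʳ m))))
prime∣primes-product {p} pp m (suc o) l l′ with m≤n⇒m<n∨m≡n (≤-trans l′ (≤-reflexive (+-suc m o))) | prime? (suc (m + o))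
... | inj₁ p< | yes _ = ∣n⇒∣m*n (suc (m + o)) (prime∣primes-product pp m o l (≤-pred p<))
... | inj₁ p< | no _  = prime∣primes-product pp m o l (≤-pred p<)
... | inj₂ refl | yes _ = m∣m*n _
... | inj₂ refl | no ¬p = ⊥-elim (¬p pp)

primes-product∣ : ∀ m o X → (∀ p → Prime p → m < p → p ≤ m + o → p ∣ X) → primes-product m o ∣ X
primes-product∣ m zero    X h = 1∣ X
primes-product∣ m (suc o) X h with prime? (suc (m + o))
... | no _ = primes-product∣ m o X (λ p pp l l′ → h p pp l (≤-trans l′ (+-monoʳ-≤ m (n≤1+n o))))
... | yes q = coprime-*-∣ (∤⇒coprime q (prime∤primes-product q m o ≤-refl))
                (h _ q (s≤s (m≤m+n m o)) (≤-reflexive (sym (+-suc m o)))) (primes-product∣ m o X (λ p pp l l′ → h p pp l (≤-trans l′ (+-monoʳ-≤ m (n≤1+n o)))))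

primes-product-+ : ∀ m o → primorial (m + o) ≡ primes-product m o * primorial m
primes-product-+ m zero    = trans (cong primorial (+-identityʳ m)) (sym (*-identityˡ _))
primes-product-+ m (suc o) rewrite +-suc m o with prime? (suc (m + o))
... | yes _ = trans (cong (suc (m + o) *_) (primes-product-+ m o)) (sym (*-assoc (suc (m + o)) (primes-product m o) (primorial m)))
... | no _  = primes-product-+ m o

-- A prime in (m, 2m] divides (2m)! but not m!, hence divides C(2m, m), which is at most 4^m.
primorial-double : ∀ m → primorial (m + m) ≤ 2 ^ (m + m) * primorial m
primorial-double m = ≤-trans (≤-reflexive (primes-product-+ m m)) (*-monoˡ-≤ (primorial m)
  (≤-trans (∣⇒≤ {{pos (1≤bin m m)}} (primes-product∣ m m (bin m m) divides-bin)) (bin≤2^ m m)))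
  where
  divides-bin : ∀ p → Prime p → m < p → p ≤ m + m → p ∣ bin m m
  divides-bin p pp l l′ with euclidsLemma (bin m m) (m ! * m !) pp (subst (p ∣_) (sym (bin-! m m)) (∣! (<⇒≤ (prime≥2 pp)) l′))
  ... | inj₁ q = q
  ... | inj₂ q with euclidsLemma (m !) (m !) pp q
  ...   | inj₁ q = ⊥-elim (prime∤! pp m l q)
  ...   | inj₂ q = ⊥-elim (prime∤! pp m l q)

primorial-upper : ∀ i → primorial (2 ^ i) ≤ 4 ^ (2 ^ i)
primorial-upper zero    = s≤s z≤n
primorial-upper (suc i) = begin
  primorial (2 ^ i + (2 ^ i + 0))                ≡⟨ cong (λ z → primorial (2 ^ i + z)) (+-identityʳ (2 ^ i)) ⟩
  primorial (2 ^ i + 2 ^ i)                      ≤⟨ primorial-double (2 ^ i) ⟩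
  2 ^ (2 ^ i + 2 ^ i) * primorial (2 ^ i)        ≤⟨ (2 ^ (2 ^ i + 2 ^ i)) ⊛ primorial-upper i ⟩
  2 ^ (2 ^ i + 2 ^ i) * 4 ^ (2 ^ i)              ≡⟨ cong (_* 4 ^ (2 ^ i)) (trans (cong (λ z → 2 ^ (2 ^ i + z)) (sym (+-identityʳ (2 ^ i)))) (sym (^-*-assoc 2 2 (2 ^ i)))) ⟩
  4 ^ (2 ^ i) * 4 ^ (2 ^ i)                      ≡⟨ ^-distribˡ-+-* 4 (2 ^ i) (2 ^ i) ⟨
  4 ^ (2 ^ i + 2 ^ i)                            ≡⟨ cong (λ z → 4 ^ (2 ^ i + z)) (+-identityʳ (2 ^ i)) ⟨
  4 ^ (2 ^ suc i)                                ∎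
  where open ≤-Reasoning

-- square-free part and squares: every j ≤ K² divides primorial (K²) (K!)²
SquareFree : ℕ → Set
SquareFree f = ∀ t → 2 ≤ t → ¬ (t * t ∣ f)

squarefree∣ : ∀ n f → f ≤ n → 1 ≤ f → SquareFree f → ∀ X → (∀ p → Prime p → p ≤ f → p ∣ X) → f ∣ X
squarefree∣ zero    f f≤n 1≤f sf X h = ⊥-elim (<⇒≱ 1≤f f≤n)
squarefree∣ (suc n) f f≤n 1≤f sf X h with 2 ≤? f
... | no ¬2≤f = subst (_∣ X) (≤-antisym 1≤f (≤-pred (≰⇒> ¬2≤f))) (1∣ X)
... | yes 2≤f = case prime-divisor f 2≤f of λ { (p , pp , divides f′ e) → go p pp f′ e }
  where
  go : ∀ p → Prime p → ∀ f′ → f ≡ f′ * p → f ∣ X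
  go p pp f′ refl = subst (_∣ X) (*-comm p f′) (coprime-*-∣ (∤⇒coprime pp (λ { (divides u refl) → sf p (prime≥2 pp) (divides u (*-assoc u p p)) }))
      (h p pp (m≤c*m p 1≤f′))
      (squarefree∣ n f′ (≤-pred (<-≤-trans (m<m*n f′ p {{pos 1≤f′}} (prime≥2 pp)) f≤n)) 1≤f′ (λ t 2≤t t²∣ → sf t 2≤t (∣-trans t²∣ (m∣m*n p))) X
        (λ q qq l → h q qq (≤-trans l (m≤m*n f′ p {{prime⇒nonZero pp}})))))
    where
    1≤f′ : 1 ≤ f′
    1≤f′ = proj₁ (⊗>0 {f′} 1≤f)

square-part : ∀ n j → j ≤ n → 1 ≤ j → ∃ λ f → ∃ λ t → j ≡ f * (t * t) × 1 ≤ f × 1 ≤ t × SquareFree f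
square-part zero    j j≤n 1≤j = ⊥-elim (<⇒≱ 1≤j j≤n)
square-part (suc n) j j≤n 1≤j with anyUpTo? (λ t → (2 ≤? t) ×-dec (t * t ∣? j)) (suc j)
... | no ¬t = j , 1 , sym (*-identityʳ j) , 1≤j , ≤-refl , λ t 2≤t t²∣j → ¬t (t , s≤s (≤-trans (m≤m*n t t {{pos (<⇒≤ 2≤t)}}) (∣⇒≤ {{pos 1≤j}} t²∣j)) , 2≤t , t²∣j)
... | yes (t , _ , 2≤t , divides j′ e) = case square-part n j′ (≤-pred (<-≤-trans j′<j j≤n)) 1≤j′ of
      λ (f , u , e′ , 1≤f , 1≤u , sf) → f , u * t , trans e (trans (cong (_* (t * t)) e′) (ar f u t)) , 1≤f , pos-* 1≤u (<⇒≤ 2≤t) , sf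
  where
  1≤j′ : 1 ≤ j′
  1≤j′ = proj₁ (⊗>0 {j′} (subst (1 ≤_) e 1≤j))
  j′<j : j′ < j
  j′<j = subst (j′ <_) (sym e) (m<m*n j′ (t * t) {{pos 1≤j′}} (<-≤-trans 2≤t (m≤m*n t t {{pos (<⇒≤ 2≤t)}})))
  ar : ∀ f u t → f * (u * u) * (t * t) ≡ f * (u * t * (u * t))
  ar f u t = solve (f ∷ u ∷ t ∷ [])

∣primorial*! : ∀ K j → 1 ≤ j → j ≤ K * K → j ∣ primorial (K * K) * (K ! * K !)
∣primorial*! K j 1≤j j≤ = case square-part j j ≤-refl 1≤j of λ (f , t , e , 1≤f , 1≤t , sf) →
  let f≤j : f ≤ j
      f≤j = ≤-trans (m≤m*n f (t * t) {{pos (pos-* 1≤t 1≤t)}}) (≤-reflexive (sym e))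
      t≤K : t ≤ K
      t≤K = ≮⇒≥ λ K<t → <⇒≱ (*-mono-<₂ K<t K<t) (≤-trans (≤-trans (m≤c*m (t * t) 1≤f) (≤-reflexive (sym e))) j≤)
  in subst (_∣ primorial (K * K) * (K ! * K !)) (sym e) (*-pres-∣
       (squarefree∣ f f ≤-refl 1≤f sf (primorial (K * K)) (λ p pp p≤f → prime∣primes-product pp 0 (K * K) (<⇒≤ (prime≥2 pp)) (≤-trans p≤f (≤-trans f≤j j≤))))
       (*-pres-∣ (∣! 1≤t t≤K) (∣! 1≤t t≤K)))

n!≤n^n : ∀ n → n ! ≤ n ^ n
n!≤n^n zero    = ≤-refl
n!≤n^n (suc n) = suc n ⊛ ≤-trans (n!≤n^n n) (^-monoˡ-≤ n (n≤1+n n))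

-- With K = 2^(i + 1), a common multiple of 1, ..., K² is at least 2^(K²/2), and primorial(K²)(K!)²
-- is such a multiple. As (K!)² is only exp(O(K log K)), the primorial is bounded from below without
-- any treatment of prime powers.
primorial-lower : ∀ i → 2 ^ (2 ^ (2 * i + 1)) ≤ primorial (4 ^ suc i) * 2 ^ (4 * suc i * 2 ^ i)
primorial-lower i = begin
  2 ^ (2 ^ (2 * i + 1)) ≤⟨ subst (λ z → 2 ^ z ≤ X) n≡ (common-multiple-large X (2 ^ (2 * i + 1) ∸ 1) 1≤X (λ j p q → ∣primorial*! K j p (≤-trans q (≤-reflexive N≡)))) ⟩
  primorial (K * K) * (K ! * K !)        ≤⟨ primorial (K * K) ⊛ *-mono-≤ (n!≤n^n K) (n!≤n^n K) ⟩
  primorial (K * K) * (K ^ K * K ^ K)    ≡⟨ cong₂ _*_ (cong primorial (trans (sym (^-distribʳ-* 2 2 (suc i))) refl)) pw ⟩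
  primorial (4 ^ suc i) * 2 ^ (4 * suc i * 2 ^ i) ∎
  where
  open ≤-Reasoning
  K = 2 ^ suc i
  X = primorial (K * K) * (K ! * K !)
  1≤X : 1 ≤ X
  1≤X = pos-* (1≤primes-product 0 (K * K)) (pos-* (1≤n! K) (1≤n! K))
  n≡ : suc (2 ^ (2 * i + 1) ∸ 1) ≡ 2 ^ (2 * i + 1)
  n≡ = trans (+-comm 1 _) (m∸n+n≡m (pos-^ (2 * i + 1) (s≤s z≤n)))
  N≡ : 2 * suc (2 ^ (2 * i + 1) ∸ 1) ≡ K * K
  N≡ = trans (cong (2 *_) n≡) (trans (cong (2 ^_) (ar i)) (^-distribˡ-+-* 2 (suc i) (suc i)))
    where
    ar : ∀ i → suc (2 * i + 1) ≡ suc i + suc i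
    ar i = solve (i ∷ [])
  pw : K ^ K * K ^ K ≡ 2 ^ (4 * suc i * 2 ^ i)
  pw = trans (sym (^-distribˡ-+-* K K K)) (trans (^-*-assoc 2 (suc i) (K + K)) (cong (2 ^_) (ar i (2 ^ i))))
    where
    ar : ∀ i x → suc i * (2 * x + 2 * x) ≡ 4 * suc i * x
    ar i x = solve (i ∷ x ∷ [])

π : ℕ → ℕ → ℕ
π m n = ∑ (suc n) (λ q → ⟦ prime? q ⟧ * ⟦ m <? q ⟧)

primes-product-≤ : ∀ m o n → m + o ≤ n → 1 ≤ n → primes-product m o ≤ n ^ π m (m + o)
primes-product-≤ m zero    n l 1≤n = pos-^ (π m (m + 0)) 1≤n
primes-product-≤ m (suc o) n l 1≤n rewrite +-suc m o with prime? (suc (m + o))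
... | no _ = ≤-trans (primes-product-≤ m o n (<⇒≤ l) 1≤n) (≤-reflexive (cong (n ^_) (sym (+-identityʳ (π m (m + o))))))
... | yes _ = ≤-trans (*-mono-≤ l (primes-product-≤ m o n (<⇒≤ l) 1≤n)) (≤-reflexive (cong (n ^_) (trans (+-comm 1 (π m (m + o))) (cong (π m (m + o) +_) (sym (trans (+-identityʳ _) (⟦⟧-yes (m <? suc (m + o)) (s≤s (m≤m+n m o)))))))))

-- In binary logarithms the product of the primes up to 16^(j + 1) is at least 8 · 16^j - 16(j +
-- 1)4^j, and that of the primes up to 16^j at most 2 · 16^j. The ratio 16 lets the first dominate,
-- and j ≥ 3 makes the subtracted term at most 2 · 16^j.
chebyshev-block : ∀ j → 3 ≤ j → 16 ^ j ≤ suc j * π (16 ^ j) (16 ^ suc j)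
chebyshev-block j 3≤j = cancelˡ 4 (s≤s z≤n) (arith (16 ^ j) (4 ^ j) j (π (16 ^ j) (16 ^ suc j)) (^-distribʳ-* 4 4 j) small (≮⇒≥ λ lt → <⇒≱ (^-monoʳ-< 2 (s≤s (s≤s z≤n)) lt) bound))
  where
  m = 16 ^ j
  i = 2 * j + 1
  bound : 2 ^ (8 * 16 ^ j) ≤ 2 ^ (4 * suc j * π m (16 * m) + 2 * 16 ^ j + 16 * suc j * 4 ^ j)
  bound = begin
    2 ^ (8 * 16 ^ j) ≡⟨ cong (2 ^_) (trans (cong (8 *_) (^-*-assoc 2 4 j)) (trans (sym (^-distribˡ-+-* 2 3 (4 * j))) (cong (2 ^_) (ar₁ j)))) ⟩
    2 ^ (2 ^ (2 * i + 1)) ≤⟨ primorial-lower i ⟩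
    primorial (4 ^ suc i) * 2 ^ (4 * suc i * 2 ^ i) ≡⟨ cong₂ (λ u v → primorial u * 2 ^ v) 4^≡ (trans (cong (4 * suc i *_) 2^i≡) (ar₂ j (4 ^ j))) ⟩
    primorial (m + 15 * m) * 2 ^ (16 * suc j * 4 ^ j) ≡⟨ cong (_* 2 ^ (16 * suc j * 4 ^ j)) (primes-product-+ m (15 * m)) ⟩
    primes-product m (15 * m) * primorial m * 2 ^ (16 * suc j * 4 ^ j) ≤⟨ *-monoˡ-≤ _ (*-mono-≤ (primes-product-≤ m (15 * m) (16 ^ suc j) ≤-refl (pos-^ (suc j) (s≤s z≤n))) upper) ⟩
    (16 ^ suc j) ^ π m (16 * m) * 2 ^ (2 * 16 ^ j) * 2 ^ (16 * suc j * 4 ^ j) ≡⟨ cong (λ z → z * 2 ^ (2 * 16 ^ j) * 2 ^ (16 * suc j * 4 ^ j)) (trans (cong (_^ π m (16 * m)) (^-*-assoc 2 4 (suc j))) (^-*-assoc 2 (4 * suc j) (π m (16 * m)))) ⟩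
    2 ^ (4 * suc j * π m (16 * m)) * 2 ^ (2 * 16 ^ j) * 2 ^ (16 * suc j * 4 ^ j) ≡⟨ cong (_* 2 ^ (16 * suc j * 4 ^ j)) (^-distribˡ-+-* 2 (4 * suc j * π m (16 * m)) (2 * 16 ^ j)) ⟨
    2 ^ (4 * suc j * π m (16 * m) + 2 * 16 ^ j) * 2 ^ (16 * suc j * 4 ^ j) ≡⟨ ^-distribˡ-+-* 2 (4 * suc j * π m (16 * m) + 2 * 16 ^ j) _ ⟨
    2 ^ (4 * suc j * π m (16 * m) + 2 * 16 ^ j + 16 * suc j * 4 ^ j) ∎
    where
    open ≤-Reasoning
    ar₁ : ∀ j → 3 + 4 * j ≡ 2 * (2 * j + 1) + 1
    ar₁ j = solve (j ∷ [])
    ar₂ : ∀ j x → 4 * suc (2 * j + 1) * (2 * x) ≡ 16 * suc j * x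
    ar₂ j x = solve (j ∷ x ∷ [])
    2^i≡ : 2 ^ i ≡ 2 * 4 ^ j
    2^i≡ = trans (cong (2 ^_) (+-comm (2 * j) 1)) (cong (2 *_) (sym (^-*-assoc 2 2 j)))
    4^≡ : 4 ^ suc i ≡ m + 15 * m
    4^≡ = trans (cong (4 ^_) (ar₃ j)) (trans (sym (^-*-assoc 4 2 (suc j))) refl)
      where
      ar₃ : ∀ j → suc (2 * j + 1) ≡ 2 * suc j
      ar₃ j = solve (j ∷ [])
    upper : primorial m ≤ 2 ^ (2 * 16 ^ j)
    upper = subst (λ z → primorial z ≤ 2 ^ (2 * z)) (sym (^-*-assoc 2 4 j)) (≤-trans (primorial-upper (4 * j)) (≤-reflexive (^-*-assoc 2 2 (2 ^ (4 * j)))))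
  small : 8 * suc j ≤ 4 ^ j
  small = case ≤⇒+ 3≤j of λ (o , e) → subst (λ j → 8 * suc j ≤ 4 ^ j) (sym e) (go o)
    where
    go : ∀ o → 8 * suc (3 + o) ≤ 4 ^ (3 + o)
    go zero    = m≤m+n 32 32
    go (suc o) = ≤-trans (≤-trans (lin o) (4 ⊛ go o)) ≤-refl
      where
      lin : ∀ o → 8 * suc (4 + o) ≤ 4 * (8 * suc (3 + o))
      lin o = by≤ (88 + 24 * o) (≤-refl {0}) (solve (o ∷ []))
  arith : ∀ x y j p → x ≡ y * y → 8 * suc j ≤ y → 8 * x ≤ 4 * suc j * p + 2 * x + 16 * suc j * y → 4 * x ≤ 4 * (suc j * p)
  arith x y j p refl h₁ h₂ = by≤ 0 (h₂ ⊕ (2 * y) ⊛ h₁) (solve (y ∷ j ∷ p ∷ []))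

-- counting smooth numbers with few prime factors

Smooth′ : ℕ → ℕ → Set
Smooth′ y n = ∀ p → Prime p → p ∣ n → p ≤ y

ϖ : ℕ → ℕ → ℕ
ϖ y n = ∑ (suc y) (λ q → ⟦ prime? q ⟧ * ⟦ q ∣? n ⟧)

extract : ∀ p n → 2 ≤ p → 1 ≤ n → ∃ λ a → ∃ λ m → n ≡ p ^ a * m × ¬ (p ∣ m)
extract p n 2≤p 1≤n = go n n ≤-refl 1≤n
  where
  go : ∀ b n → n ≤ b → 1 ≤ n → ∃ λ a → ∃ λ m → n ≡ p ^ a * m × ¬ (p ∣ m)
  go zero    n n≤b 1≤n = ⊥-elim (<⇒≱ 1≤n n≤b)
  go (suc b) n n≤b 1≤n with p ∣? n
  ... | no p∤n = 0 , n , sym (*-identityˡ n) , p∤n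
  ... | yes (divides n′ refl) = case go b n′ (≤-pred (<-≤-trans (m<m*n n′ p {{pos 1≤n′}} 2≤p) n≤b)) 1≤n′ of
        λ (a , m , e , p∤m) → suc a , m , trans (cong (_* p) e) (ar (p ^ a) m p) , p∤m
    where
    1≤n′ : 1 ≤ n′
    1≤n′ = proj₁ (⊗>0 {n′} 1≤n)
    ar : ∀ x m p → x * m * p ≡ p * x * m
    ar x m p = solve (x ∷ m ∷ p ∷ [])

module FewPrimes (N y : ℕ) where

  S ℒ base : ℕ
  S = suc N
  ℒ = lg N
  base = 1 + suc y * suc ℒ

  -- overcounts the ways to write n as a product of at most k powers p^a with p ≤ y
  cover : ℕ → ℕ → ℕ
  cover zero    n = ⟦ n ≟ 1 ⟧
  cover (suc k) n = cover k n + ∑ (suc y) (λ p → ∑ (suc ℒ) (λ a → ∑ S (λ m → ⟦ n ≟ p ^ a * m ⟧ * cover k m)))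

  ∑-cover : ∀ k → ∑ S (cover k) ≤ base ^ k
  ∑-cover zero = ≤-trans (∑-mono S (λ n _ → ≤-reflexive (sym (*-identityʳ _)))) (∑-delta≤ S (λ _ → 1) 1)
  ∑-cover (suc k) = begin
    ∑ S (cover (suc k)) ≡⟨ ∑-+ S _ _ ⟩
    ∑ S (cover k) + ∑ S (λ n → ∑ (suc y) (λ p → ∑ (suc ℒ) (λ a → ∑ S (λ m → ⟦ n ≟ p ^ a * m ⟧ * cover k m))))
      ≡⟨ cong (∑ S (cover k) +_) (trans (∑-swap S (suc y) _) (∑-ext (suc y) (λ p → trans (∑-swap S (suc ℒ) _) (∑-ext (suc ℒ) (λ a → ∑-swap S S _))))) ⟩
    ∑ S (cover k) + ∑ (suc y) (λ p → ∑ (suc ℒ) (λ a → ∑ S (λ m → ∑ S (λ n → ⟦ n ≟ p ^ a * m ⟧ * cover k m))))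
      ≤⟨ +-monoʳ-≤ (∑ S (cover k)) (∑-mono (suc y) (λ p _ → ∑-mono (suc ℒ) (λ a _ → ∑-mono S (λ m _ → ∑-delta≤ S (λ _ → cover k m) (p ^ a * m))))) ⟩
    ∑ S (cover k) + ∑ (suc y) (λ p → ∑ (suc ℒ) (λ a → ∑ S (cover k)))
      ≡⟨ cong (∑ S (cover k) +_) (trans (∑-ext (suc y) (λ p → ∑-const (suc ℒ) (∑ S (cover k)))) (∑-const (suc y) _)) ⟩
    ∑ S (cover k) + suc y * (suc ℒ * ∑ S (cover k)) ≡⟨ ar (∑ S (cover k)) (suc y) (suc ℒ) ⟩
    base * ∑ S (cover k) ≤⟨ base ⊛ ∑-cover k ⟩
    base * base ^ k ∎
    where
    open ≤-Reasoning
    ar : ∀ c y l → c + y * (l * c) ≡ (1 + y * l) * c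
    ar c y l = solve (c ∷ y ∷ l ∷ [])

  cover-one : ∀ k → 1 ≤ cover k 1
  cover-one zero    = ≤-refl
  cover-one (suc k) = ≤-trans (cover-one k) (m≤m+n _ _)

  ϖ-remove : ∀ p n m → Prime p → p ≤ y → p ∣ n → ¬ (p ∣ m) → m ∣ n → suc (ϖ y m) ≤ ϖ y n
  ϖ-remove p n m pp p≤y p∣n p∤m m∣n = begin
    suc (ϖ y m) ≡⟨ +-comm 1 (ϖ y m) ⟩
    ϖ y m + 1 ≡⟨ cong (ϖ y m +_) (∑-delta (suc y) (λ _ → 1) (s≤s p≤y)) ⟨
    ϖ y m + ∑ (suc y) (λ q → ⟦ q ≟ p ⟧ * 1) ≡⟨ ∑-+ (suc y) _ _ ⟨
    ∑ (suc y) (λ q → ⟦ prime? q ⟧ * ⟦ q ∣? m ⟧ + ⟦ q ≟ p ⟧ * 1) ≤⟨ ∑-mono (suc y) (λ q _ → term q) ⟩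
    ϖ y n ∎
    where
    open ≤-Reasoning
    term : ∀ q → ⟦ prime? q ⟧ * ⟦ q ∣? m ⟧ + ⟦ q ≟ p ⟧ * 1 ≤ ⟦ prime? q ⟧ * ⟦ q ∣? n ⟧
    term q with q ≟ p
    ... | no _ = ≤-trans (≤-reflexive (+-identityʳ _)) (⟦ prime? q ⟧ ⊛ ⟦⟧-mono (q ∣? m) (q ∣? n) (λ h → ∣-trans h m∣n))
    ... | yes refl = ≤-reflexive (trans (cong (_+ 1) (trans (cong (⟦ prime? q ⟧ *_) (⟦⟧-no (q ∣? m) p∤m)) (*-zeroʳ ⟦ prime? q ⟧)))
                       (sym (cong₂ _*_ (⟦⟧-yes (prime? q) pp) (⟦⟧-yes (q ∣? n) p∣n))))

  -- Each round strips the full power of one prime, which lowers the number of distinct prime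
  -- factors; the exponent is at most log₂ N.
  covered : ∀ k n → 1 ≤ n → n ≤ N → Smooth′ y n → ϖ y n ≤ k → 1 ≤ cover k n
  covered k n 1≤n n≤N sm few with 2 ≤? n
  ... | no ¬2≤n = subst (λ z → 1 ≤ cover k z) (≤-antisym 1≤n (≤-pred (≰⇒> ¬2≤n))) (cover-one k)
  ... | yes 2≤n = case prime-divisor n 2≤n of λ (p , pp , p∣n) → case extract p n (prime≥2 pp) 1≤n of
        λ (a , m , e , p∤m) → go k few p pp p∣n (sm p pp p∣n) a m e p∤m
    where
    go : ∀ k → ϖ y n ≤ k → ∀ p → Prime p → p ∣ n → p ≤ y → ∀ a m → n ≡ p ^ a * m → ¬ (p ∣ m) → 1 ≤ cover k n
    go k few p pp p∣n p≤y a m e p∤m = rec k (≤-trans (ϖ-remove p n m pp p≤y p∣n p∤m m∣n) few)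
      where
      m∣n : m ∣ n
      m∣n = divides (p ^ a) e
      1≤m×p^a : 1 ≤ p ^ a × 1 ≤ m
      1≤m×p^a = ⊗>0 {p ^ a} (subst (1 ≤_) e 1≤n)
      m≤n : m ≤ n
      m≤n = ∣⇒≤ {{pos 1≤n}} m∣n
      a≤ℒ : a ≤ ℒ
      a≤ℒ = lg-≥ (begin
        2 ^ a ≤⟨ ^-monoˡ-≤ a (prime≥2 pp) ⟩
        p ^ a ≤⟨ m≤m*n (p ^ a) m {{pos (proj₂ 1≤m×p^a)}} ⟩
        p ^ a * m ≡⟨ e ⟨
        n ≤⟨ n≤N ⟩
        N ∎)
        where open ≤-Reasoning
      rec : ∀ k → suc (ϖ y m) ≤ k → 1 ≤ cover k n
      rec (suc k) (s≤s few′) = begin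
        1 ≤⟨ covered k m (proj₂ 1≤m×p^a) (≤-trans m≤n n≤N) (λ q qq q∣m → sm q qq (∣-trans q∣m m∣n)) few′ ⟩
        cover k m ≡⟨ trans (cong (_* cover k m) (⟦⟧-yes (n ≟ p ^ a * m) e)) (*-identityˡ _) ⟨
        ⟦ n ≟ p ^ a * m ⟧ * cover k m ≤⟨ ∑-term S (λ m → ⟦ n ≟ p ^ a * m ⟧ * cover k m) (s≤s (≤-trans m≤n n≤N)) ⟩
        ∑ S (λ m → ⟦ n ≟ p ^ a * m ⟧ * cover k m) ≤⟨ ∑-term (suc ℒ) (λ a → ∑ S (λ m → ⟦ n ≟ p ^ a * m ⟧ * cover k m)) (s≤s a≤ℒ) ⟩
        ∑ (suc ℒ) (λ a → ∑ S (λ m → ⟦ n ≟ p ^ a * m ⟧ * cover k m)) ≤⟨ ∑-term (suc y) (λ p → ∑ (suc ℒ) (λ a → ∑ S (λ m → ⟦ n ≟ p ^ a * m ⟧ * cover k m))) (s≤s p≤y) ⟩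
        ∑ (suc y) (λ p → ∑ (suc ℒ) (λ a → ∑ S (λ m → ⟦ n ≟ p ^ a * m ⟧ * cover k m))) ≤⟨ m≤n+m _ (cover k n) ⟩
        cover (suc k) n ∎
        where open ≤-Reasoning

-- A new prime p doubles the count, since the old divisors are joined by their multiples by p. All
-- these divisors are smooth, so this becomes the lower bound for Ψ.
divisors-primorial : ∀ z N → primorial z ≤ N → 2 ^ π 0 z ≤ ∑ (suc N) (λ n → ⟦ n ∣? primorial z ⟧)
divisors-primorial zero    N h = ≤-trans (≤-reflexive (cong (2 ^_) (⟦⟧0 (prime? 0)))) (≤-trans (≤-reflexive (sym (⟦⟧-yes (1 ∣? 1) ∣-refl))) (∑-term (suc N) (λ n → ⟦ n ∣? 1 ⟧) (s≤s h)))
  where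
  ⟦⟧0 : ∀ (d : Dec (Prime 0)) → ⟦ d ⟧ * 0 ≡ 0
  ⟦⟧0 d = *-zeroʳ ⟦ d ⟧
divisors-primorial (suc z) N h with prime? (suc z)
... | no _ = ≤-trans (≤-reflexive (cong (2 ^_) (+-identityʳ (π 0 z)))) (divisors-primorial z N h)
... | yes pp = begin
    2 ^ (π 0 z + 1) ≡⟨ cong (2 ^_) (+-comm (π 0 z) 1) ⟩
    2 * 2 ^ π 0 z ≤⟨ 2 ⊛ divisors-primorial z N (≤-trans (m≤c*m {suc z} P (s≤s z≤n)) h) ⟩
    2 * ∑ (suc N) (λ n → ⟦ n ∣? P ⟧) ≡⟨ cong (∑ (suc N) (λ n → ⟦ n ∣? P ⟧) +_) (+-identityʳ _) ⟩
    ∑ (suc N) (λ n → ⟦ n ∣? P ⟧) + ∑ (suc N) (λ m → ⟦ m ∣? P ⟧) ≤⟨ +-monoʳ-≤ (∑ (suc N) (λ n → ⟦ n ∣? P ⟧)) (∑-mono (suc N) (λ m _ → scaled m)) ⟩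
    ∑ (suc N) (λ n → ⟦ n ∣? P ⟧) + ∑ (suc N) (λ m → ⟦ p * m ≤? N ⟧ * ⟦ p * m ∣? p * P ⟧) ≡⟨ cong (∑ (suc N) (λ n → ⟦ n ∣? P ⟧) +_) (∑-divisors N p (λ n → ⟦ n ∣? p * P ⟧) (s≤s z≤n)) ⟨
    ∑ (suc N) (λ n → ⟦ n ∣? P ⟧) + ∑ (suc N) (λ n → ⟦ p ∣? n ⟧ * ⟦ n ∣? p * P ⟧) ≡⟨ ∑-+ (suc N) _ _ ⟨
    ∑ (suc N) (λ n → ⟦ n ∣? P ⟧ + ⟦ p ∣? n ⟧ * ⟦ n ∣? p * P ⟧) ≤⟨ ∑-mono (suc N) (λ n _ → disjoint n) ⟩
    ∑ (suc N) (λ n → ⟦ n ∣? p * P ⟧) ∎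
  where
  open ≤-Reasoning
  p = suc z
  P = primorial z
  1≤P : 1 ≤ P
  1≤P = 1≤primes-product 0 z
  scaled : ∀ m → ⟦ m ∣? P ⟧ ≤ ⟦ p * m ≤? N ⟧ * ⟦ p * m ∣? p * P ⟧
  scaled m with m ∣? P
  ... | no _ = z≤n
  ... | yes m∣P = ≤-reflexive (sym (cong₂ _*_ (⟦⟧-yes (p * m ≤? N) (≤-trans (p ⊛ ∣⇒≤ {{pos 1≤P}} m∣P) h)) (⟦⟧-yes (p * m ∣? p * P) (*-monoʳ-∣ p m∣P))))
  disjoint : ∀ n → ⟦ n ∣? P ⟧ + ⟦ p ∣? n ⟧ * ⟦ n ∣? p * P ⟧ ≤ ⟦ n ∣? p * P ⟧
  disjoint n with n ∣? P | p ∣? n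
  ... | no _ | no _ = z≤n
  ... | no _ | yes _ = ≤-reflexive (+-identityʳ _)
  ... | yes n∣P | no _ = ≤-reflexive (sym (⟦⟧-yes (n ∣? p * P) (∣n⇒∣m*n p n∣P)))
  ... | yes n∣P | yes p∣n = ⊥-elim (prime∤primes-product pp 0 z ≤-refl (∣-trans p∣n n∣P))

primorial-smooth : ∀ z n → n ∣ primorial z → Smooth′ z n
primorial-smooth z n n∣ p pp p∣n = ≮⇒≥ λ z<p → prime∤primes-product pp 0 z z<p (∣-trans p∣n n∣)

-- Spreading the weight over the primes of each scale.

invert : ℕ → ℕ → ℕ
invert v n with 1 ≤? v | v ≤? n
... | yes p | yes q = proj₁ (inverse p q)
... | _     | _     = 0

invert-* : ∀ v n → 1 ≤ v → v ≤ n → v * invert v n ≡ n !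
invert-* v n 1≤v v≤n with 1 ≤? v | v ≤? n
... | yes p | yes q = proj₂ (inverse p q)
... | no ¬p | _     = ⊥-elim (¬p 1≤v)
... | yes _ | no ¬q = ⊥-elim (¬q v≤n)

-- The weight lam of the primes in (𝔟^i, 𝔟^(i+1)] adds up to (a multiple of) the increment of U,
-- so that the sum of lam over the primes up to N/m is comparable to V m.
record BlockData : Set where
  constructor blockData
  field
    𝔟 : ℕ
    4≤𝔟 : 4 ≤ 𝔟
    chebyshev : ∀ j → 3 ≤ j → 𝔟 ^ j ≤ suc j * π (𝔟 ^ j) (𝔟 ^ suc j)
    h : ℕ
    1≤h : 1 ≤ h
    k t : ℕ
    2≤k : 2 ≤ k
    1≤t : 1 ≤ t
    N y i₀ i₁ : ℕ
    3≤i₀ : 3 ≤ i₀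
    i₀+2≤i₁ : i₀ + 2 ≤ i₁
    𝔟^i₁≤y : 𝔟 ^ i₁ ≤ y
    y<𝔟^ : y < 𝔟 ^ suc i₁
    y≤N : y ≤ N

module Blocks (blockHyps : BlockData) where
  open BlockData blockHyps

  open Grid h 1≤h

  2≤𝔟 : 2 ≤ 𝔟
  2≤𝔟 = ≤-trans (s≤s (s≤s z≤n)) 4≤𝔟

  ℓ : ℕ
  ℓ = glog N

  g : ℕ → ℕ
  g i = glog (𝔟 ^ i)

  1≤k : 1 ≤ k
  1≤k = <⇒≤ 2≤k

  open Ramp k t ℓ (ℓ ∸ g i₁) 1≤k 1≤t

  1≤𝔟^ : ∀ i → 1 ≤ 𝔟 ^ i
  1≤𝔟^ i = pos-^ i (<⇒≤ 2≤𝔟)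

  𝔟^-mono : ∀ {i j} → i ≤ j → 𝔟 ^ i ≤ 𝔟 ^ j
  𝔟^-mono h = ^-monoʳ-≤ 𝔟 {{pos (<⇒≤ 2≤𝔟)}} h

  1≤N : 1 ≤ N
  1≤N = ≤-trans (1≤𝔟^ i₁) (≤-trans 𝔟^i₁≤y y≤N)

  g-mono : ∀ {i j} → i ≤ j → g i ≤ g j
  g-mono {i} h = glog-mono (1≤𝔟^ i) (𝔟^-mono h)

  g≤ℓ : ∀ {i} → i ≤ i₁ → g i ≤ ℓ
  g≤ℓ {i} h = ≤-trans (g-mono h) (glog-mono (1≤𝔟^ i₁) (≤-trans 𝔟^i₁≤y y≤N))

  -- `U i` stands for V at N/𝔟^i. The first block carries the whole initial value U(i₀ + 1), so that
  -- the increments telescope to `U`, and the last block extends to y. The weight `w i` stands for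
  -- inc i 𝒩 / cnt i with 𝒩 = (y + 1)!, which is an integer because cnt i ≤ y + 1.
  U hi cnt inc w : ℕ → ℕ
  U i = F (ℓ ∸ g i)
  hi i with suc i <? i₁
  ... | yes _ = 𝔟 ^ suc i
  ... | no  _ = y
  cnt i = π (𝔟 ^ i) (hi i)
  inc i with i ≟ i₀
  ... | yes _ = U (suc i₀)
  ... | no  _ = U (suc i) ∸ U i
  w i = inc i * invert (cnt i) (suc y)

  𝒩 : ℕ
  𝒩 = suc y !

  1≤𝒩 : 1 ≤ 𝒩
  1≤𝒩 = 1≤n! (suc y)

  ind : ℕ → ℕ → ℕ
  ind i q = ⟦ prime? q ⟧ * (⟦ 𝔟 ^ i <? q ⟧ * ⟦ q ≤? hi i ⟧)

  lam : ℕ → ℕ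
  lam q = ∑ i₁ (λ i → ⟦ i₀ ≤? i ⟧ * (ind i q * w i))

  hi≤y : ∀ i → hi i ≤ y
  hi≤y i with suc i <? i₁
  ... | yes p = ≤-trans (𝔟^-mono (<⇒≤ p)) 𝔟^i₁≤y
  ... | no  _ = ≤-refl

  𝔟^≤hi : ∀ i → i < i₁ → 𝔟 ^ suc i ≤ hi i
  𝔟^≤hi i i<i₁ with suc i <? i₁
  ... | yes _ = ≤-refl
  ... | no  _ = ≤-trans (𝔟^-mono i<i₁) 𝔟^i₁≤y

  hi<𝔟^ : ∀ i → i < i₁ → hi i < 𝔟 ^ (2 + i)
  hi<𝔟^ i i<i₁ with suc i <? i₁
  ... | yes _ = ^-monoʳ-< 𝔟 2≤𝔟 {suc i} {2 + i} ≤-refl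
  ... | no ¬p = <-≤-trans y<𝔟^ (𝔟^-mono (s≤s (≮⇒≥ ¬p)))

  hi≤𝔟^ : ∀ i j → i < j → j < i₁ → hi i ≤ 𝔟 ^ j
  hi≤𝔟^ i j i<j j<i₁ with suc i <? i₁
  ... | yes _ = 𝔟^-mono i<j
  ... | no ¬p = ⊥-elim (¬p (≤-<-trans i<j j<i₁))

  cnt-lower : ∀ i → i₀ ≤ i → i < i₁ → 𝔟 ^ i ≤ suc i * cnt i
  cnt-lower i i₀≤i i<i₁ = ≤-trans (chebyshev i (≤-trans 3≤i₀ i₀≤i)) (suc i ⊛ ∑-≤ _ (s≤s (𝔟^≤hi i i<i₁)))

  1≤cnt : ∀ i → i₀ ≤ i → i < i₁ → 1 ≤ cnt i
  1≤cnt i p q = proj₂ (⊗>0 {suc i} (≤-trans (1≤𝔟^ i) (cnt-lower i p q)))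

  cnt≤ : ∀ i → cnt i ≤ suc (hi i)
  cnt≤ i = ≤-trans (∑-bounded (suc (hi i)) 1 _ (λ q _ → *-mono-≤ (⟦⟧≤1 (prime? q)) (⟦⟧≤1 (𝔟 ^ i <? q)))) (≤-reflexive (*-identityʳ _))

  w-cnt : ∀ i → i₀ ≤ i → i < i₁ → cnt i * w i ≡ inc i * 𝒩
  w-cnt i p q = trans (ar (cnt i) (inc i) _) (cong (inc i *_) (invert-* (cnt i) (suc y) (1≤cnt i p q) (≤-trans (cnt≤ i) (s≤s (hi≤y i)))))
    where
    ar : ∀ a b c → a * (b * c) ≡ b * (a * c)
    ar a b c = solve (a ∷ b ∷ c ∷ [])

  ∑-ind : ∀ i → ∑ (suc y) (ind i) ≡ cnt i
  ∑-ind i = case ≤⇒+ (hi≤y i) of λ (o , e) → begin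
    ∑ (suc y) (ind i)                                         ≡⟨ cong (λ z → ∑ (suc z) (ind i)) e ⟩
    ∑ (suc (hi i) + o) (ind i)                                ≡⟨ ∑-split (suc (hi i)) o (ind i) ⟩
    ∑ (suc (hi i)) (ind i) + ∑ o (λ a → ind i (suc (hi i) + a)) ≡⟨ cong₂ _+_
      (∑-cong (suc (hi i)) (λ q q< → cong (⟦ prime? q ⟧ *_) (trans (cong (⟦ 𝔟 ^ i <? q ⟧ *_) (⟦⟧-yes (q ≤? hi i) (≤-pred q<))) (*-identityʳ _))))
      (∑-zero o (λ a _ → trans (cong (λ z → ⟦ prime? (suc (hi i) + a) ⟧ * (⟦ 𝔟 ^ i <? suc (hi i) + a ⟧ * z)) (⟦⟧-no (suc (hi i) + a ≤? hi i) (<⇒≱ (s≤s (m≤m+n (hi i) a)))))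
        (trans (cong (⟦ prime? (suc (hi i) + a) ⟧ *_) (*-zeroʳ ⟦ 𝔟 ^ i <? suc (hi i) + a ⟧)) (*-zeroʳ ⟦ prime? (suc (hi i) + a) ⟧)))) ⟩
    cnt i + 0                                                 ≡⟨ +-identityʳ (cnt i) ⟩
    cnt i                                                     ∎
    where open ≡-Reasoning

  ∑-lam : ∀ (φ : ℕ → ℕ) → ∑ (suc y) (λ q → lam q * φ q) ≡ ∑ i₁ (λ i → ⟦ i₀ ≤? i ⟧ * (w i * ∑ (suc y) (λ q → ind i q * φ q)))
  ∑-lam φ = trans (∑-ext (suc y) (λ q → sym (∑-*ʳ i₁ (φ q) _))) (trans (∑-swap (suc y) i₁ _)
    (∑-ext i₁ (λ i → trans (∑-ext (suc y) (λ q → ar ⟦ i₀ ≤? i ⟧ (ind i q) (w i) (φ q))) (trans (∑-*ˡ (suc y) ⟦ i₀ ≤? i ⟧ _) (cong (⟦ i₀ ≤? i ⟧ *_) (∑-*ˡ (suc y) (w i) _))))))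
    where
    ar : ∀ a b c d → a * (b * c) * d ≡ a * (c * (b * d))
    ar a b c d = solve (a ∷ b ∷ c ∷ d ∷ [])

  ∑-lam-≤ : ∀ (φ b : ℕ → ℕ) → (∀ q → φ q ≤ 1) → (∀ i q → 𝔟 ^ i < q → φ q ≤ b i) →
    ∑ (suc y) (λ q → lam q * φ q) ≤ ∑ i₁ (λ i → ⟦ i₀ ≤? i ⟧ * (b i * inc i)) * 𝒩
  ∑-lam-≤ φ b φ≤1 φ≤b = begin
    ∑ (suc y) (λ q → lam q * φ q)                                          ≡⟨ ∑-lam φ ⟩
    ∑ i₁ (λ i → ⟦ i₀ ≤? i ⟧ * (w i * ∑ (suc y) (λ q → ind i q * φ q)))      ≤⟨ ∑-mono i₁ (λ i i<i₁ → ⟦⟧*-mono (i₀ ≤? i) (λ i₀≤i → term i i<i₁ i₀≤i)) ⟩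
    ∑ i₁ (λ i → ⟦ i₀ ≤? i ⟧ * (b i * inc i * 𝒩))                            ≡⟨ ∑-ext i₁ (λ i → sym (*-assoc ⟦ i₀ ≤? i ⟧ (b i * inc i) 𝒩)) ⟩
    ∑ i₁ (λ i → ⟦ i₀ ≤? i ⟧ * (b i * inc i) * 𝒩)                            ≡⟨ ∑-*ʳ i₁ 𝒩 _ ⟩
    ∑ i₁ (λ i → ⟦ i₀ ≤? i ⟧ * (b i * inc i)) * 𝒩                            ∎
    where
    open ≤-Reasoning
    ar : ∀ w b c → w * (c * b) ≡ b * (c * w)
    ar w b c = solve (w ∷ b ∷ c ∷ [])
    term : ∀ i → i < i₁ → i₀ ≤ i → w i * ∑ (suc y) (λ q → ind i q * φ q) ≤ b i * inc i * 𝒩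
    term i i<i₁ i₀≤i = begin
      w i * ∑ (suc y) (λ q → ind i q * φ q)  ≤⟨ w i ⊛ ∑-mono (suc y) (λ q _ → bound q) ⟩
      w i * ∑ (suc y) (λ q → ind i q * b i)  ≡⟨ cong (w i *_) (trans (∑-*ʳ (suc y) (b i) (ind i)) (cong (_* b i) (∑-ind i))) ⟩
      w i * (cnt i * b i)                    ≡⟨ ar (w i) (b i) (cnt i) ⟩
      b i * (cnt i * w i)                    ≡⟨ cong (b i *_) (w-cnt i i₀≤i i<i₁) ⟩
      b i * (inc i * 𝒩)                      ≡⟨ *-assoc (b i) (inc i) 𝒩 ⟨
      b i * inc i * 𝒩                        ∎
      where
      bound : ∀ q → ind i q * φ q ≤ ind i q * b i
      bound q = >0*-mono (ind i q) (λ p → φ≤b i q (⟦⟧>0 (𝔟 ^ i <? q) (proj₁ (⊗>0 {⟦ 𝔟 ^ i <? q ⟧} (proj₂ (⊗>0 {⟦ prime? q ⟧} p))))))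

  U-mono : ∀ {i j} → i ≤ j → U i ≤ U j
  U-mono h = F-dec (∸-monoʳ-≤ ℓ (g-mono h))

  cumulative : ∀ j → i₀ < j → ∑ j (λ i → ⟦ i₀ ≤? i ⟧ * inc i) ≡ U j
  cumulative (suc j) (s≤s i₀≤j) with m≤n⇒m<n∨m≡n i₀≤j
  ... | inj₂ refl = trans (cong₂ _+_ (∑-zero i₀ (λ i i<i₀ → cong (_* inc i) (⟦⟧-no (i₀ ≤? i) (<⇒≱ i<i₀)))) (trans (cong (_* inc i₀) (⟦⟧-yes (i₀ ≤? i₀) ≤-refl)) (*-identityˡ _))) inc₀
    where
    inc₀ : inc i₀ ≡ U (suc i₀)
    inc₀ with i₀ ≟ i₀
    ... | yes _ = refl
    ... | no ¬p = ⊥-elim (¬p refl)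
  ... | inj₁ i₀<j = trans (cong₂ _+_ (cumulative j i₀<j) (trans (cong (_* inc j) (⟦⟧-yes (i₀ ≤? j) i₀≤j)) (trans (*-identityˡ _) incⱼ))) (m+[n∸m]≡n (U-mono (n≤1+n j)))
    where
    incⱼ : inc j ≡ U (suc j) ∸ U j
    incⱼ with j ≟ i₀
    ... | yes e = ⊥-elim (<⇒≢ i₀<j (sym e))
    ... | no _ = refl

  U-ratio : ∀ i o → U (i + o) ≤ 2 * 𝔟 ^ o * U i
  U-ratio i o = F-ratio (ℓ ∸ g (i + o)) (ℓ ∸ g i) (𝔟 ^ o) (1≤𝔟^ o) (begin
    ℓ ∸ g i                                          ≤⟨ m≤n+m∸n (ℓ ∸ g i) (glog (𝔟 ^ o) + 1) ⟩
    (glog (𝔟 ^ o) + 1) + (ℓ ∸ g i ∸ (glog (𝔟 ^ o) + 1)) ≡⟨ cong (glog (𝔟 ^ o) + 1 +_) (∸-+-assoc ℓ (g i) _) ⟩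
    (glog (𝔟 ^ o) + 1) + (ℓ ∸ (g i + (glog (𝔟 ^ o) + 1))) ≤⟨ +-monoʳ-≤ (glog (𝔟 ^ o) + 1) (∸-monoʳ-≤ ℓ step) ⟩
    (glog (𝔟 ^ o) + 1) + (ℓ ∸ g (i + o))            ≡⟨ +-comm (glog (𝔟 ^ o) + 1) _ ⟩
    (ℓ ∸ g (i + o)) + (glog (𝔟 ^ o) + 1)            ∎)
    where
    open ≤-Reasoning
    step : g (i + o) ≤ g i + (glog (𝔟 ^ o) + 1)
    step = begin
      glog (𝔟 ^ (i + o))      ≡⟨ cong glog (^-distribˡ-+-* 𝔟 i o) ⟩
      glog (𝔟 ^ i * 𝔟 ^ o)   ≤⟨ glog-≤+ (𝔟 ^ i) (𝔟 ^ o) (1≤𝔟^ i) (1≤𝔟^ o) ⟩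
      g i + g o + 1            ≡⟨ +-assoc (g i) (g o) 1 ⟩
      g i + (glog (𝔟 ^ o) + 1) ∎

  U-step : ∀ i → U (suc i) ≤ 2 * 𝔟 * U i
  U-step i = subst₂ (λ z c → U z ≤ 2 * c * U i) (+-comm i 1) (*-identityʳ 𝔟) (U-ratio i 1)

  W : ℕ → ℕ
  W m = ∑ (suc y) (λ q → lam q * ⟦ q * m ≤? N ⟧)

  V≥U : ∀ i m → 1 ≤ m → 𝔟 ^ i * m ≤ N → U i ≤ V m
  V≥U i m 1≤m h = F-dec (≤-trans (≤-reflexive (sym (m+n∸n≡m (glog m) (g i)))) (∸-monoˡ-≤ (g i)
    (≤-trans (≤-reflexive (+-comm (glog m) (g i))) (≤-trans (glog-+≤ (𝔟 ^ i) m (1≤𝔟^ i) 1≤m) (glog-mono (pos-* (1≤𝔟^ i) 1≤m) h)))))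

  -- Only blocks that begin below N/m contribute. If j is the last of them, they add up to at most
  -- U(j + 1) ≤ 2𝔟 U(j), and U(j) ≤ V(m).
  W≤V : ∀ m → 1 ≤ m → W m ≤ 2 * 𝔟 * (𝒩 * V m)
  W≤V m 1≤m = ≤-trans (∑-lam-≤ (λ q → ⟦ q * m ≤? N ⟧) (λ i → ⟦ 𝔟 ^ i * m ≤? N ⟧) (λ q → ⟦⟧≤1 (q * m ≤? N))
      (λ i q l → ⟦⟧-mono (q * m ≤? N) (𝔟 ^ i * m ≤? N) (≤-trans (*-monoˡ-≤ m (<⇒≤ l)))))
    (≤-trans (*-monoˡ-≤ 𝒩 (partial i₁)) (≤-reflexive (ar 𝔟 (V m) 𝒩)))
    where
    ar : ∀ c v n → 2 * c * v * n ≡ 2 * c * (n * v)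
    ar c v n = solve (c ∷ v ∷ n ∷ [])
    f : ℕ → ℕ
    f i = ⟦ i₀ ≤? i ⟧ * (⟦ 𝔟 ^ i * m ≤? N ⟧ * inc i)
    partial : ∀ j → ∑ j f ≤ 2 * 𝔟 * V m
    partial zero    = z≤n
    partial (suc j) with i₀ ≤? j | 𝔟 ^ j * m ≤? N
    ... | no _ | _ = ≤-trans (≤-reflexive (+-identityʳ _)) (partial j)
    ... | yes _ | no _ = ≤-trans (≤-reflexive (+-identityʳ _)) (partial j)
    ... | yes i₀≤j | yes p = begin
      ∑ j f + 1 * (1 * inc j) ≤⟨ +-mono-≤ (∑-mono j (λ i _ → ⟦ i₀ ≤? i ⟧ ⊛ ⟦⟧*≤ (𝔟 ^ i * m ≤? N) (λ _ → ≤-refl)))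
                                   (≤-reflexive (trans (*-identityˡ _) (trans (*-identityˡ _) (sym (trans (cong (_* inc j) (⟦⟧-yes (i₀ ≤? j) i₀≤j)) (*-identityˡ _)))))) ⟩
      ∑ (suc j) (λ i → ⟦ i₀ ≤? i ⟧ * inc i) ≡⟨ cumulative (suc j) (s≤s i₀≤j) ⟩
      U (suc j) ≤⟨ U-step j ⟩
      2 * 𝔟 * U j ≤⟨ (2 * 𝔟) ⊛ V≥U j m 1≤m p ⟩
      2 * 𝔟 * V m ∎
      where open ≤-Reasoning

  W≥U : ∀ j m → i₀ < j → j < i₁ → 𝔟 ^ j * m ≤ N → 𝒩 * U j ≤ W m
  W≥U j m i₀<j j<i₁ h = begin
    𝒩 * U j                                                   ≡⟨ trans (*-comm 𝒩 (U j)) (cong (_* 𝒩) (sym (cumulative j i₀<j))) ⟩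
    ∑ j (λ i → ⟦ i₀ ≤? i ⟧ * inc i) * 𝒩                        ≡⟨ trans (sym (∑-*ʳ j 𝒩 _)) (∑-ext j (λ i → *-assoc ⟦ i₀ ≤? i ⟧ (inc i) 𝒩)) ⟩
    ∑ j (λ i → ⟦ i₀ ≤? i ⟧ * (inc i * 𝒩))                      ≤⟨ ∑-mono j (λ i i<j → ⟦⟧*-mono (i₀ ≤? i) (λ i₀≤i → ≤-reflexive (term i i<j i₀≤i))) ⟩
    ∑ j (λ i → ⟦ i₀ ≤? i ⟧ * (w i * ∑ (suc y) (λ q → ind i q * ⟦ q * m ≤? N ⟧))) ≤⟨ ∑-≤ _ (<⇒≤ j<i₁) ⟩
    ∑ i₁ (λ i → ⟦ i₀ ≤? i ⟧ * (w i * ∑ (suc y) (λ q → ind i q * ⟦ q * m ≤? N ⟧))) ≡⟨ ∑-lam (λ q → ⟦ q * m ≤? N ⟧) ⟨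
    W m                                                       ∎
    where
    open ≤-Reasoning
    full : ∀ i → i < j → ∀ q → ind i q * ⟦ q * m ≤? N ⟧ ≡ ind i q
    full i i<j q with q ≤? hi i
    ... | no _ = trans (cong (_* ⟦ q * m ≤? N ⟧) z) (sym z)
      where
      z : ⟦ prime? q ⟧ * (⟦ 𝔟 ^ i <? q ⟧ * 0) ≡ 0
      z = trans (cong (⟦ prime? q ⟧ *_) (*-zeroʳ ⟦ 𝔟 ^ i <? q ⟧)) (*-zeroʳ ⟦ prime? q ⟧)
    ... | yes p = trans (cong (⟦ prime? q ⟧ * (⟦ 𝔟 ^ i <? q ⟧ * 1) *_) (⟦⟧-yes (q * m ≤? N) (≤-trans (*-monoˡ-≤ m (≤-trans p (hi≤𝔟^ i j i<j j<i₁))) h))) (*-identityʳ _)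
    term : ∀ i → i < j → i₀ ≤ i → inc i * 𝒩 ≡ w i * ∑ (suc y) (λ q → ind i q * ⟦ q * m ≤? N ⟧)
    term i i<j i₀≤i = trans (sym (w-cnt i i₀≤i (<-trans i<j j<i₁))) (trans (*-comm (cnt i) (w i)) (cong (w i *_) (sym (trans (∑-ext (suc y) (full i i<j)) (∑-ind i)))))

  V≤U : ∀ i m → 1 ≤ m → N < 𝔟 ^ suc i * m → V m ≤ 4 * 𝔟 * U i
  V≤U i m 1≤m h = begin
    V m                         ≤⟨ F-dec low ⟩
    F (ℓ ∸ (g (suc i) + 1))     ≤⟨ F-ratio (ℓ ∸ (g (suc i) + 1)) (ℓ ∸ g (suc i)) 1 ≤-refl (≤-trans shift (+-monoʳ-≤ _ (m≤n+m 1 (glog 1)))) ⟩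
    2 * U (suc i)               ≤⟨ 2 ⊛ U-step i ⟩
    2 * (2 * 𝔟 * U i)           ≡⟨ ar₂ 𝔟 (U i) ⟩
    4 * 𝔟 * U i                 ∎
    where
    open ≤-Reasoning
    ar₂ : ∀ c u → 2 * (2 * c * u) ≡ 4 * c * u
    ar₂ c u = solve (c ∷ u ∷ [])
    low : ℓ ∸ (g (suc i) + 1) ≤ glog m
    low = m≤n+o⇒m∸n≤o ℓ (g (suc i) + 1) (≤-trans (glog-mono 1≤N (<⇒≤ h)) (≤-trans (glog-≤+ (𝔟 ^ suc i) m (1≤𝔟^ (suc i)) 1≤m) (≤-reflexive (ar (g (suc i)) (glog m)))))
      where
      ar : ∀ a b → a + b + 1 ≡ a + 1 + b
      ar a b = solve (a ∷ b ∷ [])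
    shift : ℓ ∸ g (suc i) ≤ ℓ ∸ (g (suc i) + 1) + 1
    shift = ≤-trans (m≤n+m∸n (ℓ ∸ g (suc i)) 1) (≤-reflexive (trans (cong (1 +_) (∸-+-assoc ℓ (g (suc i)) 1)) (+-comm 1 _)))

  -- If 𝔟^j ≤ N/m < 𝔟^(j + 1), the blocks before j count fully and give U(j), comparable to V(m). If
  -- N/m reaches the last block, V may be larger than there, but by no more than its flat value V(0)
  -- = U(i₁), since the ramp starts at the logarithm of N/𝔟^i₁.
  V≤W : ∀ m → 1 ≤ m → m * 𝔟 ^ suc i₀ ≤ N → 𝒩 * V m ≤ 4 * 𝔟 * W m
  V≤W m 1≤m h = case ≤⇒+ i₀+2≤i₁ of λ (o , e) → go o e
    where
    close : ∀ j → i₀ < j → j < i₁ → 𝔟 ^ j * m ≤ N → V m ≤ 4 * 𝔟 * U j → 𝒩 * V m ≤ 4 * 𝔟 * W m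
    close j a b c d = ≤-trans (𝒩 ⊛ d) (≤-trans (≤-reflexive (ar 𝔟 𝒩 (U j))) ((4 * 𝔟) ⊛ W≥U j m a b c))
      where
      ar : ∀ c n u → n * (4 * c * u) ≡ 4 * c * (n * u)
      ar c n u = solve (c ∷ n ∷ u ∷ [])
    P₀ : 𝔟 ^ (suc i₀ + 0) * m ≤ N
    P₀ = ≤-trans (≤-reflexive (trans (cong (λ z → 𝔟 ^ z * m) (+-identityʳ (suc i₀))) (*-comm _ m))) h
    go : ∀ o → i₁ ≡ i₀ + 2 + o → 𝒩 * V m ≤ 4 * 𝔟 * W m
    go o e with 𝔟 ^ (suc i₀ + o) * m ≤? N
    ... | yes p = close (suc i₀ + o) (s≤s (m≤m+n i₀ o)) (≤-reflexive (sym i₁≡)) p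
          (≤-trans (V-antitone {0} {m} z≤n) (≤-trans (≤-reflexive top) (≤-trans (U-step (suc i₀ + o)) (*-monoˡ-≤ (U (suc i₀ + o)) (*-monoˡ-≤ 𝔟 {2} {4} (s≤s (s≤s z≤n)))))))
      where
      i₁≡ : i₁ ≡ suc (suc i₀ + o)
      i₁≡ = trans e (ar i₀ o)
        where
        ar : ∀ i o → i + 2 + o ≡ suc (suc i + o)
        ar i o = solve (i ∷ o ∷ [])
      top : V 0 ≡ U (suc (suc i₀ + o))
      top = trans (sym (F-flat (ℓ ∸ g i₁) ≤-refl)) (cong U i₁≡)
    ... | no ¬p = case search (λ n → 𝔟 ^ (suc i₀ + n) * m ≤? N) o P₀ ¬p of λ (n , pn , ¬pn) → found n pn ¬pn
      where
      found : ∀ n → 𝔟 ^ (suc i₀ + n) * m ≤ N → ¬ (𝔟 ^ (suc i₀ + suc n) * m ≤ N) → 𝒩 * V m ≤ 4 * 𝔟 * W m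
      found n pn ¬pn = close (suc i₀ + n) (s≤s (m≤m+n i₀ n)) n<i₁ pn (V≤U (suc i₀ + n) m 1≤m (subst (λ z → N < 𝔟 ^ z * m) (+-suc (suc i₀) n) (≰⇒> ¬pn)))
        where
        n<o : n < o
        n<o = ≰⇒> λ o≤n → ¬p (≤-trans (*-monoˡ-≤ m (𝔟^-mono (+-monoʳ-≤ (suc i₀) o≤n))) pn)
        n<i₁ : suc i₀ + n < i₁
        n<i₁ = subst (suc i₀ + n <_) (sym e) (≤-trans (s≤s (s≤s (+-monoʳ-≤ i₀ (<⇒≤ n<o)))) (≤-reflexive (ar i₀ o)))
          where
          ar : ∀ i o → suc (suc (i + o)) ≡ i + 2 + o
          ar i o = solve (i ∷ o ∷ [])

  σ-bound : ∀ j X → i₀ < j → j ≤ i₁ → X ≤ 𝔟 ^ j → ∑ (suc y) (λ q → lam q * ⟦ q <? X ⟧) ≤ 𝒩 * U j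
  σ-bound j X i₀<j j≤i₁ X≤ = ≤-trans (∑-lam-≤ (λ q → ⟦ q <? X ⟧) (λ i → ⟦ i <? j ⟧) (λ q → ⟦⟧≤1 (q <? X))
      (λ i q l → ⟦⟧-mono (q <? X) (i <? j) (λ q<X → ≰⇒> λ j≤i → <⇒≱ (<-trans l q<X) (≤-trans X≤ (𝔟^-mono j≤i)))))
    (≤-trans (*-monoˡ-≤ 𝒩 (≤-reflexive eq)) (≤-reflexive (*-comm (U j) 𝒩)))
    where
    eq : ∑ i₁ (λ i → ⟦ i₀ ≤? i ⟧ * (⟦ i <? j ⟧ * inc i)) ≡ U j
    eq = case ≤⇒+ j≤i₁ of λ (o , e) → trans (cong (λ z → ∑ z (λ i → ⟦ i₀ ≤? i ⟧ * (⟦ i <? j ⟧ * inc i))) e)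
      (trans (∑-split j o _) (trans (cong₂ _+_
        (trans (∑-cong j (λ i i<j → cong (⟦ i₀ ≤? i ⟧ *_) (trans (cong (_* inc i) (⟦⟧-yes (i <? j) i<j)) (*-identityˡ _)))) (cumulative j i₀<j))
        (∑-zero o (λ a _ → trans (cong (λ z → ⟦ i₀ ≤? j + a ⟧ * (z * inc (j + a))) (⟦⟧-no (j + a <? j) (≤⇒≯ (m≤m+n j a)))) (*-zeroʳ ⟦ i₀ ≤? j + a ⟧))))
      (+-identityʳ (U j))))

  -- The threshold has to bound every single weight, so that one prime changes the normaliser by a
  -- factor of at most 2, and it has to dwarf the weight of the primes below a fixed bound. The
  -- factor i₁, of order log y, achieves both.
  U₀ Λ : ℕ
  U₀ = U (suc i₀)
  Λ = 2 * i₁ * (U₀ * 𝒩)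

  1≤Λ : 1 ≤ Λ
  1≤Λ = pos-* (pos-* {2} (s≤s z≤n) (≤-trans (≤-trans (s≤s z≤n) (m≤n+m 2 i₀)) i₀+2≤i₁)) (pos-* (1≤F (ℓ ∸ g (suc i₀))) 1≤𝒩)

  inc≤U : ∀ i → inc i ≤ U (suc i)
  inc≤U i with i ≟ i₀
  ... | yes refl = ≤-refl
  ... | no _     = m∸n≤m (U (suc i)) (U i)

  w≤Λ : ∀ i → i₀ ≤ i → i < i₁ → w i ≤ Λ
  w≤Λ i i₀≤i i<i₁ = case ≤⇒+ i₀≤i of λ (o , e) → cancelˡ (𝔟 ^ i) (1≤𝔟^ i)
    (arith (𝔟 ^ i) (w i) i₁ (cnt i) (suc i) (inc i) 𝒩 (U (suc i)) U₀ (𝔟 ^ o) i<i₁ (cnt-lower i i₀≤i i<i₁) (w-cnt i i₀≤i i<i₁) (inc≤U i)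
      (subst (λ z → U (suc z) ≤ 2 * 𝔟 ^ o * U₀) (sym e) (U-ratio (suc i₀) o)) (𝔟^-mono (≤-trans (m≤n+m o i₀) (≤-reflexive (sym e)))))
    where
    arith : ∀ p w i₁ c si inc n U U₀ po → si ≤ i₁ → p ≤ si * c → c * w ≡ inc * n → inc ≤ U → U ≤ 2 * po * U₀ → po ≤ p → p * w ≤ p * (2 * i₁ * (U₀ * n))
    arith p w i₁ c si inc n U U₀ po h₁ h₂ h₃ h₄ h₅ h₆ = begin
      p * w                        ≤⟨ *-monoˡ-≤ w h₂ ⟩
      si * c * w                   ≡⟨ trans (*-assoc si c w) (cong (si *_) h₃) ⟩
      si * (inc * n)               ≤⟨ *-mono-≤ h₁ (*-monoˡ-≤ n (≤-trans h₄ (≤-trans h₅ (*-monoˡ-≤ U₀ (2 ⊛ h₆))))) ⟩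
      i₁ * (2 * p * U₀ * n)        ≡⟨ ar i₁ p U₀ n ⟩
      p * (2 * i₁ * (U₀ * n))      ∎
      where
      open ≤-Reasoning
      ar : ∀ i₁ p U₀ n → i₁ * (2 * p * U₀ * n) ≡ p * (2 * i₁ * (U₀ * n))
      ar i₁ p U₀ n = solve (i₁ ∷ p ∷ U₀ ∷ n ∷ [])

  ind-bounds : ∀ i q → 0 < ind i q → Prime q × 𝔟 ^ i < q × q ≤ hi i
  ind-bounds i q p = ⟦⟧>0 (prime? q) (proj₁ (⊗>0 {⟦ prime? q ⟧} p)) ,
    ⟦⟧>0 (𝔟 ^ i <? q) (proj₁ (⊗>0 {⟦ 𝔟 ^ i <? q ⟧} (proj₂ (⊗>0 {⟦ prime? q ⟧} p)))) ,
    ⟦⟧>0 (q ≤? hi i) (proj₂ (⊗>0 {⟦ 𝔟 ^ i <? q ⟧} (proj₂ (⊗>0 {⟦ prime? q ⟧} p))))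

  ind≤1 : ∀ i q → ind i q ≤ 1
  ind≤1 i q = *-mono-≤ (⟦⟧≤1 (prime? q)) (*-mono-≤ (⟦⟧≤1 (𝔟 ^ i <? q)) (⟦⟧≤1 (q ≤? hi i)))

  lam-term : ℕ → ℕ → ℕ
  lam-term q i = ⟦ i₀ ≤? i ⟧ * (ind i q * w i)

  lam-term>0 : ∀ q i → 0 < lam-term q i → i₀ ≤ i × 0 < ind i q
  lam-term>0 q i p = ⟦⟧>0 (i₀ ≤? i) (proj₁ (⊗>0 {⟦ i₀ ≤? i ⟧} p)) , proj₁ (⊗>0 {ind i q} (proj₂ (⊗>0 {⟦ i₀ ≤? i ⟧} p)))

  lam≤Λ : ∀ q → lam q ≤ Λ
  lam≤Λ q = ∑-atmost i₁ Λ (lam-term q) (λ i i<i₁ → ⟦⟧*≤ (i₀ ≤? i) (λ i₀≤i → ≤-trans (*-mono-≤ (ind≤1 i q) (w≤Λ i i₀≤i i<i₁)) (≤-reflexive (*-identityˡ Λ))))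
    (λ i j i<j j<i₁ fi>0 → n<1⇒n≡0 (≰⇒> λ fj>0 → <⇒≱ (proj₁ (proj₂ (ind-bounds j q (proj₂ (lam-term>0 q j fj>0)))))
      (≤-trans (proj₂ (proj₂ (ind-bounds i q (proj₂ (lam-term>0 q i fi>0))))) (hi≤𝔟^ i j i<j j<i₁))))

  lam>0 : ∀ q → 0 < lam q → Prime q × 𝔟 ^ i₀ < q
  lam>0 q p = case ∑>0 i₁ (lam-term q) p of λ (i , _ , fi>0) →
    proj₁ (ind-bounds i q (proj₂ (lam-term>0 q i fi>0))) ,
    ≤-<-trans (𝔟^-mono (proj₁ (lam-term>0 q i fi>0))) (proj₁ (proj₂ (ind-bounds i q (proj₂ (lam-term>0 q i fi>0)))))

  lam≥w : ∀ q → Prime q → 𝔟 ^ i₀ < q → q ≤ y → ∃ λ i → i₀ ≤ i × i < i₁ × w i ≤ lam q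
  lam≥w q pq l q≤y = case ≤⇒+ i₀+2≤i₁ of λ (o , e) → go (suc o) (trans e (ar i₀ o))
    where
    ar : ∀ i o → i + 2 + o ≡ suc (i + suc o)
    ar i o = solve (i ∷ o ∷ [])
    found : ∀ i → i₀ ≤ i → i < i₁ → 𝔟 ^ i < q → q ≤ hi i → ∃ λ i → i₀ ≤ i × i < i₁ × w i ≤ lam q
    found i i₀≤i i<i₁ a b = i , i₀≤i , i<i₁ , ≤-trans (≤-reflexive (sym (trans (cong₂ (λ u v → u * (v * w i)) (⟦⟧-yes (i₀ ≤? i) i₀≤i)
        (cong₂ _*_ (⟦⟧-yes (prime? q) pq) (cong₂ _*_ (⟦⟧-yes (𝔟 ^ i <? q) a) (⟦⟧-yes (q ≤? hi i) b)))) (trans (*-identityˡ _) (*-identityˡ _)))))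
        (∑-term i₁ (lam-term q) i<i₁)
    hi-last : ∀ i → suc i ≡ i₁ → hi i ≡ y
    hi-last i e with suc i <? i₁
    ... | yes p = ⊥-elim (<⇒≢ p e)
    ... | no _  = refl
    go : ∀ o → i₁ ≡ suc (i₀ + o) → ∃ λ i → i₀ ≤ i × i < i₁ × w i ≤ lam q
    go o e with 𝔟 ^ (i₀ + o) <? q
    ... | yes p = found (i₀ + o) (m≤m+n i₀ o) (≤-reflexive (sym e)) p (subst (q ≤_) (sym (hi-last (i₀ + o) (sym e))) q≤y)
    ... | no ¬p = case search (λ n → 𝔟 ^ (i₀ + n) <? q) o (subst (λ z → 𝔟 ^ z < q) (sym (+-identityʳ i₀)) l) ¬p of λ (n , pn , ¬pn) →
        let n<i₁ = ≤-trans (s≤s (+-monoʳ-≤ i₀ (<⇒≤ (≰⇒> λ o≤n → ¬p (≤-<-trans (𝔟^-mono (+-monoʳ-≤ i₀ o≤n)) pn))))) (≤-reflexive (sym e))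
        in found (i₀ + n) (m≤m+n i₀ n) n<i₁ pn (≤-trans (subst (λ z → q ≤ 𝔟 ^ z) (+-suc i₀ n) (≮⇒≥ ¬pn)) (𝔟^≤hi (i₀ + n) n<i₁))

  C : ℕ
  C = (1 + H) ^ (g (suc i₀) + emax + 1)

  -- As 𝔟 ≥ 4, a block spans at least two grid steps, so that `F-drop` applies to it.
  U-drop : ∀ i → i₀ ≤ i → i < i₁ → U (suc i) ≤ D * inc i
  U-drop i i₀≤i i<i₁ with i ≟ i₀
  ... | yes refl = m≤c*m (U (suc i)) 1≤D
  ... | no _ = +-cancelˡ-≤ (D * U i) _ _ (≤-trans (≤-trans (+-monoˡ-≤ (U (suc i)) (D ⊛ F-dec gap)) (F-drop a 2≤k (∸-monoʳ-≤ ℓ (g-mono i<i₁)) (≤-trans gap (m∸n≤m ℓ (g i)))))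
        (≤-reflexive (trans (cong (D *_) (sym (m+[n∸m]≡n (U-mono (n≤1+n i))))) (*-distribˡ-+ D (U i) (U (suc i) ∸ U i)))))
    where
    a = ℓ ∸ g (suc i)
    2≤g : 2 ≤ glog 𝔟
    2≤g = ≤-trans (2 ⊛ 1≤h) (≤-trans (glog-2^ 2) (glog-mono {4} (s≤s z≤n) 4≤𝔟))
    gap : 2 + a ≤ ℓ ∸ g i
    gap = m+n≤o⇒m≤o∸n (2 + a) (≤-trans (≤-reflexive (ar a (g i))) (≤-trans (+-monoʳ-≤ a (≤-trans (+-monoˡ-≤ (g i) 2≤g) (glog-+≤ 𝔟 (𝔟 ^ i) (<⇒≤ 2≤𝔟) (1≤𝔟^ i)))) (≤-reflexive (m∸n+n≡m (g≤ℓ i<i₁)))))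
      where
      ar : ∀ a g → 2 + a + g ≡ a + (2 + g)
      ar a g = solve (a ∷ g ∷ [])

  module _ (u : ℕ) (g≤khu : g i₁ ≤ k * h * u) where

    -- At full slope `U` grows like 𝔟^i up to a loss of (1 + 1/q)^x′, which 2^u bounds. The constant
    -- `C` absorbs the ramp and the scales up to 𝔟^(i₀ + 1).
    growth : ∀ i → i₀ ≤ i → i < i₁ → U₀ * 𝔟 ^ suc i ≤ C * 2 ^ u * U (suc i)
    growth i i₀≤i i<i₁ = cancelˡ (H ^ x′ * q ^ x′) (pos-* (pos-^ x′ 1≤H) (pos-^ x′ 1≤q))
      (arith U₀ (U (suc i)) (𝔟 ^ suc i) (H ^ x′) (q ^ x′) ((k * H) ^ x′) ((1 + H) ^ x′) ((1 + q) ^ x′) (2 ^ u) C decay powers (q-power u x′ x′≤) scale)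
      where
      a = ℓ ∸ g (suc i)
      x = g (suc i) ∸ g (suc i₀)
      x′ = x ∸ emax
      a+x : a + x ≡ ℓ ∸ g (suc i₀)
      a+x = trans (sym (+-∸-assoc a (g-mono (s≤s i₀≤i)))) (cong (_∸ g (suc i₀)) (m∸n+n≡m (g≤ℓ i<i₁)))
      decay : U₀ * q ^ x′ ≤ U (suc i) * (k * H) ^ x′
      decay = subst (λ z → F z * q ^ x′ ≤ U (suc i) * (k * H) ^ x′) a+x (F-decay a x (∸-monoʳ-≤ ℓ (g-mono i<i₁)) (≤-trans (≤-reflexive a+x) (m∸n≤m ℓ (g (suc i₀)))))
      powers : (k * H) ^ x′ * (1 + H) ^ x′ ≡ H ^ x′ * (1 + q) ^ x′
      powers = trans (sym (^-distribʳ-* (k * H) (1 + H) x′)) (trans (cong (_^ x′) base) (^-distribʳ-* H (1 + q) x′))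
        where
        base : k * H * (1 + H) ≡ H * (1 + q)
        base = case ≤⇒+ 1≤k of λ (o , e) → subst (λ k → k * H * (1 + H) ≡ H * (1 + (k * H + (k ∸ 1)))) (sym e) (ar o H)
          where
          ar : ∀ o H → suc o * H * (1 + H) ≡ H * (1 + (suc o * H + o))
          ar o H = solve (o ∷ H ∷ [])
      x′≤g : x′ ≤ g (suc i)
      x′≤g = ≤-trans (m∸n≤m x emax) (m∸n≤m (g (suc i)) (g (suc i₀)))
      x′≤ : x′ ≤ k * h * u
      x′≤ = ≤-trans x′≤g (≤-trans (g-mono i<i₁) g≤khu)
      scale : 𝔟 ^ suc i * H ^ x′ ≤ (1 + H) ^ x′ * C
      scale = begin
        𝔟 ^ suc i * H ^ x′                     ≤⟨ (𝔟 ^ suc i) ⊛ ^-monoʳ-≤ H {{pos 1≤H}} (m≤n⇒m≤1+n x′≤g) ⟩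
        𝔟 ^ suc i * H ^ suc (g (suc i))         ≤⟨ <⇒≤ (glog-hi (𝔟 ^ suc i) (1≤𝔟^ (suc i))) ⟩
        (1 + H) ^ suc (g (suc i))               ≤⟨ ^-monoʳ-≤ (1 + H) exponent ⟩
        (1 + H) ^ (x′ + (g (suc i₀) + emax + 1)) ≡⟨ ^-distribˡ-+-* (1 + H) x′ _ ⟩
        (1 + H) ^ x′ * C                       ∎
        where
        open ≤-Reasoning
        exponent : suc (g (suc i)) ≤ x′ + (g (suc i₀) + emax + 1)
        exponent = ≤-trans (s≤s (≤-trans (m≤n+m∸n (g (suc i)) (g (suc i₀))) (+-monoʳ-≤ (g (suc i₀)) (m≤n+m∸n x emax)))) (≤-reflexive (ar (g (suc i₀)) emax x′))
          where
          ar : ∀ g e x → suc (g + (e + x)) ≡ x + (g + e + 1)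
          ar g e x = solve (g ∷ e ∷ x ∷ [])
      arith : ∀ U₀ U P Hh Q A B Q₁ T C → U₀ * Q ≤ U * A → A * B ≡ Hh * Q₁ → Q₁ ≤ T * Q → P * Hh ≤ B * C →
              Hh * Q * (U₀ * P) ≤ Hh * Q * (C * T * U)
      arith U₀ U P Hh Q A B Q₁ T C h₁ h₂ h₃ h₄ = by≤ 0 ((B * C) ⊛ h₁ ⊕ (U * C) ⊛ ≤-reflexive h₂ ⊕ (U * C * Hh) ⊛ h₃ ⊕ (U₀ * Q) ⊛ h₄)
        (solve (U₀ ∷ U ∷ P ∷ Hh ∷ Q ∷ A ∷ B ∷ Q₁ ∷ T ∷ C ∷ []))

    few : ℕ
    few = 2 * i₁ * (𝔟 * (D * (C * 2 ^ u)))

    Λ≤few*w : ∀ i → i₀ ≤ i → i < i₁ → Λ ≤ few * w i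
    Λ≤few*w i i₀≤i i<i₁ = cancelˡ (𝔟 ^ suc i) (1≤𝔟^ (suc i))
      (arith (𝔟 ^ suc i) 𝔟 i₁ U₀ 𝒩 D (C * 2 ^ u) (w i) (inc i) (cnt i) (U (suc i)) (growth i i₀≤i i<i₁) (U-drop i i₀≤i i<i₁) (w-cnt i i₀≤i i<i₁) (≤-trans (cnt≤ i) (hi<𝔟^ i i<i₁)))
      where
      arith : ∀ P b i₁ U₀ n D T w inc c U → U₀ * P ≤ T * U → U ≤ D * inc → c * w ≡ inc * n → c ≤ b * P →
              P * (2 * i₁ * (U₀ * n)) ≤ P * (2 * i₁ * (b * (D * T)) * w)
      arith P b i₁ U₀ n D T w inc c U h₁ h₂ h₃ h₄ = by≤ 0 ((2 * i₁ * n) ⊛ h₁ ⊕ (2 * i₁ * n * T) ⊛ h₂ ⊕ (2 * i₁ * D * T) ⊛ ≤-reflexive (sym h₃) ⊕ (2 * i₁ * D * T * w) ⊛ h₄)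
        (solve (P ∷ b ∷ i₁ ∷ U₀ ∷ n ∷ D ∷ T ∷ w ∷ inc ∷ c ∷ U ∷ []))

    -- Each prime in (𝔟^i₀, y] has weight at least Λ/few, so at most `few` of them divide n when the
    -- total is below Λ. The primes up to 𝔟^i₀ are counted trivially.
    few-primes : ∀ n → ∑ (suc y) (λ q → lam q * ⟦ q ∣? n ⟧) < Λ → ϖ y n ≤ few + suc (𝔟 ^ i₀)
    few-primes n small = ≤-trans split (+-mono-≤ large little)
      where
      large-part little-part : ℕ → ℕ
      large-part q = ⟦ prime? q ⟧ * (⟦ 𝔟 ^ i₀ <? q ⟧ * ⟦ q ∣? n ⟧)
      little-part q = ⟦ q <? suc (𝔟 ^ i₀) ⟧
      split : ϖ y n ≤ ∑ (suc y) large-part + ∑ (suc y) little-part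
      split = ≤-trans (∑-mono (suc y) (λ q _ → term q)) (≤-reflexive (∑-+ (suc y) _ _))
        where
        term : ∀ q → ⟦ prime? q ⟧ * ⟦ q ∣? n ⟧ ≤ large-part q + little-part q
        term q = go (𝔟 ^ i₀ <? q)
          where
          go : ∀ (d : Dec (𝔟 ^ i₀ < q)) → ⟦ prime? q ⟧ * ⟦ q ∣? n ⟧ ≤ ⟦ prime? q ⟧ * (⟦ d ⟧ * ⟦ q ∣? n ⟧) + little-part q
          go (yes p) = ≤-trans (⟦ prime? q ⟧ ⊛ ≤-reflexive (sym (*-identityˡ _))) (m≤m+n _ _)
          go (no ¬p) = ≤-trans (≤-trans (*-mono-≤ (⟦⟧≤1 (prime? q)) (⟦⟧≤1 (q ∣? n))) (≤-reflexive (sym (⟦⟧-yes (q <? suc (𝔟 ^ i₀)) (s≤s (≮⇒≥ ¬p)))))) (m≤n+m _ (⟦ prime? q ⟧ * 0))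
      little : ∑ (suc y) little-part ≤ suc (𝔟 ^ i₀)
      little = ∑-below (suc y) (suc (𝔟 ^ i₀))
        where
        ∑-below : ∀ n b → ∑ n (λ q → ⟦ q <? b ⟧) ≤ b
        ∑-below n b = ≤-trans (∑-mono n (λ q _ → as-delta q)) (≤-trans (≤-reflexive (∑-swap n b _)) (≤-trans (∑-bounded b 1 _ (λ c _ → ∑-delta≤ n (λ _ → 1) c)) (≤-reflexive (*-identityʳ b))))
          where
          as-delta : ∀ q → ⟦ q <? b ⟧ ≤ ∑ b (λ c → ⟦ q ≟ c ⟧ * 1)
          as-delta q with q <? b
          ... | no _ = z≤n
          ... | yes p = ≤-trans (≤-reflexive (cong (_* 1) (sym (⟦⟧-yes (q ≟ q) refl)))) (∑-term b (λ c → ⟦ q ≟ c ⟧ * 1) p)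
      large : ∑ (suc y) large-part ≤ few
      large = ≮⇒≥ λ few< → <⇒≱ (*-monoˡ-< Λ {{pos 1≤Λ}} few<) (begin
        ∑ (suc y) large-part * Λ ≡⟨ ∑-*ʳ (suc y) Λ _ ⟨
        ∑ (suc y) (λ q → large-part q * Λ) ≤⟨ ∑-mono (suc y) (λ q q< → term q (≤-pred q<)) ⟩
        ∑ (suc y) (λ q → few * (lam q * ⟦ q ∣? n ⟧)) ≡⟨ ∑-*ˡ (suc y) few _ ⟩
        few * ∑ (suc y) (λ q → lam q * ⟦ q ∣? n ⟧) ≤⟨ few ⊛ <⇒≤ small ⟩
        few * Λ ∎)
        where
        open ≤-Reasoning
        term : ∀ q → q ≤ y → large-part q * Λ ≤ few * (lam q * ⟦ q ∣? n ⟧)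
        term q q≤y = go (prime? q) (𝔟 ^ i₀ <? q)
          where
          arith : ∀ f l b Λ → Λ ≤ f * l → (1 * (1 * b)) * Λ ≤ f * (l * b)
          arith f l b Λ h = by≤ 0 (b ⊛ h) (solve (f ∷ l ∷ b ∷ Λ ∷ []))
          go : ∀ (d : Dec (Prime q)) (d′ : Dec (𝔟 ^ i₀ < q)) → ⟦ d ⟧ * (⟦ d′ ⟧ * ⟦ q ∣? n ⟧) * Λ ≤ few * (lam q * ⟦ q ∣? n ⟧)
          go (no _)   _       = z≤n
          go (yes _)  (no _)  = z≤n
          go (yes pq) (yes l) = case lam≥w q pq l q≤y of λ (i , i₀≤i , i<i₁ , w≤) →
            arith few (lam q) ⟦ q ∣? n ⟧ Λ (≤-trans (Λ≤few*w i i₀≤i i<i₁) (few ⊛ w≤))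

-- rational numbers and the exponential series

ι : ℕ → ℚ
ι n = ℤ.+ n / 1

fromℚᵘ-mono : ∀ {p q} → p ℚᵘ.≤ q → ℚ.fromℚᵘ p ℚ.≤ ℚ.fromℚᵘ q
fromℚᵘ-mono {p} {q} h = ℚP.toℚᵘ-cancel-≤ (ℚᵘP.≤-respˡ-≃ (ℚᵘP.≃-sym (ℚP.toℚᵘ-fromℚᵘ p)) (ℚᵘP.≤-respʳ-≃ (ℚᵘP.≃-sym (ℚP.toℚᵘ-fromℚᵘ q)) h))

fromℚᵘ-cancel : ∀ {p q} → ℚ.fromℚᵘ p ℚ.≤ ℚ.fromℚᵘ q → p ℚᵘ.≤ q
fromℚᵘ-cancel {p} {q} h = ℚᵘP.≤-respˡ-≃ (ℚP.toℚᵘ-fromℚᵘ p) (ℚᵘP.≤-respʳ-≃ (ℚP.toℚᵘ-fromℚᵘ q) (ℚP.toℚᵘ-mono-≤ h))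

fromℚᵘ-* : ∀ p q → ℚ.fromℚᵘ p ℚ.* ℚ.fromℚᵘ q ≡ ℚ.fromℚᵘ (p ℚᵘ.* q)
fromℚᵘ-* p q = ℚP.toℚᵘ-injective (ℚᵘP.≃-trans (ℚP.toℚᵘ-homo-* (ℚ.fromℚᵘ p) (ℚ.fromℚᵘ q))
  (ℚᵘP.≃-trans (ℚᵘP.*-cong (ℚP.toℚᵘ-fromℚᵘ p) (ℚP.toℚᵘ-fromℚᵘ q)) (ℚᵘP.≃-sym (ℚP.toℚᵘ-fromℚᵘ (p ℚᵘ.* q)))))

fromℚᵘ-+ : ∀ p q → ℚ.fromℚᵘ p ℚ.+ ℚ.fromℚᵘ q ≡ ℚ.fromℚᵘ (p ℚᵘ.+ q)
fromℚᵘ-+ p q = ℚP.toℚᵘ-injective (ℚᵘP.≃-trans (ℚP.toℚᵘ-homo-+ (ℚ.fromℚᵘ p) (ℚ.fromℚᵘ q))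
  (ℚᵘP.≃-trans (ℚᵘP.+-cong (ℚP.toℚᵘ-fromℚᵘ p) (ℚP.toℚᵘ-fromℚᵘ q)) (ℚᵘP.≃-sym (ℚP.toℚᵘ-fromℚᵘ (p ℚᵘ.+ q)))))

frac-≤ : ∀ a b c d → a * suc d ≤ c * suc b → ℤ.+ a / suc b ℚ.≤ ℤ.+ c / suc d
frac-≤ a b c d h = fromℚᵘ-mono {mkℚᵘ (ℤ.+ a) b} {mkℚᵘ (ℤ.+ c) d}
  (*≤* (subst₂ ℤ._≤_ (ℤP.pos-* a (suc d)) (ℤP.pos-* c (suc b)) (ℤ.+≤+ h)))

frac-≤⁻¹ : ∀ a b c d → ℤ.+ a / suc b ℚ.≤ ℤ.+ c / suc d → a * suc d ≤ c * suc b
frac-≤⁻¹ a b c d h = ℤP.drop‿+≤+ (subst₂ ℤ._≤_ (sym (ℤP.pos-* a (suc d))) (sym (ℤP.pos-* c (suc b)))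
  (ℚᵘP.drop-*≤* (fromℚᵘ-cancel {mkℚᵘ (ℤ.+ a) b} {mkℚᵘ (ℤ.+ c) d} h)))

ι-mono : ∀ {m n} → m ≤ n → ι m ℚ.≤ ι n
ι-mono {m} {n} h = frac-≤ m 0 n 0 (*-monoˡ-≤ 1 h)

ι-cancel : ∀ {m n} → ι m ℚ.≤ ι n → m ≤ n
ι-cancel {m} {n} h = subst₂ _≤_ (*-identityʳ m) (*-identityʳ n) (frac-≤⁻¹ m 0 n 0 h)

frac-* : ∀ a b c d → (ℤ.+ a / suc b) ℚ.* (ℤ.+ c / suc d) ≡ ℤ.+ (a * c) / suc (d + b * suc d)
frac-* a b c d = trans (fromℚᵘ-* (mkℚᵘ (ℤ.+ a) b) (mkℚᵘ (ℤ.+ c) d)) (cong (λ z → z / suc (d + b * suc d)) (sym (ℤP.pos-* a c)))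

ι-* : ∀ m n → ι m ℚ.* ι n ≡ ι (m * n)
ι-* m n = frac-* m 0 n 0

ι-+ : ∀ m n → ι m ℚ.+ ι n ≡ ι (m + n)
ι-+ m n = trans (fromℚᵘ-+ (mkℚᵘ (ℤ.+ m) 0) (mkℚᵘ (ℤ.+ n) 0))
  (ℚP.fromℚᵘ-cong {mkℚᵘ (ℤ.+ m) 0 ℚᵘ.+ mkℚᵘ (ℤ.+ n) 0} {mkℚᵘ (ℤ.+ (m + n)) 0}
    (*≡* (cong (ℤ._* ℤ.+ 1) (trans (cong₂ ℤ._+_ (ℤP.*-identityʳ (ℤ.+ m)) (ℤP.*-identityʳ (ℤ.+ n))) (sym (ℤP.pos-+ m n))))))

0≤ι : ∀ n → 0ℚ ℚ.≤ ι n
0≤ι n = ι-mono {0} {n} z≤n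

0≤frac : ∀ a b → 0ℚ ℚ.≤ ℤ.+ a / suc b
0≤frac a b = frac-≤ 0 0 a b z≤n

mul-mono : ∀ {a b c d} → 0ℚ ℚ.≤ b → 0ℚ ℚ.≤ c → a ℚ.≤ b → c ℚ.≤ d → a ℚ.* c ℚ.≤ b ℚ.* d
mul-mono {a} {b} {c} {d} 0≤b 0≤c h g = ℚP.≤-trans (ℚP.*-monoʳ-≤-nonNeg c {{ℚ.nonNegative 0≤c}} h) (ℚP.*-monoˡ-≤-nonNeg b {{ℚ.nonNegative 0≤b}} g)

mul-nonneg : ∀ {a b} → 0ℚ ℚ.≤ a → 0ℚ ℚ.≤ b → 0ℚ ℚ.≤ a ℚ.* b
mul-nonneg {a} {b} h g = ℚP.≤-trans (ℚP.≤-reflexive (sym (ℚP.*-zeroʳ a))) (mul-mono h ℚP.≤-refl ℚP.≤-refl g)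

module _ (r : ℚ) (0≤r : 0ℚ ℚ.≤ r) where

  0≤expTerm : ∀ i → 0ℚ ℚ.≤ expTerm r i
  0≤expTerm zero    = 0≤ι 1
  0≤expTerm (suc i) = mul-nonneg (mul-nonneg (0≤expTerm i) 0≤r) (0≤frac 1 i)

  expTerm≤expPartial : ∀ i → expTerm r i ℚ.≤ expPartial r i
  expTerm≤expPartial zero    = ℚP.≤-refl
  expTerm≤expPartial (suc i) = ℚP.≤-trans (ℚP.≤-reflexive (sym (ℚP.+-identityˡ (expTerm r (suc i)))))
    (ℚP.+-monoˡ-≤ (expTerm r (suc i)) (ℚP.≤-trans (0≤expTerm i) (expTerm≤expPartial i)))

  -- Each factor r/(i + 1) with i < n is at least 4. Thus exp r ≤ N < 2^n will force r ≤ 4n.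
  expTerm-lower : ∀ n → ι (4 * n) ℚ.≤ r → ∀ i → i ≤ n → ι (4 ^ i) ℚ.≤ expTerm r i
  expTerm-lower n h zero    _ = ℚP.≤-refl
  expTerm-lower n h (suc i) i<n = ℚP.≤-trans (ℚP.≤-reflexive (trans (cong ι (*-comm 4 (4 ^ i))) (sym (ι-* (4 ^ i) 4))))
    (ℚP.≤-trans (mul-mono (0≤expTerm i) (0≤ι 4) (expTerm-lower n h i (<⇒≤ i<n)) factor) (ℚP.≤-reflexive (sym (ℚP.*-assoc (expTerm r i) r (ℤ.+ 1 / suc i)))))
    where
    factor : ι 4 ℚ.≤ r ℚ.* (ℤ.+ 1 / suc i)
    factor = ℚP.≤-trans (ℚP.≤-trans (frac-≤ 4 0 (4 * n * 1) (i + 0 * suc i) (arith n i i<n)) (ℚP.≤-reflexive (sym (frac-* (4 * n) 0 1 i))))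
      (ℚP.*-monoʳ-≤-nonNeg (ℤ.+ 1 / suc i) {{ℚ.nonNegative (0≤frac 1 i)}} h)
      where
      arith : ∀ n i → i < n → 4 * suc (i + 0 * suc i) ≤ 4 * n * 1 * 1
      arith n i h = by≤ 0 (4 ⊛ h) (solve (n ∷ i ∷ []))

  module _ (n : ℕ) (1≤n : 1 ≤ n) (r≤n : r ℚ.≤ ι n) where

    expTerm-upper : ∀ i → expTerm r i ℚ.≤ ι (n ^ i)
    expTerm-upper zero    = ℚP.≤-refl
    expTerm-upper (suc i) = ℚP.≤-trans (mul-mono (0≤ι (n * n ^ i)) (0≤frac 1 i)
      (ℚP.≤-trans (mul-mono (0≤ι (n ^ i)) 0≤r (expTerm-upper i) r≤n) (ℚP.≤-reflexive (trans (ι-* (n ^ i) n) (cong ι (*-comm (n ^ i) n)))))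
      (frac-≤ 1 i 1 0 (s≤s z≤n))) (ℚP.≤-reflexive (ℚP.*-identityʳ _))

    ½ : ℚ
    ½ = ℤ.+ 1 / 2

    expTerm-half : ∀ i → 2 * n ≤ suc i → expTerm r (suc i) ℚ.+ expTerm r (suc i) ℚ.≤ expTerm r i
    expTerm-half i h = ℚP.≤-trans (ℚP.+-mono-≤ half half) (ℚP.≤-reflexive (trans (sym (ℚP.*-distribˡ-+ (expTerm r i) ½ ½)) (ℚP.*-identityʳ (expTerm r i))))
      where
      half : expTerm r (suc i) ℚ.≤ expTerm r i ℚ.* ½
      half = ℚP.≤-trans (ℚP.≤-reflexive (ℚP.*-assoc (expTerm r i) r (ℤ.+ 1 / suc i))) (ℚP.*-monoˡ-≤-nonNeg (expTerm r i) {{ℚ.nonNegative (0≤expTerm i)}}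
        (ℚP.≤-trans (ℚP.*-monoʳ-≤-nonNeg (ℤ.+ 1 / suc i) {{ℚ.nonNegative (0≤frac 1 i)}} r≤n)
          (ℚP.≤-trans (ℚP.≤-reflexive (frac-* n 0 1 i)) (frac-≤ (n * 1) (i + 0 * suc i) 1 1 (arith n i h)))))
        where
        arith : ∀ n i → 2 * n ≤ suc i → n * 1 * 2 ≤ 1 * suc (i + 0 * suc i)
        arith n i h = by≤ 0 h (solve (n ∷ i ∷ []))

    bound : ℕ
    bound = (2 * n + 2) * n ^ (2 * n)

    expPartial-start : ∀ m → m ≤ 2 * n → expPartial r m ℚ.≤ ι (suc m * n ^ (2 * n))
    expPartial-start zero    _ = ι-mono (≤-trans (pos-^ (2 * n) 1≤n) (≤-reflexive (sym (*-identityˡ _))))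
    expPartial-start (suc m) h = ℚP.≤-trans (ℚP.+-mono-≤ (expPartial-start m (<⇒≤ h)) (ℚP.≤-trans (expTerm-upper (suc m)) (ι-mono (^-monoʳ-≤ n {{pos 1≤n}} h))))
      (ℚP.≤-reflexive (trans (ι-+ (suc m * n ^ (2 * n)) (n ^ (2 * n))) (cong ι (+-comm (suc m * n ^ (2 * n)) (n ^ (2 * n))))))

    -- Once every term is at most half of its predecessor, the partial sum plus its last term no
    -- longer increases.
    expPartial-tail : ∀ o → expPartial r (2 * n + o) ℚ.+ expTerm r (2 * n + o) ℚ.≤ ι bound
    expPartial-tail zero rewrite +-identityʳ (2 * n) = ℚP.≤-trans (ℚP.+-mono-≤ (expPartial-start (2 * n) ≤-refl) (expTerm-upper (2 * n)))
      (ℚP.≤-reflexive (trans (ι-+ (suc (2 * n) * n ^ (2 * n)) (n ^ (2 * n))) (cong ι (ar n (n ^ (2 * n))))))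
      where
      ar : ∀ n p → suc (2 * n) * p + p ≡ (2 * n + 2) * p
      ar n p = solve (n ∷ p ∷ [])
    expPartial-tail (suc o) rewrite +-suc (2 * n) o = ℚP.≤-trans (ℚP.≤-reflexive (ℚP.+-assoc (expPartial r (2 * n + o)) _ _))
      (ℚP.≤-trans (ℚP.+-monoʳ-≤ (expPartial r (2 * n + o)) (expTerm-half (2 * n + o) (m≤n⇒m≤1+n (m≤m+n (2 * n) o)))) (expPartial-tail o))

    expPartial-upper : ∀ m → expPartial r m ℚ.≤ ι bound
    expPartial-upper m with m ≤? 2 * n
    ... | yes p = ℚP.≤-trans (expPartial-start m p) (ι-mono (*-monoˡ-≤ (n ^ (2 * n)) (≤-trans (s≤s p) (≤-trans (≤-reflexive (+-comm 1 (2 * n))) (+-monoʳ-≤ (2 * n) (s≤s z≤n))))))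
    ... | no ¬p = case ≤⇒+ (<⇒≤ (≰⇒> ¬p)) of λ (o , e) → subst (λ z → expPartial r z ℚ.≤ ι bound) (sym e)
        (ℚP.≤-trans (ℚP.≤-trans (ℚP.≤-reflexive (sym (ℚP.+-identityʳ _))) (ℚP.+-monoʳ-≤ (expPartial r (2 * n + o)) (0≤expTerm (2 * n + o)))) (expPartial-tail o))

^ℚ-mono : ∀ {r s} k → 0ℚ ℚ.≤ r → r ℚ.≤ s → r ^ℚ k ℚ.≤ s ^ℚ k × 0ℚ ℚ.≤ r ^ℚ k
^ℚ-mono zero    h g = ℚP.≤-refl , 0≤ι 1
^ℚ-mono {r} {s} (suc k) h g = let p , q = ^ℚ-mono k h g in mul-mono (ℚP.≤-trans q p) h p g , mul-nonneg q h

^ℚ-ι : ∀ n k → ι n ^ℚ k ≡ ι (n ^ k)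
^ℚ-ι n zero    = refl
^ℚ-ι n (suc k) = trans (cong (ℚ._* ι n) (^ℚ-ι n k)) (trans (ι-* (n ^ k) n) (cong ι (*-comm (n ^ k) n)))

logPow-upper : ∀ K N p n → N < 2 ^ n → LeLogPow K N p → p ≤ (4 * n) ^ K
logPow-upper K N p n N<2^n (r , 0<r , p≤r^K , le) = ι-cancel (ℚP.≤-trans p≤r^K (ℚP.≤-trans (proj₁ (^ℚ-mono K 0≤r r≤)) (ℚP.≤-reflexive (^ℚ-ι (4 * n) K))))
  where
  0≤r : 0ℚ ℚ.≤ r
  0≤r = ℚP.<⇒≤ 0<r
  r≤ : r ℚ.≤ ι (4 * n)
  r≤ with ℚP.≤-total r (ι (4 * n))
  ... | inj₁ h = h
  ... | inj₂ h = ⊥-elim (<⇒≱ N<2^n (≤-trans (^-monoˡ-≤ n {2} {4} (s≤s (s≤s z≤n)))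
        (ι-cancel (ℚP.≤-trans (expTerm-lower r 0≤r n h n ≤-refl) (ℚP.≤-trans (expTerm≤expPartial r 0≤r n) (le n))))))

-- Of r^K ≤ q only r ≤ q is kept, by r ≤ r^K for r ≥ 1. The outcome log N = O(q log q) still puts y
-- above a fixed power of log N.
logPow-lower : ∀ K N q → 1 ≤ K → 1 ≤ q → LtLogPow K N q → N ≤ (2 * q + 2) * q ^ (2 * q)
logPow-lower (suc k) N q _ 1≤q (r , 0≤r , (m , gt) , r^K≤q) = ι-cancel (ℚP.≤-trans (ℚP.<⇒≤ gt) (expPartial-upper r 0≤r q 1≤q r≤q m))
  where
  r≤q : r ℚ.≤ ι q
  r≤q with ℚP.≤-total r (ι q)
  ... | inj₁ h = h
  ... | inj₂ h = ℚP.≤-trans (ℚP.≤-trans (ℚP.≤-reflexive (sym (ℚP.*-identityˡ r))) (ℚP.*-monoʳ-≤-nonNeg r {{ℚ.nonNegative 0≤r}} (one≤ k))) r^K≤q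
    where
    one≤ : ∀ k → 1ℚ ℚ.≤ r ^ℚ k
    one≤ k = ℚP.≤-trans (ℚP.≤-reflexive (sym (trans (^ℚ-ι 1 k) (cong ι (^-zeroˡ k))))) (proj₁ (^ℚ-mono k (0≤ι 1) (ℚP.≤-trans (ι-mono 1≤q) h)))

-- The normalising weight `ν`.

invert-anti : ∀ {v v′ n} → 1 ≤ v → v ≤ v′ → v′ ≤ n → invert v′ n ≤ invert v n
invert-anti {v} {v′} {n} 1≤v v≤v′ v′≤n = cancelˡ v 1≤v (begin
  v * invert v′ n  ≤⟨ *-monoˡ-≤ (invert v′ n) v≤v′ ⟩
  v′ * invert v′ n ≡⟨ invert-* v′ n (≤-trans 1≤v v≤v′) v′≤n ⟩
  n !              ≡⟨ invert-* v n 1≤v (≤-trans v≤v′ v′≤n) ⟨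
  v * invert v n   ∎)
  where open ≤-Reasoning

invert-double : ∀ {v v′ n} → 1 ≤ v → 1 ≤ v′ → v ≤ n → v′ ≤ n → v′ ≤ 2 * v → invert v n ≤ 2 * invert v′ n
invert-double {v} {v′} {n} 1≤v 1≤v′ v≤n v′≤n h = cancelˡ v′ 1≤v′ (begin
  v′ * invert v n        ≤⟨ *-monoˡ-≤ (invert v n) h ⟩
  2 * v * invert v n     ≡⟨ trans (*-assoc 2 v _) (cong (2 *_) (trans (invert-* v n 1≤v v≤n) (sym (invert-* v′ n 1≤v′ v′≤n)))) ⟩
  2 * (v′ * invert v′ n) ≡⟨ ar v′ (invert v′ n) ⟩
  v′ * (2 * invert v′ n) ∎)
  where
  open ≤-Reasoning
  ar : ∀ a b → 2 * (a * b) ≡ a * (2 * b)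
  ar a b = solve (a ∷ b ∷ [])

-- Up to the factor top !, ν m is the inverse of ω m ⊔ Λ; dividing by ω m alone would not be stable where it is small.
module Weights (y : ℕ) (lam : ℕ → ℕ) (Λ Z : ℕ) (1≤Λ : 1 ≤ Λ) (lam≤Λ : ∀ q → lam q ≤ Λ)
  (lam>0 : ∀ q → 0 < lam q → Prime q × Z < q) where

  ω : ℕ → ℕ
  ω n = ∑ (suc y) (λ q → lam q * ⟦ q ∣? n ⟧)

  top : ℕ
  top = ∑ (suc y) lam + Λ

  v : ℕ → ℕ
  v n = ω n ⊔ Λ

  ν : ℕ → ℕ
  ν n = invert (v n) top

  1≤v : ∀ n → 1 ≤ v n
  1≤v n = ≤-trans 1≤Λ (m≤n⊔m (ω n) Λ)

  v≤top : ∀ n → v n ≤ top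
  v≤top n = ⊔-lub (≤-trans (∑-mono (suc y) (λ q _ → ≤-trans (lam q ⊛ ⟦⟧≤1 (q ∣? n)) (≤-reflexive (*-identityʳ (lam q))))) (m≤m+n _ Λ)) (m≤n+m Λ _)

  vν : ∀ n → v n * ν n ≡ top !
  vν n = invert-* (v n) top (1≤v n) (v≤top n)

  ω-cong : ∀ x m → 1 ≤ x → x ≤ Z → ω (x * m) ≡ ω m
  ω-cong x m 1≤x x≤Z = ∑-ext (suc y) (λ q → term q (lam q) (lam>0 q))
    where
    term : ∀ q l → (0 < l → Prime q × Z < q) → l * ⟦ q ∣? x * m ⟧ ≡ l * ⟦ q ∣? m ⟧
    term q zero    _ = refl
    term q (suc l) p = case p (s≤s z≤n) of λ (pq , Z<q) → cong (suc l *_) (⟦⟧-cong (q ∣? x * m) (q ∣? m)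
      (λ q∣ → [ (λ q∣x → ⊥-elim (<⇒≱ Z<q (≤-trans (∣⇒≤ {{pos 1≤x}} q∣x) x≤Z))) , (λ q∣m → q∣m) ]′ (euclidsLemma x m pq q∣)) (∣n⇒∣m*n x))

  ν-pool : ∀ x m → 1 ≤ x → x ≤ Z → ν (x * m) ≡ ν m
  ν-pool x m h g = cong (λ z → invert (z ⊔ Λ) top) (ω-cong x m h g)

  ω-mono : ∀ q m → ω m ≤ ω (q * m)
  ω-mono q m = ∑-mono (suc y) (λ p _ → lam p ⊛ ⟦⟧-mono (p ∣? m) (p ∣? q * m) (∣n⇒∣m*n q))

  ν-dec : ∀ q m → ν (q * m) ≤ ν m
  ν-dec q m = invert-anti (1≤v m) (⊔-monoˡ-≤ Λ (ω-mono q m)) (v≤top (q * m))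

  ω-step : ∀ q m → q ≤ y → 0 < lam q → ω (q * m) ≤ ω m + lam q
  ω-step q m q≤y l>0 = begin
    ω (q * m) ≤⟨ ∑-mono (suc y) (λ p _ → term p (lam p) (lam>0 p)) ⟩
    ∑ (suc y) (λ p → lam p * ⟦ p ∣? m ⟧ + ⟦ p ≟ q ⟧ * lam p) ≡⟨ ∑-+ (suc y) _ _ ⟩
    ω m + ∑ (suc y) (λ p → ⟦ p ≟ q ⟧ * lam p) ≡⟨ cong (ω m +_) (∑-delta (suc y) lam (s≤s q≤y)) ⟩
    ω m + lam q ∎
    where
    open ≤-Reasoning
    term : ∀ p l → (0 < l → Prime p × Z < p) → l * ⟦ p ∣? q * m ⟧ ≤ l * ⟦ p ∣? m ⟧ + ⟦ p ≟ q ⟧ * l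
    term p zero    _ = z≤n
    term p (suc l) h with p ∣? q * m
    ... | no _ = ≤-trans (≤-reflexive (*-zeroʳ (suc l))) z≤n
    ... | yes p∣ = case h (s≤s z≤n) of λ (pp , _) → [ (λ p∣q → same (prime⇒irreducible (proj₁ (lam>0 q l>0)) p∣q) pp) ,
          (λ p∣m → ≤-trans (≤-reflexive (cong (suc l *_) (sym (⟦⟧-yes (p ∣? m) p∣m)))) (m≤m+n _ _)) ]′ (euclidsLemma q m pp p∣)
      where
      same : p ≡ 1 ⊎ p ≡ q → Prime p → suc l * 1 ≤ suc l * ⟦ p ∣? m ⟧ + ⟦ p ≟ q ⟧ * suc l
      same (inj₁ refl) pp = ⊥-elim (¬prime[1] pp)
      same (inj₂ refl) pp = ≤-trans (≤-reflexive (trans (*-comm (suc l) 1) (cong (_* suc l) (sym (⟦⟧-yes (p ≟ p) refl))))) (m≤n+m _ (suc l * ⟦ p ∣? m ⟧))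

  -- Passing to qm adds at most lam q ≤ Λ ≤ v m to `ω`, so `v` at most doubles.
  ν-inc : ∀ q m → q ≤ y → 0 < lam q → ν m ≤ 2 * ν (q * m)
  ν-inc q m q≤y l>0 = invert-double (1≤v m) (1≤v (q * m)) (v≤top m) (v≤top (q * m)) (⊔-lub
    (≤-trans (ω-step q m q≤y l>0) (≤-trans (+-mono-≤ (m≤m⊔n (ω m) Λ) (≤-trans (lam≤Λ q) (m≤n⊔m (ω m) Λ))) (≤-reflexive (cong (v m +_) (sym (+-identityʳ (v m)))))))
    (≤-trans (m≤n⊔m (ω m) Λ) (m≤m+n (v m) _)))

  ων≤ : ∀ n → ω n * ν n ≤ top !
  ων≤ n = ≤-trans (*-monoˡ-≤ (ν n) (m≤m⊔n (ω n) Λ)) (≤-reflexive (vν n))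

  ων≥ : ∀ n → Λ ≤ ω n → top ! ≤ ω n * ν n
  ων≥ n h = ≤-reflexive (trans (sym (vν n)) (cong (_* ν n) (m≥n⇒m⊔n≡m h)))

  Λν≤ : ∀ n → Λ * ν n ≤ top !
  Λν≤ n = ≤-trans (*-monoˡ-≤ (ν n) (m≤n⊔m (ω n) Λ)) (≤-reflexive (vν n))

-- Choice of the parameters and the combined bound.

-- D/M exceeds 1 by less than 1/H, and x²/M < 1/H because M = tkH and t > x². With H = 16e the total
-- relative error is about 3/(16e), below 1/(2e). With x the logarithm of R₂, this `t` makes the
-- ramp slow enough for all multipliers.
flatness : ∀ e H k t x D M → H ≡ 16 * e → 1 ≤ k → 1 ≤ e → t ≡ suc (x * x) → M ≡ t * (k * H) → D ≡ M + t * (k ∸ 1) →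
  D * D * (2 * e) ≤ (2 * e + 1) * ((M ∸ x * x) * M)
flatness e H k t x D M refl 1≤k 1≤e t≡ refl refl = case ≤⇒+ 1≤k of λ (k′ , k≡) → case ≤⇒+ 1≤e of λ (e′ , e≡) → go k′ k≡ e′ e≡
  where
  go : ∀ k′ → k ≡ 1 + k′ → ∀ e′ → e ≡ 1 + e′ →
    (t * (k * (16 * e)) + t * (k ∸ 1)) * (t * (k * (16 * e)) + t * (k ∸ 1)) * (2 * e) ≤ (2 * e + 1) * ((t * (k * (16 * e)) ∸ x * x) * (t * (k * (16 * e))))
  go k′ refl e′ refl = ≤-trans (arith k′ e′ t) ((2 * suc e′ + 1) ⊛ *-monoˡ-≤ (t * (suc k′ * (16 * suc e′)))
      (m+n≤o⇒m≤o∸n (t * suc k′ * (15 + 16 * e′)) (≤-trans (+-monoʳ-≤ (t * suc k′ * (15 + 16 * e′)) (≤-trans (≤-trans (n≤1+n (x * x)) (≤-reflexive (sym t≡))) (m≤m*n t (suc k′)))) (≤-reflexive (ar k′ e′ t)))))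
    where
    ar : ∀ k′ e′ t → t * suc k′ * (15 + 16 * e′) + t * suc k′ ≡ t * (suc k′ * (16 * suc e′))
    ar k′ e′ t = solve (k′ ∷ e′ ∷ t ∷ [])
    arith : ∀ k′ e′ t → (t * (suc k′ * (16 * suc e′)) + t * k′) * (t * (suc k′ * (16 * suc e′)) + t * k′) * (2 * suc e′)
      ≤ (2 * suc e′ + 1) * (t * suc k′ * (15 + 16 * e′) * (t * (suc k′ * (16 * suc e′))))
    arith k′ e′ t = ≤-trans (*-monoˡ-≤ (2 * suc e′) (*-mono-≤ up up)) core
      where
      core : t * suc k′ * (17 + 16 * e′) * (t * suc k′ * (17 + 16 * e′)) * (2 * suc e′) ≤ (2 * suc e′ + 1) * (t * suc k′ * (15 + 16 * e′) * (t * (suc k′ * (16 * suc e′))))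
      core = by≤ (t * suc k′ * (t * suc k′) * (142 + 302 * e′ + 160 * (e′ * e′))) (≤-refl {0}) (solve (k′ ∷ e′ ∷ t ∷ []))
      up : t * (suc k′ * (16 * suc e′)) + t * k′ ≤ t * suc k′ * (17 + 16 * e′)
      up = by≤ t (≤-refl {0}) (solve (k′ ∷ e′ ∷ t ∷ []))

ratio-power : ∀ c s → 1 ≤ s → ∃ λ b → c * s ^ b ≤ (1 + s) ^ b
ratio-power c s 1≤s = c * s , cancelˡ s 1≤s (arith c s (s ^ (c * s)) ((1 + s) ^ (c * s)) (bernoulli s (c * s)))
  where
  arith : ∀ c s a b → a * (s + c * s) ≤ b * s → s * (c * a) ≤ s * b
  arith c s a b h = by≤ (a * s) h (solve (c ∷ s ∷ a ∷ b ∷ []))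

exponential-growth : ∀ c → ∃ λ f₀ → ∀ f → f₀ ≤ f → c * (f + 1) ≤ 2 ^ f
exponential-growth c = 3 * c , λ f h → case ≤⇒+ h of λ (o , e) → subst (λ f → c * (f + 1) ≤ 2 ^ f) (sym e) (go o)
  where
  go : ∀ o → c * (3 * c + o + 1) ≤ 2 ^ (3 * c + o)
  go zero = ≤-trans (≤-trans (by≤ (1 + 2 * c + c * c * c) (≤-refl {0}) (cube c)) (^-monoˡ-≤ 3 (n<2^n c))) (≤-reflexive (trans (^-*-assoc 2 c 3) (cong (2 ^_) (trans (*-comm c 3) (sym (+-identityʳ (3 * c)))))))
    where
    cube : ∀ c → c * (3 * c + 0 + 1) + 0 + (1 + 2 * c + c * c * c) ≡ suc c ^ 3 + 0
    cube c = ar c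
      where
      ar : ∀ c → c * (3 * c + 0 + 1) + 0 + (1 + 2 * c + c * c * c) ≡ suc c * (suc c * (suc c * 1)) + 0
      ar c = solve (c ∷ [])
  go (suc o) = ≤-trans (by≤ (c * (3 * c + o)) (2 ⊛ go o) (ar c o (2 ^ (3 * c + o)))) (≤-reflexive (cong (2 ^_) (sym (+-suc (3 * c) o))))
    where
    ar : ∀ c o p → c * (3 * c + suc o + 1) + 2 * p + c * (3 * c + o) ≡ 2 * p + 2 * (c * (3 * c + o + 1))
    ar c o p = solve (c ∷ o ∷ p ∷ [])

-- Everything that is chosen before N. For C₁ = 2𝔟, C₂ = 4𝔟 and C₃ = 4, the values of `E` and `e`
-- make the Roth term and the variance term of `main-bound` equal to 1/(8 bb) each. `h` and `t`
-- serve `flatness`, and `i₀` places the weighted primes above R₂.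
record DensityData : Set where
  constructor densityData
  field
    𝔟 : ℕ
    4≤𝔟 : 4 ≤ 𝔟
    chebyshev : ∀ j → 3 ≤ j → 𝔟 ^ j ≤ suc j * π (𝔟 ^ j) (𝔟 ^ suc j)
    k bb E e : ℕ
    2≤k : 2 ≤ k
    1≤bb : 1 ≤ bb
    E≡ : E ≡ 8 * bb * (4 * (2 * 𝔟) * (4 * 𝔟) * 4)
    e≡ : e ≡ 8 * bb * (8 * (2 * 𝔟) * (4 * 𝔟))
    w d : ℕ
    1≤d : 1 ≤ d
    b l₀ : ℕ
    2^b≤w : 2 ^ b ≤ w
    2^l₀≤d : 2 ^ l₀ ≤ d
    b≤d : b ≤ d
    cond₁ : 2 * (2 * e + 1) * 18 * (1 + 4 * k) * (4 * k) ^ b ≤ (1 + 4 * k) ^ b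
    cond₂ : 2 * (2 * e + 1) * (4 * w !) * (4 * k) ^ l₀ ≤ (1 + 4 * k) ^ l₀
    dens : Dens E 1 d
    h : ℕ
    1≤h : 1 ≤ h
    h≡ : h ≡ 8 * e
    t : ℕ
    t≡ : t ≡ suc (Grid.glog h 1≤h (Pool.R₂ w d 1≤d) * Grid.glog h 1≤h (Pool.R₂ w d 1≤d))
    i₀ : ℕ
    3≤i₀ : 3 ≤ i₀
    R₂≤𝔟^i₀ : Pool.R₂ w d 1≤d ≤ 𝔟 ^ i₀

module Density (densityHyps : DensityData) where
  open DensityData densityHyps

  1≤𝔟 : 1 ≤ 𝔟
  1≤𝔟 = ≤-trans (s≤s z≤n) 4≤𝔟

  1≤e : 1 ≤ e
  1≤e = ≤-trans (pos-* (pos-* {8} (s≤s z≤n) 1≤bb) (pos-* (pos-* {8} (s≤s z≤n) (pos-* {2} (s≤s z≤n) 1≤𝔟)) (pos-* {4} (s≤s z≤n) 1≤𝔟))) (≤-reflexive (sym e≡))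

  1≤E : 1 ≤ E
  1≤E = ≤-trans (pos-* (pos-* {8} (s≤s z≤n) 1≤bb) (pos-* (pos-* (pos-* {4} (s≤s z≤n) (pos-* {2} (s≤s z≤n) 1≤𝔟)) (pos-* {4} (s≤s z≤n) 1≤𝔟)) (s≤s z≤n))) (≤-reflexive (sym E≡))

  1≤t : 1 ≤ t
  1≤t = ≤-trans (s≤s z≤n) (≤-reflexive (sym t≡))

  record AtData : Set where
    constructor atData
    field
      N y i₁ : ℕ
      i₀+2≤i₁ : i₀ + 2 ≤ i₁
      𝔟^i₁≤y : 𝔟 ^ i₁ ≤ y
      y<𝔟^ : y < 𝔟 ^ suc i₁
      y≤N : y ≤ N
      2i₀<i₁ : suc i₀ + i₀ ≤ i₁
      i₁-large : 8 * bb * (1 + 16 * (2 * 𝔟) * (4 * 𝔟)) * 𝔟 ^ i₀ ≤ i₁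
      s : ℕ → ℕ
      s≤1 : ∀ m → s m ≤ 1
      s0 : s 0 ≡ 0
      s-mul : ∀ x m → 1 ≤ x → x ≤ y → x * m ≤ N → s (x * m) ≡ s m
      χ : ℕ → ℕ
      free : Free χ
      χ≤s : ∀ n → χ n ≤ s n

  module At (atHyps : AtData) where
    open AtData atHyps

    blocks : BlockData
    blocks = blockData 𝔟 4≤𝔟 chebyshev h 1≤h k t 2≤k 1≤t N y i₀ i₁ 3≤i₀ i₀+2≤i₁ 𝔟^i₁≤y y<𝔟^ y≤N

    open Blocks blocks hiding (w)
    open Grid h 1≤h
    open Ramp k t ℓ (ℓ ∸ g i₁) 1≤k 1≤t hiding (e)
    open Pool w d 1≤d using (R; R₂; r; 1≤R; R≤r; r≤R₂; cof; 1≤cof×g; cof≤R₂; common)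
    open Weights y lam Λ (𝔟 ^ i₀) 1≤Λ lam≤Λ lam>0

    R₂≤y : R₂ ≤ y
    R₂≤y = ≤-trans R₂≤𝔟^i₀ (≤-trans (𝔟^-mono (≤-trans (m≤m+n i₀ 2) i₀+2≤i₁)) 𝔟^i₁≤y)

    V⁻ : ℕ → ℕ
    V⁻ m = invert (V m) (F 0)

    VV⁻ : ∀ m → V m * V⁻ m ≡ F 0 !
    VV⁻ m = invert-* (V m) (F 0) (1≤F (glog m)) (F-dec {0} {glog m} z≤n)

    module PS = PoolSum w d 1≤d (4 * k) e b l₀ 2^b≤w 2^l₀≤d b≤d cond₁ cond₂
    module Cor = Correlation h 1≤h k t ℓ (ℓ ∸ g i₁) 1≤k 1≤t w d 1≤d e b l₀ 2^b≤w 2^l₀≤d b≤d cond₁ cond₂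

    flat : D * D * (2 * e) ≤ (2 * e + 1) * ((M ∸ glog R₂ * glog R₂) * M)
    flat = flatness e H k t (glog R₂) D M (trans (cong (2 *_) h≡) (sym (*-assoc 2 8 e))) 1≤k 1≤e t≡ refl refl

    V-corr : ∀ i j → i < d → j < d → ∀ m → 1 ≤ m →
      PS.Θ * (𝒩 * V (cof i j * m) * (𝒩 * V (cof j i * m)) * V⁻ (r i * (cof i j * m))) ≤ PS.c i j * (𝒩 * F 0 ! * (𝒩 * V m))
    V-corr i j i<d j<d m 1≤m = arith PS.Θ 𝒩 (V (cof i j * m)) (V (cof j i * m)) (V⁻ (r i * (cof i j * m))) (PS.c i j) (F 0 !) (V m)
      (Cor.V-corr flat V⁻ (F 0 !) VV⁻ i j i<d j<d m 1≤m)
      where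
      arith : ∀ Θ n v u v⁻ c Π x → Θ * (v * u * v⁻) ≤ c * (Π * x) → Θ * (n * v * (n * u) * v⁻) ≤ c * (n * Π * (n * x))
      arith Θ n v u v⁻ c Π x h = by≤ 0 ((n * n) ⊛ h) (solve (Θ ∷ n ∷ v ∷ u ∷ v⁻ ∷ c ∷ Π ∷ x ∷ []))

    progressions : ∀ m → 1 ≤ m → E * ∑ d (λ i → χ (m * r i)) ≤ d
    progressions m 1≤m = begin
      E * ∑ d (λ i → χ (m * r i))                       ≡⟨ cong (E *_) (∑-ext d (λ i → cong χ (ar m (w !) d i))) ⟩
      E * ∑ d (λ i → χ (m * (1 + w ! * d) + i * (m * w !))) ≤⟨ dens _ (free-affine free (m * (1 + w ! * d)) (m * w !) (pos-* 1≤m (1≤n! w))) ⟩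
      1 * d                                             ≡⟨ *-identityˡ d ⟩
      d                                                 ∎
      where
      open ≤-Reasoning
      ar : ∀ m q d i → m * (1 + q * (d + i)) ≡ m * (1 + q * d) + i * (m * q)
      ar m q d i = solve (m ∷ q ∷ d ∷ i ∷ [])

    ratio : ∀ m → 1 ≤ m → 𝒩 * V (R * m) ≤ 4 * (𝒩 * V (R₂ * m))
    ratio m 1≤m = ≤-trans (𝒩 ⊛ V-scale (R * m) 2 (pos-* 1≤R 1≤m) (s≤s z≤n)) (≤-reflexive (trans (cong (λ z → 𝒩 * (4 * V z)) (sym (*-assoc 2 R m))) (ar 𝒩 (V (R₂ * m)))))
      where
      ar : ∀ n v → n * (4 * v) ≡ 4 * (n * v)
      ar n v = solve (n ∷ v ∷ [])

    core : CoreData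
    core = coreData N y s s≤1 s0 R₂ s-mul R₂≤y lam (λ q p → <⇒≤ (prime≥2 (proj₁ (lam>0 q p)))) ν (top !) Λ
      (λ x m 1≤x x≤R₂ → ν-pool x m 1≤x (≤-trans x≤R₂ R₂≤𝔟^i₀)) (λ q m _ _ _ → ν-dec q m) (λ q m q≤y l _ → ν-inc q m q≤y l)
      (λ n _ → ων≤ n) (λ n _ → ων≥ n) (λ n _ → Λν≤ n)
      (λ m → 𝒩 * V m) V⁻ (𝒩 * F 0 !) (pos-* 1≤𝒩 (1≤n! (F 0))) (λ m → trans (*-assoc 𝒩 (V m) (V⁻ m)) (cong (𝒩 *_) (VV⁻ m)))
      (λ {m} {m′} h → invert-anti (1≤F (glog m′)) (V-antitone h) (F-dec {0} {glog m} z≤n))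
      (2 * 𝔟) (4 * 𝔟) 4 (𝔟 ^ suc i₀) (1≤𝔟^ (suc i₀)) W≤V V≤W
      d R r 1≤d 1≤R (λ i _ → R≤r i) r≤R₂ ratio
      PS.Θ e (pos-* (pos-* {2} (s≤s z≤n) 1≤e) (pos-^ {1 + 4 * k} PS.J (s≤s z≤n))) 1≤e PS.c cof (λ i j _ _ → proj₁ (1≤cof×g i j)) (λ i j _ j<d → cof≤R₂ i j j<d)
      (λ i j _ _ → common i j) V-corr PS.c-sum χ χ≤s E 1≤E progressions

    module Main = Core core

    -- σ/Λ ≤ 𝔟^i₀/i₁, thanks to the factor i₁ in Λ, while i₀ is fixed.
    σ-small : 8 * bb * (1 + 16 * (2 * 𝔟) * (4 * 𝔟)) * Main.σ ≤ Λ
    σ-small = arith (8 * bb * (1 + 16 * (2 * 𝔟) * (4 * 𝔟))) (𝔟 ^ i₀) i₁ Main.σ 𝒩 (U (suc i₀ + i₀)) U₀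
        (σ-bound (suc i₀ + i₀) (R₂ * 𝔟 ^ suc i₀) (s≤s (m≤m+n i₀ i₀)) 2i₀<i₁ X≤) (U-ratio (suc i₀) i₀) i₁-large
      where
      X≤ : R₂ * 𝔟 ^ suc i₀ ≤ 𝔟 ^ (suc i₀ + i₀)
      X≤ = ≤-trans (*-monoˡ-≤ (𝔟 ^ suc i₀) R₂≤𝔟^i₀) (≤-reflexive (trans (sym (^-distribˡ-+-* 𝔟 i₀ (suc i₀))) (cong (𝔟 ^_) (+-comm i₀ (suc i₀)))))
      arith : ∀ c p i₁ σ n U U₀ → σ ≤ n * U → U ≤ 2 * p * U₀ → c * p ≤ i₁ → c * σ ≤ 2 * i₁ * (U₀ * n)
      arith c p i₁ σ n U U₀ h₁ h₂ h₃ = by≤ 0 (c ⊛ h₁ ⊕ (c * n) ⊛ h₂ ⊕ (2 * U₀ * n) ⊛ h₃) (solve (c ∷ p ∷ i₁ ∷ σ ∷ n ∷ U ∷ U₀ ∷ []))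

    main : 8 * bb * Main.A₁ ≤ 3 * Main.Ψ
    main = cancelˡ (E * e * Λ) (pos-* (pos-* 1≤E 1≤e) 1≤Λ)
      (arith E e Λ Main.A₁ Main.σ (1 + 16 * (2 * 𝔟) * (4 * 𝔟)) (4 * (2 * 𝔟) * (4 * 𝔟) * 4) (8 * (2 * 𝔟) * (4 * 𝔟)) (8 * bb) Main.Ψ
        E≡ e≡ σ-small (subst (E * e * Λ * Main.A₁ ≤_) (cong (_* Main.Ψ) (shape E e Main.σ 𝔟 Λ)) (Main.main-bound (1≤n! top))))
      where
      shape : ∀ E e σ 𝔟 Λ → E * e * σ * (1 + 16 * (2 * 𝔟) * (4 * 𝔟)) + 4 * e * (2 * 𝔟) * (4 * 𝔟) * 4 * Λ + 8 * E * (2 * 𝔟) * (4 * 𝔟) * Λ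
        ≡ E * e * σ * (1 + 16 * (2 * 𝔟) * (4 * 𝔟)) + e * (4 * (2 * 𝔟) * (4 * 𝔟) * 4) * Λ + E * (8 * (2 * 𝔟) * (4 * 𝔟)) * Λ
      shape E e σ 𝔟 Λ = solve (E ∷ e ∷ σ ∷ 𝔟 ∷ Λ ∷ [])
      arith : ∀ E e Λ A σ x y z B Ψ → E ≡ B * y → e ≡ B * z → B * x * σ ≤ Λ → E * e * Λ * A ≤ (E * e * σ * x + e * y * Λ + E * z * Λ) * Ψ →
        E * e * Λ * (B * A) ≤ E * e * Λ * (3 * Ψ)
      arith E e Λ A σ x y z B Ψ h₁ h₂ h₃ h₄ = by≤ 0 (B ⊛ h₄ ⊕ (E * e * Ψ) ⊛ h₃ ⊕ (e * Λ * Ψ) ⊛ ≤-reflexive (sym h₁) ⊕ (E * Λ * Ψ) ⊛ ≤-reflexive (sym h₂))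
        (solve (E ∷ e ∷ Λ ∷ A ∷ σ ∷ x ∷ y ∷ z ∷ B ∷ Ψ ∷ []))

    module _ (smooth : ∀ n → 0 < χ n → 1 ≤ n × n ≤ N × Smooth′ y n) (f : ℕ) (g≤ : g i₁ ≤ k * h * (f + 1)) where

      open FewPrimes N y using (base; cover; covered; ∑-cover)

      total : ∑ (suc N) χ ≤ Main.A₁ + base ^ (few (f + 1) g≤ + suc (𝔟 ^ i₀))
      total = ≤-trans (∑-mono (suc N) (λ n _ → split n)) (≤-trans (≤-reflexive (∑-+ (suc N) _ _)) (+-monoʳ-≤ Main.A₁ (∑-cover (few (f + 1) g≤ + suc (𝔟 ^ i₀)))))
        where
        K′ = few (f + 1) g≤ + suc (𝔟 ^ i₀)
        split : ∀ n → χ n ≤ ⟦ Λ ≤? Main.ω n ⟧ * χ n + cover K′ n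
        split n = go (Λ ≤? Main.ω n) (χ n) (smooth n) (≤-trans (χ≤s n) (s≤1 n))
          where
          go : ∀ (D : Dec (Λ ≤ Main.ω n)) x → (0 < x → 1 ≤ n × n ≤ N × Smooth′ y n) → x ≤ 1 → x ≤ ⟦ D ⟧ * x + cover K′ n
          go (yes _) x _ _ = ≤-trans (≤-reflexive (sym (*-identityˡ x))) (m≤m+n _ _)
          go (no ¬p) zero _ _ = z≤n
          go (no ¬p) (suc x) sm x≤1 = case sm (s≤s z≤n) of λ (1≤n , n≤N , s) → ≤-trans x≤1 (covered K′ n 1≤n n≤N s (few-primes (f + 1) g≤ n (≰⇒> ¬p)))

      -- At most 3/8 of Ψ/bb comes from n with ω n ≥ Λ and at most 1/8 from the others, less than
      -- the assumed Ψ/bb.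
      contradiction : 8 * bb * base ^ (few (f + 1) g≤ + suc (𝔟 ^ i₀)) ≤ ∑ (suc N) s → 1 ≤ ∑ (suc N) s → ∑ (suc N) s ≤ bb * ∑ (suc N) χ → ⊥
      contradiction rare 1≤Ψ dense = <⇒≱ (s≤s z≤n) (arith bb (∑ (suc N) s) (∑ (suc N) χ) Main.A₁ (base ^ (few (f + 1) g≤ + suc (𝔟 ^ i₀))) main total rare 1≤Ψ dense)
        where
        arith : ∀ bb Ψ A A₁ F → 8 * bb * A₁ ≤ 3 * Ψ → A ≤ A₁ + F → 8 * bb * F ≤ Ψ → 1 ≤ Ψ → Ψ ≤ bb * A → 1 ≤ 0
        arith bb Ψ A A₁ F h₁ h₂ h₃ h₄ h₅ = by≤ (3 * Ψ) (h₁ ⊕ (8 * bb) ⊛ h₂ ⊕ h₃ ⊕ h₄ ⊕ 8 ⊛ h₅) (solve (bb ∷ Ψ ∷ A ∷ A₁ ∷ F ∷ []))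

-- From lists and rational densities to indicator functions.

χ⟦_⟧ : List ℕ → ℕ → ℕ
χ⟦ A ⟧ n = ⟦ n ∈? A ⟧

∑-length : ∀ N A → Unique A → (∀ n → n ∈ A → n ≤ N) → ∑ (suc N) χ⟦ A ⟧ ≡ length A
∑-length N [] _ _ = ∑-zero (suc N) (λ n _ → ⟦⟧-no (n ∈? []) (λ ()))
∑-length N (x ∷ A) (x∉ AllPairs.∷ u) h = begin
  ∑ (suc N) χ⟦ x ∷ A ⟧                                 ≡⟨ ∑-ext (suc N) split ⟩
  ∑ (suc N) (λ n → ⟦ n ≟ x ⟧ * 1 + χ⟦ A ⟧ n)           ≡⟨ ∑-+ (suc N) _ _ ⟩
  ∑ (suc N) (λ n → ⟦ n ≟ x ⟧ * 1) + ∑ (suc N) χ⟦ A ⟧   ≡⟨ cong₂ _+_ (∑-delta (suc N) (λ _ → 1) (s≤s (h x (here refl)))) (∑-length N A u (λ n p → h n (there p))) ⟩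
  suc (length A)                                       ∎
  where
  open ≡-Reasoning
  split : ∀ n → χ⟦ x ∷ A ⟧ n ≡ ⟦ n ≟ x ⟧ * 1 + χ⟦ A ⟧ n
  split n = go (n ≟ x)
    where
    go : (D : Dec (n ≡ x)) → χ⟦ x ∷ A ⟧ n ≡ ⟦ D ⟧ * 1 + χ⟦ A ⟧ n
    go (yes refl) = trans (⟦⟧-yes (n ∈? (n ∷ A)) (here refl)) (cong suc (sym (⟦⟧-no (n ∈? A) (λ p → All.lookup x∉ p refl))))
    go (no n≢x) = ⟦⟧-cong (n ∈? (x ∷ A)) (n ∈? A) (λ { (here e) → ⊥-elim (n≢x e) ; (there p) → p }) there

free-or-3AP : ∀ N A → (∀ n → n ∈ A → n ≤ N) → Has3AP A ⊎ Free χ⟦ A ⟧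
free-or-3AP N A bounded = go (anyUpTo? (λ a → anyUpTo? (λ b → (1 ≤? b) ×-dec ((a ∈? A) ×-dec ((a + b ∈? A) ×-dec (a + b + b ∈? A)))) (suc N)) (suc N))
  where
  go : Dec (∃ λ a → a < suc N × ∃ λ b → b < suc N × 1 ≤ b × a ∈ A × a + b ∈ A × a + b + b ∈ A) → Has3AP A ⊎ Free χ⟦ A ⟧
  go (yes (a , _ , b , _ , 1≤b , p , q , r)) = inj₁ (ℤ.+ a , ℤ.+ b , (λ e → <⇒≢ 1≤b (sym (ℤP.+-injective e))) , ∈-map⁺ ℤ.+_ p , ∈-map⁺ ℤ.+_ q ,
    subst (_∈ map ℤ.+_ A) (trans (cong ℤ.+_ (ar a b)) (cong (λ z → ℤ.+ a ℤ.+ z) (ℤP.pos-* 2 b))) (∈-map⁺ ℤ.+_ r))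
    where
    ar : ∀ a b → a + b + b ≡ a + 2 * b
    ar a b = solve (a ∷ b ∷ [])
  go (no none) = inj₂ ((λ n → ⟦⟧≤1 (n ∈? A)) , λ a b 0<b p q → ⟦⟧-no (a + b + b ∈? A) (λ r →
    let a∈ = ⟦⟧>0 (a ∈? A) p
        ab∈ = ⟦⟧>0 (a + b ∈? A) q
    in none (a , s≤s (bounded a a∈) , b , s≤s (≤-trans (m≤n+m b a) (bounded (a + b) ab∈)) , 0<b , a∈ , ab∈ , r)))

-- `bb` is the denominator of δ, whose numerator is at least 1.
positive-fraction : ∀ δ → 0ℚ ℚ.< δ → ∃ λ bb → 1 ≤ bb × ι 1 ℚ.≤ ι bb ℚ.* δ
positive-fraction (ℚ.mkℚ (ℤ.+ suc n) b-1 c) _ = suc b-1 , s≤s z≤n , ℚP.≤-trans (frac-≤ 1 0 (suc b-1 * suc n) (b-1 + 0 * suc b-1) (arith n b-1))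
  (ℚP.≤-reflexive (trans (sym (frac-* (suc b-1) 0 (suc n) b-1)) (cong (ι (suc b-1) ℚ.*_) (ℚP.fromℚᵘ-toℚᵘ (ℚ.mkℚ (ℤ.+ suc n) b-1 c)))))
  where
  arith : ∀ n b → 1 * suc (b + 0 * suc b) ≤ suc b * suc n * 1
  arith n b = by≤ (n + n * b) (≤-refl {0}) (solve (n ∷ b ∷ []))
positive-fraction (ℚ.mkℚ (ℤ.+ 0) b-1 c) (ℚ.*<* (ℤ.+<+ ()))
positive-fraction (ℚ.mkℚ ℤ.-[1+ n ] b-1 c) (ℚ.*<* ())

clear-denominator : ∀ bb δ l a → ι 1 ℚ.≤ ι bb ℚ.* δ → δ ℚ.* ι l ℚ.≤ ι a → l ≤ bb * a
clear-denominator bb δ l a h g = ι-cancel (begin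
  ι l                      ≡⟨ ℚP.*-identityˡ (ι l) ⟨
  ι 1 ℚ.* ι l              ≤⟨ ℚP.*-monoʳ-≤-nonNeg (ι l) {{ℚ.nonNegative (0≤ι l)}} h ⟩
  ι bb ℚ.* δ ℚ.* ι l       ≡⟨ ℚP.*-assoc (ι bb) δ (ι l) ⟩
  ι bb ℚ.* (δ ℚ.* ι l)     ≤⟨ ℚP.*-monoˡ-≤-nonNeg (ι bb) {{ℚ.nonNegative (0≤ι bb)}} g ⟩
  ι bb ℚ.* ι a             ≡⟨ ι-* bb a ⟩
  ι (bb * a)               ∎)
  where open ℚP.≤-Reasoning

module Enumeration (N y : ℕ) (L : List ℕ) (enum : Enumerates N y L) where

  s : ℕ → ℕ
  s = χ⟦ L ⟧

  ∈⇒ : ∀ {n} → n ∈ L → InS N y n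
  ∈⇒ {n} = Equivalence.to (proj₂ enum n)

  ⇒∈ : ∀ {n} → InS N y n → n ∈ L
  ⇒∈ {n} = Equivalence.from (proj₂ enum n)

  s0 : s 0 ≡ 0
  s0 = ⟦⟧-no (0 ∈? L) (λ p → <⇒≢ (proj₁ (proj₂ (∈⇒ p))) refl)

  s-mul : ∀ x m → 1 ≤ x → x ≤ y → x * m ≤ N → s (x * m) ≡ s m
  s-mul x m 1≤x x≤y xm≤N = ⟦⟧-cong (x * m ∈? L) (m ∈? L)
    (λ p → let _ , 0<xm , sm = ∈⇒ p in ⇒∈ (≤-trans (m≤c*m m 1≤x) xm≤N , proj₂ (⊗>0 {x} 0<xm) , λ q qq q∣m → sm q qq (∣n⇒∣m*n x q∣m)))
    (λ p → let _ , 0<m , sm = ∈⇒ p in ⇒∈ (xm≤N , pos-* 1≤x 0<m , λ q qq q∣xm →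
      [ (λ q∣x → ≤-trans (∣⇒≤ {{pos 1≤x}} q∣x) x≤y) , sm q qq ]′ (euclidsLemma x m qq q∣xm)))

  Ψ-lower : ∀ z → z ≤ y → primorial z ≤ N → 2 ^ π 0 z ≤ ∑ (suc N) s
  Ψ-lower z z≤y h = ≤-trans (divisors-primorial z N h) (∑-mono (suc N) (λ n n≤N → ⟦⟧-mono (n ∣? primorial z) (n ∈? L)
    (λ n∣P → ⇒∈ (≤-pred n≤N , 1≤n n n∣P , λ p pp p∣n → ≤-trans (primorial-smooth z n n∣P p pp p∣n) z≤y))))
    where
    1≤n : ∀ n → n ∣ primorial z → 1 ≤ n
    1≤n zero    p = ⊥-elim (<⇒≢ (1≤primes-product 0 z) (sym (0∣⇒≡0 p)))
    1≤n (suc n) _ = s≤s z≤n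

-- The sizes of y and Ψ, and the choice of N₀.

π-lower : ∀ f x → x * suc f * 16 ≤ 16 ^ suc f → 3 ≤ f → x ≤ π 0 (16 ^ suc f)
π-lower f x h 3≤f = *-cancelˡ-≤ (suc f) (≤-trans (*-cancelˡ-≤ 16 (≤-trans (≤-reflexive (ar x f)) h)) (≤-trans (chebyshev-block f 3≤f)
  (suc f ⊛ ∑-mono (suc (16 ^ suc f)) (λ q _ → ⟦ prime? q ⟧ ⊛ ⟦⟧-mono (16 ^ f <? q) (0 <? q) (≤-trans (s≤s z≤n))))))
  where
  ar : ∀ x f → 16 * (suc f * x) ≡ x * suc f * 16
  ar x f = solve (x ∷ f ∷ [])

-- 2^f plays the part of (log N)^(1/8). Up to constants in the exponents, there will be exp(f² 2^f)
-- exceptional n at most, against Ψ ≥ exp(16^f / f); the primes up to 16^f are available because y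
-- exceeds about (log N)^(1/2).
module Range (K N y f : ℕ) (1≤K : 1 ≤ K) (2≤f : 2 ≤ f) (lo : 2 ^ (8 * f) ≤ lg N) (hi : lg N < 2 ^ (8 * f + 8)) (1≤N : 1 ≤ N)
  (floor : IsFloorLogPow K N y) where

  y-upper : y ≤ 2 ^ (K * (8 * f + 10))
  y-upper = ≤-trans (logPow-upper K N y (2 ^ (8 * f + 8)) (<-≤-trans (<2^1+lg N) (^-monoʳ-≤ 2 hi)) (proj₁ floor))
    (≤-reflexive (trans (cong (_^ K) (trans (sym (^-distribˡ-+-* 2 2 (8 * f + 8))) (cong (2 ^_) (ar f)))) (trans (^-*-assoc 2 (8 * f + 10) K) (cong (2 ^_) (*-comm (8 * f + 10) K)))))
    where
    ar : ∀ f → 2 + (8 * f + 8) ≡ 8 * f + 10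
    ar f = solve (f ∷ [])

  y-lower : 2 ^ (4 * f + 2) ≤ y
  y-lower = ≮⇒≥ λ y< → <⇒≱ (big f 2≤f) (≮⇒≥ λ lt → <⇒≱ (^-monoʳ-< 2 (s≤s (s≤s z≤n)) lt) (≤-trans (^-monoʳ-≤ 2 lo) (≤-trans (2^lg N 1≤N) (≤-trans (logPow-lower K N (suc y) 1≤K (s≤s z≤n) (proj₂ floor)) (crude (suc y) (4 * f + 2) y<)))))
    where
    crude : ∀ q a → q ≤ 2 ^ a → (2 * q + 2) * q ^ (2 * q) ≤ 2 ^ (a + 2 + a * (2 * 2 ^ a))
    crude q a h = begin
      (2 * q + 2) * q ^ (2 * q) ≤⟨ *-mono-≤ (≤-trans (+-mono-≤ (2 ⊛ h) (2 ⊛ pos-^ {2} a (s≤s z≤n))) (≤-reflexive (trans (ar₂ (2 ^ a)) (sym (^-distribˡ-+-* 2 a 2))))) (≤-trans (^-monoˡ-≤ (2 * q) h) (^-monoʳ-≤ (2 ^ a) {{pos (pos-^ {2} a (s≤s z≤n))}} (2 ⊛ h))) ⟩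
      2 ^ (a + 2) * (2 ^ a) ^ (2 * 2 ^ a) ≡⟨ cong (2 ^ (a + 2) *_) (^-*-assoc 2 a (2 * 2 ^ a)) ⟩
      2 ^ (a + 2) * 2 ^ (a * (2 * 2 ^ a)) ≡⟨ ^-distribˡ-+-* 2 (a + 2) _ ⟨
      2 ^ (a + 2 + a * (2 * 2 ^ a)) ∎
      where
      open ≤-Reasoning
      ar₂ : ∀ p → 2 * p + 2 * p ≡ p * 4
      ar₂ p = solve (p ∷ [])
    big : ∀ f → 2 ≤ f → 4 * f + 2 + 2 + (4 * f + 2) * (2 * 2 ^ (4 * f + 2)) < 2 ^ (8 * f)
    big f 2≤f = subst₂ (λ u v → 4 * f + 2 + 2 + (4 * f + 2) * (2 * u) < v) (sym (trans (^-distribˡ-+-* 2 (4 * f) 2) (cong (_* 4) (pw 4)))) (sym (pw 8))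
        (arith f (2 ^ f) (n<2^n f) (≤-trans (s≤s (s≤s (s≤s (s≤s z≤n)))) (^-monoʳ-≤ 2 2≤f)))
      where
      pw : ∀ c → 2 ^ (c * f) ≡ (2 ^ f) ^ c
      pw c = trans (cong (2 ^_) (*-comm c f)) (sym (^-*-assoc 2 f c))
      arith : ∀ f X → suc f ≤ X → 4 ≤ X → 4 * f + 2 + 2 + (4 * f + 2) * (2 * (X ^ 4 * 4)) < X ^ 8
      arith f X h₁ h₂ = case ≤⇒+ h₁ of λ (o , e) → case ≤⇒+ h₂ of λ (o′ , e′) → begin-strict
        4 * f + 2 + 2 + (4 * f + 2) * (2 * (X ^ 4 * 4)) ≤⟨ +-mono-≤ lin₁ (*-monoˡ-≤ (2 * (X ^ 4 * 4)) lin₂) ⟩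
        4 * X + 4 * X * (2 * (X ^ 4 * 4))               <⟨ +-monoˡ-< (4 * X * (2 * (X ^ 4 * 4))) small ⟩
        32 * X ^ 5 + 4 * X * (2 * (X ^ 4 * 4))          ≡⟨ ar X ⟩
        64 * X ^ 5                                      ≤⟨ *-monoˡ-≤ (X ^ 5) (^-monoˡ-≤ 3 h₂) ⟩
        X ^ 3 * X ^ 5                                   ≡⟨ ^-distribˡ-+-* X 3 5 ⟨
        X ^ 8                                           ∎
        where
        open ≤-Reasoning
        ar′ : ∀ X → 32 * (X * (X * (X * (X * (X * 1))))) + 4 * X * (2 * (X * (X * (X * (X * 1))) * 4)) ≡ 64 * (X * (X * (X * (X * (X * 1)))))
        ar′ X = solve (X ∷ [])
        ar : ∀ X → 32 * X ^ 5 + 4 * X * (2 * (X ^ 4 * 4)) ≡ 64 * X ^ 5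
        ar = ar′
        1≤X : 1 ≤ X
        1≤X = ≤-trans (s≤s z≤n) h₂
        small : 4 * X < 32 * X ^ 5
        small = <-≤-trans (*-monoˡ-< X {{pos 1≤X}} {4} {32} (s≤s (s≤s (s≤s (s≤s (s≤s z≤n)))))) (32 ⊛ m≤m*n X (X ^ 4) {{pos (pos-^ 4 1≤X)}})
        lin₁ : 4 * f + 2 + 2 ≤ 4 * X
        lin₁ = by≤ 0 (4 ⊛ h₁) (solve (f ∷ X ∷ []))
        lin₂ : 4 * f + 2 ≤ 4 * X
        lin₂ = by≤ 2 (4 ⊛ h₁) (solve (f ∷ X ∷ []))

base-bound : ∀ K f N y → 1 ≤ K → y ≤ 2 ^ (K * (8 * f + 10)) → lg N < 2 ^ (8 * f + 8) → FewPrimes.base N y ≤ 2 ^ (20 * K * (f + 1))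
base-bound K f N y 1≤K y≤ ℒ< = begin
  1 + suc y * suc (lg N)                      ≤⟨ s≤s (*-mono-≤ (≤-trans (s≤s y≤) (+-mono-≤ (pos-^ a (s≤s z≤n)) (≤-reflexive (sym (+-identityʳ (2 ^ a)))))) ℒ<) ⟩
  1 + 2 ^ suc a * 2 ^ (8 * f + 8)             ≡⟨ cong suc (^-distribˡ-+-* 2 (suc a) (8 * f + 8)) ⟨
  1 + 2 ^ (suc a + (8 * f + 8))               ≤⟨ +-mono-≤ (pos-^ (suc a + (8 * f + 8)) (s≤s z≤n)) (≤-reflexive (sym (+-identityʳ _))) ⟩
  2 ^ suc (suc a + (8 * f + 8))               ≤⟨ ^-monoʳ-≤ 2 (arith K f 1≤K) ⟩
  2 ^ (20 * K * (f + 1))                      ∎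
  where
  open ≤-Reasoning
  a = K * (8 * f + 10)
  arith : ∀ K f → 1 ≤ K → suc (suc (K * (8 * f + 10)) + (8 * f + 8)) ≤ 20 * K * (f + 1)
  arith K f h = by≤ (4 * K * f) ((8 * f + 10) ⊛ h) (solve (K ∷ f ∷ []))

Conclusion : ℕ → ℕ → Set
Conclusion K bb = ∃ λ N₀ → ∀ N → N₀ ≤ N → ∀ y → IsFloorLogPow K N y → ∀ (A : List ℕ) → SubsetS N y A →
  ∀ (L : List ℕ) → Enumerates N y L → length L ≤ bb * length A → Has3AP A

module Threshold (K : ℕ) (1≤K : 1 ≤ K) (densityHyps : DensityData) (k≡ : DensityData.k densityHyps ≡ 32 * K) where
  open DensityData densityHyps
  module Den = Density densityHyps
  open Den using (1≤𝔟)

  -- constants occurring in the bound Blocks.few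
  steps decay levels exponent rate : ℕ
  steps = t * (k * (2 * h)) + t * (k ∸ 1)
  decay = (1 + 2 * h) ^ (Grid.glog h 1≤h (𝔟 ^ suc i₀) + t * (k ∸ 1) + 1)
  levels = (i₀ + 2) + (suc i₀ + i₀) + 8 * bb * (1 + 16 * (2 * 𝔟) * (4 * 𝔟)) * 𝔟 ^ i₀
  exponent = 8 * bb + 20 * K * (40 * K * (𝔟 * (steps * decay)) + suc (𝔟 ^ i₀))
  rate = 16 * exponent + 10 * K

  record LargeData : Set where
    constructor largeData
    field
      f₁ : ℕ
      growth : ∀ f → f₁ ≤ f → rate * (f + 1) ≤ 2 ^ f
      N y f : ℕ
      f₁≤f : f₁ ≤ f
      4≤f : 4 ≤ f
      levels-small : 𝔟 ^ levels ≤ f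
      1≤N : 1 ≤ N
      lo : 2 ^ (8 * f) ≤ lg N
      hi : lg N < 2 ^ (8 * f + 8)
      floor : IsFloorLogPow K N y
      A : List ℕ
      A⊆S : SubsetS N y A
      L : List ℕ
      enum : Enumerates N y L
      dense : length L ≤ bb * length A

  module Large (largeHyps : LargeData) where
    open LargeData largeHyps

    open Range K N y f 1≤K (≤-trans (s≤s (s≤s z≤n)) 4≤f) lo hi 1≤N floor
    open Enumeration N y L enum

    10K≤ : 10 * K * (f + 1) ≤ 2 ^ f
    10K≤ = ≤-trans (*-monoˡ-≤ (f + 1) (m≤n+m (10 * K) (16 * exponent))) (growth f f₁≤f)

    16x≤ : 16 * exponent * (f + 1) ≤ 2 ^ f
    16x≤ = ≤-trans (*-monoˡ-≤ (f + 1) (m≤m+n (16 * exponent) (10 * K))) (growth f f₁≤f)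

    K8f≤ : K * (8 * f + 10) ≤ 10 * K * (f + 1)
    K8f≤ = arith K f
      where
      arith : ∀ K f → K * (8 * f + 10) ≤ 10 * K * (f + 1)
      arith K f = by≤ (2 * K * f) (≤-refl {0}) (solve (K ∷ f ∷ []))

    2^f≤2^ : ∀ c → 1 ≤ c → 2 ^ f ≤ 2 ^ (c * f)
    2^f≤2^ c 1≤c = ^-monoʳ-≤ 2 (m≤c*m f 1≤c)

    y≤N : y ≤ N
    y≤N = ≤-trans y-upper (≤-trans (^-monoʳ-≤ 2 (≤-trans K8f≤ (≤-trans 10K≤ (≤-trans (2^f≤2^ 8 (s≤s z≤n)) lo)))) (2^lg N 1≤N))

    f≤y : f ≤ y
    f≤y = ≤-trans (<⇒≤ (n<2^n f)) (≤-trans (^-monoʳ-≤ 2 (≤-trans (m≤c*m {4} f (s≤s z≤n)) (m≤m+n (4 * f) 2))) y-lower)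

    2^≤𝔟^ : ∀ i → 2 ^ i ≤ 𝔟 ^ i
    2^≤𝔟^ i = ^-monoˡ-≤ i (≤-trans (s≤s (s≤s z≤n)) 4≤𝔟)

    z : ℕ
    z = 16 ^ f

    z≡ : z ≡ 2 ^ (4 * f)
    z≡ = ^-*-assoc 2 4 f

    Ψ-large : 2 ^ π 0 z ≤ ∑ (suc N) s
    Ψ-large = Ψ-lower z (≤-trans (≤-reflexive z≡) (≤-trans (^-monoʳ-≤ 2 (m≤m+n (4 * f) 2)) y-lower))
      (subst (λ v → primorial v ≤ N) (sym z≡) (≤-trans (primorial-upper (4 * f)) (≤-trans (≤-reflexive (^-*-assoc 2 2 (2 ^ (4 * f))))
        (≤-trans (^-monoʳ-≤ 2 (≤-trans (≤-trans (^-monoʳ-≤ 2 {suc (4 * f)} {8 * f} (arith f 4≤f)) ≤-refl) lo)) (2^lg N 1≤N)))))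
      where
      arith : ∀ f → 4 ≤ f → suc (4 * f) ≤ 8 * f
      arith f h = by≤ (3 * f + 3) h (solve (f ∷ []))

    -- The binary logarithm of the left side is at most `exponent` times (f + 1)² 2^f, with one
    -- factor f + 1 from the logarithm of `base` and one from i₁. `rate` makes this smaller than the
    -- number of primes up to 16^f.
    few-bound : ∀ i₁ → i₁ ≤ 10 * K * (f + 1) →
      8 * bb * FewPrimes.base N y ^ (2 * i₁ * (𝔟 * (steps * (decay * 2 ^ (f + 1)))) + suc (𝔟 ^ i₀)) ≤ 2 ^ π 0 z
    few-bound i₁ i₁≤ = begin
      8 * bb * FewPrimes.base N y ^ k′            ≤⟨ *-mono-≤ (<⇒≤ (n<2^n (8 * bb))) (^-monoˡ-≤ k′ (base-bound K f N y 1≤K y-upper hi)) ⟩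
      2 ^ (8 * bb) * (2 ^ (20 * K * (f + 1))) ^ k′ ≡⟨ cong (2 ^ (8 * bb) *_) (^-*-assoc 2 (20 * K * (f + 1)) k′) ⟩
      2 ^ (8 * bb) * 2 ^ (20 * K * (f + 1) * k′)  ≡⟨ ^-distribˡ-+-* 2 (8 * bb) _ ⟨
      2 ^ (8 * bb + 20 * K * (f + 1) * k′)        ≤⟨ ^-monoʳ-≤ 2 (≤-trans size many-primes) ⟩
      2 ^ π 0 z                                   ∎
      where
      open ≤-Reasoning
      k′ = 2 * i₁ * (𝔟 * (steps * (decay * 2 ^ (f + 1)))) + suc (𝔟 ^ i₀)
      size : 8 * bb + 20 * K * (f + 1) * k′ ≤ exponent * ((f + 1) * (f + 1) * 2 ^ f)
      size = subst (λ v → 8 * bb + 20 * K * (f + 1) * (2 * i₁ * (𝔟 * (steps * (decay * v))) + suc (𝔟 ^ i₀)) ≤ exponent * ((f + 1) * (f + 1) * 2 ^ f))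
        (cong (2 ^_) (+-comm 1 f)) (arith bb K f i₁ 𝔟 steps decay (suc (𝔟 ^ i₀)) (2 ^ f) (pos-^ f (s≤s z≤n)) i₁≤)
        where
        arith : ∀ bb K f i₁ 𝔟 S C Y p → 1 ≤ p → i₁ ≤ 10 * K * (f + 1) →
          8 * bb + 20 * K * (f + 1) * (2 * i₁ * (𝔟 * (S * (C * (2 * p)))) + Y) ≤ (8 * bb + 20 * K * (40 * K * (𝔟 * (S * C)) + Y)) * ((f + 1) * (f + 1) * p)
        arith bb K f i₁ 𝔟 S C Y p h₁ h₂ = by≤ ((8 * bb * p + 20 * K * (f + 1) * Y * p) * f + 8 * bb * p * (f + 1) * f)
          ((20 * K * (f + 1) * (4 * (𝔟 * (S * (C * p))))) ⊛ h₂ ⊕ (8 * bb + 20 * K * (f + 1) * Y) ⊛ h₁)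
          (solve (bb ∷ K ∷ f ∷ i₁ ∷ 𝔟 ∷ S ∷ C ∷ Y ∷ p ∷ []))
      many-primes : exponent * ((f + 1) * (f + 1) * 2 ^ f) ≤ π 0 z
      many-primes = from-pred f 4≤f refl
        where
        cubes : exponent * ((f + 1) * (f + 1) * 2 ^ f) * f * 16 ≤ 16 ^ f
        cubes = ≤-trans (arith exponent f (2 ^ f) 16x≤ (≤-trans (≤-reflexive (+-comm f 1)) (n<2^n f)) (<⇒≤ (n<2^n f))) (≤-reflexive (trans (^-*-assoc 2 f 4) (trans (cong (2 ^_) (*-comm f 4)) (sym z≡))))
          where
          arith : ∀ x f p → 16 * x * (f + 1) ≤ p → f + 1 ≤ p → f ≤ p → x * ((f + 1) * (f + 1) * p) * f * 16 ≤ p ^ 4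
          arith x f p h₁ h₂ h₃ = ≤-trans (≤-reflexive (ar x f p)) (*-mono-≤ h₁ (*-mono-≤ h₂ (*-mono-≤ (≤-refl {p}) (≤-trans h₃ (≤-reflexive (sym (*-identityʳ p)))))))
            where
            ar : ∀ x f p → x * ((f + 1) * (f + 1) * p) * f * 16 ≡ 16 * x * (f + 1) * ((f + 1) * (p * f))
            ar x f p = solve (x ∷ f ∷ p ∷ [])
        from-pred : ∀ f′ → 4 ≤ f′ → f′ ≡ f → exponent * ((f + 1) * (f + 1) * 2 ^ f) ≤ π 0 z
        from-pred (suc f′) (s≤s 3≤f′) eq = subst (λ v → exponent * ((f + 1) * (f + 1) * 2 ^ f) ≤ π 0 (16 ^ v)) eq
          (π-lower f′ _ (subst (λ v → exponent * ((f + 1) * (f + 1) * 2 ^ f) * v * 16 ≤ 16 ^ v) (sym eq) cubes) 3≤f′)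

    A≤N : ∀ n → n ∈ A → n ≤ N
    A≤N n p = proj₁ (proj₂ A⊆S n p)

    impossible : ∀ i₁ → 𝔟 ^ i₁ ≤ y → y < 𝔟 ^ suc i₁ → Free χ⟦ A ⟧ → ⊥
    impossible i₁ 𝔟^i₁≤y y<𝔟^ free = At.contradiction smooth f g≤ rare 1≤Ψ dense′
      where
      levels≤i₁ : levels ≤ i₁
      levels≤i₁ = ≮⇒≥ λ i₁<levels → <⇒≱ y<𝔟^ (≤-trans (^-monoʳ-≤ 𝔟 {{pos 1≤𝔟}} i₁<levels) (≤-trans levels-small f≤y))
      i₁≤ : i₁ ≤ K * (8 * f + 10)
      i₁≤ = ≮⇒≥ λ lt → <⇒≱ (^-monoʳ-< 2 (s≤s (s≤s z≤n)) lt) (≤-trans (2^≤𝔟^ i₁) (≤-trans 𝔟^i₁≤y y-upper))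
      at : Den.AtData
      at = Den.atData N y i₁ (≤-trans (≤-trans (m≤m+n (i₀ + 2) (suc i₀ + i₀)) (m≤m+n _ (8 * bb * (1 + 16 * (2 * 𝔟) * (4 * 𝔟)) * 𝔟 ^ i₀))) levels≤i₁) 𝔟^i₁≤y y<𝔟^ y≤N
        (≤-trans (≤-trans (m≤n+m (suc i₀ + i₀) (i₀ + 2)) (m≤m+n _ (8 * bb * (1 + 16 * (2 * 𝔟) * (4 * 𝔟)) * 𝔟 ^ i₀))) levels≤i₁) (≤-trans (m≤n+m _ ((i₀ + 2) + (suc i₀ + i₀))) levels≤i₁)
        s (λ m → ⟦⟧≤1 (m ∈? L)) s0 s-mul χ⟦ A ⟧ free (λ n → ⟦⟧-mono (n ∈? A) (n ∈? L) (λ p → ⇒∈ (proj₂ A⊆S n p)))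
      module At = Den.At at
      -- The origin of k = 32K: log₂ y ≤ K(8f + 10), and `glog` has at most 2h steps per factor 2.
      g≤ : Grid.glog h 1≤h (𝔟 ^ i₁) ≤ k * h * (f + 1)
      g≤ = begin
        Grid.glog h 1≤h (𝔟 ^ i₁)                    ≤⟨ Grid.glog-mono h 1≤h (pos-^ i₁ 1≤𝔟) (≤-trans 𝔟^i₁≤y y-upper) ⟩
        Grid.glog h 1≤h (2 ^ (K * (8 * f + 10)))    ≤⟨ Grid.glog-2^≤ h 1≤h (K * (8 * f + 10)) ⟩
        K * (8 * f + 10) * (2 * h)                  ≤⟨ arith K f h ⟩
        32 * K * h * (f + 1)                        ≡⟨ cong (λ v → v * h * (f + 1)) k≡ ⟨
        k * h * (f + 1)                             ∎
        where
        open ≤-Reasoning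
        arith : ∀ K f h → K * (8 * f + 10) * (2 * h) ≤ 32 * K * h * (f + 1)
        arith K f h = by≤ (16 * K * h * f + 12 * K * h) (≤-refl {0}) (solve (K ∷ f ∷ h ∷ []))
      smooth : ∀ n → 0 < χ⟦ A ⟧ n → 1 ≤ n × n ≤ N × Smooth′ y n
      smooth n p = let n≤N , 0<n , sm = proj₂ A⊆S n (⟦⟧>0 (n ∈? A) p) in 0<n , n≤N , sm
      rare : 8 * bb * FewPrimes.base N y ^ (2 * i₁ * (𝔟 * (steps * (decay * 2 ^ (f + 1)))) + suc (𝔟 ^ i₀)) ≤ ∑ (suc N) s
      rare = ≤-trans (few-bound i₁ (≤-trans i₁≤ K8f≤)) Ψ-large
      1≤Ψ : 1 ≤ ∑ (suc N) s
      1≤Ψ = ≤-trans (pos-^ {2} (π 0 z) (s≤s z≤n)) Ψ-large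
      dense′ : ∑ (suc N) s ≤ bb * ∑ (suc N) χ⟦ A ⟧
      dense′ = subst₂ (λ u v → u ≤ bb * v) (sym (∑-length N L (proj₁ enum) (λ n p → proj₁ (∈⇒ p)))) (sym (∑-length N A (proj₁ A⊆S) A≤N)) dense

    has-3AP : Has3AP A
    has-3AP = [ (λ p → p) , (λ free → ⊥-elim (case search (λ i → 𝔟 ^ i ≤? y) y (≤-trans (pos-^ {2} (4 * f + 2) (s≤s z≤n)) y-lower)
        (λ p → <⇒≱ (n<2^n y) (≤-trans (2^≤𝔟^ y) p)) of λ (i₁ , p , ¬p) → impossible i₁ p (≰⇒> ¬p) free)) ]′ (free-or-3AP N A A≤N)

  goal : Conclusion K bb
  -- Doubly exponential, since f is the integer part of log₂ log₂ N / 8.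
  goal = case exponential-growth rate of λ (f₁ , growth) → 2 ^ (2 ^ (8 * (f₁ + 4 + 𝔟 ^ levels))) ,
    λ N N₀≤N y floor A A⊆S L enum dense → apply f₁ growth N y N₀≤N floor A A⊆S L enum dense
    where
    apply : ∀ f₁ → (∀ f → f₁ ≤ f → rate * (f + 1) ≤ 2 ^ f) → ∀ N y → 2 ^ (2 ^ (8 * (f₁ + 4 + 𝔟 ^ levels))) ≤ N → IsFloorLogPow K N y →
      ∀ A → SubsetS N y A → ∀ L → Enumerates N y L → length L ≤ bb * length A → Has3AP A
    apply f₁ growth N y N₀≤N floor A A⊆S L enum dense =
      Large.has-3AP (largeData f₁ growth N y f (≤-trans (≤-trans (m≤m+n f₁ 4) (m≤m+n _ (𝔟 ^ levels))) f₀≤f) (≤-trans (≤-trans (m≤n+m 4 f₁) (m≤m+n _ (𝔟 ^ levels))) f₀≤f)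
        (≤-trans (m≤n+m (𝔟 ^ levels) (f₁ + 4)) f₀≤f) 1≤N lo hi floor A A⊆S L enum dense)
      where
      f₀ = f₁ + 4 + 𝔟 ^ levels
      ℓ₂ = lg (lg N)
      f = ℓ₂ ℕ./ 8
      1≤N : 1 ≤ N
      1≤N = ≤-trans (pos-^ {2} (2 ^ (8 * f₀)) (s≤s z≤n)) N₀≤N
      8f₀≤ : 8 * f₀ ≤ ℓ₂
      8f₀≤ = lg-≥ (lg-≥ N₀≤N)
      f₀≤f : f₀ ≤ f
      f₀≤f = ≤-trans (≤-reflexive (sym (trans (cong (ℕ._/ 8) (*-comm 8 f₀)) (m*n/n≡m f₀ 8)))) (/-monoˡ-≤ 8 8f₀≤)
      1≤ℒ : 1 ≤ lg N
      1≤ℒ = ≤-trans (pos-^ {2} (8 * f₀) (s≤s z≤n)) (lg-≥ N₀≤N)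
      lo : 2 ^ (8 * f) ≤ lg N
      lo = ≤-trans (^-monoʳ-≤ 2 (≤-trans (≤-reflexive (*-comm 8 f)) (m/n*n≤m ℓ₂ 8))) (2^lg (lg N) 1≤ℒ)
      hi : lg N < 2 ^ (8 * f + 8)
      hi = <-≤-trans (<2^1+lg (lg N)) (^-monoʳ-≤ 2 (≤-trans (s≤s (≤-reflexive (m≡m%n+[m/n]*n ℓ₂ 8))) (≤-trans (+-monoˡ-≤ (f * 8) (m%n<n ℓ₂ 8)) (≤-reflexive (ar f)))))
        where
        ar : ∀ f → 8 + f * 8 ≡ 8 * f + 8
        ar f = solve (f ∷ [])

-- The order of choice matters: `b` and w = 2^b against the tail of the gcd sum, then `l₀` against
-- the diagonal, where w! enters, then the length n from Roth's theorem. d is a multiple of n that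
-- is large enough for both, and i₀ = R₂ + 3 comes last.
conclusion : ∀ (𝔟 : ℕ) (4≤𝔟 : 4 ≤ 𝔟) (chebyshev : ∀ j → 3 ≤ j → 𝔟 ^ j ≤ suc j * π (𝔟 ^ j) (𝔟 ^ suc j))
  (K k bb E e : ℕ) (1≤K : 1 ≤ K) (2≤k : 2 ≤ k) (k≡ : k ≡ 32 * K) (1≤bb : 1 ≤ bb) (1≤e : 1 ≤ e) (1≤E : 1 ≤ E)
  (E≡ : E ≡ 8 * bb * (4 * (2 * 𝔟) * (4 * 𝔟) * 4)) (e≡ : e ≡ 8 * bb * (8 * (2 * 𝔟) * (4 * 𝔟))) → Conclusion K bb
conclusion 𝔟 4≤𝔟 chebyshev K k bb E e 1≤K 2≤k k≡ 1≤bb 1≤e 1≤E E≡ e≡ = case ratio-power (2 * (2 * e + 1) * 18 * (1 + 4 * k)) (4 * k) 1≤4k of λ (b , cond₁) →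
  case ratio-power (2 * (2 * e + 1) * (4 * (2 ^ b) !)) (4 * k) 1≤4k of λ (l₀ , cond₂) →
  case roth E 1≤E of λ (n , 1≤n , dens) → choose b cond₁ l₀ cond₂ n 1≤n dens
  where
  1≤𝔟 : 1 ≤ 𝔟
  1≤𝔟 = ≤-trans (s≤s z≤n) 4≤𝔟
  1≤4k : 1 ≤ 4 * k
  1≤4k = pos-* {4} (s≤s z≤n) (<⇒≤ 2≤k)
  choose : ∀ b → 2 * (2 * e + 1) * 18 * (1 + 4 * k) * (4 * k) ^ b ≤ (1 + 4 * k) ^ b →
    ∀ l₀ → 2 * (2 * e + 1) * (4 * (2 ^ b) !) * (4 * k) ^ l₀ ≤ (1 + 4 * k) ^ l₀ → ∀ n → 1 ≤ n → Dens E 1 n → Conclusion K bb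
  choose b cond₁ l₀ cond₂ n 1≤n dens = Threshold.goal K 1≤K (densityData 𝔟 4≤𝔟 chebyshev k bb E e 2≤k 1≤bb E≡ e≡ (2 ^ b) d 1≤d b l₀ ≤-refl
      (≤-trans (m≤m*n (2 ^ l₀) (2 ^ b) {{pos 1≤2^b}}) (m≤m*n (2 ^ l₀ * 2 ^ b) n {{pos 1≤n}}))
      (≤-trans (<⇒≤ (n<2^n b)) (≤-trans (m≤c*m (2 ^ b) 1≤2^l₀) (m≤m*n (2 ^ l₀ * 2 ^ b) n {{pos 1≤n}})))
      cond₁ cond₂ (dens-multiple {E} {1} {n} (2 ^ l₀ * 2 ^ b) dens) (8 * e) 1≤8e refl _ refl (Pool.R₂ (2 ^ b) d 1≤d + 3) (m≤n+m 3 _)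
      (≤-trans (<⇒≤ (n<2^n R₂)) (≤-trans (^-monoˡ-≤ R₂ (≤-trans (s≤s (s≤s z≤n)) 4≤𝔟)) (^-monoʳ-≤ 𝔟 {{pos 1≤𝔟}} (m≤m+n R₂ 3))))) k≡
    where
    1≤2^b : 1 ≤ 2 ^ b
    1≤2^b = pos-^ b (s≤s z≤n)
    1≤2^l₀ : 1 ≤ 2 ^ l₀
    1≤2^l₀ = pos-^ l₀ (s≤s z≤n)
    d : ℕ
    d = 2 ^ l₀ * 2 ^ b * n
    1≤d : 1 ≤ d
    1≤d = pos-* (pos-* 1≤2^l₀ 1≤2^b) 1≤n
    R₂ = Pool.R₂ (2 ^ b) d 1≤d
    1≤8e : 1 ≤ 8 * e
    1≤8e = pos-* {8} (s≤s z≤n) 1≤e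

theorem1p1 : ∃ λ K₀ → ∀ K → K₀ ℕ.≤ K → ∀ (δ : ℚ) → 0ℚ ℚ.< δ →
    ∃ λ N₀ → ∀ N → N₀ ℕ.≤ N → ∀ y → IsFloorLogPow K N y →
    ∀ (A : List ℕ) → SubsetS N y A →
    ∀ (L : List ℕ) → Enumerates N y L →
    δ ℚ.* (ℤ.+ length L / 1) ℚ.≤ (ℤ.+ length A / 1) → Has3AP A
-- K₀ = 1, because the slope adapts to `K` through k = 32K.
theorem1p1 = 1 , λ K 1≤K δ 0<δ → case positive-fraction δ 0<δ of λ (bb , 1≤bb , fraction) →
  case conclusion 16 (m≤m+n 4 12) chebyshev-block K (32 * K) bb _ _ 1≤K (*-mono-≤ {2} {32} (m≤m+n 2 30) 1≤K) refl 1≤bb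
      (pos-* (pos-* {8} (s≤s z≤n) 1≤bb) (s≤s z≤n)) (pos-* (pos-* {8} (s≤s z≤n) 1≤bb) (s≤s z≤n)) refl refl of λ (N₀ , P) →
    N₀ , λ N N₀≤N y floor A A⊆S L enum dense → P N N₀≤N y floor A A⊆S L enum (clear-denominator bb δ (length L) (length A) fraction dense)
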